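{- Let $A$ be a finite set of integers with $|A|\geqslant 2$, normalized so that $\min A=0$, $\gcd(A)=1$ and $\max A=n$. If $|2A|=3|A|-3$, then at least one of the following holds: \begin{enumerate} \item $A$ is a bi-arithmetic progression; \item $2A$ contains an interval of integers of length $2|A|-1$ (i.e. $2|A|-1$ consecutive integers); \item $|A|=6$ and $A$ is a Freiman isomorphic image of $K_6=\{(0,0),(0,1),(0,2),(1,0),(1,1),(2,0)\}\subseteq\mathbb{Z}^2$; \item $|A|=\frac12(n+2)$ and $A$ equals either a set of the form $T_{k,n}$, or a set of the form $n-T_{k,n}=\{n-t: t\in T_{k,n}\}$, or a set of the form $S_{u,n}$, where $T_{k,n}=\{0,2,\ldots,2k\}\cup B\cup\{n\}$ for some integer $k\in[0,\frac12 n-2]$ and some $B$ which is left dense, anti-symmetric and additively minimal in $[2k,n-1]$; and $S_{u,n}=\{0\}\cup C\cup D\cup\{n\}$ for some integer $u\in[4,n-6]$, some $C$ which is right dense, anti-symmetric and additively minimal in $[1,u]$, and some $D$ which is left dense, anti-symmetric and additively minimal in $[u+2,n-1]$. \end{enumerate}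
   Context: For sets $X,Y$ of integers, $X+Y=\{x+y:x\in X,y\in Y\}$ and $2X=X+X$; $b\pm X=\{b\pm x:x\in X\}$. For integers $a\le b$, $[a,b]$ denotes the set of integers $x$ with $a\le x\le b$ (empty if $a>b$), and $X(a,b)=|X\cap[a,b]|$. A bijection $\varphi:X\to Y$ between subsets of abelian semigroups is a Freiman isomorphism (of order 2) if for all $a,b,c,d\in X$: $a+b=c+d$ iff $\varphi(a)+\varphi(b)=\varphi(c)+\varphi(d)$. A finite set $B\subseteq\mathbb{Z}$ is a bi-arithmetic progression if it is a Freiman isomorphic image of $\{(0,0),(0,1),\ldots,(0,n_0)\}\cup\{(1,0),(1,1),\ldots,(1,n_1)\}\subseteq\mathbb{Z}^2$ for some $n_0,n_1\ge0$ with $n_0+n_1+2=|B|$ (equivalently, $B=I_0\cup I_1$ with $I_0,I_1$ arithmetic progressions of the same difference such that $2I_0$, $I_0+I_1$, $2I_1$ are pairwise disjoint). For $B\subseteq[u,v]$: $B$ is half dense in $[u,v]$ if $B(u,v)=\frac12(v-u+1)$; $B$ is anti-symmetric in $[u,v]$ if $B\cap(u+v-B)=\emptyset$ and $B\cup(u+v-B)=[u,v]$; a half dense $B$ is left dense in $[u,v]$ if $B(u,x)>\frac12(x-u+1)$ for all $x\in[u,v-1]$, and right dense in $[u,v]$ if $B(x,v)>\frac12(v-x+1)$ for all $x\in[u+1,v]$. A left dense anti-symmetric $B$ in $[u,v]$ is additively minimal in $[u,v]$ if $2(B\cup\{v+1\})=[2u,u+v-1]\cup(v+1+(B\cup\{v+1\}))$;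 a right dense anti-symmetric $B$ in $[u,v]$ is additively minimal in $[u,v]$ if $2(B\cup\{u-1\})=[u+v+1,2v]\cup(u-1+(B\cup\{u-1\}))$. -}

module Defs where

open import Level using (0ℓ)
open import Data.Nat using (ℕ; suc) renaming (_*_ to _*ℕ_)
open import Data.Integer using (ℤ; +_; _+_; _-_; _*_; _≤_; _<_; _≤?_)
open import Data.Integer.Divisibility using (_∣_)
open import Data.Product using (Σ; ∃; ∃-syntax; _×_; _,_)
open import Data.Sum using (_⊎_)
open import Data.List using (List; []; _∷_; length; filter; map; upTo; _++_)
open import Data.List.Membership.Propositional using (_∈_)
open import Data.List.Relation.Unary.Unique.Propositional using (Unique)
open import Relation.Binary.PropositionalEquality using (_≡_)
open import Relation.Nullary using (¬_)
open import Relation.Nullary.Decidable using (_×-dec_)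
open import Relation.Unary using (Pred; _≐_)
open import Function.Bundles using (_⇔_)

-- Subsets of ℤ are predicates; finite sets are given as lists.
Setℤ : Set₁
Setℤ = Pred ℤ 0ℓ

⟦_⟧ : List ℤ → Setℤ
⟦ L ⟧ x = x ∈ L

_⊕_ : Setℤ → Setℤ → Setℤ
(X ⊕ Y) x = ∃[ a ] ∃[ b ] (X a × Y b × x ≡ a + b)

dbl : Setℤ → Setℤ
dbl X = X ⊕ X

_+ₛ_ : ℤ → Setℤ → Setℤ
(c +ₛ X) x = ∃[ y ] (X y × x ≡ c + y)

_∪_ : Setℤ → Setℤ → Setℤ
(X ∪ Y) x = X x ⊎ Y x

singleton : ℤ → Setℤ
singleton c x = x ≡ c

Interval : ℤ → ℤ → Setℤ
Interval a b x = a ≤ x × x ≤ b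

HasSize : Setℤ → ℕ → Set
HasSize X k = ∃[ L ] (Unique L × (∀ x → (x ∈ L) ⇔ X x) × length L ≡ k)

IsMin : List ℤ → ℤ → Set
IsMin A m = m ∈ A × (∀ a → a ∈ A → m ≤ a)

IsMax : List ℤ → ℤ → Set
IsMax A m = m ∈ A × (∀ a → a ∈ A → a ≤ m)

GcdOne : List ℤ → Set
GcdOne A = ∀ (d : ℤ) → (∀ a → a ∈ A → d ∣ a) → d ∣ (+ 1)

-- X(a,b) = |X ∩ [a,b]| for a duplicate-free list X
count : List ℤ → ℤ → ℤ → ℕ
count X a b = length (filter (λ x → (a ≤? x) ×-dec (x ≤? b)) X)

SubsetOf : List ℤ → ℤ → ℤ → Set
SubsetOf B u v = ∀ x → x ∈ B → u ≤ x × x ≤ v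

HalfDense : List ℤ → ℤ → ℤ → Set
HalfDense B u v = + (2 *ℕ count B u v) ≡ v - u + + 1

AntiSymmetric : List ℤ → ℤ → ℤ → Set
AntiSymmetric B u v =
  (∀ x → ¬ (x ∈ B × (u + v - x) ∈ B)) ×
  (∀ x → u ≤ x → x ≤ v → (x ∈ B) ⊎ ((u + v - x) ∈ B))

LeftDense : List ℤ → ℤ → ℤ → Set
LeftDense B u v = HalfDense B u v ×
  (∀ x → u ≤ x → x ≤ v - + 1 → (x - u + + 1) < + (2 *ℕ count B u x))

RightDense : List ℤ → ℤ → ℤ → Set
RightDense B u v = HalfDense B u v ×
  (∀ x → u + + 1 ≤ x → x ≤ v → (v - x + + 1) < + (2 *ℕ count B x v))

LeftAdditivelyMinimal : List ℤ → ℤ → ℤ → Set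
LeftAdditivelyMinimal B u v = LeftDense B u v × AntiSymmetric B u v ×
  (dbl (⟦ B ⟧ ∪ singleton (v + + 1)) ≐
     (Interval (u + u) (u + v - + 1) ∪ ((v + + 1) +ₛ (⟦ B ⟧ ∪ singleton (v + + 1)))))

RightAdditivelyMinimal : List ℤ → ℤ → ℤ → Set
RightAdditivelyMinimal B u v = RightDense B u v × AntiSymmetric B u v ×
  (dbl (⟦ B ⟧ ∪ singleton (u - + 1)) ≐
     (Interval (u + v + + 1) (v + v) ∪ ((u - + 1) +ₛ (⟦ B ⟧ ∪ singleton (u - + 1)))))

ℤ² : Set
ℤ² = ℤ × ℤ

_+²_ : ℤ² → ℤ² → ℤ²
(a , b) +² (c , d) = (a + c , b + d)

FreimanImage : List ℤ² → List ℤ → Set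
FreimanImage X A = Σ (ℤ² → ℤ) λ φ →
  (∀ x → x ∈ X → φ x ∈ A) ×
  (∀ y → y ∈ A → ∃[ x ] (x ∈ X × φ x ≡ y)) ×
  (∀ x x' → x ∈ X → x' ∈ X → φ x ≡ φ x' → x ≡ x') ×
  (∀ a b c d → a ∈ X → b ∈ X → c ∈ X → d ∈ X →
     ((a +² b) ≡ (c +² d)) ⇔ (φ a + φ b ≡ φ c + φ d))

biAPModel : ℕ → ℕ → List ℤ²
biAPModel n0 n1 = map (λ j → (+ 0 , + j)) (upTo (suc n0)) ++ map (λ j → (+ 1 , + j)) (upTo (suc n1))

BiArithmeticProgression : List ℤ → Set
BiArithmeticProgression B = ∃[ n0 ] ∃[ n1 ]
  (n0 Data.Nat.+ n1 Data.Nat.+ 2 ≡ length B × FreimanImage (biAPModel n0 n1) B)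

K6 : List ℤ²
K6 = (+ 0 , + 0) ∷ (+ 0 , + 1) ∷ (+ 0 , + 2) ∷ (+ 1 , + 0) ∷ (+ 1 , + 1) ∷ (+ 2 , + 0) ∷ []

ContainsIntervalOfLength : Setℤ → ℕ → Set
ContainsIntervalOfLength X m = ∃[ a ] (∀ (i : ℕ) → i Data.Nat.< m → X (a + + i))

TSet : ℤ → ℤ → List ℤ → Setℤ
TSet k n B = (λ x → ∃[ j ] (+ 0 ≤ j × j ≤ k × x ≡ + 2 * j)) ∪ (⟦ B ⟧ ∪ singleton n)

IsTForm : List ℤ → ℤ → Set
IsTForm A n = ∃[ k ] ∃[ B ]
  (+ 0 ≤ k × + 2 * k ≤ n - + 4 × Unique B × SubsetOf B (+ 2 * k) (n - + 1) ×
   LeftDense B (+ 2 * k) (n - + 1) × AntiSymmetric B (+ 2 * k) (n - + 1) ×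
   LeftAdditivelyMinimal B (+ 2 * k) (n - + 1) ×
   ⟦ A ⟧ ≐ TSet k n B)

IsReflectedTForm : List ℤ → ℤ → Set
IsReflectedTForm A n = ∃[ k ] ∃[ B ]
  (+ 0 ≤ k × + 2 * k ≤ n - + 4 × Unique B × SubsetOf B (+ 2 * k) (n - + 1) ×
   LeftDense B (+ 2 * k) (n - + 1) × AntiSymmetric B (+ 2 * k) (n - + 1) ×
   LeftAdditivelyMinimal B (+ 2 * k) (n - + 1) ×
   ⟦ A ⟧ ≐ (λ x → ∃[ t ] (TSet k n B t × x ≡ n - t)))

IsSForm : List ℤ → ℤ → Set
IsSForm A n = ∃[ u ] ∃[ C ] ∃[ D ]
  (+ 4 ≤ u × u ≤ n - + 6 ×
   Unique C × SubsetOf C (+ 1) u ×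
   RightDense C (+ 1) u × AntiSymmetric C (+ 1) u × RightAdditivelyMinimal C (+ 1) u ×
   Unique D × SubsetOf D (u + + 2) (n - + 1) ×
   LeftDense D (u + + 2) (n - + 1) × AntiSymmetric D (u + + 2) (n - + 1) ×
   LeftAdditivelyMinimal D (u + + 2) (n - + 1) ×
   ⟦ A ⟧ ≐ (singleton (+ 0) ∪ (⟦ C ⟧ ∪ (⟦ D ⟧ ∪ singleton n))))

module Submission where

-- Write f(z) = 2|A ∩ [0,z]| - (z + 1).  By the pigeonhole principle z ∈ 2A when f(z) > 0, and
-- z + n ∈ 2A when f(z - 1) < f(n); if this fails at the critical level then A is antisymmetric
-- on [0,z], respectively on [z,n].  Folding 2A modulo n gives |2A| = 2|A| - 1 + (sums at holes).
-- For n ≤ 2|A| - 3 the positions missing on the left of 2A and those missing on its right either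
-- are separated, which leaves a long interval, or overlap, and then equality in the count forces
-- two progressions.  For n = 2|A| - 2 at most one hole z₀ is uncovered (or A is periodic), every
-- other hole is covered once, and antisymmetry around z₀ yields the sets T and S.  For larger n
-- one removes the maximum and uses induction on |A|: if this destroys at most three sums, then
-- all elements of n - A but 0, the least positive one and one more are sums of two others.

-- The final balance f(n) is 2|A| - 1 - n, so the three ranges of n are f(n) at least 2, equal to 1,
-- and at most 0. The equation |2A| = 3|A| - 3 says that the numbers of sums among z and z + n, each
-- less one, add up to f(n) - 2 over the holes z in [0,n). As f moves by one at each step, this
-- total can be compared with the descents that f has to make, and equality then fixes how often
-- each hole is covered. The recurring tool: two antisymmetries with different centres compose to a
-- translation. A second uncovered position thus makes A periodic, and a centre next to the first
-- carries membership from c to c + 1 or c + 2. The obstacle is the sparse range. Removing the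
-- maximum keeps pace with 3|A| - 3 only if it destroys three sums, so bound and structure are
-- proved in one induction. If it destroys only two at either end, A is cut at an element m instead:
-- the two parts share only the sum 2m, and each is generated from its first step by sums, which
-- neither a bi-arithmetic progression nor K_6 is.

open import Data.Bool using (Bool; true; false; _∧_; _∨_; if_then_else_; T; not)
open import Data.Nat as ℕ using (ℕ; zero; suc)
import Data.Nat.Properties as ℕ
import Data.Nat.GCD as GCD
open import Data.Integer using (ℤ; +_; -[1+_]; _+_; _-_; _*_; -_; _≤_; _<_; _≤ᵇ_; ∣_∣; _/ℕ_; 1ℤ; +≤+; +<+; -<+; -≤+) renaming (0ℤ to 0z)
open import Data.Integer.Properties renaming (≤-trans to ≤t; ≤-refl to ≤r; ≤-reflexive to ≡⇒≤; +-identityˡ to 0+; +-identityʳ to +0; *-zeroʳ to *0; *-identityˡ to 1*; *-identityʳ to *1; +-mono-≤ to +≤; i≤j⇒0≤j-i to 0≤-; ≤-antisym to ≤≥; 0≤i⇒+∣i∣≡i to ∣+∣; ≤∧≢⇒< to ≤≢⇒<)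
open import Data.Integer.Tactic.RingSolver using () renaming (solve-∀ to solve)
open import Data.List using (List; []; _∷_; map; _++_; foldr; length)
open import Data.List.Relation.Unary.All using (All; []; _∷_)
open import Data.List.Relation.Unary.Any using (Any; here) renaming (there to th)
open import Data.Product using (Σ; _×_; _,_) renaming (proj₁ to fst; proj₂ to snd)
open import Data.Sum using (_⊎_; [_,_]′) renaming (inj₁ to inl; inj₂ to inr)
open import Data.Empty using (⊥) renaming (⊥-elim to ⊥e)
open import Data.Unit using (⊤; tt)
open import Function using (case_of_)
open import Relation.Nullary using (¬_; Dec; yes; no)
open import Relation.Nullary.Decidable using (_×-dec_; _⊎-dec_; _→-dec_; decidable-stable)
open import Relation.Binary.PropositionalEquality renaming (trans to tr)
open import Relation.Binary.Definitions using (tri<; tri≈; tri>)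
open import Defs using (K6; _+²_; ℤ²)
open import Data.List.Relation.Unary.AllPairs using (AllPairs; []; _∷_)
import Data.List.Relation.Unary.All as All
import Data.List.Relation.Unary.Any as Any
open import Data.List.Relation.Unary.All.Properties using (¬Any⇒All¬)
import Data.List.Membership.Propositional as Mem
open import Data.List.Membership.Propositional.Properties using (∈-map⁺; ∈-map⁻)
import Data.List.Membership.DecPropositional as DecMem
open import Data.Product.Properties using (≡-dec)
open import Relation.Nullary.Decidable using (toWitness)
import Defs as Df
import Data.List as L
open import Data.List.Relation.Unary.Unique.Propositional using (Unique)
import Data.List.Relation.Unary.Unique.Propositional.Properties as Unique
open import Data.List.Membership.Propositional.Properties using (∈-filter⁺; ∈-filter⁻; ∈-++⁺ˡ; ∈-++⁺ʳ; ∈-++⁻; ∈-upTo⁺; ∈-upTo⁻)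
import Data.Nat.Divisibility as ℕ
open import Function.Bundles using (mk⇔; Equivalence)

-- A reflective decision procedure for linear integer arithmetic

module Lia where
 infixl 6 _:+_ _:-_
 infixl 7 _:*_
 infix 4 _<=_ _:<_ _==_
 infixr 3 _:∧_
 infixr 2 _:∨_
 infixr 1 _=>_
 -- Products of unknowns do not fit in here. A caller that needs one passes it as a further
 -- variable, together with the linear facts known about it.
 data Expr : Set where
  var  : ℕ -> Expr
  con  : ℤ -> Expr
  _:+_ _:-_ : Expr -> Expr -> Expr
  _:*_ : ℤ -> Expr -> Expr
 κ : ℕ -> Expr
 κ m = con (+ m)
 data Formula : Set where
  _<=_ _:<_ _==_ : Expr -> Expr -> Formula
  _:∧_ _:∨_ _=>_ : Formula -> Formula -> Formula
  ff : Formula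
 Env : Set
 Env = List ℤ
 look : ℕ -> Env -> ℤ
 look _ [] = 0z
 look zero (x ∷ _) = x
 look (suc i) (_ ∷ xs) = look i xs
 ev : Expr -> Env -> ℤ
 ev (var i) ρ = look i ρ
 ev (con c) ρ = c
 ev (a :+ b) ρ = ev a ρ + ev b ρ
 ev (a :- b) ρ = ev a ρ - ev b ρ
 ev (c :* a) ρ = c * ev a ρ
 ⟪_⟫ : Formula -> Env -> Set
 ⟪ a <= b ⟫ ρ = ev a ρ ≤ ev b ρ
 ⟪ a :< b ⟫ ρ = ev a ρ < ev b ρ
 ⟪ a == b ⟫ ρ = ev a ρ ≡ ev b ρ
 ⟪ a :∧ b ⟫ ρ = ⟪ a ⟫ ρ × ⟪ b ⟫ ρ
 ⟪ a :∨ b ⟫ ρ = ⟪ a ⟫ ρ ⊎ ⟪ b ⟫ ρ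
 ⟪ a => b ⟫ ρ = ⟪ a ⟫ ρ -> ⟪ b ⟫ ρ
 ⟪ ff ⟫ ρ = ⊥
 formula? : ∀ φ ρ -> Dec (⟪ φ ⟫ ρ)
 formula? (a <= b) ρ = ev a ρ ≤? ev b ρ
 formula? (a :< b) ρ = ev a ρ <? ev b ρ
 formula? (a == b) ρ = ev a ρ ≟ ev b ρ
 formula? (a :∧ b) ρ = formula? a ρ ×-dec formula? b ρ
 formula? (a :∨ b) ρ = formula? a ρ ⊎-dec formula? b ρ
 formula? (a => b) ρ = formula? a ρ →-dec formula? b ρ
 formula? ff ρ = no \ ()
 -- A constant and a list of coefficients whose head belongs to the variable eliminated next.
 -- Missing entries count as 0, so lists of different lengths can be added.
 Lin : Set
 Lin = ℤ × List ℤ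
 dot : List ℤ -> Env -> ℤ
 dot [] _ = 0z
 dot (_ ∷ _) [] = 0z
 dot (a ∷ as) (x ∷ xs) = a * x + dot as xs
 evL : Lin -> Env -> ℤ
 evL (c , as) ρ = c + dot as ρ
 addV : List ℤ -> List ℤ -> List ℤ
 addV [] bs = bs
 addV as@(_ ∷ _) [] = as
 addV (a ∷ as) (b ∷ bs) = a + b ∷ addV as bs
 scaleV : ℤ -> List ℤ -> List ℤ
 scaleV k = map (k *_)
 unitV : ℕ -> List ℤ
 unitV zero = 1ℤ ∷ []
 unitV (suc i) = 0z ∷ unitV i
 dot-add : ∀ as bs ρ -> dot (addV as bs) ρ ≡ dot as ρ + dot bs ρ
 dot-add [] bs ρ = sym (0+ _)
 dot-add (a ∷ as) [] ρ = sym (+0 _)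
 dot-add (a ∷ as) (b ∷ bs) [] = refl
 dot-add (a ∷ as) (b ∷ bs) (x ∷ ρ) rewrite dot-add as bs ρ = ring a b x (dot as ρ) (dot bs ρ)
  where
  ring : ∀ a b x s t -> (a + b) * x + (s + t) ≡ a * x + s + (b * x + t)
  ring = solve
 dot-scale : ∀ k as ρ -> dot (scaleV k as) ρ ≡ k * dot as ρ
 dot-scale k [] ρ = sym (*0 k)
 dot-scale k (a ∷ as) [] = sym (*0 k)
 dot-scale k (a ∷ as) (x ∷ ρ) rewrite dot-scale k as ρ = ring k a x (dot as ρ)
  where
  ring : ∀ k a x s -> k * a * x + k * s ≡ k * (a * x + s)
  ring = solve
 dot-unit : ∀ i ρ -> dot (unitV i) ρ ≡ look i ρ
 dot-unit zero [] = refl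
 dot-unit zero (x ∷ ρ) = tr (+0 _) (1* x)
 dot-unit (suc i) [] = refl
 dot-unit (suc i) (x ∷ ρ) = tr (0+ _) (dot-unit i ρ)
 comb : ℤ -> Lin -> ℤ -> Lin -> Lin
 comb k (c , as) l (d , bs) = k * c + l * d , addV (scaleV k as) (scaleV l bs)
 ev-comb : ∀ k P l Q ρ -> evL (comb k P l Q) ρ ≡ k * evL P ρ + l * evL Q ρ
 ev-comb k (c , as) l (d , bs) ρ
  rewrite dot-add (scaleV k as) (scaleV l bs) ρ | dot-scale k as ρ | dot-scale l bs ρ
  = ring k c (dot as ρ) l d (dot bs ρ)
  where
  ring : ∀ k c s l d t -> k * c + l * d + (k * s + l * t) ≡ k * (c + s) + l * (d + t)
  ring = solve
 lin : Expr -> Lin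
 lin (var i) = 0z , unitV i
 lin (con c) = c , []
 lin (a :+ b) = comb 1ℤ (lin a) 1ℤ (lin b)
 lin (a :- b) = comb 1ℤ (lin a) (- 1ℤ) (lin b)
 lin (c :* a) = comb c (lin a) 0z (0z , [])
 ev-lin : ∀ e ρ -> evL (lin e) ρ ≡ ev e ρ
 ev-lin (var i) ρ = tr (0+ _) (dot-unit i ρ)
 ev-lin (con c) ρ = +0 c
 ev-lin (a :+ b) ρ rewrite ev-comb 1ℤ (lin a) 1ℤ (lin b) ρ | ev-lin a ρ | ev-lin b ρ =
  ring (ev a ρ) (ev b ρ)
  where
  ring : ∀ a b -> 1ℤ * a + 1ℤ * b ≡ a + b
  ring = solve
 ev-lin (a :- b) ρ rewrite ev-comb 1ℤ (lin a) (- 1ℤ) (lin b) ρ | ev-lin a ρ | ev-lin b ρ =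
  ring (ev a ρ) (ev b ρ)
  where
  ring : ∀ a b -> 1ℤ * a + (- 1ℤ) * b ≡ a - b
  ring = solve
 ev-lin (c :* a) ρ rewrite ev-comb c (lin a) 0z (0z , []) ρ | ev-lin a ρ = +0 _
 Zero NonNeg : Lin -> Env -> Set
 Zero P ρ = evL P ρ ≡ 0z
 NonNeg P ρ = 0z ≤ evL P ρ
 hd : List ℤ -> ℤ
 hd [] = 0z
 hd (a ∷ _) = a
 tl : List ℤ -> List ℤ
 tl [] = []
 tl (_ ∷ as) = as
 hdE : Env -> ℤ
 hdE [] = 0z
 hdE (x ∷ _) = x
 tlE : Env -> Env
 tlE [] = []
 tlE (_ ∷ xs) = xs
 coef : Lin -> ℤ
 coef (_ , as) = hd as
 rest : Lin -> Lin
 rest (c , as) = c , tl as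
 dot-[] : ∀ as -> dot as [] ≡ 0z
 dot-[] [] = refl
 dot-[] (_ ∷ _) = refl
 ev-split : ∀ P ρ -> evL P ρ ≡ coef P * hdE ρ + evL (rest P) (tlE ρ)
 ev-split (c , []) ρ = sym (0+ _)
 ev-split (c , a ∷ as) [] rewrite dot-[] as | *0 a = sym (0+ _)
 ev-split (c , a ∷ as) (x ∷ ρ) = ring c a x (dot as ρ)
  where
  ring : ∀ c a x s -> c + (a * x + s) ≡ a * x + (c + s)
  ring = solve
 eqV : List ℤ -> List ℤ -> Bool
 eqV [] [] = true
 eqV (a ∷ as) (b ∷ bs) = (a ≤ᵇ b) ∧ (b ≤ᵇ a) ∧ eqV as bs
 eqV _ _ = false
 T-∧ : ∀ {a b} -> T (a ∧ b) -> T a × T b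
 T-∧ {true} t = tt , t
 eqV-sound : ∀ as bs -> T (eqV as bs) -> as ≡ bs
 eqV-sound [] [] _ = refl
 eqV-sound (a ∷ as) (b ∷ bs) t = let p , q = T-∧ {a ≤ᵇ b} t ; q1 , q₂ = T-∧ {b ≤ᵇ a} q in
  cong₂ _∷_ (≤≥ (≤ᵇ⇒≤ p) (≤ᵇ⇒≤ q1)) (eqV-sound as bs q₂)
 content : List ℤ -> ℕ
 content = foldr (\ a g -> GCD.gcd ∣ a ∣ g) 0
 quotients : ℕ -> Lin -> Lin
 quotients zero P = P
 quotients m@(suc _) (c , as) = c /ℕ m , map (_/ℕ m) as
 divides-by : ℕ -> Lin -> Lin -> Bool
 divides-by m (c , as) (d , bs) = eqV (scaleV (+ m) bs) as ∧ (c + + 1 ≤ᵇ + m * (d + + 1))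
 -- Integer tightening. The result of the division is re-checked, so no property of gcd or of division is needed.
 normalise : Lin -> Lin
 normalise P@(c , as) = if divides-by m P Q then Q else P
  where
  m = content as
  Q = quotients m P
 divides-sound : ∀ m P Q ρ -> T (divides-by m P Q) -> NonNeg P ρ -> NonNeg Q ρ
 divides-sound m P@(c , as) (d , bs) ρ checked h = conclude
  where
  t = T-∧ {eqV (scaleV (+ m) bs) as} checked
  s : ℤ
  s = dot bs ρ
  as≡ : dot as ρ ≡ + m * s
  as≡ = tr (cong (\ v -> dot v ρ) (sym (eqV-sound (scaleV (+ m) bs) as (fst t)))) (dot-scale (+ m) bs ρ)
  ring : ∀ m d s -> m * (d + + 1) + m * s ≡ m * (d + s + + 1)
  ring = solve
  big : + 1 ≤ + m * (d + s + + 1)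
  big = begin
   + 1 ≤⟨ +-monoʳ-≤ (+ 1) h ⟩
   + 1 + (c + dot as ρ) ≡⟨ tr (sym (+-assoc (+ 1) c _)) (cong₂ _+_ (+-comm (+ 1) c) as≡) ⟩
   c + + 1 + + m * s ≤⟨ +-monoˡ-≤ (+ m * s) (≤ᵇ⇒≤ {c + + 1} {+ m * (d + + 1)} (snd t)) ⟩
   + m * (d + + 1) + + m * s ≡⟨ ring (+ m) d s ⟩
   + m * (d + s + + 1) ∎
   where open ≤-Reasoning
  conclude : 0z ≤ d + s
  conclude with 0z ≤? d + s
  ... | yes p = p
  ... | no p = ⊥e (≤⇒≯ big (≤-<-trans low (+<+ (ℕ.s≤s ℕ.z≤n))))
   where
   neg : d + s + + 1 ≤ 0z
   neg = subst (_≤ 0z) (+-comm (+ 1) (d + s)) (i<j⇒suc[i]≤j (≰⇒> p))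
   low : + m * (d + s + + 1) ≤ 0z
   low = subst (+ m * (d + s + + 1) ≤_) (*0 (+ m)) (*-monoˡ-≤-nonNeg (+ m) neg)
 normalise-sound : ∀ P ρ -> NonNeg P ρ -> NonNeg (normalise P) ρ
 normalise-sound P@(c , as) ρ h with divides-by (content as) P (quotients (content as) P) in eq
 ... | true = divides-sound (content as) P (quotients (content as) P) ρ (subst T (sym eq) tt) h
 ... | false = h
 record System : Set where
  constructor sys
  field
   eqs ins : List Lin
 open System
 Holds : System -> Env -> Set
 Holds s ρ = All (\ P -> Zero P ρ) (eqs s) × All (\ P -> NonNeg P ρ) (ins s)
 isUnit : ℤ -> Bool
 isUnit (+ 1) = true
 isUnit -[1+ 0 ] = true
 isUnit _ = false
 unit-sq : ∀ u -> T (isUnit u) -> u * u ≡ 1ℤ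
 unit-sq (+ 1) _ = refl
 unit-sq -[1+ 0 ] _ = refl
 data Pick : Set where
  none : Pick
  found : Lin -> Pick
 pick : List Lin -> Pick
 pick [] = none
 pick (P ∷ Ps) = if isUnit (coef P) then found P else pick Ps
 pick-sound : ∀ Ps ρ P -> All (\ P -> Zero P ρ) Ps -> pick Ps ≡ found P -> Zero P ρ × T (isUnit (coef P))
 pick-sound (Q ∷ Qs) ρ P (h ∷ hs) e with isUnit (coef Q) in eq
 pick-sound (Q ∷ Qs) ρ .Q (h ∷ hs) refl | true = h , subst T (sym eq) tt
 ... | false = pick-sound Qs ρ P hs e
 -- The leading coefficient e of the equation is 1 or -1, so subtracting c * e times the equation
 -- cancels a leading coefficient c without any division.
 substE : Lin -> Lin -> Lin
 substE E P = comb 1ℤ (rest P) (- (coef P * coef E)) (rest E)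
 substE-sound : ∀ E P ρ -> Zero E ρ -> T (isUnit (coef E)) -> evL (substE E P) (tlE ρ) ≡ evL P ρ
 substE-sound E P ρ z u rewrite ev-comb 1ℤ (rest P) (- (coef P * coef E)) (rest E) (tlE ρ) = begin
  1ℤ * p + - (c * e) * s      ≡⟨ ring1 p c e s x ⟩
  c * (e * e) * x + p - c * e * (e * x + s) ≡⟨ cong₂ (\ v w -> c * v * x + p - c * e * w) (unit-sq e u) (tr (sym (ev-split E ρ)) z) ⟩
  c * 1ℤ * x + p - c * e * 0z ≡⟨ ring2 p c e x ⟩
  c * x + p ≡⟨ ev-split P ρ ⟨
  evL P ρ ∎
  where
  open ≡-Reasoning
  p = evL (rest P) (tlE ρ)
  s = evL (rest E) (tlE ρ)
  c = coef P
  e = coef E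
  x = hdE ρ
  ring1 : ∀ p c e s x -> 1ℤ * p + - (c * e) * s ≡ c * (e * e) * x + p - c * e * (e * x + s)
  ring1 = solve
  ring2 : ∀ p c e x -> c * 1ℤ * x + p - c * e * 0z ≡ c * x + p
  ring2 = solve
 neg : Lin -> Lin
 neg P = comb (- 1ℤ) P 0z (0z , [])
 data SignOf (a : ℤ) : Set where
  isZero : a ≡ 0z -> SignOf a
  isPos : 0z ≤ a -> SignOf a
  isNeg : 0z ≤ - a -> SignOf a
 signOf : ∀ a -> SignOf a
 signOf (+ 0) = isZero refl
 signOf (+ suc n) = isPos (+≤+ ℕ.z≤n)
 signOf -[1+ n ] = isNeg (+≤+ ℕ.z≤n)
 -- Equations on which the eliminated variable still occurs become two inequalities.
 demote : List Lin -> System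
 demote [] = sys [] []
 demote (P ∷ Ps) with signOf (coef P) | demote Ps
 ... | isZero _ | sys es is = sys (rest P ∷ es) is
 ... | _ | sys es is = sys es (normalise P ∷ normalise (neg P) ∷ is)
 record Parts : Set where
  constructor parts
  field
   zeros poss negs : List Lin
 open Parts
 partition3 : List Lin -> Parts
 partition3 [] = parts [] [] []
 partition3 (P ∷ Ps) with signOf (coef P) | partition3 Ps
 ... | isZero _ | parts z p n = parts (rest P ∷ z) p n
 ... | isPos _ | parts z p n = parts z (P ∷ p) n
 ... | isNeg _ | parts z p n = parts z p (P ∷ n)
 -- The step of Fourier and Motzkin: opposite signs of the leading coefficients make both
 -- multipliers nonnegative, and the leading terms cancel.
 cross : Lin -> Lin -> Lin
 cross P Q = normalise (comb (- coef Q) (rest P) (coef P) (rest Q))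
 -- Discarding combinations that hold everywhere curbs the growth of the system under elimination.
 trivial : Lin -> Bool
 trivial (c , as) = (0z ≤ᵇ c) ∧ foldr (\ a b -> (a ≤ᵇ 0z) ∧ (0z ≤ᵇ a) ∧ b) true as
 addTo : Lin -> List Lin -> List Lin
 addTo P Ps = if trivial P then Ps else P ∷ Ps
 crosses : Lin -> List Lin -> List Lin -> List Lin
 crosses P [] acc = acc
 crosses P (Q ∷ Qs) acc = addTo (cross P Q) (crosses P Qs acc)
 allCrosses : List Lin -> List Lin -> List Lin -> List Lin
 allCrosses [] ns acc = acc
 allCrosses (P ∷ Ps) ns acc = crosses P ns (allCrosses Ps ns acc)
 -- Only constraints without coefficients are inspected. Passing over the others is sound, since the
 -- answer `true` claims no more than a refutation.
 contra : System -> Bool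
 contra (sys es is) = bad1 es ∨ bad2 is
  where
  bad1 bad2 : List Lin -> Bool
  bad1 [] = false
  bad1 ((c , []) ∷ Ps) = not ((0z ≤ᵇ c) ∧ (c ≤ᵇ 0z)) ∨ bad1 Ps
  bad1 (_ ∷ Ps) = bad1 Ps
  bad2 [] = false
  bad2 ((c , []) ∷ Ps) = not (0z ≤ᵇ c) ∨ bad2 Ps
  bad2 (_ ∷ Ps) = bad2 Ps
 -- Each round removes the variable at the head of the environment. A unit equation is preferred
 -- because substitution does not increase the number of inequalities.
 elim : ℕ -> System -> Bool
 elim zero s = contra s
 elim (suc m) s with pick (eqs s)
 ... | found E = elim m (sys (map (substE E) (eqs s)) (map (\ P -> normalise (substE E P)) (ins s)))
 ... | none with demote (eqs s)
 ... | sys es is with partition3 (is ++ ins s)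
 ... | parts z p n = elim m (sys es (allCrosses p n z))
 contra-sound : ∀ s ρ -> Holds s ρ -> T (contra s) -> ⊥
 contra-sound (sys es is) ρ (he , hi) t = go es he t
  where
  go2 : ∀ is -> All (\ P -> NonNeg P ρ) is -> T (contra (sys [] is)) -> ⊥
  go2 ((c , []) ∷ Ps) (h ∷ hs) t with 0z ≤ᵇ c in eq
  ... | true = go2 Ps hs t
  ... | false = subst T eq (≤⇒≤ᵇ (subst (0z ≤_) (+0 c) h))
  go2 ((c , _ ∷ _) ∷ Ps) (h ∷ hs) t = go2 Ps hs t
  go : ∀ es -> All (\ P -> Zero P ρ) es -> T (contra (sys es is)) -> ⊥
  go [] _ t = go2 is hi t
  go ((c , []) ∷ Ps) (h ∷ hs) t with (0z ≤ᵇ c) ∧ (c ≤ᵇ 0z) in eq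
  ... | true = go Ps hs t
  ... | false with tr (sym (+0 c)) h
  ... | refl with () ← eq
  go ((c , _ ∷ _) ∷ Ps) (h ∷ hs) t = go Ps hs t
 rest-zero : ∀ P ρ -> coef P ≡ 0z -> evL P ρ ≡ evL (rest P) (tlE ρ)
 rest-zero P ρ e rewrite ev-split P ρ | e = 0+ _
 demote-sound : ∀ Ps ρ -> All (\ P -> Zero P ρ) Ps ->
  All (\ P -> Zero P (tlE ρ)) (eqs (demote Ps)) × All (\ P -> NonNeg P ρ) (ins (demote Ps))
 demote-sound [] ρ [] = [] , []
 demote-sound (P ∷ Ps) ρ (h ∷ hs) with signOf (coef P) | demote Ps | demote-sound Ps ρ hs
 ... | isZero e | sys es is | he , hi = tr (sym (rest-zero P ρ e)) h ∷ he , hi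
 ... | isPos _ | sys es is | he , hi = he , normalise-sound P ρ (≡⇒≤ (sym h)) ∷ normalise-sound (neg P) ρ (≡⇒≤ (sym (tr (ev-comb (- 1ℤ) P 0z (0z , []) ρ) (cong (\ v -> - 1ℤ * v + 0z) h)))) ∷ hi
 ... | isNeg _ | sys es is | he , hi = he , normalise-sound P ρ (≡⇒≤ (sym h)) ∷ normalise-sound (neg P) ρ (≡⇒≤ (sym (tr (ev-comb (- 1ℤ) P 0z (0z , []) ρ) (cong (\ v -> - 1ℤ * v + 0z) h)))) ∷ hi
 NN : Env -> List Lin -> Set
 NN ρ = All (\ P -> NonNeg P ρ)
 partition3-sound : ∀ Ps ρ -> NN ρ Ps -> let s = partition3 Ps in
  NN (tlE ρ) (zeros s) × (NN ρ (poss s) × All (\ P -> 0z ≤ coef P) (poss s)) × (NN ρ (negs s) × All (\ P -> 0z ≤ - coef P) (negs s))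
 partition3-sound [] ρ [] = [] , ([] , []) , ([] , [])
 partition3-sound (P ∷ Ps) ρ (h ∷ hs) with signOf (coef P) | partition3 Ps | partition3-sound Ps ρ hs
 ... | isZero e | parts z p n | hz , hp , hn = subst (0z ≤_) (rest-zero P ρ e) h ∷ hz , hp , hn
 ... | isPos e | parts z p n | hz , (hp , hp') , hn = hz , (h ∷ hp , e ∷ hp') , hn
 ... | isNeg e | parts z p n | hz , hp , (hn , hn') = hz , hp , (h ∷ hn , e ∷ hn')
 0≤* : ∀ {a b} -> 0z ≤ a -> 0z ≤ b -> 0z ≤ a * b
 0≤* {+ m} {+ n} _ _ = subst (0z ≤_) (pos-* m n) (+≤+ ℕ.z≤n)
 cross-sound : ∀ P Q ρ -> NonNeg P ρ -> NonNeg Q ρ -> 0z ≤ coef P -> 0z ≤ - coef Q -> NonNeg (cross P Q) (tlE ρ)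
 cross-sound P Q ρ hP hQ a b = normalise-sound (comb (- coef Q) (rest P) (coef P) (rest Q)) (tlE ρ)
  (subst (0z ≤_) eq (+≤ (0≤* b hP) (0≤* a hQ)))
  where
  ring : ∀ a b x p q -> - b * (a * x + p) + a * (b * x + q) ≡ - b * p + a * q
  ring = solve
  eq : - coef Q * evL P ρ + coef P * evL Q ρ ≡ evL (comb (- coef Q) (rest P) (coef P) (rest Q)) (tlE ρ)
  eq = tr (cong₂ (\ v w -> - coef Q * v + coef P * w) (ev-split P ρ) (ev-split Q ρ))
   (tr (ring (coef P) (coef Q) (hdE ρ) _ _) (sym (ev-comb (- coef Q) (rest P) (coef P) (rest Q) (tlE ρ))))
 addTo-sound : ∀ P Ps ρ -> NonNeg P ρ -> NN ρ Ps -> NN ρ (addTo P Ps)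
 addTo-sound P Ps ρ h hs with trivial P
 ... | true = hs
 ... | false = h ∷ hs
 crosses-sound : ∀ P Qs acc ρ -> NonNeg P ρ -> 0z ≤ coef P -> NN ρ Qs -> All (\ Q -> 0z ≤ - coef Q) Qs ->
  NN (tlE ρ) acc -> NN (tlE ρ) (crosses P Qs acc)
 crosses-sound P [] acc ρ hP a _ _ h = h
 crosses-sound P (Q ∷ Qs) acc ρ hP a (hQ ∷ hQs) (b ∷ bs) h =
  addTo-sound (cross P Q) _ (tlE ρ) (cross-sound P Q ρ hP hQ a b) (crosses-sound P Qs acc ρ hP a hQs bs h)
 allCrosses-sound : ∀ Ps Qs acc ρ -> NN ρ Ps -> All (\ P -> 0z ≤ coef P) Ps -> NN ρ Qs -> All (\ Q -> 0z ≤ - coef Q) Qs ->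
  NN (tlE ρ) acc -> NN (tlE ρ) (allCrosses Ps Qs acc)
 allCrosses-sound [] Qs acc ρ _ _ _ _ h = h
 allCrosses-sound (P ∷ Ps) Qs acc ρ (hP ∷ hPs) (a ∷ as) hQ b h =
  crosses-sound P Qs _ ρ hP a hQ b (allCrosses-sound Ps Qs acc ρ hPs as hQ b h)
 mapAll : ∀ {p q} {A B : Set} {P : A -> Set p} {Q : B -> Set q} (f : A -> B) {xs} -> (∀ {x} -> P x -> Q (f x)) -> All P xs -> All Q (map f xs)
 mapAll f g [] = []
 mapAll f g (p ∷ ps) = g p ∷ mapAll f g ps
 ++All : ∀ {p} {A : Set} {P : A -> Set p} {xs ys} -> All P xs -> All P ys -> All P (xs ++ ys)
 ++All [] qs = qs
 ++All (p ∷ ps) qs = p ∷ ++All ps qs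
 elim-sound : ∀ m s ρ -> Holds s ρ -> T (elim m s) -> ⊥
 elim-sound zero s ρ h t = contra-sound s ρ h t
 elim-sound (suc m) s ρ (he , hi) t with pick (eqs s) in pk
 ... | found E = elim-sound m _ (tlE ρ)
    ( mapAll (substE E) (\ {P} z -> tr (substE-sound E P ρ (fst ze) (snd ze)) z) he
    , mapAll (\ P -> normalise (substE E P)) (\ {P} z -> normalise-sound (substE E P) (tlE ρ) (subst (0z ≤_) (sym (substE-sound E P ρ (fst ze) (snd ze))) z)) hi) t
  where ze = pick-sound (eqs s) ρ E he pk
 ... | none with demote (eqs s) | demote-sound (eqs s) ρ he
 ... | sys es is | he' , hi' with partition3 (is ++ ins s) | partition3-sound (is ++ ins s) ρ (++All hi' hi)
 ... | parts z p n | hz , (hp , hp') , (hn , hn') = elim-sound m _ (tlE ρ) (he' , allCrosses-sound p n z ρ hp hp' hn hn' hz) t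
 leq less : Expr -> Expr -> Lin
 leq a b = comb 1ℤ (lin b) (- 1ℤ) (lin a)
 -- Integrality enters here: a < b becomes b - a - 1 >= 0.
 less a b = let (c , as) = leq a b in c - 1ℤ , as
 leq-ev : ∀ a b ρ -> evL (leq a b) ρ ≡ ev b ρ - ev a ρ
 leq-ev a b ρ rewrite ev-comb 1ℤ (lin b) (- 1ℤ) (lin a) ρ | ev-lin a ρ | ev-lin b ρ = ring (ev a ρ) (ev b ρ)
  where
  ring : ∀ a b -> 1ℤ * b + (- 1ℤ) * a ≡ b - a
  ring = solve
 leq-sound : ∀ a b ρ -> ev a ρ ≤ ev b ρ -> NonNeg (leq a b) ρ
 leq-sound a b ρ h = subst (0z ≤_) (sym (leq-ev a b ρ)) (0≤- h)
 less-sound : ∀ a b ρ -> ev a ρ < ev b ρ -> NonNeg (less a b) ρ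
 less-sound a b ρ h = subst (0z ≤_) (sym eq) (0≤- (i<j⇒suc[i]≤j h))
  where
  ring : ∀ c s -> c - 1ℤ + s ≡ c + s - 1ℤ
  ring = solve
  ring2 : ∀ a b -> b - a - 1ℤ ≡ b - (1ℤ + a)
  ring2 = solve
  eq : evL (less a b) ρ ≡ ev b ρ - (1ℤ + ev a ρ)
  eq = tr (ring (fst (leq a b)) _) (tr (cong (_- 1ℤ) (leq-ev a b ρ)) (ring2 (ev a ρ) (ev b ρ)))
 eq-sound : ∀ a b ρ -> ev a ρ ≡ ev b ρ -> Zero (leq a b) ρ
 eq-sound a b ρ h = tr (leq-ev a b ρ) (i≡j⇒i-j≡0 (sym h))
 -- Case splits are in continuation style: the remainder of the check runs once for each branch, and
 -- all branches must be refuted.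
 Cont : Set
 Cont = System -> Bool
 SoundAt : Env -> Cont -> Set
 SoundAt ρ k = ∀ s -> Holds s ρ -> T (k s) -> ⊥
 addIn addEq : Lin -> System -> System
 addIn P (sys es is) = sys es (normalise P ∷ is)
 addEq P (sys es is) = sys (P ∷ es) is
 assume deny : Formula -> Cont -> Cont
 assume (a <= b) k s = k (addIn (leq a b) s)
 assume (a :< b) k s = k (addIn (less a b) s)
 assume (a == b) k s = k (addEq (leq a b) s)
 assume (φ :∧ ψ) k s = assume φ (assume ψ k) s
 assume (φ :∨ ψ) k s = assume φ k s ∧ assume ψ k s
 assume (φ => ψ) k s = deny φ k s ∧ assume ψ k s
 assume ff k s = true
 deny (a <= b) k s = k (addIn (less b a) s)
 deny (a :< b) k s = k (addIn (leq b a) s)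
 deny (a == b) k s = k (addIn (less a b) s) ∧ k (addIn (less b a) s)
 deny (φ :∧ ψ) k s = deny φ k s ∧ deny ψ k s
 deny (φ :∨ ψ) k s = deny φ (deny ψ k) s
 deny (φ => ψ) k s = assume φ (deny ψ k) s
 deny ff k s = k s
 assume-sound : ∀ φ {k ρ} -> SoundAt ρ k -> ⟪ φ ⟫ ρ -> SoundAt ρ (assume φ k)
 deny-sound : ∀ φ {k ρ} -> SoundAt ρ k -> ¬ ⟪ φ ⟫ ρ -> SoundAt ρ (deny φ k)
 assume-sound (a <= b) hk p s (he , hi) t = hk _ (he , normalise-sound (leq a b) _ (leq-sound a b _ p) ∷ hi) t
 assume-sound (a :< b) hk p s (he , hi) t = hk _ (he , normalise-sound (less a b) _ (less-sound a b _ p) ∷ hi) t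
 assume-sound (a == b) hk p s (he , hi) t = hk _ (eq-sound a b _ p ∷ he , hi) t
 assume-sound (φ :∧ ψ) hk (p , q) = assume-sound φ (assume-sound ψ hk q) p
 assume-sound (φ :∨ ψ) {k} hk (inl p) s h t = assume-sound φ hk p s h (fst (T-∧ {assume φ k s} t))
 assume-sound (φ :∨ ψ) {k} hk (inr q) s h t = assume-sound ψ hk q s h (snd (T-∧ {assume φ k s} t))
 assume-sound (φ => ψ) {k} {ρ} hk p s h t with formula? φ ρ
 ... | yes q = assume-sound ψ hk (p q) s h (snd (T-∧ {deny φ k s} t))
 ... | no q = deny-sound φ hk q s h (fst (T-∧ {deny φ k s} t))
 deny-sound (a <= b) hk p s (he , hi) t = hk _ (he , normalise-sound (less b a) _ (less-sound b a _ (≰⇒> p)) ∷ hi) t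
 deny-sound (a :< b) hk p s (he , hi) t = hk _ (he , normalise-sound (leq b a) _ (leq-sound b a _ (≮⇒≥ p)) ∷ hi) t
 deny-sound (a == b) {k} {ρ} hk p s (he , hi) t with <-cmp (ev a ρ) (ev b ρ)
 ... | tri< l _ _ = hk _ (he , normalise-sound (less a b) ρ (less-sound a b ρ l) ∷ hi) (fst (T-∧ {k (addIn (less a b) s)} t))
 ... | tri≈ _ e _ = p e
 ... | tri> _ _ g = hk _ (he , normalise-sound (less b a) ρ (less-sound b a ρ g) ∷ hi) (snd (T-∧ {k (addIn (less a b) s)} t))
 deny-sound (φ :∧ ψ) {k} {ρ} hk p s h t with formula? φ ρ
 ... | yes q = deny-sound ψ hk (\ r -> p (q , r)) s h (snd (T-∧ {deny φ k s} t))
 ... | no q = deny-sound φ hk q s h (fst (T-∧ {deny φ k s} t))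
 deny-sound (φ :∨ ψ) hk p = deny-sound φ (deny-sound ψ hk (\ q -> p (inr q))) (\ q -> p (inl q))
 deny-sound (φ => ψ) {k} {ρ} hk p s h t with formula? φ ρ
 ... | yes q = assume-sound φ (deny-sound ψ hk (\ r -> p (\ _ -> r))) q s h t
 ... | no q = ⊥e (p (\ r -> ⊥e (q r)))
 deny-sound ff hk p s h t = hk s h t
 valid : ℕ -> Formula -> Bool
 valid n φ = deny φ (elim n) (sys [] [])
 valid-sound : ∀ n φ ρ -> T (valid n φ) -> ⟪ φ ⟫ ρ
 valid-sound n φ ρ t = decidable-stable (formula? φ ρ) \ p -> deny-sound φ {elim n} (\ s -> elim-sound n s ρ) p (sys [] []) ([] , []) t
 Builder : ℕ -> Set
 Builder zero = Formula
 Builder (suc n) = Expr -> Builder n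
 build : ∀ n -> ℕ -> Builder n -> Formula
 build zero _ φ = φ
 build (suc n) i f = build n (suc i) (f (var i))
 ForAll : ℕ -> (Env -> Set) -> Set
 ForAll zero P = P []
 ForAll (suc n) P = (x : ℤ) -> ForAll n (\ ρ -> P (x ∷ ρ))
 forAll : ∀ n {P} -> (∀ ρ -> P ρ) -> ForAll n P
 forAll zero h = h []
 forAll (suc n) h x = forAll n (\ ρ -> h (x ∷ ρ))
 -- The hidden argument is a closed boolean that evaluates to `true` during type checking for the
 -- formulas below, so it is filled in automatically.
 lia : ∀ n (f : Builder n) -> {T (valid n (build n 0 f))} -> ForAll n ⟪ build n 0 f ⟫
 lia n f {t} = forAll n (\ ρ -> valid-sound n (build n 0 f) ρ t)


open Lia using (Expr; Formula; con; κ; _:+_; _:-_; _:*_; _<=_; _:<_; _==_; _:∧_; _:∨_; _=>_; ff; lia)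

infix 3 ~_
~_ : Formula -> Formula
~ F = F => ff

infixl 7 _*:_
_*:_ : ℕ -> Expr -> Expr
m *: e = + m :* e

#0 #1 #2 #3 #4 #5 #6 #13 #15 : Expr
#0 = κ 0
#1 = κ 1
#2 = κ 2
#3 = κ 3
#4 = κ 4
#5 = κ 5
#6 = κ 6
#13 = κ 13
#15 = κ 15

-- Frequent linear inequalities

0≤+ : ∀ {m} -> 0z ≤ + m
0≤+ = +≤+ ℕ.z≤n

1≤+ : ∀ {m} -> + 1 ≤ + suc m
1≤+ = +≤+ (ℕ.s≤s ℕ.z≤n)

0<+ : ∀ {m} -> 0z < + suc m
0<+ = +<+ (ℕ.s≤s ℕ.z≤n)

x≤x+1 : ∀ {x} -> x ≤ x + + 1
x≤x+1 = lia 1 (\x -> x <= x :+ #1) _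

x<x+1 : ∀ {x} -> x < x + + 1
x<x+1 = lia 1 (\x -> x :< x :+ #1) _

x-1≤x : ∀ {x} -> x - + 1 ≤ x
x-1≤x = lia 1 (\x -> x :- #1 <= x) _

x-1<x : ∀ {x} -> x - + 1 < x
x-1<x = lia 1 (\x -> x :- #1 :< x) _

x≡0+1x : ∀ {x} -> x ≡ 0z + + 1 * x
x≡0+1x = lia 1 (\x -> x == #0 :+ 1 *: x) _

x≰0⇒1≤x : ∀ {x} -> (x ≤ 0z -> ⊥) -> + 1 ≤ x
x≰0⇒1≤x = lia 1 (\x -> ~ x <= #0 => #1 <= x) _

1≤x⇒0<x : ∀ {x} -> + 1 ≤ x -> 0z < x
1≤x⇒0<x = lia 1 (\x -> #1 <= x => #0 :< x) _

x≡x-1+1 : ∀ {x} -> x ≡ x - + 1 + + 1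
x≡x-1+1 = lia 1 (\x -> x == x :- #1 :+ #1) _

x≰1⇒2≤x : ∀ {x} -> (x ≤ + 1 -> ⊥) -> + 2 ≤ x
x≰1⇒2≤x = lia 1 (\x -> ~ x <= #1 => #2 <= x) _

x-1+1≡x : ∀ {x} -> x - + 1 + + 1 ≡ x
x-1+1≡x = lia 1 (\x -> x :- #1 :+ #1 == x) _

0≤x⇒0≤x+1 : ∀ {x} -> 0z ≤ x -> 0z ≤ x + + 1
0≤x⇒0≤x+1 = lia 1 (\x -> #0 <= x => #0 <= x :+ #1) _

1≤x⇒0≤x-1 : ∀ {x} -> + 1 ≤ x -> 0z ≤ x - + 1
1≤x⇒0≤x-1 = lia 1 (\x -> #1 <= x => #0 <= x :- #1) _

2≤x⇒0≤x-2 : ∀ {x} -> + 2 ≤ x -> 0z ≤ x - + 2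
2≤x⇒0≤x-2 = lia 1 (\x -> #2 <= x => #0 <= x :- #2) _

0≤x⇒1≤x+1 : ∀ {x} -> 0z ≤ x -> + 1 ≤ x + + 1
0≤x⇒1≤x+1 = lia 1 (\x -> #0 <= x => #1 <= x :+ #1) _

0≤x⇒0≤x+x+1 : ∀ {x} -> 0z ≤ x -> 0z ≤ x + x + + 1
0≤x⇒0≤x+x+1 = lia 1 (\x -> #0 <= x => #0 <= x :+ x :+ #1) _

0≤x⇒x≢0⇒1≤x : ∀ {x} -> 0z ≤ x -> (x ≡ 0z -> ⊥) -> + 1 ≤ x
0≤x⇒x≢0⇒1≤x = lia 1 (\x -> #0 <= x => ~ x == #0 => #1 <= x) _

1≤x⇒x≢1⇒2≤x : ∀ {x} -> + 1 ≤ x -> (x ≡ + 1 -> ⊥) -> + 2 ≤ x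
1≤x⇒x≢1⇒2≤x = lia 1 (\x -> #1 <= x => ~ x == #1 => #2 <= x) _

1≤x⇒2≰x⇒x≡1 : ∀ {x} -> + 1 ≤ x -> (+ 2 ≤ x -> ⊥) -> x ≡ + 1
1≤x⇒2≰x⇒x≡1 = lia 1 (\x -> #1 <= x => ~ #2 <= x => x == #1) _

0≤y⇒x≤x+y : ∀ {x y} -> 0z ≤ y -> x ≤ x + y
0≤y⇒x≤x+y = lia 2 (\x y -> #0 <= y => x <= x :+ y) _ _

x+1≤y⇒x<y : ∀ {x y} -> x + + 1 ≤ y -> x < y
x+1≤y⇒x<y = lia 2 (\x y -> x :+ #1 <= y => x :< y) _ _

x+1≤y⇒x≤y : ∀ {x y} -> x + + 1 ≤ y -> x ≤ y
x+1≤y⇒x≤y = lia 2 (\x y -> x :+ #1 <= y => x <= y) _ _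

x<y⇒x+1≤y : ∀ {x y} -> x < y -> x + + 1 ≤ y
x<y⇒x+1≤y = lia 2 (\x y -> x :< y => x :+ #1 <= y) _ _

x<y+1⇒x≤y : ∀ {x y} -> x < y + + 1 -> x ≤ y
x<y+1⇒x≤y = lia 2 (\x y -> x :< y :+ #1 => x <= y) _ _

x≤y⇒x<y+1 : ∀ {x y} -> x ≤ y -> x < y + + 1
x≤y⇒x<y+1 = lia 2 (\x y -> x <= y => x :< y :+ #1) _ _

x<y⇒x≤y+1 : ∀ {x y} -> x < y -> x ≤ y + + 1
x<y⇒x≤y+1 = lia 2 (\x y -> x :< y => x <= y :+ #1) _ _

x<y⇒1≤y-x : ∀ {x y} -> x < y -> + 1 ≤ y - x
x<y⇒1≤y-x = lia 2 (\x y -> x :< y => #1 <= y :- x) _ _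

y<x⇒1≤x-y : ∀ {x y} -> y < x -> + 1 ≤ x - y
y<x⇒1≤x-y = lia 2 (\x y -> y :< x => #1 <= x :- y) _ _

1≤y⇒x<x+y : ∀ {x y} -> + 1 ≤ y -> x < x + y
1≤y⇒x<x+y = lia 2 (\x y -> #1 <= y => x :< x :+ y) _ _

0≤x⇒y-x≤y : ∀ {x y} -> 0z ≤ x -> y - x ≤ y
0≤x⇒y-x≤y = lia 2 (\x y -> #0 <= x => y :- x <= y) _ _

y≤x⇒y≤x+1 : ∀ {x y} -> y ≤ x -> y ≤ x + + 1
y≤x⇒y≤x+1 = lia 2 (\x y -> y <= x => y <= x :+ #1) _ _

x≤y⇒0≤y-x : ∀ {x y} -> x ≤ y -> 0z ≤ y - x
x≤y⇒0≤y-x = lia 2 (\x y -> x <= y => #0 <= y :- x) _ _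

x≤y⇒x-1<y : ∀ {x y} -> x ≤ y -> x - + 1 < y
x≤y⇒x-1<y = lia 2 (\x y -> x <= y => x :- #1 :< y) _ _

x<y⇒x≤y-1 : ∀ {x y} -> x < y -> x ≤ y - + 1
x<y⇒x≤y-1 = lia 2 (\x y -> x :< y => x <= y :- #1) _ _

x<y⇒x+1≤y+1 : ∀ {x y} -> x < y -> x + + 1 ≤ y + + 1
x<y⇒x+1≤y+1 = lia 2 (\x y -> x :< y => x :+ #1 <= y :+ #1) _ _

x≤y⇒x≢y⇒x<y : ∀ {x y} -> x ≤ y -> (x ≡ y -> ⊥) -> x < y
x≤y⇒x≢y⇒x<y = lia 2 (\x y -> x <= y => ~ x == y => x :< y) _ _

x≤y⇒x≢y⇒x≤y-1 : ∀ {x y} -> x ≤ y -> (x ≡ y -> ⊥) -> x ≤ y - + 1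
x≤y⇒x≢y⇒x≤y-1 = lia 2 (\x y -> x <= y => ~ x == y => x <= y :- #1) _ _

y≡x-1⇒1≤y⇒2≤x : ∀ {x y} -> y ≡ x - + 1 -> + 1 ≤ y -> + 2 ≤ x
y≡x-1⇒1≤y⇒2≤x = lia 2 (\x y -> y == x :- #1 => #1 <= y => #2 <= x) _ _

x<y⇒x+1≢y⇒x+1<y : ∀ {x y} -> x < y -> (x + + 1 ≡ y -> ⊥) -> x + + 1 < y
x<y⇒x+1≢y⇒x+1<y = lia 2 (\x y -> x :< y => ~ x :+ #1 == y => x :+ #1 :< y) _ _

x<y⇒y≤z+1⇒x≤z : ∀ {x y z} -> x < y -> y ≤ z + + 1 -> x ≤ z
x<y⇒y≤z+1⇒x≤z = lia 3 (\x y z -> x :< y => y <= z :+ #1 => x <= z) _ _ _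

x≡0⇒x≡y+z-1⇒z≡1⇒y≤0 : ∀ {x y z} -> x ≡ 0z -> x ≡ y + z - + 1 -> z ≡ + 1 -> y ≤ 0z
x≡0⇒x≡y+z-1⇒z≡1⇒y≤0 = lia 3 (\x y z -> x == #0 => x == y :+ z :- #1 => z == #1 => y <= #0) _ _ _

x≡0⇒x≡y+z-1⇒y≡1⇒z≤0 : ∀ {x y z} -> x ≡ 0z -> x ≡ y + z - + 1 -> y ≡ + 1 -> z ≤ 0z
x≡0⇒x≡y+z-1⇒y≡1⇒z≤0 = lia 3 (\x y z -> x == #0 => x == y :+ z :- #1 => y == #1 => z <= #0) _ _ _

1≤x⇒0≤x : ∀ {x} -> + 1 ≤ x -> 0z ≤ x
1≤x⇒0≤x = lia 1 (\x -> #1 <= x => #0 <= x) _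

x-0+1≡x+1 : ∀ x -> x - 0z + + 1 ≡ x + + 1
x-0+1≡x+1 x = lia 1 (\x -> x :- #0 :+ #1 == x :+ #1) x

x≡x-y+y : ∀ {x} y -> x ≡ x - y + y
x≡x-y+y y = lia 2 (\x y -> x == x :- y :+ y) _ y

x-[x-y]≡y : ∀ x {y} -> x - (x - y) ≡ y
x-[x-y]≡y x = lia 2 (\x y -> x :- (x :- y) == y) x _

x+[y-x]≡y : ∀ x {y} -> x + (y - x) ≡ y
x+[y-x]≡y x = lia 2 (\x y -> x :+ (y :- x) == y) x _

x≡y-[y-x] : ∀ {x} y -> x ≡ y - (y - x)
x≡y-[y-x] y = lia 2 (\x y -> x == y :- (y :- x)) _ y

x-y≡z⇒y≡x-z : ∀ x {y z} -> x - y ≡ z -> y ≡ x - z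
x-y≡z⇒y≡x-z x = lia 3 (\x y z -> x :- y == z => y == x :- z) x _ _

-- Induction from an integer bound, and sums over half-open intervals

≤-expand : ∀ {a x} -> a ≤ x -> Σ ℕ \m -> x ≡ a + + m
≤-expand {a} {x} a≤x with x - a in eq
... | + m = m , tr (ring a x) (cong (\d -> a + d) eq)
 where
 ring : ∀ a x -> x ≡ a + (x - a)
 ring = solve
... | -[1+ m ] = ⊥e (≤⇒≯ (0≤- a≤x) (subst (_< 0z) (sym eq) -<+))

rise : ∀ {ℓ} (P : ℤ -> Set ℓ) {a} -> P a -> (∀ x -> a ≤ x -> P x -> P (x + + 1)) -> ∀ {x} -> a ≤ x -> P x
rise P {a} base step a≤x with ≤-expand a≤x
... | m , refl = go m
 where
 go : ∀ m -> P (a + + m)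
 go zero = subst P (sym (+0 a)) base
 go (suc m) = subst P (lia 2 (\a m -> a :+ m :+ #1 == a :+ (#1 :+ m)) a (+ m))
  (step (a + + m) (0≤y⇒x≤x+y 0≤+) (go m))

climb : ∀ {ℓ} (P : ℤ -> Set ℓ) {a} b -> P a -> (∀ x -> a ≤ x -> x < b -> P x -> P (x + + 1)) ->
 ∀ {x} -> a ≤ x -> x ≤ b -> P x
climb P {a} b base step = \a≤x -> rise (\x -> x ≤ b -> P x) (\_ -> base)
 (\x a≤x ih x+1≤b -> step x a≤x (x+1≤y⇒x<y x+1≤b)
  (ih (x+1≤y⇒x≤y x+1≤b))) a≤x

descend : ∀ {ℓ} (P : ℤ -> Set ℓ) {b} a -> P b -> (∀ x -> x ≤ b -> a < x -> P x -> P (x - + 1)) ->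
 ∀ {x} -> a ≤ x -> x ≤ b -> P x
descend P {b} a base step {x} a≤x x≤b = subst P (x-[x-y]≡y b)
 (climb (\t -> P (b - t)) (b - a) (subst P (sym (lia 1 (\b -> b :- #0 == b) b)) base)
  (\t 0≤t t<b-a p -> subst P (lia 2 (\b t -> b :- t :- #1 == b :- (t :+ #1)) b t)
   (step (b - t) (lia 2 (\b t -> #0 <= t => b :- t <= b) b t 0≤t)
    (lia 3 (\a b t -> t :< b :- a => a :< b :- t) a b t t<b-a) p))
  {b - x} (lia 2 (\b x -> x <= b => #0 <= b :- x) b x x≤b)
  (lia 3 (\a b x -> a <= x => b :- x <= b :- a) a b x a≤x))

-- ∑ g a b sums g over a ≤ x < b and vanishes when b ≤ a.
span : ℤ -> ℕ
span (+ m) = m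
span -[1+ _ ] = 0

sumℕ : (ℤ -> ℤ) -> ℤ -> ℕ -> ℤ
sumℕ g a zero = 0z
sumℕ g a (suc m) = sumℕ g a m + g (a + + m)

abstract
 ∑ : (ℤ -> ℤ) -> ℤ -> ℤ -> ℤ
 ∑ g a b = sumℕ g a (span (b - a))
 span-+ : ∀ a m -> span (a + + m - a) ≡ m
 span-+ a m = cong span (lia 2 (\a m -> a :+ m :- a == m) a _)
 ∑-step : ∀ g a b -> a ≤ b -> ∑ g a (b + + 1) ≡ ∑ g a b + g b
 ∑-step g a b a≤b with ≤-expand a≤b
 ... | m , refl = tr (cong (sumℕ g a) eq) (cong (\s -> sumℕ g a s + g (a + + m)) (sym (span-+ a m)))
  where
  eq : span (a + + m + + 1 - a) ≡ suc m
  eq = cong span (lia 2 (\a m -> a :+ m :+ #1 :- a == #1 :+ m) a (+ m))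
 ∑-empty : ∀ g a -> ∑ g a a ≡ 0z
 ∑-empty g a = cong (sumℕ g a) (cong span (i≡j⇒i-j≡0 {a} refl))

∑-one : ∀ g a -> ∑ g a (a + + 1) ≡ g a
∑-one g a = tr (∑-step g a a ≤r) (tr (cong (_+ g a) (∑-empty g a)) (0+ (g a)))

∑-split : ∀ g {a b c} -> a ≤ b -> b ≤ c -> ∑ g a c ≡ ∑ g a b + ∑ g b c
∑-split g {a} {b} a≤b = rise (\c -> ∑ g a c ≡ ∑ g a b + ∑ g b c)
 (lia 2 (\s e -> e == #0 => s == s :+ e) _ _ (∑-empty g b))
 (\c b≤c ih -> lia 6 (\p q r s t u -> p == q :+ r => q == s :+ t => u == t :+ r => p == s :+ u)
  _ _ (g c) (∑ g a b) (∑ g b c) _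
  (∑-step g a c (≤t a≤b b≤c)) ih (∑-step g b c b≤c))

∑-step-low : ∀ g {a b} -> a < b -> ∑ g a b ≡ g a + ∑ g (a + + 1) b
∑-step-low g {a} {b} a<b = tr
 (∑-split g x≤x+1 (x<y⇒x+1≤y a<b))
 (cong (_+ ∑ g (a + + 1) b) (∑-one g a))

∑-mono : ∀ g h {a b} -> a ≤ b -> (∀ x -> a ≤ x -> x < b -> g x ≤ h x) -> ∑ g a b ≤ ∑ h a b
∑-mono g h {a} {b} a≤b le = climb (\c -> ∑ g a c ≤ ∑ h a c) b
 (≡⇒≤ (tr (∑-empty g a) (sym (∑-empty h a))))
 (\c a≤c c<b ih -> subst₂ _≤_ (sym (∑-step g a c a≤c)) (sym (∑-step h a c a≤c)) (+≤ ih (le c a≤c c<b)))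
 a≤b ≤r

∑-cong : ∀ g h {a b} -> a ≤ b -> (∀ x -> a ≤ x -> x < b -> g x ≡ h x) -> ∑ g a b ≡ ∑ h a b
∑-cong g h a≤b eq = ≤≥ (∑-mono g h a≤b \x p q -> ≡⇒≤ (eq x p q))
 (∑-mono h g a≤b \x p q -> ≡⇒≤ (sym (eq x p q)))

∑-+ : ∀ g h {a b} -> a ≤ b -> ∑ (\x -> g x + h x) a b ≡ ∑ g a b + ∑ h a b
∑-+ g h {a} = rise (\b -> ∑ (\x -> g x + h x) a b ≡ ∑ g a b + ∑ h a b)
 (lia 3 (\p q r -> p == #0 => q == #0 => r == #0 => p == q :+ r) _ _ _
  (∑-empty (\x -> g x + h x) a) (∑-empty g a) (∑-empty h a))
 (\b a≤b ih -> lia 8 (\p p' q q' r r' u v -> p' == p :+ (u :+ v) => q' == q :+ u => r' == r :+ v => p == q :+ r => p' == q' :+ r')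
  _ _ (∑ g a b) _ (∑ h a b) _ (g b) (h b)
  (∑-step (\x -> g x + h x) a b a≤b) (∑-step g a b a≤b) (∑-step h a b a≤b) ih)

∑-const : ∀ c {a b} -> a ≤ b -> ∑ (\_ -> c) a b ≡ c * (b - a)
∑-const c {a} = rise (\b -> ∑ (\_ -> c) a b ≡ c * (b - a))
 (tr (∑-empty (\_ -> c) a) (ring0 c a))
 (\b a≤b ih -> tr (∑-step (\_ -> c) a b a≤b) (tr (cong (_+ c) ih) (ring c a b)))
 where
 ring0 : ∀ c a -> 0z ≡ c * (a - a)
 ring0 = solve
 ring : ∀ c a b -> c * (b - a) + c ≡ c * (b + + 1 - a)
 ring = solve

∑-one' : ∀ {a b} -> a ≤ b -> ∑ (\_ -> + 1) a b ≡ b - a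
∑-one' {a} {b} a≤b = tr (∑-const (+ 1) a≤b) (1* (b - a))

∑-zero : ∀ {a b} -> a ≤ b -> ∑ (\_ -> 0z) a b ≡ 0z
∑-zero a≤b = ∑-const 0z a≤b

∑-shift : ∀ g c {a b} -> a ≤ b -> ∑ (\x -> g (x + c)) a b ≡ ∑ g (a + c) (b + c)
∑-shift g c {a} = rise (\b -> ∑ (\x -> g (x + c)) a b ≡ ∑ g (a + c) (b + c))
 (tr (∑-empty (\x -> g (x + c)) a) (sym (∑-empty g (a + c))))
 (\b a≤b ih -> tr (∑-step (\x -> g (x + c)) a b a≤b) (tr (cong (_+ g (b + c)) ih)
  (tr (sym (∑-step g (a + c) (b + c) (+-monoˡ-≤ c a≤b))) (cong (∑ g (a + c)) (lia 2 (\b c -> b :+ c :+ #1 == b :+ #1 :+ c) b c)))))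

-- The map x -> c - x turns [a,b) into the interval (c - b, c - a], open at the other end; hence the
-- 1 added to both bounds.
∑-reflect : ∀ g c {a b} -> a ≤ b -> ∑ (\x -> g (c - x)) a b ≡ ∑ g (c - b + + 1) (c - a + + 1)
∑-reflect g c {a} = rise (\b -> ∑ (\x -> g (c - x)) a b ≡ ∑ g (c - b + + 1) (c - a + + 1))
 (tr (∑-empty (\x -> g (c - x)) a) (sym (∑-empty g (c - a + + 1))))
 (\b a≤b ih -> tr (∑-step (\x -> g (c - x)) a b a≤b) (tr (cong (_+ g (c - b)) ih)
  (tr (+-comm (∑ g (c - b + + 1) (c - a + + 1)) (g (c - b)))
  (tr (sym (∑-step-low g (lia 3 (\a b c -> a <= b => c :- b :< c :- a :+ #1) a b c a≤b)))
   (cong (\e -> ∑ g e (c - a + + 1)) (lia 2 (\b c -> c :- b == c :- (b :+ #1) :+ #1) b c))))))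

∑-telescope : ∀ (h : ℤ -> ℤ) {a b} -> a ≤ b -> ∑ (\x -> h (x + + 1) - h x) a b ≡ h b - h a
∑-telescope h {a} = rise (\b -> ∑ (\x -> h (x + + 1) - h x) a b ≡ h b - h a)
 (tr (∑-empty (\x -> h (x + + 1) - h x) a) (lia 1 (\u -> #0 == u :- u) (h a)))
 (\b a≤b ih -> lia 5 (\p p' u v w -> p' == p :+ (w :- v) => p == v :- u => p' == w :- u)
  _ _ (h a) (h b) (h (b + + 1))
  (∑-step (\x -> h (x + + 1) - h x) a b a≤b) ih)

∑-nonneg : ∀ g {a b} -> a ≤ b -> (∀ x -> a ≤ x -> x < b -> 0z ≤ g x) -> 0z ≤ ∑ g a b
∑-nonneg g {a} {b} a≤b h = subst (_≤ ∑ g a b) (∑-zero a≤b) (∑-mono (\_ -> 0z) g a≤b h)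

∑-point : ∀ g {a b} x -> a ≤ x -> x < b -> ∑ g a b ≡ ∑ g a x + g x + ∑ g (x + + 1) b
∑-point g {a} {b} x a≤x x<b = tr (∑-split g a≤x (<⇒≤ x<b)) (tr (cong (\s -> ∑ g a x + s) (∑-step-low g x<b)) (sym (+-assoc (∑ g a x) (g x) (∑ g (x + + 1) b))))

∑-term≤ : ∀ g {a b} x -> (∀ x -> a ≤ x -> x < b -> 0z ≤ g x) -> a ≤ x -> x < b -> g x ≤ ∑ g a b
∑-term≤ g {a} {b} x h a≤x x<b = lia 4 (\s p q r -> s == p :+ q :+ r => #0 <= p => #0 <= r => q <= s)
 _ _ _ _ (∑-point g x a≤x x<b)
 (∑-nonneg g a≤x \y p q -> h y p (<-trans q x<b))
 (∑-nonneg g (x<y⇒x+1≤y x<b) \y p q -> h y (lia 3 (\a x y -> a <= x => x :+ #1 <= y => a <= y) a x y a≤x p) q)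

-- This is how extremal cases are exploited: the slack of a counting inequality is a sum of
-- nonnegative terms, so a total of at most 0 kills each of them.
∑-zeros : ∀ g {a b} -> (∀ x -> a ≤ x -> x < b -> 0z ≤ g x) -> ∑ g a b ≤ 0z -> ∀ x -> a ≤ x -> x < b -> g x ≡ 0z
∑-zeros g h s x p q = ≤≥ (≤t (∑-term≤ g x h p q) s) (h x p q)

∑-sub : ∀ g h {a b} -> a ≤ b -> ∑ (\x -> g x - h x) a b ≡ ∑ g a b - ∑ h a b
∑-sub g h {a} {b} a≤b = lia 3 (\d s t -> s == d :+ t => d == s :- t) _ _ (∑ h a b)
 (tr (∑-cong g (\x -> (g x - h x) + h x) a≤b (\x _ _ -> x≡x-y+y (h x)))
  (∑-+ (\x -> g x - h x) h a≤b))

∑-widen : ∀ g {a b c d} -> a ≤ b -> b ≤ c -> c ≤ d -> (∀ x -> a ≤ x -> x < b -> g x ≡ 0z) -> (∀ x -> c ≤ x -> x < d -> g x ≡ 0z) ->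
 ∑ g a d ≡ ∑ g b c
∑-widen g {a} {b} {c} {d} a≤b b≤c c≤d lo hi =
 lia 5 (\s p q r u -> s == p :+ q => q == r :+ u => p == #0 => u == #0 => s == r)
 _ _ _ _ _ (∑-split g a≤b (≤t b≤c c≤d)) (∑-split g b≤c c≤d)
 (tr (∑-cong g (\_ -> 0z) a≤b lo) (∑-zero a≤b)) (tr (∑-cong g (\_ -> 0z) c≤d hi) (∑-zero c≤d))

-- Decidable sets of integers, indicators and bounded search

𝔹 : Set
𝔹 = ℤ -> Bool

infix 4 _∈_ _∉_
_∈_ _∉_ : ℤ -> 𝔹 -> Set
x ∈ P = P x ≡ true
x ∉ P = P x ≡ false

mem? : ∀ (P : 𝔹) x -> (x ∈ P) ⊎ (x ∉ P)
mem? P x with P x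
... | true = inl refl
... | false = inr refl

clash : ∀ {b : Bool} {ℓ} {Z : Set ℓ} -> b ≡ true -> b ≡ false -> Z
clash refl ()

move : ∀ (P : 𝔹) {x y} {b : Bool} -> P x ≡ b -> x ≡ y -> P y ≡ b
move P p refl = p

bit : Bool -> ℤ
bit true = + 1
bit false = 0z

χ : 𝔹 -> ℤ -> ℤ
χ P x = bit (P x)

χ-in : ∀ {b} -> b ≡ true -> bit b ≡ + 1
χ-in = cong bit

χ-out : ∀ {b} -> b ≡ false -> bit b ≡ 0z
χ-out = cong bit

χ≥0 : ∀ P x -> 0z ≤ χ P x
χ≥0 P x with P x
... | true = 0≤+
... | false = 0≤+

χ≤1 : ∀ P x -> χ P x ≤ + 1
χ≤1 P x with P x
... | true = ≤r
... | false = 0≤+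

χ-in⁻ : ∀ {b} -> + 1 ≤ bit b -> b ≡ true
χ-in⁻ {true} _ = refl
χ-in⁻ {false} h = ⊥e (≤⇒≯ h 0<+)

χ-out⁻ : ∀ {b} -> bit b ≤ 0z -> b ≡ false
χ-out⁻ {false} _ = refl
χ-out⁻ {true} h = ⊥e (≤⇒≯ h 0<+)

χ-mono : ∀ {P Q : 𝔹} {x y} -> (x ∈ P -> y ∈ Q) -> χ P x ≤ χ Q y
χ-mono {P} {Q} {x} {y} imp with mem? P x
... | inl p = subst₂ _≤_ (sym (χ-in p)) (sym (χ-in (imp p))) ≤r
... | inr p = subst (_≤ χ Q y) (sym (χ-out p)) (χ≥0 Q y)

Least : 𝔹 -> ℤ -> ℤ -> Set
Least P a b = Σ ℤ \x -> a ≤ x × x < b × x ∈ P × (∀ y -> a ≤ y -> y < x -> y ∉ P)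

least : ∀ P {a b} -> a ≤ b -> Least P a b ⊎ (∀ x -> a ≤ x -> x < b -> x ∉ P)
least P {a} {b} a≤b = climb (\c -> Least P a c ⊎ (∀ x -> a ≤ x -> x < c -> x ∉ P)) b
 (inr \x p q -> ⊥e (≤⇒≯ p q))
 (\c a≤c c<b -> \ where
  (inl (x , p , q , r)) -> inl (x , p , lia 2 (\x c -> x :< c => x :< c :+ #1) x c q , r)
  (inr none) -> case mem? P c of \ where
   (inl p) -> inl (c , a≤c , x<x+1 , p , none)
   (inr p) -> inr \x a≤x x<c+1 -> case x <? c of \ where
    (yes x<c) -> none x a≤x x<c
    (no x≮c) -> move P p (lia 2 (\x c -> x :< c :+ #1 => ~ x :< c => c == x) x c x<c+1 x≮c))
 a≤b ≤r

Greatest : 𝔹 -> ℤ -> ℤ -> Set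
Greatest P a b = Σ ℤ \x -> a ≤ x × x < b × x ∈ P × (∀ y -> x < y -> y < b -> y ∉ P)

greatest : ∀ P {a b} -> a ≤ b -> Greatest P a b ⊎ (∀ x -> a ≤ x -> x < b -> x ∉ P)
greatest P {a} {b} a≤b = climb (\c -> Greatest P a c ⊎ (∀ x -> a ≤ x -> x < c -> x ∉ P)) b
 (inr \x p q -> ⊥e (≤⇒≯ p q))
 (\c a≤c c<b prev -> case mem? P c of \ where
  (inl p) -> inl (c , a≤c , x<x+1 , p , \y c<y y<c+1 -> ⊥e (lia 2 (\y c -> c :< y => y :< c :+ #1 => ff) y c c<y y<c+1))
  (inr p) -> let last = \x (x<c+1 : x < c + + 1) (x≮c : ¬ x < c) -> move P p (lia 2 (\x c -> x :< c :+ #1 => ~ x :< c => c == x) x c x<c+1 x≮c) in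
   case prev of \ where
    (inl (x , q , r , s , t)) -> inl (x , q , lia 2 (\x c -> x :< c => x :< c :+ #1) x c r , s , \y x<y y<c+1 -> case y <? c of \ where
      (yes y<c) -> t y x<y y<c
      (no y≮c) -> last y y<c+1 y≮c)
    (inr none) -> inr \x a≤x x<c+1 -> case x <? c of \ where
      (yes x<c) -> none x a≤x x<c
      (no x≮c) -> last x x<c+1 x≮c)
 a≤b ≤r

∃? : ∀ (P : 𝔹) {a b} -> a ≤ b -> (Σ ℤ \x -> a ≤ x × x < b × x ∈ P) ⊎ (∀ x -> a ≤ x -> x < b -> x ∉ P)
∃? P a≤b with least P a≤b
... | inl (x , p , q , r , _) = inl (x , p , q , r)
... | inr none = inr none

not-true : ∀ {b} -> not b ≡ true -> b ≡ false
not-true {false} _ = refl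

not-false : ∀ {b} -> not b ≡ false -> b ≡ true
not-false {true} _ = refl

infixl 1 _|>_
_|>_ : ∀ {A B : Set} -> A -> (A -> B) -> B
x |> f = f x

bool : ∀ {ℓ} {Z : Set ℓ} -> Dec Z -> Bool
bool (yes _) = true
bool (no _) = false

bool-in : ∀ {ℓ} {Z : Set ℓ} (d : Dec Z) -> bool d ≡ true -> Z
bool-in (yes z) _ = z

bool-out : ∀ {ℓ} {Z : Set ℓ} (d : Dec Z) -> bool d ≡ false -> ¬ Z
bool-out (no z) _ = z

in-bool : ∀ {ℓ} {Z : Set ℓ} (d : Dec Z) -> Z -> bool d ≡ true
in-bool (yes _) _ = refl
in-bool (no z) p = ⊥e (z p)

out-bool : ∀ {ℓ} {Z : Set ℓ} (d : Dec Z) -> ¬ Z -> bool d ≡ false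
out-bool (yes z) n = ⊥e (n z)
out-bool (no _) _ = refl

∧-in : ∀ {a b} -> a ∧ b ≡ true -> a ≡ true × b ≡ true
∧-in {true} {true} _ = refl , refl

in-∧ : ∀ {a b} -> a ≡ true -> b ≡ true -> a ∧ b ≡ true
in-∧ refl refl = refl

∨-in : ∀ {a b} -> a ∨ b ≡ true -> a ≡ true ⊎ b ≡ true
∨-in {true} _ = inl refl
∨-in {false} p = inr p

out : ∀ {b : Bool} -> ¬ b ≡ true -> b ≡ false
out {true} n = ⊥e (n refl)
out {false} _ = refl

-- The balance of a set and the pigeonhole principle

step : 𝔹 -> ℤ -> ℤ
step P x = + 2 * χ P x - + 1

bal : 𝔹 -> ℤ -> ℤ -> ℤ
bal P = ∑ (step P)

count : 𝔹 -> ℤ -> ℤ -> ℤ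
count P = ∑ (χ P)

bal-count : ∀ P {a b} -> a ≤ b -> bal P a b ≡ + 2 * count P a b - (b - a)
bal-count P {a} = rise (\b -> bal P a b ≡ + 2 * count P a b - (b - a))
 (lia 3 (\p c a -> p == #0 => c == #0 => p == 2 *: c :- (a :- a)) _ _ a (∑-empty (step P) a) (∑-empty (χ P) a))
 (\b a≤b ih -> lia 7 (\p p' c c' x a b -> p' == p :+ (2 *: x :- #1) => c' == c :+ x => p == 2 *: c :- (b :- a) => p' == 2 *: c' :- (b :+ #1 :- a))
  _ _ (count P a b) _ (χ P b) a b (∑-step (step P) a b a≤b) (∑-step (χ P) a b a≤b) ih)

bal-in : ∀ P {a b} -> a ≤ b -> b ∈ P -> bal P a (b + + 1) ≡ bal P a b + + 1
bal-in P {a} {b} a≤b p = lia 3 (\s t x -> s == t :+ (2 *: x :- #1) => x == #1 => s == t :+ #1) _ (bal P a b) _ (∑-step (step P) a b a≤b) (χ-in p)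

bal-out : ∀ P {a b} -> a ≤ b -> b ∉ P -> bal P a (b + + 1) ≡ bal P a b - + 1
bal-out P {a} {b} a≤b p = lia 3 (\s t x -> s == t :+ (2 *: x :- #1) => x == #0 => s == t :- #1) _ (bal P a b) _ (∑-step (step P) a b a≤b) (χ-out p)

bal-upper : ∀ P {a b} -> a ≤ b -> bal P a b ≤ b - a
bal-upper P {a} {b} a≤b = subst (bal P a b ≤_) (∑-one' a≤b) (∑-mono (step P) (\_ -> + 1) a≤b \x _ _ ->
 lia 1 (\x -> x <= #1 => 2 *: x :- #1 <= #1) _ (χ≤1 P x))

bal-lower : ∀ P {a b} -> a ≤ b -> a - b ≤ bal P a b
bal-lower P {a} {b} a≤b = lia 4 (\a b s m -> s == m => m == - (+ 1) :* (b :- a) => #0 <= #0 => a :- b <= s) a b _ _ (∑-const (- + 1) a≤b) refl 0≤+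
 |> \h -> ≤t h (∑-mono (\_ -> - + 1) (step P) a≤b \x _ _ -> lia 1 (\x -> #0 <= x => con (- + 1) <= 2 *: x :- #1) _ (χ≥0 P x))

-- Pairing x with p + q - x on [p,q]: the balance is the number of pairs inside P minus the number of pairs outside.
pairs : 𝔹 -> ℤ -> ℤ -> ℤ
pairs P s x = χ P x + χ P (s - x) - + 1

-- The terms of `pairs` count P once as it stands and once reflected in p + q, which is twice the
-- number of members, less the length.
bal-pairs : ∀ P p q -> p ≤ q + + 1 -> ∑ (pairs P (p + q)) p (q + + 1) ≡ bal P p (q + + 1)
bal-pairs P p q le = lia 7 (\s c d b m p q -> s == m :- (q :+ #1 :- p) => m == c :+ d => d == c => b == 2 *: c :- (q :+ #1 :- p) => s == b)
 _ _ _ _ _ p q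
 (tr (∑-sub (\x -> χ P x + χ P (p + q - x)) (\_ -> + 1) le) (cong (\s -> ∑ (\x -> χ P x + χ P (p + q - x)) p (q + + 1) - s) (∑-one' le)))
 (∑-+ (χ P) (\x -> χ P (p + q - x)) le)
 (tr (∑-reflect (χ P) (p + q) le) (cong₂ (count P) (lia 2 (\p q -> p :+ q :- (q :+ #1) :+ #1 == p) p q) (lia 2 (\p q -> p :+ q :- p :+ #1 == q :+ #1) p q)))
 (bal-count P le)

pigeonhole : ∀ P p q -> p ≤ q + + 1 -> + 1 ≤ bal P p (q + + 1) -> Σ ℤ \x -> p ≤ x × x < q + + 1 × x ∈ P × p + q - x ∈ P
pigeonhole P p q le big with ∃? (\x -> P x ∧ P (p + q - x)) le
... | inl (x , a , b , c) = x , a , b , fst (∧-in c) , snd (∧-in {P x} c)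
... | inr none = ⊥e (lia 2 (\s b -> s <= #0 => s == b => #1 <= b => ff) _ _
  (subst (∑ (pairs P (p + q)) p (q + + 1) ≤_) (∑-zero le) (∑-mono (pairs P (p + q)) (\_ -> 0z) le nonpos)) (bal-pairs P p q le) big)
 where
 nonpos : ∀ x -> p ≤ x -> x < q + + 1 -> pairs P (p + q) x ≤ 0z
 nonpos x a b with P x in eq
 ... | false = lia 1 (\y -> y <= #1 => #0 :+ y :- #1 <= #0) _ (χ≤1 P (p + q - x))
 ... | true with P (p + q - x) in eq'
 ... | false = ≤r
 ... | true = clash (in-∧ eq eq') (none x a b)

-- In other words, p + q is not a sum of two members of P taken from [p,q].
Avoids : 𝔹 -> ℤ -> ℤ -> Set
Avoids P p q = ∀ x -> p ≤ x -> x ≤ q -> x ∈ P -> p + q - x ∉ P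

avoids-bal : ∀ P p q -> p ≤ q + + 1 -> Avoids P p q -> bal P p (q + + 1) ≤ 0z
avoids-bal P p q le av with bal P p (q + + 1) ≤? 0z
... | yes h = h
... | no h with pigeonhole P p q le (x≰0⇒1≤x h)
... | x , a , b , c , d = clash d (av x a (x<y+1⇒x≤y b) c)

-- The equality case of `avoids-bal`: all terms of `pairs` are at most 0 and their total is not
-- negative, so no term is -1 and no pair lies wholly outside P.
antisymmetric : ∀ P p q -> p ≤ q + + 1 -> Avoids P p q -> 0z ≤ bal P p (q + + 1) ->
 ∀ x -> p ≤ x -> x ≤ q -> x ∉ P -> p + q - x ∈ P
antisymmetric P p q le av b≥0 x p≤x x≤q x∉ = χ-in⁻ (lia 2 (\u v -> u == #0 => #0 :- (u :+ v :- #1) == #0 => #1 <= v) _ _ (χ-out x∉)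
  (∑-zeros (\x -> 0z - pairs P (p + q) x) nonneg total x p≤x (x≤y⇒x<y+1 x≤q)))
 where
 nonneg : ∀ x -> p ≤ x -> x < q + + 1 -> 0z ≤ 0z - pairs P (p + q) x
 nonneg x a b with P x in eq
 ... | false = lia 1 (\y -> y <= #1 => #0 <= #0 :- (#0 :+ y :- #1)) _ (χ≤1 P (p + q - x))
 ... | true = lia 1 (\y -> y == #0 => #0 <= #0 :- (#1 :+ y :- #1)) _ (χ-out (av x a (x<y+1⇒x≤y b) eq))
 total = lia 4 (\s z t b -> s == z :- t => z == #0 => t == b => #0 <= b => s <= #0) _ _ _ _
  (∑-sub (\_ -> 0z) (pairs P (p + q)) le) (∑-zero le) (bal-pairs P p q le) b≥0

-- Normalised sets, their sumsets and the folding modulo n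

record NSet (n : ℤ) : Set where
 field
  A : 𝔹
  supp : ∀ {x} -> x ∈ A -> 0z ≤ x × x ≤ n
  lo : 0z ∈ A
  hi : n ∈ A

abstract
 some : 𝔹 -> ℤ -> ℤ -> Bool
 some P a b with a ≤? b
 ... | no _ = false
 ... | yes a≤b with ∃? P a≤b
 ... | inl _ = true
 ... | inr _ = false
 some-in : ∀ P {a b} -> some P a b ≡ true -> Σ ℤ \x -> a ≤ x × x < b × x ∈ P
 some-in P {a} {b} p with a ≤? b
 ... | yes a≤b with ∃? P a≤b
 ... | inl q = q
 in-some : ∀ P {a b} x -> a ≤ x -> x < b -> x ∈ P -> some P a b ≡ true
 in-some P {a} {b} x a≤x x<b p with a ≤? b
 ... | no a≰b = ⊥e (a≰b (≤t a≤x (<⇒≤ x<b)))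
 ... | yes a≤b with ∃? P a≤b
 ... | inl q = refl
 ... | inr none = clash p (none x a≤x x<b)

Anti : 𝔹 -> ℤ -> ℤ -> Set
Anti P p q = Avoids P p q × (∀ x -> p ≤ x -> x ≤ q -> x ∉ P -> p + q - x ∈ P)

-- Reflection in p + q exchanges members and holes, so an initial piece and the final piece facing
-- it have opposite balances.
anti-bal : ∀ P p q -> Anti P p q -> ∀ w -> p ≤ w -> w ≤ q + + 1 -> bal P p w ≡ - bal P (p + q + + 1 - w) (q + + 1)
anti-bal P p q (av , an) w p≤w w≤ =
 lia 3 (\b s t -> #0 == b :+ s => s == t => b == #0 :- t) _ _ _
  (tr (sym (tr (∑-cong (\x -> step P x + step P (p + q - x)) (\_ -> 0z) p≤w cancel) (∑-zero p≤w))) (∑-+ (step P) (\x -> step P (p + q - x)) p≤w))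
  (∑-reflect (step P) (p + q) p≤w)
 |> \h -> tr h (tr (0+ _) (cong -_ (cong₂ (bal P) (lia 3 (\p q w -> p :+ q :- w :+ #1 == p :+ q :+ #1 :- w) p q w) (lia 2 (\p q -> p :+ q :- p :+ #1 == q :+ #1) p q))))
 where
 cancel : ∀ x -> p ≤ x -> x < w -> step P x + step P (p + q - x) ≡ 0z
 cancel x a b with P x in eq
 ... | true = cong (\c -> + 1 + (+ 2 * c - + 1)) (χ-out (av x a (x<y⇒y≤z+1⇒x≤z b w≤) eq))
 ... | false = cong (\c -> - + 1 + (+ 2 * c - + 1)) (χ-in (an x a (x<y⇒y≤z+1⇒x≤z b w≤) eq))

module OnSet {n : ℤ} (X : NSet n) where
 open NSet X public
 0≤n = fst (supp hi)
 0≤n+1 = 0≤x⇒0≤x+1 0≤n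
 below : ∀ {x} -> x < 0z -> x ∉ A
 below {x} x<0 with mem? A x
 ... | inl p = ⊥e (≤⇒≯ (fst (supp p)) x<0)
 ... | inr p = p
 above : ∀ {x} -> n < x -> x ∉ A
 above {x} n<x with mem? A x
 ... | inl p = ⊥e (≤⇒≯ (snd (supp p)) n<x)
 ... | inr p = p
 abstract
  D : 𝔹
  D x = some (\i -> A i ∧ A (x - i)) 0z (n + + 1)
  D-in : ∀ {a b x} -> a ∈ A -> b ∈ A -> a + b ≡ x -> x ∈ D
  D-in {a} {b} p q refl = in-some _ a (fst (supp p)) (x≤y⇒x<y+1 (snd (supp p)))
   (in-∧ p (move A q (lia 2 (\a b -> b == a :+ b :- a) a b)))
  D-out : ∀ {x} -> x ∈ D -> Σ ℤ \a -> Σ ℤ \b -> a ∈ A × b ∈ A × a + b ≡ x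
  D-out {x} p with some-in (\i -> A i ∧ A (x - i)) {0z} {n + + 1} p
  ... | i , _ , _ , q = i , x - i , fst (∧-in q) , snd (∧-in {A i} q) , x+[y-x]≡y i
 D-not : ∀ {x a b} -> x ∉ D -> a ∈ A -> a + b ≡ x -> b ∉ A
 D-not {b = b} p q e with mem? A b
 ... | inl r = clash (D-in q r e) p
 ... | inr r = r
 D-supp : ∀ {x} -> x ∈ D -> 0z ≤ x × x ≤ n + n
 D-supp p with D-out p
 ... | a , b , a∈ , b∈ , refl = +≤ (fst (supp a∈)) (fst (supp b∈)) , +≤ (snd (supp a∈)) (snd (supp b∈))
 A⊂D : ∀ {a} -> a ∈ A -> a ∈ D
 A⊂D {a} p = D-in p lo (+0 a)
 n+A⊂D : ∀ {a} -> a ∈ A -> a + n ∈ D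
 n+A⊂D p = D-in p hi refl
 -- These are |A| and |2A|, as A lies in [0,n] and 2A in [0,2n].
 k dd : ℤ
 k = count A 0z (n + + 1)
 dd = count D 0z (n + n + + 1)
 -- The f(z) of the overview is `φ (z + 1)`: the balance before the step at z is `φ z`, the balance
 -- after it `φ (z + 1)`.
 φ : ℤ -> ℤ
 φ z = bal A 0z z
 φ0 = ∑-empty (step A) 0z
 -- The final balance 2k - n - 1, which separates the three ranges of n.
 φend = tr (bal-count A 0≤n+1) (lia 2 (\k n -> 2 *: k :- (n :+ #1 :- #0) == 2 *: k :- n :- #1) k n)
 φ-in : ∀ {z} -> z ∈ A -> φ (z + + 1) ≡ φ z + + 1
 φ-in p = bal-in A (fst (supp p)) p
 φ-out : ∀ {z} -> 0z ≤ z -> z ∉ A -> φ (z + + 1) ≡ φ z - + 1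
 φ-out 0≤z p = bal-out A 0≤z p
 φ1 = tr (φ-in lo) (cong (_+ + 1) φ0)
 φn = φ-in hi
 φ-split : ∀ {a b} -> 0z ≤ a -> a ≤ b -> φ b ≡ φ a + bal A a b
 φ-split 0≤a a≤b = ∑-split (step A) 0≤a a≤b
 low : ∀ {z} -> 0z ≤ z -> + 1 ≤ φ (z + + 1) -> z ∈ D
 low {z} 0≤z big with pigeonhole A 0z z (0≤x⇒0≤x+1 0≤z) big
 ... | x , _ , _ , p , q = D-in p q (lia 2 (\x z -> x :+ (#0 :+ z :- x) == z) x z)
 -- The balance of [z,n] is `φ (n + 1) - φ z`; when it is positive, some pair in [z,n] has the sum z
 -- + n.
 high : ∀ {z} -> 0z ≤ z -> z ≤ n + + 1 -> φ z < φ (n + + 1) -> z + n ∈ D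
 high {z} 0≤z z≤n big with pigeonhole A z n z≤n (lia 3 (\u v b -> v == u :+ b => u :< v => #1 <= b) _ _ _ (φ-split 0≤z z≤n) big)
 ... | x , _ , _ , p , q = D-in p q (lia 3 (\x z n -> x :+ (z :+ n :- x) == z :+ n) x z n)
 avoidL : ∀ {z} -> z ∉ D -> Avoids A 0z z
 avoidL {z} out x _ _ p = D-not out p (lia 2 (\x z -> x :+ (#0 :+ z :- x) == z) x z)
 avoidR : ∀ {z} -> z + n ∉ D -> Avoids A z n
 avoidR {z} out x _ _ p = D-not out p (lia 3 (\x z n -> x :+ (z :+ n :- x) == z :+ n) x z n)
 lowφ : ∀ {z} -> 0z ≤ z -> z ∉ D -> φ (z + + 1) ≤ 0z
 lowφ {z} 0≤z out = avoids-bal A 0z z (0≤x⇒0≤x+1 0≤z) (avoidL out)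
 highφ : ∀ {z} -> 0z ≤ z -> z ≤ n + + 1 -> z + n ∉ D -> φ (n + + 1) ≤ φ z
 highφ {z} 0≤z z≤n out = lia 3 (\u v b -> v == u :+ b => b <= #0 => v <= u) _ _ _ (φ-split 0≤z z≤n)
  (avoids-bal A z n z≤n (avoidR out))
 antiL : ∀ {z} -> 0z ≤ z -> z ∉ D -> 0z ≤ φ (z + + 1) -> Anti A 0z z
 antiL {z} 0≤z out b = avoidL out , antisymmetric A 0z z (0≤x⇒0≤x+1 0≤z) (avoidL out) b
 antiR : ∀ {z} -> 0z ≤ z -> z ≤ n + + 1 -> z + n ∉ D -> φ z ≤ φ (n + + 1) -> Anti A z n
 antiR {z} 0≤z z≤n out b = avoidR out , antisymmetric A z n z≤n (avoidR out)
  (lia 3 (\u v b -> v == u :+ b => u <= v => #0 <= b) _ _ _ (φ-split 0≤z z≤n) b)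
 -- The final piece of length w in [0,z] has the opposite balance of the initial one. As the total
 -- over [0,z] is 0, the level at w is that at z + 1 - w.
 symL : ∀ {z} -> 0z ≤ z -> Anti A 0z z -> φ (z + + 1) ≡ 0z -> ∀ w -> 0z ≤ w -> w ≤ z + + 1 -> φ w ≡ φ (z + + 1 - w)
 symL {z} 0≤z an e w 0≤w w≤ = lia 4 (\u v s t -> u == #0 :- t => s == v :+ t => s == #0 => u == v) _ _ _ (bal A (z + + 1 - w) (z + + 1))
  (tr (anti-bal A 0z z an w 0≤w w≤) (tr (sym (0+ _)) (cong (\e -> 0z - bal A e (z + + 1)) (lia 2 (\z w -> #0 :+ z :+ #1 :- w == z :+ #1 :- w) z w))))
  (φ-split (lia 2 (\z w -> w <= z :+ #1 => #0 <= z :+ #1 :- w) z w w≤) (lia 2 (\z w -> #0 <= w => z :+ #1 :- w <= z :+ #1) z w 0≤w)) e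
 symR : ∀ {z} -> 0z ≤ z -> z ≤ n -> Anti A z n -> φ z ≡ φ (n + + 1) -> ∀ w -> z ≤ w -> w ≤ n + + 1 -> φ w ≡ φ (z + n + + 1 - w)
 symR {z} 0≤z z≤n an e w z≤w w≤ = lia 6 (\u v s t p q -> p == #0 :- t => u == s :+ p => q == v :+ t => s == q => u == v) _ _ _ (bal A (z + n + + 1 - w) (n + + 1)) _ _
  (tr (anti-bal A z n an w z≤w w≤) (sym (0+ _)))
  (φ-split 0≤z z≤w)
  (φ-split (lia 3 (\z n w -> #0 <= z => w <= n :+ #1 => #0 <= z :+ n :+ #1 :- w) z n w 0≤z w≤) (lia 3 (\z n w -> z <= w => z :+ n :+ #1 :- w <= n :+ #1) z n w z≤w)) e
 -- Folds [0,2n) modulo n. The sum 2n is left over, which explains the 1 added in `dd-cov`.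
 cov : ℤ -> ℤ
 cov z = χ D z + χ D (z + n)
 dd-cov = lia 6 (\d a b c e x -> d == e :+ x => e == a :+ b => c == a :+ b => x == #1 => d == c :+ #1)
  _ (count D 0z n) (count D n (n + n)) _ _ _
  (∑-step (χ D) 0z (n + n) (+≤ 0≤n 0≤n))
  (∑-split (χ D) 0≤n (lia 1 (\n -> #0 <= n => n <= n :+ n) n 0≤n))
  (tr (∑-+ (χ D) (\z -> χ D (z + n)) 0≤n) (cong (\s -> count D 0z n + s) (tr (∑-shift (χ D) n 0≤n) (cong (\e -> count D e (n + n)) (0+ n)))))
  (χ-in (n+A⊂D hi))
 -- ex z = 0 on A, and on a hole it is the number of sums congruent to z mod n, minus one.
 ex : ℤ -> ℤ
 ex z = cov z - + 1 - χ A z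
 -- The total is |2A| - n - |A|: only k - 1 members lie in [0,n), and this makes up for the sum 2n
 -- that the folding leaves out.
 ∑ex = lia 8 (\s c u a d n k t -> s == t :- a => t == c :- u => u == n :- #0 => k == a :+ #1 => d == c :+ #1 => s == d :- n :- k)
  _ (∑ cov 0z n) _ (count A 0z n) _ n k _
  (∑-sub (\z -> cov z - + 1) (χ A) 0≤n) (∑-sub cov (\_ -> + 1) 0≤n) (∑-one' 0≤n)
  (tr (∑-step (χ A) 0z n 0≤n) (cong (\s -> count A 0z n + s) (χ-in hi))) dd-cov
 ex-in : ∀ {z} -> z ∈ A -> ex z ≡ 0z
 ex-in {z} p = lia 3 (\a b c -> a == #1 => b == #1 => c == #1 => a :+ b :- #1 :- c == #0) _ _ _ (χ-in (A⊂D p)) (χ-in (n+A⊂D p)) (χ-in p)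
 ex-hole : ∀ {z} -> z ∉ A -> ex z ≡ χ D z + χ D (z + n) - + 1
 ex-hole {z} p = lia 3 (\a b c -> c == #0 => a :+ b :- #1 :- c == a :+ b :- #1) (χ D z) (χ D (z + n)) _ (χ-out p)
 k≥1 = subst (_≤ k) (χ-in lo) (∑-term≤ (χ A) {0z} {n + + 1} 0z (\x _ _ -> χ≥0 A x) ≤r (lia 1 (\n -> #0 <= n => #0 :< n :+ #1) n 0≤n))
 k≤n+1 = subst (k ≤_) (tr (∑-one' 0≤n+1) (+0 (n + + 1))) (∑-mono (χ A) (\_ -> + 1) 0≤n+1 (\x _ _ -> χ≤1 A x))

-- Reflection and truncation of a set

abstract
 rev : ∀ {n} -> NSet n -> NSet n
 rev {n} X = record
  { A = \x -> A (n - x)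
  ; supp = \{x} p -> lia 2 (\x n -> n :- x <= n => #0 <= x) x n (snd (supp p)) , lia 2 (\x n -> #0 <= n :- x => x <= n) x n (fst (supp p))
  ; lo = move A hi (lia 1 (\n -> n == n :- #0) n) ; hi = move A lo (lia 1 (\n -> #0 == n :- n) n) }
  where open NSet X
 A-rev : ∀ {n} (X : NSet n) x -> NSet.A (rev X) x ≡ NSet.A X (n - x)
 A-rev X x = refl

count-rev : ∀ P c {a b} -> a ≤ b -> count (\x -> P (c - x)) a b ≡ count P (c - b + + 1) (c - a + + 1)
count-rev P c = ∑-reflect (χ P) c

Bool-ext : ∀ {a b : Bool} -> (a ≡ true -> b ≡ true) -> (b ≡ true -> a ≡ true) -> a ≡ b
Bool-ext {true} f g = sym (f refl)
Bool-ext {false} {false} f g = refl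
Bool-ext {false} {true} f g = g refl

module Rev {n : ℤ} (X : NSet n) where
 private
  module X = OnSet X
  module Y = OnSet (rev X)
 rev-out : ∀ {x} -> x ∈ Y.A -> n - x ∈ X.A
 rev-out {x} p = tr (sym (A-rev X x)) p
 in-rev : ∀ {x y} -> x ∈ X.A -> n - x ≡ y -> y ∈ Y.A
 in-rev {x} p refl = tr (A-rev X (n - x)) (move X.A p (x≡y-[y-x] n))
 D-rev : ∀ x -> Y.D x ≡ X.D (n + n - x)
 D-rev x = Bool-ext
  (\p -> case Y.D-out p of \ where
   (a , b , p , q , e) -> X.D-in (rev-out p) (rev-out q) (tr (lia 3 (\a b n -> n :- a :+ (n :- b) == n :+ n :- (a :+ b)) a b n) (cong (\y -> n + n - y) e)))
  (\p -> case X.D-out p of \ where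
   (a , b , p , q , e) -> Y.D-in (in-rev p refl) (in-rev q refl)
    (lia 4 (\a b n x -> a :+ b == n :+ n :- x => n :- a :+ (n :- b) == x) a b n x e))
 k-rev = tr (∑-cong (χ Y.A) (\x -> χ X.A (n - x)) X.0≤n+1 (\x _ _ -> cong bit (A-rev X x))) (tr (count-rev X.A n X.0≤n+1)
  (cong₂ (count X.A) (lia 1 (\n -> n :- (n :+ #1) :+ #1 == #0) n) (x-0+1≡x+1 n)))
 dd-rev = tr (∑-cong (χ Y.D) (\x -> χ X.D (n + n - x)) 0≤ (\x _ _ -> cong bit (D-rev x)))
  (tr (count-rev X.D (n + n) 0≤) (cong₂ (count X.D) (lia 1 (\n -> n :- (n :+ #1) :+ #1 == #0) (n + n)) (x-0+1≡x+1 (n + n))))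
  where
  0≤ = 0≤x⇒0≤x+x+1 X.0≤n
 φ-rev : ∀ z -> 0z ≤ z -> z ≤ n + + 1 -> Y.φ z ≡ X.φ (n + + 1) - X.φ (n + + 1 - z)
 φ-rev z 0≤z z≤ = tr (tr (∑-cong (step Y.A) (\x -> step X.A (n - x)) 0≤z (\x _ _ -> cong (\b -> + 2 * bit b - + 1) (A-rev X x))) (∑-reflect (step X.A) n 0≤z)) (lia 3 (\b u v -> v == u :+ b => b == v :- u) _ (X.φ (n + + 1 - z)) _
  (subst₂ (\e e' -> X.φ (n + + 1) ≡ X.φ (n + + 1 - z) + bal X.A e e') (lia 2 (\n z -> n :+ #1 :- z == n :- z :+ #1) n z) (lia 1 (\n -> n :+ #1 == n :- #0 :+ #1) n)
   (X.φ-split (lia 2 (\n z -> z <= n :+ #1 => #0 <= n :+ #1 :- z) n z z≤) (lia 2 (\n z -> #0 <= z => n :+ #1 :- z <= n :+ #1) n z 0≤z))))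

abstract
 cut : ∀ {n} (X : NSet n) (m : ℤ) -> m ∈ NSet.A X -> NSet m
 cut X m m∈ = record
  { A = \x -> A x ∧ bool (x ≤? m)
  ; supp = \{x} p -> fst (supp (fst (∧-in p))) , bool-in (x ≤? m) (snd (∧-in {A x} p))
  ; lo = in-∧ lo (in-bool (0z ≤? m) (fst (supp m∈))) ; hi = in-∧ m∈ (in-bool (m ≤? m) ≤r) }
  where open NSet X
 cut-A : ∀ {n} (X : NSet n) (m : ℤ) (m∈ : m ∈ NSet.A X) x -> NSet.A (cut X m m∈) x ≡ (NSet.A X x ∧ bool (x ≤? m))
 cut-A X m m∈ x = refl

module Cut {n : ℤ} (X : NSet n) (m : ℤ) (m∈ : m ∈ NSet.A X) where
 private
  module X = OnSet X
  module Y = OnSet (cut X m m∈)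
 cut-in : ∀ {x} -> x ∈ X.A -> x ≤ m -> x ∈ Y.A
 cut-in {x} p q = tr (cut-A X m m∈ x) (in-∧ p (in-bool (x ≤? m) q))
 cut-out : ∀ {x} -> x ∈ Y.A -> x ∈ X.A
 cut-out {x} p = fst (∧-in {X.A x} (tr (sym (cut-A X m m∈ x)) p))
 cut-≡ : ∀ {x} -> x ≤ m -> Y.A x ≡ X.A x
 cut-≡ q = Bool-ext cut-out (\p -> cut-in p q)
 D⊂ : ∀ {x} -> x ∈ Y.D -> x ∈ X.D
 D⊂ p with Y.D-out p
 ... | a , b , p , q , e = X.D-in (cut-out p) (cut-out q) e
 m≤n = snd (X.supp m∈)
 φ-cut : ∀ z -> 0z ≤ z -> z ≤ m + + 1 -> Y.φ z ≡ X.φ z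
 φ-cut z 0≤z z≤ = ∑-cong (step Y.A) (step X.A) 0≤z \x _ x<z -> cong (\b -> + 2 * bit b - + 1) (cut-≡ (x<y⇒y≤z+1⇒x≤z x<z z≤))
 k-cut = ∑-cong (χ Y.A) (χ X.A) Y.0≤n+1 \x _ x< -> cong bit (cut-≡ (x<y+1⇒x≤y x<))
 k-split = tr (∑-split (χ X.A) Y.0≤n+1 (+-monoˡ-≤ (+ 1) m≤n)) (cong (_+ count X.A (m + + 1) (n + + 1)) (sym k-cut))
 dd-cut = sym (∑-widen (χ Y.D) ≤r (0≤x⇒0≤x+x+1 Y.0≤n) (lia 2 (\m n -> m <= n => m :+ m :+ #1 <= n :+ n :+ #1) m n m≤n)
  (\x a b -> ⊥e (≤⇒≯ a b))
  (\x a b -> χ-out (out \p -> lia 2 (\x m -> m :+ m :+ #1 <= x => x <= m :+ m => ff) x m a (snd (Y.D-supp p)))))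

φ-case : ∀ {n} (X : NSet n) z -> 0z ≤ z -> let open OnSet X in (z ∈ A × φ (z + + 1) ≡ φ z + + 1) ⊎ (z ∉ A × φ (z + + 1) ≡ φ z - + 1)
φ-case X z 0≤z with mem? (NSet.A X) z
... | inl p = inl (p , OnSet.φ-in X p)
... | inr p = inr (p , OnSet.φ-out X 0≤z p)

-- Positions missing from 2A on the left and on the right

HasInterval : 𝔹 -> ℤ -> Set
HasInterval P m = Σ ℤ \a -> ∀ x -> a ≤ x -> x < a + m -> x ∈ P

-- With |P| for `size`, the equation `size≡` forces the two progressions, which together make up P,
-- to be disjoint.
record TwoAP (P : 𝔹) (size : ℤ) : Set where
 field
  u v δ p q : ℤ
  δ≥1 : + 1 ≤ δ
  p≥0 : 0z ≤ p
  q≥0 : 0z ≤ q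
  size≡ : p + q + + 2 ≡ size
  cover : ∀ x -> x ∈ P -> (Σ ℤ \i -> 0z ≤ i × i ≤ p × x ≡ u + δ * i) ⊎ (Σ ℤ \i -> 0z ≤ i × i ≤ q × x ≡ v + δ * i)
  in0 : ∀ i -> 0z ≤ i -> i ≤ p -> u + δ * i ∈ P
  in1 : ∀ i -> 0z ≤ i -> i ≤ q -> v + δ * i ∈ P

module Overlaps {n : ℤ} (X : NSet n) where
 open OnSet X
 -- Position y is missing on the right and does not lie beyond x, which is missing on the left;
 -- `lowest` and `highest` show that otherwise a long interval remains.
 Overlap = Σ ℤ \x -> Σ ℤ \y -> 0z ≤ y × y ≤ x × x < n × x ∉ D × y + n ∉ D
 private
  negD : 𝔹
  negD x = not (D x)
  -- The last position of [0,n) outside 2A. For the default -1 the level `φ (x + 1)` is `φ 0`, so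
  -- the bound by 0 holds there too.
  lowest : Σ ℤ \x -> - + 1 ≤ x × φ (x + + 1) ≤ 0z × (∀ z -> x < z -> z < n -> z ∈ D) × (0z ≤ x -> x < n × x ∉ D)
  lowest with greatest negD {0z} {n} 0≤n
  ... | inl (x , 0≤x , x<n , p , later) = x , lia 1 (\x -> #0 <= x => con (- + 1) <= x) x 0≤x , lowφ 0≤x (not-true p) , (\z a b -> not-false (later z a b)) , \_ -> x<n , not-true p
  ... | inr none = - + 1 , ≤r , ≡⇒≤ φ0 , (\z a b -> not-false (none z (lia 1 (\z -> con (- + 1) :< z => #0 <= z) z a) b)) , \p -> ⊥e (lia 0 (#0 <= con (- + 1) => ff) p)
  -- The first y with y + n outside 2A. At the default n + 1 the level is the final balance itself.
  highest : Σ ℤ \y -> 0z ≤ y × y ≤ n + + 1 × φ (n + + 1) ≤ φ y × (∀ z -> 0z ≤ z -> z < y -> z + n ∈ D) × (y ≤ n -> y + n ∉ D)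
  highest with least (\z -> not (D (z + n))) {0z} {n + + 1} 0≤n+1
  ... | inl (y , 0≤y , y<n , p , earlier) = y , 0≤y , <⇒≤ y<n , highφ 0≤y (<⇒≤ y<n) (not-true p) , (\z a b -> not-false (earlier z a b)) , \_ -> not-true p
  ... | inr none = n + + 1 , 0≤n+1 , ≤r , ≤r , (\z a b -> not-false (none z a b)) , \p -> ⊥e (lia 1 (\n -> n :+ #1 <= n => ff) n p)
 interval-or-overlap : n ≤ + 2 * k - + 2 -> HasInterval D (+ 2 * k - + 1) ⊎ Overlap
 interval-or-overlap dense with lowest | highest
 ... | x , -1≤x , φx , lowD , lowN | y , 0≤y , y≤n+1 , φy , highD , highN with x <? y
 ... | no x≮y = inr (x , y , 0≤y , lia 2 (\x y -> ~ x :< y => y <= x) x y x≮y , fst low! , snd low! , highN (lia 3 (\x y n -> ~ x :< y => x :< n => y <= n) x y n x≮y (fst low!)))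
  where
  low! = lowN (lia 2 (\x y -> ~ x :< y => #0 <= y => #0 <= x) x y x≮y 0≤y)
 -- All of [x + 1, y + n - 1] lies in 2A. From x + 1 to y the balance grows by at least 2k - n - 1,
 -- so y - x - 1 is at least that much, and the interval has at least 2k - 1 elements.
 ... | yes x<y = inl (x + + 1 , \z a b -> inside z a b)
  where
  gap = φ-split (lia 1 (\x -> con (- + 1) <= x => #0 <= x :+ #1) x -1≤x) (x<y⇒x+1≤y x<y)
  inside : ∀ z -> x + + 1 ≤ z -> z < x + + 1 + (+ 2 * k - + 1) -> z ∈ D
  inside z a b with z <? n
  ... | yes z<n = lowD z (x+1≤y⇒x<y a) z<n
  ... | no z≮n = move D (highD (z - n) (lia 2 (\z n -> ~ z :< n => #0 <= z :- n) z n z≮n)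
   (lia 9 (\z n x y k fx fy b e -> z :< x :+ #1 :+ (2 *: k :- #1) => fy == fx :+ b => fx <= #0 => e <= fy => e == 2 *: k :- n :- #1 => b <= y :- (x :+ #1) => z :- n :< y)
    z n x y k _ _ _ _ b gap φx φy φend (bal-upper A (x<y⇒x+1≤y x<y))))
   (lia 2 (\z n -> z :- n :+ n == z) z n)

divide : ∀ {d x} -> + 1 ≤ d -> 0z ≤ x -> Σ ℤ \r -> Σ ℤ \i -> 0z ≤ r × r < d × 0z ≤ i × x ≡ r + d * i
divide {d} d≥1 = rise (\x -> Σ ℤ \r -> Σ ℤ \i -> 0z ≤ r × r < d × 0z ≤ i × x ≡ r + d * i)
 (0z , 0z , ≤r , 1≤x⇒0<x d≥1 , ≤r , sym (tr (0+ (d * 0z)) (*0 d)))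
 next
 where
 ring : ∀ d i -> d * (i + + 1) ≡ d * i + d
 ring = solve
 next : ∀ x -> 0z ≤ x -> (Σ ℤ \r -> Σ ℤ \i -> 0z ≤ r × r < d × 0z ≤ i × x ≡ r + d * i) -> Σ ℤ \r -> Σ ℤ \i -> 0z ≤ r × r < d × 0z ≤ i × x + + 1 ≡ r + d * i
 next x _ (r , i , 0≤r , r<d , 0≤i , e) with r + + 1 <? d
 ... | yes lt = r + + 1 , i , 0≤x⇒0≤x+1 0≤r , lt , 0≤i , lia 3 (\x r m -> x == r :+ m => x :+ #1 == r :+ #1 :+ m) x r (d * i) e
 ... | no ge = 0z , i + + 1 , ≤r , 1≤x⇒0<x d≥1 , 0≤x⇒0≤x+1 0≤i ,
  lia 5 (\x r m m' d -> x == r :+ m => m' == m :+ d => r :< d => ~ r :+ #1 :< d => x :+ #1 == #0 :+ m') x r (d * i) _ d e (ring d i) r<d ge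

*-step : ∀ d i -> d * (i + + 1) ≡ d * i + d
*-step = solve

*-nonneg : ∀ {a b} -> 0z ≤ a -> 0z ≤ b -> 0z ≤ a * b
*-nonneg {+ m} {+ n} _ _ = subst (0z ≤_) (pos-* m n) 0≤+

*-pos⁻ : ∀ g m -> + 1 ≤ g -> 0z < g * m -> + 1 ≤ m
*-pos⁻ g m g≥1 h with + 1 ≤? m
... | yes r = r
... | no r = ⊥e (≤⇒≯ (*-nonneg {g} { - m} (≤t 0≤+ g≥1) (neg-mono-≤ (lia 1 (\m -> ~ #1 <= m => m <= #0) m r)))
  (subst (_< 0z) (neg-distribʳ-* g m) (neg-mono-< h)))

-- Antisymmetry as an equation between booleans: chaining two such equations yields a translation.
anti-not : ∀ P {p q x y} -> Anti P p q -> p ≤ x -> x ≤ q -> y ≡ p + q - x -> P x ≡ not (P y)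
anti-not P {p} {q} {x} (av , an) a b refl with P x in eq
... | true = sym (cong not (av x a b eq))
... | false = sym (cong not (an x a b eq))

point : ℤ -> 𝔹
point c x = bool (x ≟ c)

count-point : ∀ c {a b} -> a ≤ c -> c < b -> count (point c) a b ≡ + 1
count-point c {a} {b} a≤c c<b = lia 4 (\s u v w -> s == u :+ v :+ w => u == #0 => v == #1 => w == #0 => s == #1)
 _ _ _ _
 (∑-point (χ (point c)) c a≤c c<b)
 (tr (∑-cong (χ (point c)) (\_ -> 0z) a≤c (\x _ x<c -> χ-out (out-bool (x ≟ c) (\e -> <-irrefl e x<c)))) (∑-zero a≤c))
 (χ-in (in-bool (c ≟ c) refl))
 (tr (∑-cong (χ (point c)) (\_ -> 0z) le (\x c<x _ -> χ-out (out-bool (x ≟ c) (\e -> lia 2 (\x c -> c :+ #1 <= x => x == c => ff) x c c<x e)))) (∑-zero le))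
 where
 le = x<y⇒x+1≤y c<b

ins : ℤ -> 𝔹 -> 𝔹
ins c P x = P x ∨ point c x

ins-out : ∀ c P {x} -> x ∈ ins c P -> x ∈ P ⊎ x ≡ c
ins-out c P {x} p = [ inl , (\q -> inr (bool-in (x ≟ c) q)) ]′ (∨-in {P x} p)

ins-not : ∀ c P {x} -> x ∉ P -> ¬ x ≡ c -> x ∉ ins c P
ins-not c P p ne = out \q -> [ (\r -> clash r p) , ne ]′ (ins-out c P q)

count-ins : ∀ c P {a b} -> c ∉ P -> a ≤ c -> c < b -> count (ins c P) a b ≡ count P a b + + 1
count-ins c P {a} {b} c∉ a≤c c<b = tr (∑-cong (χ (ins c P)) (\x -> χ P x + χ (point c) x) a≤b (\x _ _ -> pt x)) (tr (∑-+ (χ P) (χ (point c)) a≤b) (cong (\s -> count P a b + s) (count-point c a≤c c<b)))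
 where
 a≤b = ≤t a≤c (<⇒≤ c<b)
 pt : ∀ x -> χ (ins c P) x ≡ χ P x + χ (point c) x
 pt x with P x in eq
 ... | false = sym (0+ _)
 ... | true = sym (cong (\e -> + 1 + e) (χ-out (out-bool (x ≟ c) \e -> clash eq (move P c∉ (sym e)))))

count-⊂ : ∀ P Q {a b} -> a ≤ b -> (∀ {x} -> x ∈ P -> x ∈ Q) -> count P a b ≤ count Q a b
count-⊂ P Q a≤b h = ∑-mono (χ P) (χ Q) a≤b \x _ _ -> χ-mono {P} {Q} h

-- Uncovered residues and periods when n = 2|A| - 2

module Periods {n : ℤ} (X : NSet n) where
 open OnSet X
 -- For z in [0,n) this says that no member of 2A is congruent to z modulo n.
 U : ℤ -> Set
 U z = z ∉ D × z + n ∉ D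
 record Critical (z : ℤ) : Set where
  field
   hole : z ∉ A
   prior : φ z ≡ + 1
   next : φ (z + + 1) ≡ 0z
   left : Anti A 0z z
   right : Anti A z n
 -- The level is at least 1 before z and at most 0 after it, so the step at z is a descent from 1 to
 -- 0. Both bounds are then attained, which gives antisymmetry on either side.
 critical : φ (n + + 1) ≡ + 1 -> ∀ {z} -> 0z ≤ z -> z < n -> U z -> Critical z
 critical half {z} 0≤z z<n (p , q) with φ-case X z 0≤z | lowφ 0≤z p | highφ 0≤z (x<y⇒x≤y+1 z<n) q
 ... | inl (_ , e) | l | h = ⊥e (lia 3 (\u v w -> v == u :+ #1 => v <= #0 => w == #1 => w <= u => ff) _ _ _ e l half h)
 ... | inr (z∉ , e) | l | h = record { hole = z∉ ; prior = e₁ ; next = e₂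
   ; left = antiL 0≤z p (≡⇒≤ (sym e₂)) ; right = antiR 0≤z (x<y⇒x≤y+1 z<n) q (≡⇒≤ (tr e₁ (sym half))) }
  where
  e₁ = lia 3 (\u v w -> v == u :- #1 => v <= #0 => w == #1 => w <= u => u == #1) _ _ _ e l half h
  e₂ = lia 3 (\u v w -> v == u :- #1 => v <= #0 => w == #1 => w <= u => v == #0) _ _ _ e l half h
 Per : ℤ -> Set
 Per g = ∀ x y -> 0z ≤ x -> y ≤ n -> y ≡ x + g -> A x ≡ A y
 -- Two left reflections, or two right ones, compose to the shift by z1 - z0. The left reflection of
 -- z1 followed by the right one of z0 is the shift by n - (z1 - z0).
 per-two : ∀ {z0 z1} -> 0z ≤ z0 -> z0 < z1 -> z1 < n -> Critical z0 -> Critical z1 -> Per (z1 - z0) × Per (n - (z1 - z0))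
 per-two {z0} {z1} 0≤z0 lt z1<n c0 c1 = first , second
  where
  open Critical
  first : Per (z1 - z0)
  first x y 0≤x y≤n refl with x ≤? z0
  ... | yes x≤z0 = tr (anti-not A (left c0) 0≤x x≤z0 refl)
   (sym (anti-not A (left c1) (lia 3 (\x z0 z1 -> #0 <= x => z0 :< z1 => #0 <= x :+ (z1 :- z0)) x _ _ 0≤x lt) (lia 3 (\x z0 z1 -> x <= z0 => x :+ (z1 :- z0) <= z1) x _ _ x≤z0)
    (lia 3 (\x z0 z1 -> #0 :+ z0 :- x == #0 :+ z1 :- (x :+ (z1 :- z0))) x z0 z1)))
  ... | no x≰z0 = tr (anti-not A (right c0) (lia 2 (\x z -> ~ x <= z => z <= x) x _ x≰z0) (lia 4 (\x z0 z1 n -> z0 :< z1 => x :+ (z1 :- z0) <= n => x <= n) x _ _ n lt y≤n) refl)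
   (sym (anti-not A (right c1) (lia 3 (\x z0 z1 -> ~ x <= z0 => z1 <= x :+ (z1 :- z0)) x _ _ x≰z0) y≤n
    (lia 4 (\x z0 z1 n -> z0 :+ n :- x == z1 :+ n :- (x :+ (z1 :- z0))) x z0 z1 n)))
  second : Per (n - (z1 - z0))
  second x y 0≤x y≤n refl = tr (anti-not A (left c1) 0≤x (lia 4 (\x z0 z1 n -> #0 <= z0 => x :+ (n :- (z1 :- z0)) <= n => x <= z1) x _ _ n 0≤z0 y≤n) refl)
   (sym (anti-not A (right c0) (lia 4 (\x z0 z1 n -> #0 <= x => z1 :< n => z0 <= x :+ (n :- (z1 :- z0))) x _ _ n 0≤x z1<n) y≤n
    (lia 4 (\x z0 z1 n -> #0 :+ z1 :- x == z0 :+ n :- (x :+ (n :- (z1 :- z0)))) x z0 z1 n)))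
 -- A Euclidean step for periods of a finite word, as in the theorem of Fine and Wilf: if x + b
 -- leaves [0,n], then x - a is still inside, because a + b is at most n.
 per-sub : ∀ {a b} -> 0z ≤ a -> a ≤ b -> a + b ≤ n -> Per a -> Per b -> Per (b - a)
 per-sub {a} {b} 0≤a a≤b ab pa pb x y 0≤x y≤n refl with x + b ≤? n
 ... | yes le = tr (pb x (x + b) 0≤x le refl) (sym (pa (x + (b - a)) (x + b) (lia 3 (\x a b -> #0 <= x => a <= b => #0 <= x :+ (b :- a)) x a b 0≤x a≤b) le (lia 3 (\x a b -> x :+ b == x :+ (b :- a) :+ a) x a b)))
 ... | no gt = tr (sym (pa (x - a) x 0≤x-a (lia 4 (\x a b n -> a <= b => x :+ (b :- a) <= n => x <= n) x a b n a≤b y≤n) (x≡x-y+y a)))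
   (pb (x - a) (x + (b - a)) 0≤x-a y≤n (lia 3 (\x a b -> x :+ (b :- a) == x :- a :+ b) x a b))
  where
  0≤x-a = lia 4 (\x a b n -> a :+ b <= n => ~ x :+ b <= n => #0 <= x :- a) x a b n ab gt
 record Common (a b : ℤ) : Set where
  field
   g s t : ℤ
   g≥1 : + 1 ≤ g
   g≤a : g ≤ a
   a≡ : a ≡ g * s
   b≡ : b ≡ g * t
   per : Per g
 euclid : ∀ m a b -> a + b ≤ + m -> + 1 ≤ a -> + 1 ≤ b -> a + b ≤ n -> Per a -> Per b -> Common a b
 euclid zero a b le a≥1 b≥1 _ _ _ = ⊥e (lia 2 (\a b -> a :+ b <= #0 => #1 <= a => #1 <= b => ff) a b le a≥1 b≥1)
 euclid (suc m) a b le a≥1 b≥1 ab pa pb with <-cmp a b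
 ... | tri≈ _ refl _ = record { g = a ; s = + 1 ; t = + 1 ; g≥1 = a≥1 ; g≤a = ≤r ; a≡ = sym (*1 a) ; b≡ = sym (*1 a) ; per = pa }
 ... | tri< a<b _ _ = record { g = g ; s = s ; t = s + t ; g≥1 = g≥1 ; g≤a = g≤a ; a≡ = a≡ ; per = per
   ; b≡ = lia 5 (\a b u v w -> b :- a == v => a == u => w == u :+ v => b == w) a b _ _ _ b≡ a≡ (*-distribˡ-+ g s t) }
  where
  open Common (euclid m a (b - a) (lia 3 (\a b m -> a :+ b <= #1 :+ m => #1 <= a => a :+ (b :- a) <= m) a b _ le a≥1) a≥1 (x<y⇒1≤y-x a<b)
   (lia 3 (\a b n -> a :+ b <= n => #1 <= a => a :+ (b :- a) <= n) a b n ab a≥1) pa (per-sub (1≤x⇒0≤x a≥1) (<⇒≤ a<b) ab pa pb))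
 ... | tri> _ _ b<a = record { g = g ; s = s + t ; t = t ; g≥1 = g≥1 ; g≤a = lia 3 (\a b g -> #1 <= b => g <= a :- b => g <= a) a b g b≥1 g≤a ; b≡ = b≡ ; per = per
   ; a≡ = lia 5 (\a b u v w -> a :- b == u => b == v => w == u :+ v => a == w) a b _ _ _ a≡ b≡ (*-distribˡ-+ g s t) }
  where
  open Common (euclid m (a - b) b (lia 3 (\a b m -> a :+ b <= #1 :+ m => #1 <= b => a :- b :+ b <= m) a b _ le b≥1) (y<x⇒1≤x-y b<a) b≥1
   (lia 3 (\a b n -> a :+ b <= n => #1 <= b => a :- b :+ b <= n) a b n ab b≥1) (per-sub (1≤x⇒0≤x b≥1) (<⇒≤ b<a) (subst (_≤ n) (+-comm a b) ab) pb pa) pb)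
 per-mult : ∀ {g} -> 0z ≤ g -> Per g -> ∀ {i} -> 0z ≤ i -> Per (g * i)
 per-mult {g} 0≤g pg = rise (\i -> Per (g * i))
  (\x y _ _ e -> cong A (sym (tr e (tr (cong (\m -> x + m) (*0 g)) (+0 x)))))
  (\i 0≤i ih x y 0≤x y≤n e -> tr (ih x (y - g) 0≤x (lia 3 (\y g n -> #0 <= g => y <= n => y :- g <= n) y g n 0≤g y≤n) (lia 5 (\x y g m m' -> y == x :+ m' => m' == m :+ g => y :- g == x :+ m) x y g (g * i) _ e (*-step g i)))
   (pg (y - g) y (lia 5 (\x y g m m' -> y == x :+ m' => m' == m :+ g => #0 <= x => #0 <= m => #0 <= y :- g) x y g _ _ e (*-step g i) 0≤x (*-nonneg 0≤g 0≤i)) y≤n (x≡x-y+y g)))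
 per-in : ∀ {g x y} -> Per g -> x ∈ A -> y ≤ n -> y ≡ x + g -> y ∈ A
 per-in pg p y≤n e = tr (sym (pg _ _ (fst (supp p)) y≤n e)) p
 per-in⁻ : ∀ {g x y} -> Per g -> y ∈ A -> 0z ≤ x -> y ≡ x + g -> x ∈ A
 per-in⁻ pg p 0≤x e = tr (pg _ _ 0≤x (snd (supp p)) e) p
 -- A representation of z + g becomes one of z by lowering a summand by g, or one of z + n by
 -- raising it by n - g. One of them is always possible.
 U-up : ∀ {g z} -> + 1 ≤ g -> Per g -> Per (n - g) -> 0z ≤ z -> z + g < n -> U z -> U (z + g)
 U-up {g} {z} g≥1 pg png 0≤z lt (p , q) = out no1 , out no2
  where
  no1 : ¬ z + g ∈ D
  no1 r with D-out r
  ... | a , b , a∈ , b∈ , e with g ≤? a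
  ... | yes g≤a = clash (D-in (per-in⁻ {x = a - g} pg a∈ (lia 2 (\a g -> g <= a => #0 <= a :- g) a g g≤a) (x≡x-y+y g)) b∈ (lia 4 (\a b g z -> a :+ b == z :+ g => a :- g :+ b == z) a b g z e)) p
  ... | no a<g = clash (D-in (per-in {y = a + (n - g)} png a∈ (lia 3 (\a g n -> ~ g <= a => a :+ (n :- g) <= n) a g n a<g) refl) b∈ (lia 5 (\a b g z n -> a :+ b == z :+ g => a :+ (n :- g) :+ b == z :+ n) a b g z n e)) q
  no2 : ¬ z + g + n ∈ D
  no2 r with D-out r
  ... | a , b , a∈ , b∈ , e = clash (D-in (per-in⁻ {x = a - g} pg a∈ (lia 5 (\a b g z n -> a :+ b == z :+ g :+ n => b <= n => #0 <= z => #0 <= a :- g) a b g z n e (snd (supp b∈)) 0≤z) (x≡x-y+y g)) b∈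
    (lia 5 (\a b g z n -> a :+ b == z :+ g :+ n => a :- g :+ b == z :+ n) a b g z n e)) q
 U-down : ∀ {g z} -> + 1 ≤ g -> Per g -> Per (n - g) -> g ≤ z -> z < n -> U z -> U (z - g)
 U-down {g} {z} g≥1 pg png g≤z lt (p , q) = out no1 , out no2
  where
  no1 : ¬ z - g ∈ D
  no1 r with D-out r
  ... | a , b , a∈ , b∈ , e = clash (D-in (per-in {y = a + g} pg a∈ (lia 5 (\a b g z n -> a :+ b == z :- g => #0 <= b => z :< n => a :+ g <= n) a b g z n e (fst (supp b∈)) lt) refl) b∈ (lia 4 (\a b g z -> a :+ b == z :- g => a :+ g :+ b == z) a b g z e)) p
  no2 : ¬ z - g + n ∈ D
  no2 r with D-out r
  ... | a , b , a∈ , b∈ , e with a + g ≤? n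
  ... | yes le = clash (D-in (per-in {y = a + g} pg a∈ le refl) b∈ (lia 5 (\a b g z n -> a :+ b == z :- g :+ n => a :+ g :+ b == z :+ n) a b g z n e)) q
  ... | no gt = clash (D-in (per-in⁻ {x = a - (n - g)} png a∈ (lia 3 (\a g n -> ~ a :+ g <= n => #0 <= a :- (n :- g)) a g n gt) (lia 3 (\a g n -> a == a :- (n :- g) :+ (n :- g)) a g n)) b∈
    (lia 5 (\a b g z n -> a :+ b == z :- g :+ n => a :- (n :- g) :+ b == z) a b g z n e)) p
 isU : 𝔹
 isU z = not (D z) ∧ not (D (z + n))
 isU-in : ∀ {z} -> isU z ≡ true -> U z
 isU-in {z} p with D z | D (z + n)
 ... | false | false = refl , refl
 in-isU : ∀ {z} -> U z -> isU z ≡ true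
 in-isU (p , q) rewrite p | q = refl
 record Lattice : Set where
  field
   d q ζ : ℤ
   d≥1 : + 1 ≤ d
   q≥2 : + 2 ≤ q
   n≡ : n ≡ d * q
   per : Per d
   per' : Per (n - d)
   ζ≥0 : 0z ≤ ζ
   ζ<d : ζ < d
   Uζ : U ζ
   only : ∀ z -> 0z ≤ z -> z < d -> U z -> z ≡ ζ
   flat : φ d ≡ 0z
 -- The window loses the step at t and gains the step at t + d, which is the same by periodicity.
 slide : ∀ {d} -> + 1 ≤ d -> Per d -> ∀ {t} -> 0z ≤ t -> t + d ≤ n -> bal A t (t + d) ≡ φ d
 slide {d} d≥1 pd {t} 0≤t le = climb (\t -> bal A t (t + d) ≡ φ d) (n - d) (cong φ (0+ d))
  (\t 0≤t t< ih -> lia 6 (\b b' m s s' f -> b == f => b == s :+ m => b' == m :+ s' => s == s' => b' == f)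
   _ _ (bal A (t + + 1) (t + d)) _ _ _ ih
   (∑-step-low (step A) (1≤y⇒x<x+y d≥1))
   (tr (cong (bal A (t + + 1)) (lia 2 (\t d -> t :+ #1 :+ d == t :+ d :+ #1) t d))
    (∑-step (step A) (t + + 1) (t + d) (lia 2 (\t d -> #1 <= d => t :+ #1 <= t :+ d) t d d≥1)))
   (cong (\b -> + 2 * bit b - + 1) (pd t (t + d) 0≤t (lia 3 (\t d n -> t :< n :- d => t :+ d <= n) t d n t<) refl)))
  0≤t (lia 3 (\t d n -> t :+ d <= n => t <= n :- d) t d n le)
 private
  gaps : 𝔹
  gaps δ = some (\z -> isU z ∧ isU (z + δ)) 0z (n - δ)
 -- Let d be the least distance between uncovered positions. The common divisor g of the periods d
 -- and n - d is a period and translates uncovered positions; minimality gives d = g, so d divides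
 -- n.
 lattice0 : φ (n + + 1) ≡ + 1 -> ∀ {z0 z1} -> 0z ≤ z0 -> z0 < z1 -> z1 < n -> U z0 -> U z1 -> Lattice
 lattice0 half {z0} {z1} 0≤z0 lt z1<n u₀ u₁ with least gaps {+ 1} {n} (lia 3 (\a b n -> #0 <= a => a :< b => b :< n => #1 <= n) _ _ n 0≤z0 lt z1<n)
 ... | inr none = clash (in-some _ z0 0≤z0 (lia 3 (\a b n -> b :< n => a :< n :- (b :- a)) _ _ n z1<n) (in-∧ (in-isU u₀) (in-isU (subst U (lia 2 (\a b -> b == a :+ (b :- a)) z0 _) u₁))))
   (none (z1 - z0) (x<y⇒1≤y-x lt) (lia 3 (\a b n -> #0 <= a => b :< n => b :- a :< n) _ _ n 0≤z0 z1<n))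
 ... | inl (d , d≥1 , d<n , p , before) with some-in (\z -> isU z ∧ isU (z + d)) {0z} {n - d} p
 ... | z , 0≤z , z<n-d , q = result
  where
  z+d<n = lia 3 (\z d n -> z :< n :- d => z :+ d :< n) z d n z<n-d
  z<z+d = 1≤y⇒x<x+y d≥1
  z<n = <-trans z<z+d z+d<n
  uz = isU-in (fst (∧-in q))
  uz+ = isU-in (snd (∧-in {isU z} q))
  d≡ = lia 2 (\z d -> z :+ d :- z == d) z d
  cz = critical half 0≤z z<n uz
  cz+ = critical half (≤t 0≤z (<⇒≤ z<z+d)) z+d<n uz+
  both = per-two 0≤z z<z+d z+d<n cz cz+
  pd = subst Per d≡ (fst both)
  pd' = subst (\e -> Per (n - e)) d≡ (snd both)
  minimal : ∀ a b -> 0z ≤ a -> a < b -> b < n -> U a -> U b -> d ≤ b - a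
  minimal a b 0≤a a<b b<n ua ub with d ≤? b - a
  ... | yes h = h
  ... | no h = clash (in-some _ a 0≤a (lia 3 (\a b n -> b :< n => a :< n :- (b :- a)) a b n b<n) (in-∧ (in-isU ua) (in-isU (subst U (lia 2 (\a b -> b == a :+ (b :- a)) a b) ub))))
    (before (b - a) (x<y⇒1≤y-x a<b) (≰⇒> h))
  0≤d = 1≤x⇒0≤x d≥1
  span-≥ : ∀ n -> d + (n - d) ≤ + span n
  span-≥ (+ m) = ≡⇒≤ (x+[y-x]≡y d)
  span-≥ -[1+ m ] = ≤t (≡⇒≤ (x+[y-x]≡y d)) -≤+
  module C = Common (euclid (span n) d (n - d) (span-≥ n) d≥1 (x<y⇒1≤y-x d<n) (lia 2 (\d n -> d :+ (n :- d) <= n) d n) pd pd')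
  open C using (g; s; t)
  0≤g = 1≤x⇒0≤x C.g≥1
  n≡g = lia 5 (\n d u v w -> d == u => n :- d == v => w == u :+ v => n == w) n d _ _ _ C.a≡ C.b≡ (*-distribˡ-+ g s t)
  0<n = lia 2 (\d n -> #1 <= d => d :< n => #0 :< n) d n d≥1 d<n
  png = subst Per (lia 4 (\n g u v -> n == v => v == u :+ g => u == n :- g) n g _ _ n≡g (tr (cong (g *_) (lia 2 (\s t -> s :+ t == s :+ t :- #1 :+ #1) s t)) (*-step g (s + t - + 1))))
   (per-mult 0≤g C.per (1≤x⇒0≤x-1 (*-pos⁻ g (s + t) C.g≥1 (subst (0z <_) n≡g 0<n))))
  d≡g = ≤≥ (subst (d ≤_) (lia 2 (\z g -> z :+ g :- z == g) z g)
    (minimal z (z + g) 0≤z (1≤y⇒x<x+y C.g≥1) z+g<n uz (U-up C.g≥1 C.per png 0≤z z+g<n uz))) C.g≤a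
   where
   z+g<n = lia 4 (\z g d n -> g <= d => z :+ d :< n => z :+ g :< n) z g d n C.g≤a z+d<n
  n≡dq = tr n≡g (cong (_* (s + t)) (sym d≡g))
  rem = divide d≥1 0≤z
  ζ = fst rem
  i = fst (snd rem)
  0≤ζ = fst (snd (snd rem))
  ζ<d = fst (snd (snd (snd rem)))
  0≤i = fst (snd (snd (snd (snd rem))))
  z≡ = snd (snd (snd (snd (snd rem))))
  Uζ = rise (\j -> ζ + d * j < n -> U (ζ + d * j) -> U ζ)
   (\_ h -> subst U (tr (cong (\m -> ζ + m) (*0 d)) (+0 ζ)) h)
   (\j 0≤j ih lt' h -> ih (lia 5 (\x m m' d n -> x :+ m' :< n => m' == m :+ d => #1 <= d => x :+ m :< n) ζ (d * j) _ d n lt' (*-step d j) d≥1)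
    (subst U (lia 4 (\x m m' d -> m' == m :+ d => x :+ m' :- d == x :+ m) ζ (d * j) _ d (*-step d j))
     (U-down d≥1 pd pd' (lia 4 (\x m m' d -> m' == m :+ d => #0 <= x => #0 <= m => d <= x :+ m') ζ _ _ d (*-step d j) 0≤ζ (*-nonneg 0≤d 0≤j)) lt' h)))
   0≤i (subst (_< n) z≡ z<n) (subst U z≡ uz)
  only : ∀ y -> 0z ≤ y -> y < d -> U y -> y ≡ ζ
  only y 0≤y y<d uy with <-cmp y ζ
  ... | tri≈ _ e _ = e
  ... | tri< a _ _ = ⊥e (lia 3 (\y x d -> d <= x :- y => #0 <= y => x :< d => ff) y ζ d (minimal y ζ 0≤y a (<-trans ζ<d d<n) uy Uζ) 0≤y ζ<d)
  ... | tri> _ _ b = ⊥e (lia 3 (\y x d -> d <= y :- x => #0 <= x => y :< d => ff) y ζ d (minimal ζ y 0≤ζ b (<-trans y<d d<n) Uζ uy) 0≤ζ y<d)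
  -- The level is 0 after z and after z + d, so one window of length d is balanced, and by `slide`
  -- all of them are.
  flat = lia 4 (\f b u v -> b == f => v == u :+ b => u == #0 => v == #0 => f == #0) _ _ _ _
   (slide d≥1 pd (0≤x⇒0≤x+1 0≤z) (lia 3 (\z d n -> z :+ d :< n => z :+ #1 :+ d <= n) z d n z+d<n))
   (tr (cong φ (lia 2 (\z d -> z :+ d :+ #1 == z :+ #1 :+ d) z d)) (φ-split (0≤x⇒0≤x+1 0≤z) (lia 2 (\z d -> #0 <= d => z :+ #1 <= z :+ #1 :+ d) z d 0≤d)))
   (Critical.next cz) (Critical.next cz+)
  result : Lattice
  result = record { d = d ; q = s + t ; ζ = ζ ; d≥1 = d≥1 ; n≡ = n≡dq ; per = pd ; per' = pd' ; ζ≥0 = 0≤ζ ; ζ<d = ζ<d ; Uζ = Uζ ; only = only ; flat = flat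
   ; q≥2 = q≥2 }
   where
   q≥2 = lia 1 (\q -> #1 <= q :- #1 => #2 <= q) _ (*-pos⁻ d (s + t - + 1) d≥1
    (lia 4 (\d n u v -> d :< n => n == v => v == u :+ d => #0 :< u) d n _ _ d<n n≡dq
     (tr (cong (d *_) (lia 2 (\s t -> s :+ t == s :+ t :- #1 :+ #1) s t)) (*-step d (s + t - + 1)))))
 abstract
  lattice : φ (n + + 1) ≡ + 1 -> ∀ {z0 z1} -> 0z ≤ z0 -> z0 < z1 -> z1 < n -> U z0 -> U z1 -> Lattice
  lattice = lattice0

-- The period is at most 5

module LatticeBound {n : ℤ} (X : NSet n) (half : OnSet.φ X (n + + 1) ≡ + 1) (L : Periods.Lattice X) where
 open OnSet X
 open Periods X
 open Lattice L
 private
  0≤d = ≤t 0≤+ d≥1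
  d*q : ∀ j -> d * (q - j) ≡ n - d * j
  d*q j = tr (ring d q j) (cong (_- d * j) (sym n≡))
   where
   ring : ∀ d q j -> d * (q - j) ≡ d * q - d * j
   ring = solve
  2d≤n = lia 4 (\d n u v -> #0 <= u => u == n :- v => v == d :+ d => d :+ d <= n) d n _ _
   (*-nonneg 0≤d (2≤x⇒0≤x-2 q≥2)) (d*q (+ 2)) (ring d)
   where
   ring : ∀ d -> d * + 2 ≡ d + d
   ring = solve
  up : ∀ x -> x ∈ D -> x + d ≤ n + n - d -> x + d ∈ D
  up x p le with D-out p
  ... | a , b , a∈ , b∈ , e with a + d ≤? n
  ... | yes h = D-in (per-in {y = a + d} per a∈ h refl) b∈ (lia 4 (\a b d x -> a :+ b == x => a :+ d :+ b == x :+ d) a b d x e)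
  ... | no h = D-in a∈ (per-in {y = b + d} per b∈ (lia 5 (\a b d x n -> a :+ b == x => x :+ d <= n :+ n :- d => ~ a :+ d <= n => b :+ d <= n) a b d x n e le h) refl) (lia 4 (\a b d x -> a :+ b == x => a :+ (b :+ d) == x :+ d) a b d x e)
  down : ∀ x -> x ∈ D -> d ≤ x - d -> x - d ∈ D
  down x p le with D-out p
  ... | a , b , a∈ , b∈ , e with d ≤? a
  ... | yes h = D-in (per-in⁻ {x = a - d} per a∈ (lia 2 (\a d -> d <= a => #0 <= a :- d) a d h) (x≡x-y+y d)) b∈ (lia 4 (\a b d x -> a :+ b == x => a :- d :+ b == x :- d) a b d x e)
  ... | no h = D-in a∈ (per-in⁻ {x = b - d} per b∈ (lia 4 (\a b d x -> a :+ b == x => d <= x :- d => ~ d <= a => #0 <= b :- d) a b d x e le h) (x≡x-y+y d)) (lia 4 (\a b d x -> a :+ b == x => a :+ (b :- d) == x :- d) a b d x e)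
  up* : ∀ x -> x ∈ D -> ∀ {j} -> 0z ≤ j -> x + d * j ≤ n + n - d -> x + d * j ∈ D
  up* x p = rise (\j -> x + d * j ≤ n + n - d -> x + d * j ∈ D)
   (\_ -> move D p (sym (tr (cong (\m -> x + m) (*0 d)) (+0 x))))
   (\j 0≤j ih le -> move D (up (x + d * j) (ih (lia 5 (\x m m' d N -> x :+ m' <= N => m' == m :+ d => #0 <= d => x :+ m <= N) x (d * j) _ d _ le (*-step d j) 0≤d))
     (lia 5 (\x m m' d N -> x :+ m' <= N => m' == m :+ d => x :+ m :+ d <= N) x (d * j) _ d _ le (*-step d j)))
    (lia 4 (\x m m' d -> m' == m :+ d => x :+ m :+ d == x :+ m') x (d * j) _ d (*-step d j)))
  down* : ∀ x -> x ∈ D -> ∀ {j} -> 0z ≤ j -> d ≤ x - d * j -> x - d * j ∈ D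
  down* x p = rise (\j -> d ≤ x - d * j -> x - d * j ∈ D)
   (\_ -> move D p (sym (tr (cong (\m -> x - m) (*0 d)) (+0 x))))
   (\j 0≤j ih le -> move D (down (x - d * j) (ih (lia 4 (\x m m' d -> d <= x :- m' => m' == m :+ d => #0 <= d => d <= x :- m) x (d * j) _ d le (*-step d j) 0≤d))
     (lia 4 (\x m m' d -> d <= x :- m' => m' == m :+ d => d <= x :- m :- d) x (d * j) _ d le (*-step d j)))
    (lia 4 (\x m m' d -> m' == m :+ d => x :- m :- d == x :- m') x (d * j) _ d (*-step d j)))
  q≥0 = ≤t 0≤+ q≥2
  -- Some sum is congruent to z modulo n. If it is z itself, then q upward moves by d lead from z to
  -- z + n.
  z+n : ∀ z -> 0z ≤ z -> z < d -> ¬ U z -> z + n ∈ D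
  z+n z 0≤z z<d ¬u with mem? D (z + n) | mem? D z
  ... | inl p | _ = p
  ... | inr p | inr p' = ⊥e (¬u (p' , p))
  ... | inr p | inl p' = move D (up* z p' q≥0 (subst (\m -> z + m ≤ n + n - d) n≡ (lia 3 (\z d n -> z :< d => d :+ d <= n => z :+ n <= n :+ n :- d) z d n z<d 2d≤n))) (cong (\m -> z + m) (sym n≡))
  z+d : ∀ z -> 0z ≤ z -> z < d -> ¬ U z -> z + d ∈ D
  z+d z 0≤z z<d ¬u = move D (down* (z + n) (z+n z 0≤z z<d ¬u) {q - + 1} (lia 1 (\q -> #2 <= q => #0 <= q :- #1) q q≥2) (lia 4 (\z d n m -> #0 <= z => m == n :- d => d <= z :+ n :- m) z d n _ 0≤z e)) (lia 4 (\z d n m -> m == n :- d => z :+ n :- m == z :+ d) z d n _ e)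
   where
   e = tr (d*q (+ 1)) (cong (\m -> n - m) (*1 d))
  -- In an inner block a hole outside the class of ζ is covered twice and contributes 1, while a
  -- hole in that class contributes at least -1 = 1 - 2.
  inner-bound : ∀ z j -> 0z ≤ z -> z < d -> + 1 ≤ j -> z + d * j ≤ n - d -> + 1 - χ A z - + 2 * χ (point ζ) z ≤ ex (z + d * j)
  inner-bound z j 0≤z z<d j≥1 le with mem? A z
  ... | inl z∈ = lia 3 (\a p e -> a == #1 => #0 <= p => e == #0 => #1 :- a :- 2 *: p <= e) _ _ _ (χ-in z∈) (χ≥0 (point ζ) z)
    (ex-in (per-in (per-mult 0≤d per (≤t 0≤+ j≥1)) z∈ (lia 3 (\u d n -> u <= n :- d => #0 <= d => u <= n) _ d n le 0≤d) refl))
  ... | inr z∉ = case z ≟ ζ of \ where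
    (yes e) -> lia 5 (\a p u v w -> a == #0 => p == #1 => w == u :+ v :- #1 => #0 <= u => #0 <= v => #1 :- a :- 2 *: p <= w) _ _ _ _ _ (χ-out z∉) (χ-in (in-bool (z ≟ ζ) e)) (ex-hole hole') (χ≥0 D _) (χ≥0 D _)
    (no ne) -> let ¬u = \u -> ne (only z 0≤z z<d u) in
     lia 5 (\a p u v w -> a == #0 => #0 <= p => w == u :+ v :- #1 => u == #1 => v == #1 => #1 :- a :- 2 *: p <= w) _ _ _ _ _ (χ-out z∉) (χ≥0 (point ζ) z) (ex-hole hole')
      (χ-in (move D (up* (z + d) (z+d z 0≤z z<d ¬u) {j - + 1} (1≤x⇒0≤x-1 j≥1) (lia 5 (\z d n m m' -> z :+ m' <= n :- d => m == m' :- d => d :+ d <= n => #0 <= d => z :+ d :+ m <= n :+ n :- d) z d n _ (d * j) le (ring d j) 2d≤n 0≤d)) (lia 4 (\z d m m' -> m == m' :- d => z :+ d :+ m == z :+ m') z d _ (d * j) (ring d j))))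
      (χ-in (move D (up* (z + n) (z+n z 0≤z z<d ¬u) {j} (≤t 0≤+ j≥1) (lia 4 (\z d n m -> z :+ m <= n :- d => z :+ n :+ m <= n :+ n :- d) z d n (d * j) le)) (lia 3 (\z n m -> z :+ n :+ m == z :+ m :+ n) z n (d * j))))
   where
   ring : ∀ d j -> d * (j - + 1) ≡ d * j - d
   ring = solve
   hole' = tr (sym (per-mult 0≤d per (≤t 0≤+ j≥1) z (z + d * j) 0≤z (lia 3 (\u d n -> u <= n :- d => #0 <= d => u <= n) _ d n le 0≤d) refl)) z∉
  -- The first and the last block are taken together because neither alone need be doubly covered. A
  -- hole outside the class of ζ contributes at least 1 to the pair, the class of ζ at least -2 = 1
  -- - 3.
  outer-bound : ∀ z -> 0z ≤ z -> z < d -> + 1 - χ A z - + 3 * χ (point ζ) z ≤ ex z + ex (z + (n - d))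
  outer-bound z 0≤z z<d with mem? A z
  ... | inl z∈ = lia 4 (\a p e e' -> a == #1 => #0 <= p => e == #0 => e' == #0 => #1 :- a :- 3 *: p <= e :+ e') _ _ _ _ (χ-in z∈) (χ≥0 (point ζ) z) (ex-in z∈)
    (ex-in (per-in per' z∈ (lia 3 (\z d n -> z :< d => z :+ (n :- d) <= n) z d n z<d) refl))
  ... | inr z∉ = case z ≟ ζ of \ where
    (yes e) -> lia 8 (\a p u v w u' v' w' -> a == #0 => p == #1 => w == u :+ v :- #1 => #0 <= u => #0 <= v => w' == u' :+ v' :- #1 => #0 <= u' => #0 <= v' => #1 :- a :- 3 *: p <= w :+ w')
     _ _ _ _ _ _ _ _ (χ-out z∉) (χ-in (in-bool (z ≟ ζ) e)) (ex-hole z∉) (χ≥0 D _) (χ≥0 D _) (ex-hole hole') (χ≥0 D _) (χ≥0 D _)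
    (no ne) -> other (\u -> ne (only z 0≤z z<d u))
   where
   y = z + (n - d)
   hole' = tr (sym (per' z y 0≤z (lia 3 (\z d n -> z :< d => z :+ (n :- d) <= n) z d n z<d) refl)) z∉
   e1 = tr (d*q (+ 1)) (cong (\m -> n - m) (*1 d))
   e2 = tr (d*q (+ 2)) (ring d n)
    where
    ring : ∀ d n -> n - d * + 2 ≡ n - d - d
    ring = solve
   module _ (¬u : ¬ U z) where
    y∈ = move D (up* (z + d) (z+d z 0≤z z<d ¬u) {q - + 2} (2≤x⇒0≤x-2 q≥2) (lia 4 (\z d n m -> z :< d => d :+ d <= n => m == n :- d :- d => #0 <= d => z :+ d :+ m <= n :+ n :- d) z d n _ z<d 2d≤n e2 0≤d)) (lia 4 (\z d n m -> m == n :- d :- d => z :+ d :+ m == z :+ (n :- d)) z d n _ e2)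
    -- By periodicity z + 2n - 2d is a sum. Raising one summand by d gives y + n; if neither can be
    -- raised, lowering both by n - d gives the excluded z.
    top : z ∉ D -> y + n ∈ D
    top z∉D with D-out (up* (z + n) (z+n z 0≤z z<d ¬u) {q - + 2} (2≤x⇒0≤x-2 q≥2) (lia 4 (\z d n m -> z :< d => m == n :- d :- d => z :+ n :+ m <= n :+ n :- d) z d n _ z<d e2))
    ... | a , b , a∈ , b∈ , e with a + d ≤? n | b + d ≤? n
    ... | yes h | _ = D-in (per-in {y = a + d} per a∈ h refl) b∈ (lia 6 (\a b z n d m -> a :+ b == z :+ n :+ m => m == n :- d :- d => a :+ d :+ b == z :+ (n :- d) :+ n) a b z n d _ e e2)
    ... | no _ | yes h = D-in a∈ (per-in {y = b + d} per b∈ h refl) (lia 6 (\a b z n d m -> a :+ b == z :+ n :+ m => m == n :- d :- d => a :+ (b :+ d) == z :+ (n :- d) :+ n) a b z n d _ e e2)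
    ... | no h | no h' = clash (D-in (per-in⁻ {x = a - (n - d)} per' a∈ (lia 3 (\a d n -> ~ a :+ d <= n => #0 <= a :- (n :- d)) a d n h) (x≡x-y+y (n - d)))
       (per-in⁻ {x = b - (n - d)} per' b∈ (lia 3 (\a d n -> ~ a :+ d <= n => #0 <= a :- (n :- d)) b d n h') (x≡x-y+y (n - d)))
       (lia 6 (\a b z n d m -> a :+ b == z :+ n :+ m => m == n :- d :- d => a :- (n :- d) :+ (b :- (n :- d)) == z) a b z n d _ e e2)) z∉D
    other = lia 8 (\a p u v w u' v' w' -> a == #0 => #0 <= p => w == u :+ v :- #1 => v == #1 => w' == u' :+ v' :- #1 => u' == #1 => #1 <= u :+ v' => #1 :- a :- 3 *: p <= w :+ w')
     _ _ (χ D z) _ _ _ (χ D (y + n)) _ (χ-out z∉) (χ≥0 (point ζ) z) (ex-hole z∉) (χ-in (z+n z 0≤z z<d ¬u)) (ex-hole hole') (χ-in y∈) either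
     where
     either : + 1 ≤ χ D z + χ D (y + n)
     either with mem? D z
     ... | inl p = lia 2 (\u v -> u == #1 => #0 <= v => #1 <= u :+ v) _ _ (χ-in p) (χ≥0 D _)
     ... | inr p = lia 2 (\u v -> #0 <= u => v == #1 => #1 <= u :+ v) _ _ (χ≥0 D _) (χ-in (top p))
  -- By `flat` half of the d positions are holes, so the bounds add up to d/2 - c.
  weight : ∀ c -> + 2 * ∑ (\z -> + 1 - χ A z - c * χ (point ζ) z) 0z d ≡ d - + 2 * c
  weight c = lia 8 (\s t u v w d c f -> s == t :- w => t == u :- v => u == d :- #0 => f == 2 *: v :- (d :- #0) => f == #0 => w == c => 2 *: s == d :- 2 *: c)
   _ _ _ (count A 0z d) _ d c _
   (∑-sub (\z -> + 1 - χ A z) (\z -> c * χ (point ζ) z) 0≤d) (∑-sub (\_ -> + 1) (χ A) 0≤d) (∑-one' 0≤d) (bal-count A 0≤d) flat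
   (tr (scale 0≤d) (tr (cong (c *_) (count-point ζ ζ≥0 ζ<d)) (*1 c)))
   where
   scale = rise (\b -> ∑ (\z -> c * χ (point ζ) z) 0z b ≡ c * count (point ζ) 0z b)
    (tr (∑-empty _ 0z) (sym (tr (cong (c *_) (∑-empty _ 0z)) (*0 c))))
    (\b 0≤b ih -> tr (∑-step _ 0z b 0≤b) (tr (cong (_+ c * χ (point ζ) b) ih) (tr (sym (*-distribˡ-+ c _ _)) (cong (c *_) (sym (∑-step _ 0z b 0≤b))))))
 -- An inner block contributes at least d/2 - 2 and the outer pair at least d/2 - 3. For d at least
 -- 6 nothing is negative, so the total cannot be.
 d≤5 : ∑ ex 0z n ≤ - + 1 -> d ≤ + 5
 d≤5 small with d ≤? + 5
 ... | yes h = h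
 ... | no h = ⊥e (lia 7 (\t a b c r s u -> t == a :+ r => r == b :+ c => s <= a :+ c => 2 *: s == u :- #6 => ~ u <= #5 => #0 <= b => t <= con (- + 1) => ff)
   _ (∑ ex 0z d) _ (∑ ex (n - d) n) _ _ d
   (∑-split ex 0≤d (lia 2 (\d n -> d :+ d <= n => #0 <= d => d <= n) d n 2d≤n 0≤d)) (∑-split ex (lia 2 (\d n -> d :+ d <= n => d <= n :- d) d n 2d≤n) (0≤x⇒y-x≤y 0≤d))
   (subst (∑ (\z -> + 1 - χ A z - + 3 * χ (point ζ) z) 0z d ≤_) outer (∑-mono _ (\z -> ex z + ex (z + (n - d))) 0≤d outer-bound)) (weight (+ 3)) h middle small)
  where
  outer = tr (∑-+ ex (\z -> ex (z + (n - d))) 0≤d) (cong (\s -> ∑ ex 0z d + s) (tr (∑-shift ex (n - d) 0≤d) (cong₂ (∑ ex) (0+ (n - d)) (x+[y-x]≡y d))))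
  blocks = rise (\j -> d + d * j ≤ n - d -> 0z ≤ ∑ ex d (d + d * j))
   (\_ -> ≡⇒≤ (sym (tr (cong (∑ ex d) (tr (cong (\m -> d + m) (*0 d)) (+0 d))) (∑-empty ex d))))
   (\j 0≤j ih le ->
    let
      e = tr (+-comm d (d * j)) (sym (*-step d j))
      le' = lia 4 (\d m m' N -> d :+ m' <= N => m' == m :+ d => d :+ m <= N :- d) d (d * j) _ _ le (*-step d j)
      0≤dj = *-nonneg 0≤d 0≤j
     in lia 5 (\t a b w d -> t == a :+ b => #0 <= a => w <= b => 2 *: w == d :- #4 => ~ d <= #5 => #0 <= t)
      _ _ _ _ d
      (∑-split ex (0≤y⇒x≤x+y 0≤dj) (lia 4 (\d m m' N -> m' == m :+ d => #0 <= d => d :+ m <= d :+ m') d (d * j) _ (n - d) (*-step d j) 0≤d))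
      (ih (lia 3 (\u N d -> u <= N :- d => #0 <= d => u <= N) _ _ d le' 0≤d))
      (subst (∑ (\z -> + 1 - χ A z - + 2 * χ (point ζ) z) 0z d ≤_)
      (tr (∑-shift ex (d * (j + + 1)) 0≤d) (cong₂ (∑ ex) (tr (0+ _) (sym e)) refl))
      (∑-mono _ (\z -> ex (z + d * (j + + 1))) 0≤d \z 0≤z z<d -> inner-bound z (j + + 1) 0≤z z<d (0≤x⇒1≤x+1 0≤j)
      (lia 4 (\z d m N -> d :+ m <= N => z :< d => z :+ m <= N) z d (d * (j + + 1)) _ le z<d)))
      (weight (+ 2)) h)
  middle = subst (\m -> 0z ≤ ∑ ex d m) (lia 3 (\d n m -> m == n :- d :- d => d :+ m == n :- d) d n _ e2)
   (blocks {q - + 2} (2≤x⇒0≤x-2 q≥2) (lia 3 (\d n m -> m == n :- d :- d => d :+ m <= n :- d) d n _ e2))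
   where
   ring : ∀ d n -> n - d * + 2 ≡ n - d - d
   ring = solve
   e2 = tr (d*q (+ 2)) (ring d n)

Even : ∀ {n} -> NSet n -> Set
Even X = ∀ x -> x ∈ NSet.A X -> Σ ℤ \i -> x ≡ + 2 * i

record Four {n : ℤ} (X : NSet n) : Set where
 open NSet X
 field
  ρ m : ℤ
  ρ≡ : ρ ≡ + 1 ⊎ ρ ≡ + 3
  m≥1 : + 1 ≤ m
  n≡4m : n ≡ + 4 * m
  cls : ∀ x -> x ∈ A -> (Σ ℤ \i -> 0z ≤ i × i ≤ m × x ≡ + 4 * i) ⊎ (Σ ℤ \i -> 0z ≤ i × i ≤ m - + 1 × x ≡ ρ + + 4 * i)
  in-0 : ∀ i -> 0z ≤ i -> i ≤ m -> + 4 * i ∈ A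
  in-ρ : ∀ i -> 0z ≤ i -> i ≤ m - + 1 -> ρ + + 4 * i ∈ A

module FourPeriodic {n : ℤ} (X : NSet n) (half : OnSet.φ X (n + + 1) ≡ + 1) (small : ∑ (OnSet.ex X) 0z n ≤ - + 1) (L : Periods.Lattice X) where
 open OnSet X
 open Periods X
 open Lattice L
 private
  bnd = LatticeBound.d≤5 X half L small
  0≤d = ≤t 0≤+ d≥1
  cnt = lia 3 (\c d f -> f == 2 *: c :- (d :- #0) => f == #0 => 2 *: c == d) (count A 0z d) d _ (bal-count A 0≤d) flat
  -- A balanced window has even length.
  two-or-four = lia 2 (\d c -> 2 *: c == d => #1 <= d => d <= #5 => d == #2 :∨ d == #4) d (count A 0z d) cnt d≥1 bnd
  reduce : ∀ x -> x ∈ A -> Σ ℤ \r -> Σ ℤ \i -> 0z ≤ r × r < d × 0z ≤ i × x ≡ r + d * i × r ∈ A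
  reduce x p with divide d≥1 (fst (supp p))
  ... | r , i , a , b , c , e = r , i , a , b , c , e , per-in⁻ (per-mult 0≤d per c) p a e
  sum2 = tr (∑-step (χ A) 0z (+ 1) 0≤+) (cong (_+ χ A (+ 1)) (∑-one (χ A) 0z))
  sum4 = tr (∑-step (χ A) 0z (+ 3) 0≤+) (cong (_+ χ A (+ 3)) (tr (∑-step (χ A) 0z (+ 2) 0≤+) (cong (_+ χ A (+ 2)) sum2)))
  even2 : d ≡ + 2 -> Even X
  even2 e x p with reduce x p
  ... | r , i , 0≤r , r<d , _ , x≡ , r∈ with lia 2 (\r d -> #0 <= r => r :< d => d == #2 => r == #0 :∨ r == #1) r d 0≤r r<d e
  ... | inl refl = i , tr x≡ (tr (0+ (d * i)) (cong (_* i) e))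
  ... | inr refl = ⊥e (lia 3 (\c a b -> 2 *: c == #2 => c == a :+ b => a == #1 => b == #1 => ff) _ _ _ (subst (\d -> + 2 * count A 0z d ≡ d) e cnt) sum2 (χ-in lo) (χ-in r∈))
  module _ (e : d ≡ + 4) where
   tot = tr (cong (+ 2 *_) (sym sum4)) (subst (\d -> + 2 * count A 0z d ≡ d) e cnt)
   n≡4q = tr n≡ (cong (_* q) e)
   mult : ∀ r i -> 0z ≤ i -> r + + 4 * i ≤ n -> r ∈ A -> r + + 4 * i ∈ A
   mult r i 0≤i le r∈ = per-in (per-mult 0≤d per 0≤i) r∈ le (cong (\d -> r + d * i) (sym e))
   even4 : + 2 ∈ A -> Even X
   even4 2∈ x p with reduce x p
   ... | r , i , 0≤r , r<d , _ , x≡ , r∈ with lia 2 (\r d -> #0 <= r => r :< d => d == #4 => r == #0 :∨ r == #1 :∨ r == #2 :∨ r == #3) r d 0≤r r<d e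
   ... | inl refl = + 2 * i , tr x≡ (tr (cong (\d -> 0z + d * i) e) (lia 1 (\i -> #0 :+ 4 *: i == 2 *: (2 *: i)) i))
   ... | inr (inr (inl refl)) = + 2 * i + + 1 , tr x≡ (tr (cong (\d -> + 2 + d * i) e) (lia 1 (\i -> #2 :+ 4 *: i == 2 *: (2 *: i :+ #1)) i))
   ... | inr (inl refl) = ⊥e (lia 4 (\a b c d -> 2 *: (a :+ b :+ c :+ d) == #4 => a == #1 => b == #1 => c == #1 => #0 <= d => ff) _ _ _ _ tot (χ-in lo) (χ-in r∈) (χ-in 2∈) (χ≥0 A _))
   ... | inr (inr (inr refl)) = ⊥e (lia 4 (\a b c d -> 2 *: (a :+ b :+ c :+ d) == #4 => a == #1 => d == #1 => c == #1 => #0 <= b => ff) _ _ _ _ tot (χ-in lo) (χ-in r∈) (χ-in 2∈) (χ≥0 A _))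
   four : ∀ ρ -> ρ ≡ + 1 ⊎ ρ ≡ + 3 -> ρ ∈ A -> Four X
   four ρ c ρ∈ = record { ρ = ρ ; m = q ; ρ≡ = c ; m≥1 = ≤t 1≤+ q≥2 ; n≡4m = n≡4q ; cls = cls
    ; in-0 = \i 0≤i i≤q -> move A (mult 0z i 0≤i (lia 3 (\i q n -> i <= q => n == 4 *: q => #0 :+ 4 *: i <= n) i q n i≤q n≡4q) lo) (0+ _)
    ; in-ρ = \i 0≤i i≤q -> mult ρ i 0≤i (lia 4 (\r i q n -> (r == #1 :∨ r == #3) => i <= q :- #1 => n == 4 *: q => r :+ 4 *: i <= n) ρ i q n c i≤q n≡4q) ρ∈ }
    where
    tot' = lia 4 (\a b c d -> 2 *: (a :+ b :+ c :+ d) == #4 => a == #1 => b :+ c :+ d == #1) _ (χ A (+ 1)) (χ A (+ 2)) (χ A (+ 3)) tot (χ-in lo)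
    no12 : + 1 ∈ A -> + 2 ∈ A -> ⊥
    no12 p p' = lia 3 (\a b c -> a :+ b :+ c == #1 => a == #1 => b == #1 => #0 <= c => ff) _ _ _ tot' (χ-in p) (χ-in p') (χ≥0 A _)
    no23 : + 2 ∈ A -> + 3 ∈ A -> ⊥
    no23 p p' = lia 3 (\a b c -> a :+ b :+ c == #1 => b == #1 => c == #1 => #0 <= a => ff) _ _ _ tot' (χ-in p) (χ-in p') (χ≥0 A _)
    no13 : + 1 ∈ A -> + 3 ∈ A -> ⊥
    no13 p p' = lia 3 (\a b c -> a :+ b :+ c == #1 => a == #1 => c == #1 => #0 <= b => ff) _ _ _ tot' (χ-in p) (χ-in p') (χ≥0 A _)
    pick : ∀ r -> r ∈ A -> (r ≡ 0z ⊎ r ≡ + 1 ⊎ r ≡ + 2 ⊎ r ≡ + 3) -> (ρ ≡ + 1 ⊎ ρ ≡ + 3) -> r ≡ 0z ⊎ r ≡ ρ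
    pick r r∈ (inl a) _ = inl a
    pick r r∈ (inr (inl a)) (inl b) = inr (tr a (sym b))
    pick r r∈ (inr (inl a)) (inr b) = ⊥e (no13 (move A r∈ a) (move A ρ∈ b))
    pick r r∈ (inr (inr (inl a))) (inl b) = ⊥e (no12 (move A ρ∈ b) (move A r∈ a))
    pick r r∈ (inr (inr (inl a))) (inr b) = ⊥e (no23 (move A r∈ a) (move A ρ∈ b))
    pick r r∈ (inr (inr (inr a))) (inl b) = ⊥e (no13 (move A ρ∈ b) (move A r∈ a))
    pick r r∈ (inr (inr (inr a))) (inr b) = inr (tr a (sym b))
    one : ∀ r -> 0z ≤ r -> r < d -> r ∈ A -> r ≡ 0z ⊎ r ≡ ρ
    one r 0≤r r<d r∈ = pick r r∈ (lia 2 (\r d -> #0 <= r => r :< d => d == #4 => r == #0 :∨ r == #1 :∨ r == #2 :∨ r == #3) r d 0≤r r<d e) c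
    cls : ∀ x -> x ∈ A -> (Σ ℤ \i -> 0z ≤ i × i ≤ q × x ≡ + 4 * i) ⊎ (Σ ℤ \i -> 0z ≤ i × i ≤ q - + 1 × x ≡ ρ + + 4 * i)
    cls x p with reduce x p
    ... | r , i , 0≤r , r<d , 0≤i , x≡ , r∈ with one r 0≤r r<d r∈ | tr x≡ (cong (\d -> r + d * i) e)
    ... | inl refl | x≡' = inl (i , 0≤i , lia 4 (\i q n x -> n == 4 *: q => x == #0 :+ 4 *: i => x <= n => i <= q) i q n x n≡4q x≡' (snd (supp p)) , tr x≡' (0+ _))
    ... | inr r≡ρ | x≡' = inr (i , 0≤i , lia 5 (\r i q n x -> (r == #1 :∨ r == #3) => n == 4 *: q => x == r :+ 4 *: i => x <= n => i <= q :- #1) ρ i q n x c n≡4q x≡'' (snd (supp p)) , x≡'')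
     where
     x≡'' = tr x≡' (cong (_+ + 4 * i) r≡ρ)
   fourCase : Even X ⊎ Four X
   fourCase with mem? A (+ 2) | mem? A (+ 1) | mem? A (+ 3)
   ... | inl p | _ | _ = inl (even4 p)
   ... | inr _ | inl p | _ = inr (four (+ 1) (inl refl) p)
   ... | inr _ | inr _ | inl p = inr (four (+ 3) (inr refl) p)
   ... | inr a | inr b | inr c = ⊥e (lia 4 (\a b c d -> 2 *: (a :+ b :+ c :+ d) == #4 => a == #1 => b == #0 => c == #0 => d == #0 => ff) _ _ _ _ tot (χ-in lo) (χ-out b) (χ-out a) (χ-out c))
 abstract
  even-or-four : Even X ⊎ Four X
  even-or-four = [ (\e -> inl (even2 e)) , fourCase ]′ two-or-four

-- Overlapping missing positions when n is at most 2|A| - 3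

bal-full : ∀ P {a b} -> a ≤ b -> (∀ x -> a ≤ x -> x < b -> x ∈ P) -> bal P a b ≡ b - a
bal-full P a≤b h = tr (∑-cong (step P) (\_ -> + 1) a≤b \x p q -> cong (\b -> + 2 * bit b - + 1) (h x p q)) (∑-one' a≤b)

bal-void : ∀ P {a b} -> a ≤ b -> (∀ x -> a ≤ x -> x < b -> x ∉ P) -> bal P a b ≡ a - b
bal-void P {a} {b} a≤b h = tr (tr (∑-cong (step P) (\_ -> - + 1) a≤b \x p q -> cong (\b -> + 2 * bit b - + 1) (h x p q)) (∑-const (- + 1) a≤b)) (ring a b)
 where
 ring : ∀ a b -> - + 1 * (b - a) ≡ a - b
 ring = solve

-- Every hole is covered: either the level after it is positive, or the level before it is at most 1
-- and hence below the final balance.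
ex-bound : ∀ {n} (X : NSet n) -> let open OnSet X in + 2 ≤ φ (n + + 1) -> ∀ z -> 0z ≤ z -> z < n -> 0z ≤ ex z
ex-bound {n} X big z 0≤z z<n with φ-case X z 0≤z
... | inl (z∈ , _) = ≡⇒≤ (sym (OnSet.ex-in X z∈))
... | inr (z∉ , e) with + 1 ≤? OnSet.φ X (z + + 1)
... | yes h = lia 3 (\w u v -> w == u :+ v :- #1 => u == #1 => #0 <= v => #0 <= w) _ _ _ (ex-hole z∉) (χ-in (low 0≤z h)) (χ≥0 D _)
 where open OnSet X
... | no h = lia 3 (\w u v -> w == u :+ v :- #1 => v == #1 => #0 <= u => #0 <= w) _ _ _ (ex-hole z∉)
  (χ-in (high 0≤z (x<y⇒x≤y+1 z<n) (lia 3 (\u v m -> v == u :- #1 => ~ #1 <= v => #2 <= m => u :< m) _ _ _ e h big))) (χ≥0 D _)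
 where open OnSet X

-- Truncation to [1,m]. With m one less than the final balance it retains exactly those descents
-- whose hole is covered by both `low` and `high`.
clamp : ℤ -> ℤ -> ℤ
clamp m v with v ≤? + 1 | v ≤? m
... | yes _ | _ = + 1
... | no _ | yes _ = v
... | no _ | no _ = m

clamp-spec : ∀ m v -> + 1 ≤ m -> (v ≤ + 1 × clamp m v ≡ + 1) ⊎ (+ 1 ≤ v × v ≤ m × clamp m v ≡ v) ⊎ (m ≤ v × clamp m v ≡ m)
clamp-spec m v m≥1 with v ≤? + 1 | v ≤? m
... | yes p | _ = inl (p , refl)
... | no p | yes q = inr (inl (<⇒≤ (≰⇒> p) , q , refl))
... | no _ | no q = inr (inr (<⇒≤ (≰⇒> q) , refl))

module RangeI {n : ℤ} (X : NSet n) (big : + 2 ≤ OnSet.φ X (n + + 1)) (ov : Overlaps.Overlap X) where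
 open OnSet X
 M : ℤ
 M = φ (n + + 1)
 cl = clamp (M - + 1)
 xo yo : ℤ
 xo = fst ov
 yo = fst (snd ov)
 private
  spec : ∀ v -> (v ≤ + 1 × cl v ≡ + 1) ⊎ (+ 1 ≤ v × v ≤ M - + 1 × cl v ≡ v) ⊎ (M - + 1 ≤ v × cl v ≡ M - + 1)
  spec v = clamp-spec (M - + 1) v (lia 1 (\m -> #2 <= m => #1 <= m :- #1) M big)
  0≤yo = fst (snd (snd ov))
  yo≤xo = fst (snd (snd (snd ov)))
  xo<n = fst (snd (snd (snd (snd ov))))
  xo∉ = fst (snd (snd (snd (snd (snd ov)))))
  yo∉ = snd (snd (snd (snd (snd (snd ov)))))
  0≤xo = ≤t 0≤yo yo≤xo
  φx = lowφ 0≤xo xo∉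
  φy : M ≤ φ yo
  φy = highφ 0≤yo (lia 3 (\x y n -> y <= x => x :< n => y <= n :+ #1) _ _ n yo≤xo xo<n) yo∉
  drop : ℤ -> ℤ
  drop z = cl (φ z) - cl (φ (z + + 1))
  -- At a member the truncated balance does not fall. At a hole it falls, by one, only if the level
  -- after it is positive and the level before it is below M, and then both z and z + n are sums.
  drop≤ex : ∀ z -> 0z ≤ z -> z < n -> drop z ≤ ex z
  drop≤ex z 0≤z z<n with φ-case X z 0≤z
  ... | inl (z∈ , e) = lia 6 (\c c' f f' m w ->
    (f <= #1 :∧ c == #1 :∨ #1 <= f :∧ f <= m :- #1 :∧ c == f :∨ m :- #1 <= f :∧ c == m :- #1) =>
    (f' <= #1 :∧ c' == #1 :∨ #1 <= f' :∧ f' <= m :- #1 :∧ c' == f' :∨ m :- #1 <= f' :∧ c' == m :- #1) =>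
    f' == f :+ #1 => #2 <= m => w == #0 => c :- c' <= w) (cl (φ z)) (cl (φ (z + + 1))) (φ z) (φ (z + + 1)) M (ex z) (spec (φ z)) (spec (φ (z + + 1))) e big (ex-in z∈)
  ... | inr (z∉ , e) = case (+ 1 ≤? φ (z + + 1)) ×-dec (φ z <? M) of \ where
    (no h) -> lia 6 (\c c' f f' m w ->
     (f <= #1 :∧ c == #1 :∨ #1 <= f :∧ f <= m :- #1 :∧ c == f :∨ m :- #1 <= f :∧ c == m :- #1) =>
     (f' <= #1 :∧ c' == #1 :∨ #1 <= f' :∧ f' <= m :- #1 :∧ c' == f' :∨ m :- #1 <= f' :∧ c' == m :- #1) =>
     f' == f :- #1 => #2 <= m => #0 <= w => ~ #1 <= f' :∧ f :< m => c :- c' <= w) (cl (φ z)) (cl (φ (z + + 1))) (φ z) (φ (z + + 1)) M (ex z) (spec (φ z)) (spec (φ (z + + 1))) e big (ex-bound X big z 0≤z z<n) h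
    (yes (h , h')) -> lia 8 (\c c' f f' m w p q ->
     (f <= #1 :∧ c == #1 :∨ #1 <= f :∧ f <= m :- #1 :∧ c == f :∨ m :- #1 <= f :∧ c == m :- #1) =>
     (f' <= #1 :∧ c' == #1 :∨ #1 <= f' :∧ f' <= m :- #1 :∧ c' == f' :∨ m :- #1 <= f' :∧ c' == m :- #1) =>
     f' == f :- #1 => #2 <= m => w == p :+ q :- #1 => p == #1 => q == #1 => c :- c' <= w) (cl (φ z)) (cl (φ (z + + 1))) (φ z) (φ (z + + 1)) M (ex z) (χ D z) (χ D (z + n)) (spec (φ z)) (spec (φ (z + + 1))) e big (ex-hole z∉)
      (χ-in (low 0≤z h)) (χ-in (high 0≤z (x<y⇒x≤y+1 z<n) h'))
  -- The sum telescopes. The balance is at least M at `yo` and at most 0 after `xo`, so the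
  -- truncated values are M - 1 and 1.
  drops : ∑ drop yo (xo + + 1) ≡ M - + 2
  drops = tr (tr (∑-cong drop (\z -> (- cl (φ (z + + 1))) - (- cl (φ z)))  yo≤xo+1 (\z _ _ -> swap (cl (φ z)) (cl (φ (z + + 1))))) (∑-telescope (\z -> - cl (φ z)) yo≤xo+1))
   (tr (swap' (cl (φ (xo + + 1))) (cl (φ yo)))
   (lia 5 (\a b f g m ->
     (f <= #1 :∧ a == #1 :∨ #1 <= f :∧ f <= m :- #1 :∧ a == f :∨ m :- #1 <= f :∧ a == m :- #1) =>
     (g <= #1 :∧ b == #1 :∨ #1 <= g :∧ g <= m :- #1 :∧ b == g :∨ m :- #1 <= g :∧ b == m :- #1) =>
     f <= #0 => m <= g => #2 <= m => b :- a == m :- #2) (cl (φ (xo + + 1))) (cl (φ yo)) (φ (xo + + 1)) (φ yo) M (spec _) (spec _) φx φy big))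
   where
   yo≤xo+1 = y≤x⇒y≤x+1 yo≤xo
   swap : ∀ a b -> a - b ≡ - b - - a
   swap = solve
   swap' : ∀ a b -> - a - - b ≡ b - a
   swap' = solve
  slack : ℤ -> ℤ
  slack z = ex z - drop z
  pieces : ∑ ex 0z n ≡ ∑ ex 0z yo + ∑ slack yo (xo + + 1) + ∑ ex (xo + + 1) n + (M - + 2)
  pieces = lia 8 (\t a r b c s d m -> t == a :+ r => r == b :+ c => s == b :- d => d == m :- #2 => t == a :+ s :+ c :+ (m :- #2))
   _ (∑ ex 0z yo) _ (∑ ex yo (xo + + 1)) (∑ ex (xo + + 1) n) _ _ M
   (∑-split ex 0≤yo (lia 3 (\x y n -> y <= x => x :< n => y <= n) _ _ n yo≤xo xo<n)) (∑-split ex yo≤xo+1 (x<y⇒x+1≤y xo<n)) (∑-sub ex drop yo≤xo+1) drops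
   where
   yo≤xo+1 = y≤x⇒y≤x+1 yo≤xo
  pos1 : ∀ z -> 0z ≤ z -> z < yo -> 0z ≤ ex z
  pos1 z a b = ex-bound X big z a (lia 4 (\z x y n -> z :< y => y <= x => x :< n => z :< n) z _ _ n b yo≤xo xo<n)
  pos2 : ∀ z -> yo ≤ z -> z < xo + + 1 -> 0z ≤ slack z
  pos2 z a b = x≤y⇒0≤y-x (drop≤ex z (≤t 0≤yo a) (lia 3 (\z x n -> z :< x :+ #1 => x :< n => z :< n) z _ n b xo<n))
  pos3 : ∀ z -> xo + + 1 ≤ z -> z < n -> 0z ≤ ex z
  pos3 z a b = ex-bound X big z (lia 2 (\z x -> #0 <= x => x :+ #1 <= z => #0 <= z) z _ 0≤xo a) b
  s1 = ∑-nonneg ex 0≤yo pos1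
  s2 = ∑-nonneg slack (y≤x⇒y≤x+1 yo≤xo) pos2
  s3 = ∑-nonneg ex (x<y⇒x+1≤y xo<n) pos3
 -- Since M = 2k - n - 1, a total excess of at least M - 2 means precisely that |2A| is at least 3k
 -- - 3.
 dd≥ : + 3 * k - + 3 ≤ dd
 dd≥ = lia 8 (\t a s c m d n k -> t == a :+ s :+ c :+ (m :- #2) => #0 <= a => #0 <= s => #0 <= c => t == d :- n :- k => m == 2 *: k :- n :- #1 => 3 *: k :- #3 <= d)
  _ _ _ _ M _ n k pieces s1 s2 s3 ∑ex φend
 module Tight (small : dd ≤ + 3 * k - + 3) where
  private
   tot = lia 8 (\t a s c m d n k -> t == a :+ s :+ c :+ (m :- #2) => t == d :- n :- k => m == 2 *: k :- n :- #1 => d <= 3 *: k :- #3 => a :+ s :+ c <= #0)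
    _ (∑ ex 0z yo) (∑ slack yo (xo + + 1)) (∑ ex (xo + + 1) n) M _ n k pieces ∑ex φend small
   outside : ∀ z -> 0z ≤ z -> z < n -> (z < yo ⊎ xo < z) -> ex z ≡ 0z
   outside z 0≤z z<n (inl h) = ∑-zeros ex pos1 (lia 3 (\a s c -> a :+ s :+ c <= #0 => #0 <= s => #0 <= c => a <= #0) _ _ _ tot s2 s3) z 0≤z h
   outside z 0≤z z<n (inr h) = ∑-zeros ex pos3 (lia 3 (\a s c -> a :+ s :+ c <= #0 => #0 <= s => #0 <= a => c <= #0) _ _ _ tot s2 s1) z (lia 2 (\z x -> x :< z => x :+ #1 <= z) z _ h) z<n
   inside : ∀ z -> yo ≤ z -> z ≤ xo -> ex z ≡ drop z
   inside z a b = lia 2 (\u v -> u :- v == #0 => u == v) _ _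
    (∑-zeros slack pos2 (lia 3 (\a s c -> a :+ s :+ c <= #0 => #0 <= a => #0 <= c => s <= #0) _ _ _ tot s1 s3) z a (x≤y⇒x<y+1 b))
   where? : ∀ z -> 0z ≤ z -> z < n -> (yo ≤ z × z ≤ xo) ⊎ ex z ≡ 0z
   where? z 0≤z z<n with yo ≤? z | z ≤? xo
   ... | yes a | yes b = inl (a , b)
   ... | no a | _ = inr (outside z 0≤z z<n (inl (≰⇒> a)))
   ... | yes _ | no b = inr (outside z 0≤z z<n (inr (≰⇒> b)))
  single : ∀ z -> 0z ≤ z -> z < n -> z ∉ A -> φ z ≤ + 1 ⊎ M ≤ φ z -> ex z ≡ 0z
  single z 0≤z z<n z∉ h with where? z 0≤z z<n
  ... | inr e = e
  ... | inl (a , b) = tr (inside z a b) (lia 5 (\c c' f f' m ->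
     (f <= #1 :∧ c == #1 :∨ #1 <= f :∧ f <= m :- #1 :∧ c == f :∨ m :- #1 <= f :∧ c == m :- #1) =>
     (f' <= #1 :∧ c' == #1 :∨ #1 <= f' :∧ f' <= m :- #1 :∧ c' == f' :∨ m :- #1 <= f' :∧ c' == m :- #1) =>
     f' == f :- #1 => #2 <= m => (f <= #1 :∨ m <= f) => c :- c' == #0) (cl (φ z)) (cl (φ (z + + 1))) (φ z) (φ (z + + 1)) M (spec (φ z)) (spec (φ (z + + 1))) (φ-out 0≤z z∉) big h)
  double : ∀ z -> 0z ≤ z -> z < n -> z ∉ A -> + 2 ≤ φ z -> φ z < M -> yo ≤ z × z ≤ xo
  double z 0≤z z<n z∉ h h' with where? z 0≤z z<n
  ... | inl p = p
  ... | inr e = ⊥e (lia 3 (\w p q -> w == #0 => w == p :+ q :- #1 => p == #1 => q == #1 => ff) _ _ _ e (ex-hole z∉)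
    (χ-in (low 0≤z (lia 2 (\u v -> v == u :- #1 => #2 <= u => #1 <= v) _ _ (φ-out 0≤z z∉) h))) (χ-in (high 0≤z (x<y⇒x≤y+1 z<n) h')))
  -- At a member the excess is 0, whereas a rise of the truncated balance would make `drop` equal to
  -- -1.
  no-rise : ∀ z -> yo ≤ z -> z ≤ xo -> z ∈ A -> + 1 ≤ φ z -> φ z ≤ M - + 2 -> ⊥
  no-rise z a b z∈ h h' = lia 6 (\c c' f f' m w ->
     (f <= #1 :∧ c == #1 :∨ #1 <= f :∧ f <= m :- #1 :∧ c == f :∨ m :- #1 <= f :∧ c == m :- #1) =>
     (f' <= #1 :∧ c' == #1 :∨ #1 <= f' :∧ f' <= m :- #1 :∧ c' == f' :∨ m :- #1 <= f' :∧ c' == m :- #1) =>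
     f' == f :+ #1 => #1 <= f => f <= m :- #2 => w == c :- c' => w == #0 => ff) (cl (φ z)) (cl (φ (z + + 1))) (φ z) (φ (z + + 1)) M (ex z) (spec (φ z)) (spec (φ (z + + 1))) (φ-in z∈) h h' (inside z a b) (ex-in z∈)
  record Drop : Set where
   field
    x y : ℤ
    yo≤y : yo ≤ y
    x≤xo : x ≤ xo
    x+1≡y+M : x + + 1 ≡ y + M
    holes : ∀ z -> y ≤ z -> z ≤ x -> z ∉ A
    level : ∀ z -> y ≤ z -> z ≤ x + + 1 -> φ z ≡ M - (z - y)
    x∉D : x ∉ D
    y∉D : y + n ∉ D
  -- Here x is the first position from `yo` on after which the level is at most 0, and y the last
  -- one up to x where it is at least M. A member between them would rise to a level below M,
  -- against `no-rise`.
  drop-exists : Drop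
  drop-exists with least (\z -> bool (φ (z + + 1) ≤? 0z)) {yo} {xo + + 1} (y≤x⇒y≤x+1 yo≤xo)
  ... | inr none = ⊥e (bool-out (φ (xo + + 1) ≤? 0z) (none xo yo≤xo (x<x+1)) φx)
  ... | inl (x , yo≤x , x<xo+1 , zero-x , before) with greatest (\z -> bool (M ≤? φ z)) {yo} {x + + 1} (y≤x⇒y≤x+1 yo≤x)
  ... | inr none = ⊥e (bool-out (M ≤? φ yo) (none yo ≤r (lia 2 (\x y -> y <= x => y :< x :+ #1) x _ yo≤x)) φy)
  ... | inl (y , yo≤y , y<x+1 , big-y , after) = record
    { x = x ; y = y ; yo≤y = yo≤y ; x≤xo = x<y+1⇒x≤y x<xo+1 ; holes = holes ; level = level
    ; x+1≡y+M = lia 4 (\x y m f -> f == m :- (x :+ #1 :- y) => f == #0 => x :+ #1 == y :+ m) x y M _ (level (x + + 1) (<⇒≤ y<x+1) ≤r) φx+1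
    ; x∉D = x∉D ; y∉D = y∉D }
   where
   0≤x = ≤t 0≤yo yo≤x
   0≤y = ≤t 0≤yo yo≤y
   x<n = lia 3 (\x z n -> x :< z :+ #1 => z :< n => x :< n) x _ n x<xo+1 xo<n
   y≤x = lia 2 (\x y -> y :< x :+ #1 => y <= x) x y y<x+1
   positive : ∀ t -> yo ≤ t -> t ≤ x -> + 1 ≤ φ t
   positive t a b with t ≟ yo
   ... | yes refl = lia 2 (\m f -> #2 <= m => m <= f => #1 <= f) M _ big φy
   ... | no ne = x≰0⇒1≤x \h -> bool-out (φ (t - + 1 + + 1) ≤? 0z) (before (t - + 1) (lia 2 (\t y -> y <= t => ~ t == y => y <= t :- #1) t _ a ne) (x≤y⇒x-1<y b))
     (subst (\e -> φ e ≤ 0z) x≡x-1+1 h)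
   x∉ : x ∉ A × φ (x + + 1) ≡ φ x - + 1
   x∉ with φ-case X x 0≤x
   ... | inr p = p
   ... | inl (_ , e) = ⊥e (lia 2 (\u v -> v == u :+ #1 => #1 <= u => v <= #0 => ff) _ _ e (positive x yo≤x ≤r) (bool-in (φ (x + + 1) ≤? 0z) zero-x))
   φx+1 = lia 2 (\u v -> v == u :- #1 => #1 <= u => v <= #0 => v == #0) _ _ (snd x∉) (positive x yo≤x ≤r) (bool-in (φ (x + + 1) ≤? 0z) zero-x)
   small-after : ∀ t -> y < t -> t ≤ x -> φ t < M
   small-after t a b = ≰⇒> (bool-out (M ≤? φ t) (after t a (x≤y⇒x<y+1 b)))
   φy≡ : φ y ≡ M × y ∉ A
   φy≡ with y ≟ x
   ... | yes refl = ⊥e (lia 3 (\u v m -> v == u :- #1 => v == #0 => #2 <= m => m <= u => ff) _ _ M (snd x∉) φx+1 big (bool-in (M ≤? φ y) big-y))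
   ... | no ne with φ-case X y 0≤y | small-after (y + + 1) x<x+1 (lia 2 (\x y -> y <= x => ~ y == x => y :+ #1 <= x) x y y≤x ne) | bool-in (M ≤? φ y) big-y
   ... | inl (_ , e) | s | b = ⊥e (lia 3 (\u v m -> v == u :+ #1 => v :< m => m <= u => ff) _ _ M e s b)
   ... | inr (y∉ , e) | s | b = lia 3 (\u v m -> v == u :- #1 => v :< m => m <= u => u == m) _ _ M e s b , y∉
   holes : ∀ z -> y ≤ z -> z ≤ x -> z ∉ A
   holes z a b with mem? A z
   ... | inr p = p
   ... | inl p with z ≟ y | z ≟ x
   ... | yes refl | _ = snd φy≡
   ... | no _ | yes refl = fst x∉
   ... | no ne | no ne' = ⊥e (no-rise z (≤t yo≤y a) (lia 3 (\z x w -> z <= x => x :< w :+ #1 => z <= w) z x _ b x<xo+1) p (positive z (≤t yo≤y a) b)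
     (lia 3 (\u v m -> v == u :+ #1 => v :< m => u <= m :- #2) _ _ M (φ-in p) (small-after (z + + 1) (lia 2 (\z y -> y <= z => y :< z :+ #1) z y a) (lia 2 (\z x -> z <= x => ~ z == x => z :+ #1 <= x) z x b ne'))))
   level : ∀ z -> y ≤ z -> z ≤ x + + 1 -> φ z ≡ M - (z - y)
   level z a b = lia 6 (\u v w z y m -> u == v :+ w => w == y :- z => v == m => u == m :- (z :- y)) _ _ _ z y M (φ-split 0≤y a)
    (bal-void A a \t c d -> holes t c (x<y⇒y≤z+1⇒x≤z d b)) (fst φy≡)
   x∉D = χ-out⁻ (x≡0⇒x≡y+z-1⇒z≡1⇒y≤0 (single x 0≤x x<n (fst x∉) (inl φx≤1)) (ex-hole (fst x∉))
    (χ-in (high 0≤x (x<y⇒x≤y+1 x<n) (lia 2 (\u m -> u <= #1 => #2 <= m => u :< m) _ M φx≤1 big))))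
    where
    φx≤1 = lia 2 (\u v -> v == u :- #1 => v == #0 => u <= #1) _ _ (snd x∉) φx+1
   y∉D = χ-out⁻ (x≡0⇒x≡y+z-1⇒y≡1⇒z≤0 (single y 0≤y (≤-<-trans y≤x x<n) (snd φy≡) (inr (≡⇒≤ (sym (fst φy≡))))) (ex-hole (snd φy≡))
    (χ-in (low 0≤y (lia 3 (\u v m -> v == u :- #1 => u == m => #2 <= m => #1 <= v) _ _ M (φ-out 0≤y (snd φy≡)) (fst φy≡) big))))
  abstract
   theDrop : Drop
   theDrop = drop-exists

module RangeIShape {n : ℤ} (X : NSet n) (big : + 2 ≤ OnSet.φ X (n + + 1)) (ov : Overlaps.Overlap X) (small : OnSet.dd X ≤ + 3 * OnSet.k X - + 3) where
 open OnSet X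
 open RangeI X big ov
 open Tight small
 open Drop theDrop
 -- For M = 2 the two holes of `Drop` are of this kind. Once n is removed, such a z is an uncovered
 -- residue modulo n - 1.
 V : ℤ -> Set
 V z = 0z < z × z < n × z ∉ D × z - + 1 + n ∉ D
 private
  0≤yo = fst (snd (snd ov))
  xo<n = fst (snd (snd (snd (snd ov))))
  0≤y = ≤t 0≤yo yo≤y
  x<n = ≤-<-trans x≤xo xo<n
  y<x = lia 3 (\x y m -> x :+ #1 == y :+ m => #2 <= m => y :< x) x y M x+1≡y+M big
  0≤x = ≤t 0≤y (<⇒≤ y<x)
  φy = tr (level y ≤r (lia 2 (\x y -> y :< x => y <= x :+ #1) x y y<x)) (lia 2 (\m y -> m :- (y :- y) == m) M y)
  φx+1 = tr (level (x + + 1) (lia 2 (\x y -> y :< x => y <= x :+ #1) x y y<x) ≤r) (lia 3 (\m x y -> x :+ #1 == y :+ m => m :- (x :+ #1 :- y) == #0) M x y x+1≡y+M)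
  aL = antiL 0≤x x∉D (≡⇒≤ (sym φx+1))
  aR = antiR 0≤y (lia 3 (\y x n -> y :< x => x :< n => y <= n :+ #1) y x n y<x x<n) y∉D (≡⇒≤ φy)
  y≤n = <⇒≤ (<-trans y<x x<n)
  bottom : ∀ i -> 0z ≤ i -> i < M -> i ∈ A
  bottom i a b = move A (snd aL (x - i) (lia 4 (\x y m i -> x :+ #1 == y :+ m => #0 <= y => i :< m => #0 <= x :- i) x y M i x+1≡y+M 0≤y b) (lia 2 (\x i -> #0 <= i => x :- i <= x) x i a)
   (holes (x - i) (lia 4 (\x y m i -> x :+ #1 == y :+ m => i :< m => y <= x :- i) x y M i x+1≡y+M b) (lia 2 (\x i -> #0 <= i => x :- i <= x) x i a))) (lia 2 (\x i -> #0 :+ x :- (x :- i) == i) x i)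
  top : ∀ i -> 0z ≤ i -> i < M -> n - i ∈ A
  top i a b = move A (snd aR (y + i) (0≤y⇒x≤x+y a) (lia 5 (\x y m i n -> x :+ #1 == y :+ m => i :< m => x :< n => y :+ i <= n) x y M i n x+1≡y+M b x<n)
   (holes (y + i) (0≤y⇒x≤x+y a) (lia 4 (\x y m i -> x :+ #1 == y :+ m => i :< m => y :+ i <= x) x y M i x+1≡y+M b))) (lia 3 (\y i n -> y :+ n :- (y :+ i) == n :- i) y i n)
  1∈ = bottom (+ 1) 0≤+ (lia 1 (\m -> #2 <= m => #1 :< m) M big)
  n-1∈ = top (+ 1) 0≤+ (lia 1 (\m -> #2 <= m => #1 :< m) M big)
  M≤x = lia 3 (\x y m -> x :+ #1 == y :+ m => #0 <= y => m <= x :+ #1) x y M x+1≡y+M 0≤y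
  M≤n : M ≤ n
  M≤n = lia 3 (\x m n -> m <= x :+ #1 => x :< n => m <= n) x M n M≤x x<n
  isL : ∀ z -> 0z ≤ z -> z < n -> z ∉ A -> φ z ≤ + 1 -> z ∉ D
  isL z 0≤z z<n z∉ h = χ-out⁻ (x≡0⇒x≡y+z-1⇒z≡1⇒y≤0 (single z 0≤z z<n z∉ (inl h)) (ex-hole z∉)
   (χ-in (high 0≤z (x<y⇒x≤y+1 z<n) (lia 2 (\u m -> u <= #1 => #2 <= m => u :< m) _ M h big))))
  isR : ∀ z -> 0z ≤ z -> z < n -> z ∉ A -> M ≤ φ z -> z + n ∉ D
  isR z 0≤z z<n z∉ h = χ-out⁻ (x≡0⇒x≡y+z-1⇒y≡1⇒z≤0 (single z 0≤z z<n z∉ (inr h)) (ex-hole z∉)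
   (χ-in (low 0≤z (lia 3 (\u v m -> v == u :- #1 => m <= u => #2 <= m => #1 <= v) _ _ M (φ-out 0≤z z∉) h big))))
  M=2or3 = lia 1 (\m -> #2 <= m => m == #2 :∨ #3 <= m) M big
  Vx : M ≡ + 2 -> V x
  Vx e = ≤-<-trans 0≤y y<x , x<n , x∉D , move D y∉D (lia 4 (\x y m n -> x :+ #1 == y :+ m => m == #2 => y :+ n == x :- #1 :+ n) x y M n x+1≡y+M e)
  φM = tr (bal-full A 0≤M (\t a b -> bottom t a b)) (+0 M)
   where
   0≤M = ≤t 0≤+ big
  φtop : φ (n + + 1 - M) ≡ 0z
  φtop = lia 4 (\f b m e -> m == f :+ b => b == e :- (e :- m) => #0 <= #0 => f == #0) _ _ M (n + + 1)
   (φ-split (lia 2 (\n m -> m <= n => #0 <= n :+ #1 :- m) n M M≤n) le) (bal-full A le \t a b -> move A (top (n - t) (lia 2 (\n t -> t :< n :+ #1 => #0 <= n :- t) n t b) (lia 3 (\n t m -> n :+ #1 :- m <= t => n :- t :< m) n t M a)) (x-[x-y]≡y n)) 0≤+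
   where
   le = lia 2 (\n m -> #2 <= m => n :+ #1 :- m <= n :+ #1) n M big
  crossing : ∀ a b -> 0z ≤ a -> a < b -> φ a ≤ + 1 -> + 2 ≤ φ b -> Σ ℤ \t -> a ≤ t × t < b × t ∈ A × φ t ≡ + 1
  crossing a b 0≤a a<b fa fb with greatest (\t -> bool (φ t ≤? + 1)) {a} {b} (<⇒≤ a<b)
  ... | inr none = ⊥e (bool-out (φ a ≤? + 1) (none a ≤r a<b) fa)
  ... | inl (t , a≤t , t<b , p , after) = case φ-case X t (≤t 0≤a a≤t) of \ where
    (inl (t∈ , e)) -> t , a≤t , t<b , t∈ , lia 2 (\u v -> v == u :+ #1 => u <= #1 => #2 <= v => u == #1) _ _ e (bool-in (φ t ≤? + 1) p) next
    (inr (_ , e)) -> ⊥e (lia 2 (\u v -> v == u :- #1 => u <= #1 => #2 <= v => ff) _ _ e (bool-in (φ t ≤? + 1) p) next)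
   where
   next : + 2 ≤ φ (t + + 1)
   next with t + + 1 ≟ b
   ... | yes e = subst (\s -> + 2 ≤ φ s) (sym e) fb
   ... | no ne = x≰1⇒2≤x (bool-out (φ (t + + 1) ≤? + 1) (after (t + + 1) x<x+1 (x<y⇒x+1≢y⇒x+1<y t<b ne)))
  -- If the level reaches 0 at some z before x, it must rise again to M at y, through a member at
  -- level 1. For M at least 3 the last hole at level 2 before z is doubly covered and so lies in
  -- [yo,xo]; the member then lies there too, against `no-rise`.
  first? : (∀ t -> + 1 ≤ t -> t ≤ x -> + 1 ≤ φ t) ⊎ (M ≡ + 2 × Σ ℤ \z -> z < x × V z)
  first? with least (\z -> bool (φ (z + + 1) ≤? 0z)) {0z} {x} 0≤x
  ... | inr none = inl \t a b -> x≰0⇒1≤x \h -> bool-out (φ (t - + 1 + + 1) ≤? 0z) (none (t - + 1) (1≤x⇒0≤x-1 a) (x≤y⇒x-1<y b)) (subst (\e -> φ e ≤ 0z) x≡x-1+1 h)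
  ... | inl (z , 0≤z , z<x , p , before) = inr (case M=2or3 of \ where
    (inl e) -> e , z , z<x , lia 1 (\z -> #2 <= z => #0 :< z) z z≥2 , <-trans z<x x<n , isL z 0≤z (<-trans z<x x<n) z∉ (≡⇒≤ φz) , isR (z - + 1) z-1≥0 (lia 3 (\z x n -> z :< x => x :< n => z :- #1 :< n) z x n z<x x<n) (fst (prev e)) (snd (prev e))
    (inr M≥3) -> ⊥e (absurd M≥3))
   where
   positive : ∀ t -> + 1 ≤ t -> t ≤ z -> + 1 ≤ φ t
   positive t a b = x≰0⇒1≤x \h -> bool-out (φ (t - + 1 + + 1) ≤? 0z) (before (t - + 1) (1≤x⇒0≤x-1 a) (x≤y⇒x-1<y b)) (subst (\e -> φ e ≤ 0z) x≡x-1+1 h)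
   neg = bool-in (φ (z + + 1) ≤? 0z) p
   M≤z : M ≤ z
   M≤z with M ≤? z
   ... | yes h = h
   ... | no h = ⊥e (lia 3 (\f b z -> f == b :- #0 => b == z :+ #1 => #0 <= z => f <= #0 => ff) _ _ z (bal-full A (0≤x⇒0≤x+1 0≤z) (\t a b -> bottom t a (lia 3 (\t z m -> t :< z :+ #1 => ~ m <= z => t :< m) t z M b h))) refl 0≤z neg)
   z≥2 = ≤t big M≤z
   z-1≥0 = lia 1 (\z -> #2 <= z => #0 <= z :- #1) z z≥2
   pz = positive z (lia 1 (\z -> #2 <= z => #1 <= z) z z≥2) ≤r
   z∉ : z ∉ A
   z∉ with φ-case X z 0≤z
   ... | inr (h , _) = h
   ... | inl (_ , e) = ⊥e (lia 2 (\u v -> v == u :+ #1 => #1 <= u => v <= #0 => ff) _ _ e pz neg)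
   φz = lia 2 (\u v -> v == u :- #1 => #1 <= u => v <= #0 => u == #1) _ _ (φ-out 0≤z z∉) pz neg
   prev : M ≡ + 2 -> z - + 1 ∉ A × M ≤ φ (z - + 1)
   prev e with φ-case X (z - + 1) z-1≥0
   ... | inl (_ , e') = ⊥e (lia 2 (\u v -> v == u :+ #1 => v == #1 => #1 <= u => ff) _ _ e' (tr (cong φ (x-1+1≡x)) φz) (positive (z - + 1) (lia 1 (\z -> #2 <= z => #1 <= z :- #1) z z≥2) (x-1≤x)))
   ... | inr (h , e') = h , lia 3 (\u v m -> v == u :- #1 => v == #1 => m == #2 => m <= u) _ _ M e' (tr (cong φ (x-1+1≡x)) φz) e
   z<y : z + + 1 < y
   z<y with z + + 1 <? y
   ... | yes h = h
   ... | no h = ⊥e (lia 5 (\f m z x y -> f == m :- (z :+ #1 :- y) => x :+ #1 == y :+ m => z :< x => f <= #0 => ff) _ M z x y (level (z + + 1) (lia 2 (\z y -> ~ z :+ #1 :< y => y <= z :+ #1) z y h) (x<y⇒x+1≤y+1 z<x)) x+1≡y+M z<x neg)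
   absurd : + 3 ≤ M -> ⊥
   absurd M≥3 with greatest (\t -> bool (+ 2 ≤? φ t)) {M} {z} M≤z
   ... | inr none = bool-out (+ 2 ≤? φ M) (none M ≤r (lia 3 (\z m f -> m <= z => ~ m == z => #0 <= #0 => m :< z) z M M M≤z (\e -> lia 3 (\a b m -> a == #1 => b == m => a == b => #3 <= m => ff) _ _ M φz φM (cong φ (sym e)) M≥3) 0≤+)) (subst (+ 2 ≤_) (sym φM) big)
   ... | inl (t , M≤t , t<z , p , after) = case crossing (z + + 1) y (0≤x⇒0≤x+1 0≤z) z<y (≤t neg 0≤+) (subst (+ 2 ≤_) (sym φy) big) of \ where
     (s , z<s , s<y , s∈ , e) -> no-rise s (lia 4 (\w t z s -> w <= t => t :< z => z :+ #1 <= s => w <= s) _ t z s (fst (double t (≤t (≤t 0≤+ big) M≤t) (<-trans t<z (<-trans z<x x<n)) (fst hole) (bool-in (+ 2 ≤? φ t) p) (lia 2 (\f m -> f == #2 => #3 <= m => f :< m) _ M (snd hole) M≥3))) t<z z<s)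
      (≤t (<⇒≤ (<-trans s<y y<x)) x≤xo) s∈ (≡⇒≤ (sym e)) (lia 2 (\f m -> f == #1 => #3 <= m => f <= m :- #2) _ M e M≥3)
    where
    next : φ (t + + 1) ≤ + 1
    next with t + + 1 ≟ z
    ... | yes e = ≡⇒≤ (tr (cong φ e) φz)
    ... | no ne = lia 1 (\u -> ~ #2 <= u => u <= #1) _ (bool-out (+ 2 ≤? φ (t + + 1)) (after (t + + 1) x<x+1 (x<y⇒x+1≢y⇒x+1<y t<z ne)))
    hole : t ∉ A × φ t ≡ + 2
    hole with φ-case X t (≤t (≤t 0≤+ big) M≤t)
    ... | inl (_ , e) = ⊥e (lia 2 (\u v -> v == u :+ #1 => #2 <= u => v <= #1 => ff) _ _ e (bool-in (+ 2 ≤? φ t) p) next)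
    ... | inr (h , e) = h , lia 2 (\u v -> v == u :- #1 => #2 <= u => v <= #1 => u == #2) _ _ e (bool-in (+ 2 ≤? φ t) p) next
  isHigh : 𝔹
  isHigh t = bool (M ≤? φ t)
  -- The mirror image: a level of at least M after the run needs a rise through level 1, and for M
  -- at least 3 a doubly covered hole at level M - 1 beyond it places this rise inside [yo,xo].
  late : Greatest isHigh (y + + 1) (n + + 1) -> M ≡ + 2 × Σ ℤ \z -> x < z × V z
  late (t , y<t , t<n+1 , p , after) = [ two , (\M≥3 -> ⊥e (absurd M≥3)) ]′ M=2or3
   where
   high' = bool-in (M ≤? φ t) p
   0≤t = lia 2 (\y t -> #0 <= y => y :+ #1 <= t => #0 <= t) y t 0≤y y<t
   x+1<t : x + + 1 < t
   x+1<t with x + + 1 <? t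
   ... | yes h = h
   ... | no h = ⊥e (lia 4 (\f m t y -> f == m :- (t :- y) => y :+ #1 <= t => m <= f => ff) _ M t y (level t (x+1≤y⇒x≤y y<t) (≮⇒≥ h)) y<t high')
   t<n : t < n
   t<n with t ≟ n
   ... | no ne = lia 2 (\t n -> t :< n :+ #1 => ~ t == n => t :< n) t n t<n+1 ne
   ... | yes refl = ⊥e (lia 2 (\u m -> m == u :+ #1 => m <= u => ff) _ M φn high')
   later : ∀ s -> t < s -> s ≤ n -> φ s < M
   later s a b = ≰⇒> (bool-out (M ≤? φ s) (after s a (x≤y⇒x<y+1 b)))
   t∉ : t ∉ A × φ t ≡ M
   t∉ with φ-case X t 0≤t | later (t + + 1) x<x+1 (x<y⇒x+1≤y t<n)
   ... | inl (_ , e) | l = ⊥e (lia 3 (\u v m -> v == u :+ #1 => m <= u => v :< m => ff) _ _ M e high' l)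
   ... | inr (h , e) | l = h , lia 3 (\u v m -> v == u :- #1 => m <= u => v :< m => u == m) _ _ M e high' l
   t+1<n : t + + 1 < n
   t+1<n with t + + 1 ≟ n
   ... | no ne = x<y⇒x+1≢y⇒x+1<y t<n ne
   ... | yes e = clash (move A n-1∈ (lia 2 (\t n -> t :+ #1 == n => n :- #1 == t) t n e)) (fst t∉)
   t+1∉ : M ≡ + 2 -> t + + 1 ∉ A
   t+1∉ e = out \h -> lia 4 (\u v w m -> v == u :- #1 => w == v :+ #1 => u == m => w :< m => ff) _ _ _ M (φ-out 0≤t (fst t∉)) (φ-in h) (snd t∉)
    (later (t + + 1 + + 1) (lia 1 (\t -> t :< t :+ #1 :+ #1) t) (lia 2 (\t n -> t :+ #1 :< n => t :+ #1 :+ #1 <= n) t n t+1<n))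
   t<e : t < n + + 1 - M
   t<e with t <? n + + 1 - M
   ... | yes h = h
   ... | no h = ⊥e (lia 5 (\f b g t e -> f == g :+ b => b <= t :- e => g == #0 => #0 <= #0 => f <= t :- e) _ _ _ t (n + + 1 - M) (φ-split (lia 2 (\n m -> m <= n => #0 <= n :+ #1 :- m) n M M≤n) (≮⇒≥ h)) (bal-upper A (≮⇒≥ h)) φtop 0≤+
     |> \le -> lia 4 (\f t n m -> f <= t :- (n :+ #1 :- m) => m <= f => t :< n => ff) _ t n M le high' t<n)
   absurd : + 3 ≤ M -> ⊥
   absurd M≥3 with least (\s -> bool (φ (s + + 1) ≤? M - + 2)) {t} {n} (<⇒≤ t<n)
   ... | inr none = bool-out (φ (n - M + + 1) ≤? M - + 2) (none (n - M) (lia 3 (\t n m -> t :< n :+ #1 :- m => t <= n :- m) t n M t<e) (lia 2 (\n m -> #2 <= m => n :- m :< n) n M big))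
      (lia 2 (\f m -> f == #0 => #2 <= m => f <= m :- #2) _ M (tr (cong φ (lia 2 (\n m -> n :- m :+ #1 == n :+ #1 :- m) n M)) φtop) big)
   ... | inl (z , t≤z , z<n , p , before) = case crossing (x + + 1) t (0≤x⇒0≤x+1 0≤x) x+1<t (subst (_≤ + 1) (sym φx+1) 0≤+) (≤t big high') of \ where
     (s , x<s , s<t , s∈ , e) -> no-rise s (lia 4 (\w y x s -> w <= y => y :< x => x :+ #1 <= s => w <= s) _ y x s yo≤y y<x x<s)
      (≤t (<⇒≤ (<-≤-trans s<t t≤z)) (snd (double z (≤t 0≤t t≤z) z<n (fst hole) (lia 2 (\f m -> f == m :- #1 => #3 <= m => #2 <= f) _ M (snd hole) M≥3) (lia 2 (\f m -> f == m :- #1 => f :< m) _ M (snd hole)))))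
      s∈ (≡⇒≤ (sym e)) (lia 2 (\f m -> f == #1 => #3 <= m => f <= m :- #2) _ M e M≥3)
    where
    φz≥ : M - + 1 ≤ φ z
    φz≥ with z ≟ t
    ... | yes refl = lia 2 (\f m -> m <= f => m :- #1 <= f) _ M high'
    ... | no ne = lia 2 (\f m -> ~ f <= m :- #2 => m :- #1 <= f) _ M \h -> bool-out (φ (z - + 1 + + 1) ≤? M - + 2) (before (z - + 1) (lia 2 (\z t -> t <= z => ~ z == t => t <= z :- #1) z t t≤z ne) (x-1<x)) (subst (\e -> φ e ≤ M - + 2) x≡x-1+1 h)
    hole : z ∉ A × φ z ≡ M - + 1
    hole with φ-case X z (≤t 0≤t t≤z)
    ... | inl (_ , e) = ⊥e (lia 3 (\u v m -> v == u :+ #1 => m :- #1 <= u => v <= m :- #2 => ff) _ _ M e φz≥ (bool-in (φ (z + + 1) ≤? M - + 2) p))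
    ... | inr (h , e) = h , lia 3 (\u v m -> v == u :- #1 => m :- #1 <= u => v <= m :- #2 => u == m :- #1) _ _ M e φz≥ (bool-in (φ (z + + 1) ≤? M - + 2) p)
   two : M ≡ + 2 -> M ≡ + 2 × Σ ℤ \z -> x < z × V z
   two e = e , t + + 1 , lia 2 (\t x -> x :+ #1 :< t => x :< t :+ #1) t x x+1<t , lia 1 (\t -> #0 <= t => #0 :< t :+ #1) t 0≤t , t+1<n , L , R
    where
    L = isL (t + + 1) (0≤x⇒0≤x+1 0≤t) t+1<n (t+1∉ e) (lia 3 (\u v m -> v == u :- #1 => u == m => m == #2 => v <= #1) _ _ M (φ-out 0≤t (fst t∉)) (snd t∉) e)
    R = move D (isR t 0≤t t<n (fst t∉) (≡⇒≤ (sym (snd t∉)))) (lia 2 (\t n -> t :+ n == t :+ #1 :- #1 :+ n) t n)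
  last? : (∀ t -> y < t -> t ≤ n -> φ t < M) ⊎ (M ≡ + 2 × Σ ℤ \z -> x < z × V z)
  last? = [ (\g -> inr (late g)) , (\none -> inl \t a b -> ≰⇒> (bool-out (M ≤? φ t) (none t (x<y⇒x+1≤y a) (x≤y⇒x<y+1 b)))) ]′
   (greatest isHigh {y + + 1} {n + + 1} (lia 3 (\y x n -> y :< x => x :< n => y :+ #1 <= n :+ #1) y x n y<x x<n))
 module TwoIntervals (F1 : ∀ t -> + 1 ≤ t -> t ≤ x -> + 1 ≤ φ t) (F2 : ∀ t -> y < t -> t ≤ n -> φ t < M) where
  private
   -- A doubly covered hole beside the run would lie in [yo,xo], and between it and the run the
   -- level would have to rise, against `no-rise`.
   single' : ∀ z -> 0z ≤ z -> z < n -> z ∉ A -> z < y ⊎ x < z -> ex z ≡ 0z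
   single' z 0≤z z<n z∉ side with φ z ≤? + 1 | M ≤? φ z
   ... | yes h | _ = single z 0≤z z<n z∉ (inl h)
   ... | no _ | yes h = single z 0≤z z<n z∉ (inr h)
   ... | no h | no h' = ⊥e (case side of \ where
      (inl z<y) -> left z<y
      (inr x<z) -> case crossing (x + + 1) z (0≤x⇒0≤x+1 0≤x) (lia 2 (\x z -> x :< z => ~ z == x :+ #1 => x :+ #1 :< z) x z x<z (\e -> h (≤t (≡⇒≤ (tr (cong φ e) φx+1)) 0≤+))) (≤t (≡⇒≤ φx+1) 0≤+) 2≤ of \ where
       (s , x<s , s<z , s∈ , e) -> no-rise s (lia 4 (\w y x s -> w <= y => y :< x => x :+ #1 <= s => w <= s) _ y x s yo≤y y<x x<s) (≤t (<⇒≤ s<z) (snd dbl)) s∈ (≡⇒≤ (sym e)) (lia 3 (\f m g -> f == #1 => #2 <= g => g :< m => f <= m :- #2) _ M _ e 2≤ (≰⇒> h')))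
    where
    2≤ = x≰1⇒2≤x h
    dbl = double z 0≤z z<n z∉ 2≤ (≰⇒> h')
    left : z < y -> ⊥
    left z<y with greatest (\s -> bool (φ s ≤? M - + 2)) {z + + 1} {y} (x<y⇒x+1≤y z<y)
    ... | inr none = bool-out (φ (z + + 1) ≤? M - + 2) (none (z + + 1) ≤r (x<y⇒x+1≢y⇒x+1<y z<y \e -> lia 4 (\u v w m -> v == u :- #1 => v == w => w == m => u :< m => ff) _ _ _ M (φ-out 0≤z z∉) (cong φ e) φy (≰⇒> h'))) (lia 3 (\u v m -> v == u :- #1 => u :< m => v <= m :- #2) _ _ M (φ-out 0≤z z∉) (≰⇒> h'))
    ... | inl (s , z<s , s<y , p , after) = no-rise s (lia 3 (\w z s -> w <= z => z :+ #1 <= s => w <= s) _ z s (fst dbl) z<s) (≤t (<⇒≤ (<-trans s<y y<x)) x≤xo) s∈ (F1 s (lia 2 (\z s -> #0 <= z => z :+ #1 <= s => #1 <= s) z s 0≤z z<s) (<⇒≤ (<-trans s<y y<x))) (bool-in (φ s ≤? M - + 2) p)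
     where
     next : M - + 1 ≤ φ (s + + 1)
     next with s + + 1 ≟ y
     ... | yes e = lia 3 (\f g m -> f == g => g == m => m :- #1 <= f) _ _ M (cong φ e) φy
     ... | no ne = lia 2 (\f m -> ~ f <= m :- #2 => m :- #1 <= f) _ M (bool-out (φ (s + + 1) ≤? M - + 2) (after (s + + 1) x<x+1 (x<y⇒x+1≢y⇒x+1<y s<y ne)))
     s∈ : s ∈ A
     s∈ with φ-case X s (lia 2 (\z s -> #0 <= z => z :+ #1 <= s => #0 <= s) z s 0≤z z<s)
     ... | inl (h , _) = h
     ... | inr (_ , e) = ⊥e (lia 3 (\u v m -> v == u :- #1 => u <= m :- #2 => m :- #1 <= v => ff) _ _ M e (bool-in (φ s ≤? M - + 2) p) next)
   -- The positive level makes z a sum, so z + n is none, and n - 1 in A then excludes z + 1.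
   -- `prev-hole` argues in the same way with 1 in A. Hence the holes form a single interval.
   next-hole : ∀ z -> 0z ≤ z -> z < y -> z ∉ A -> z + + 1 ∉ A
   next-hole z 0≤z z<y z∉ = D-not {z + n} (χ-out⁻ (x≡0⇒x≡y+z-1⇒y≡1⇒z≤0 (single' z 0≤z z<n z∉ (inl z<y)) (ex-hole z∉) (χ-in (low 0≤z (F1 (z + + 1) (0≤x⇒1≤x+1 0≤z) (lia 3 (\z y x -> z :< y => y :< x => z :+ #1 <= x) z y x z<y y<x)))))) n-1∈ (lia 2 (\z n -> n :- #1 :+ (z :+ #1) == z :+ n) z n)
    where
    z<n = <-trans z<y (<-trans y<x x<n)
   prev-hole : ∀ z -> x < z -> z < n -> z ∉ A -> z - + 1 ∉ A
   prev-hole z x<z z<n z∉ = D-not {z} (χ-out⁻ (x≡0⇒x≡y+z-1⇒z≡1⇒y≤0 (single' z 0≤z z<n z∉ (inr x<z)) (ex-hole z∉) (χ-in (high 0≤z (x<y⇒x≤y+1 z<n) (F2 z (<-trans y<x x<z) (<⇒≤ z<n)))))) 1∈ (lia 1 (\z -> #1 :+ (z :- #1) == z) z)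
    where
    0≤z = ≤t 0≤x (<⇒≤ x<z)
  shape : TwoAP A k
  shape with least (\z -> not (A z)) {0z} {x + + 1} (0≤x⇒0≤x+1 0≤x) | greatest (\z -> not (A z)) {y} {n} y≤n
  ... | inr none | _ = clash (not-false (none x 0≤x (x<x+1))) (holes x (<⇒≤ y<x) ≤r)
  ... | inl _ | inr none = clash (not-false (none y ≤r (<-trans y<x x<n))) (holes y ≤r (<⇒≤ y<x))
  ... | inl (h , 0≤h , h≤x , h∉ , before) | inl (w , y≤w , w<n , w∉ , after) = record
    { u = 0z ; v = w + + 1 ; δ = + 1 ; p = h - + 1 ; q = n - w - + 1 ; δ≥1 = ≤r ; p≥0 = 1≤x⇒0≤x-1 h≥1 ; q≥0 = lia 2 (\n w -> w :< n => #0 <= n :- w :- #1) n w w<n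
    ; size≡ = lia 8 (\a b c d h w n k -> d == c :+ (n :- w) => c == a :+ b => b == h :- (w :+ #1) => a == h :- #0 => d == 2 *: k :- n :- #1 => h :- #1 :+ (n :- w :- #1) :+ #2 == k)
      _ _ _ _ h w n k
      (tr (φ-split 0≤w+1 w+1≤n+1) (cong (\s -> φ (w + + 1) + s) (tr (bal-full A w+1≤n+1 \t a b -> up t (x+1≤y⇒x<y a) (x<y+1⇒x≤y b)) (lia 2 (\n w -> n :+ #1 :- (w :+ #1) == n :- w) n w))))
      (φ-split 0≤h h≤w+1) (bal-void A h≤w+1 \t a b -> gap t a (x<y+1⇒x≤y b)) (bal-full A 0≤h \t a b -> down t a b) φend
    ; cover = cover
    ; in0 = \i a b -> move A (down i a (lia 2 (\i h -> i <= h :- #1 => i :< h) i h b)) x≡0+1x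
    ; in1 = \i a b -> up (w + + 1 + + 1 * i) (lia 2 (\w i -> #0 <= i => w :< w :+ #1 :+ 1 *: i) w i a) (lia 3 (\w i n -> i <= n :- w :- #1 => w :+ #1 :+ 1 *: i <= n) w i n b) }
   where
   down : ∀ t -> 0z ≤ t -> t < h -> t ∈ A
   down t a b = not-false (before t a b)
   up : ∀ t -> w < t -> t ≤ n -> t ∈ A
   up t a b with t ≟ n
   ... | yes e = move A hi (sym e)
   ... | no ne = not-false (after t a (x≤y⇒x≢y⇒x<y b ne))
   h≥1 : + 1 ≤ h
   h≥1 with h ≟ 0z
   ... | yes refl = clash lo (not-true h∉)
   ... | no ne = 0≤x⇒x≢0⇒1≤x 0≤h ne
   lowGap : ∀ t -> h ≤ t -> t ≤ x -> t ∉ A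
   lowGap t = climb (\t -> t ∉ A) x (not-true h∉) (\t a b ih -> case t <? y of \ where
    (yes t<y) -> next-hole t (≤t 0≤h a) t<y ih
    (no t≮y) -> holes (t + + 1) (lia 2 (\t y -> ~ t :< y => y <= t :+ #1) t y t≮y) (x<y⇒x+1≤y b))
   highGap : ∀ t -> y ≤ t -> t ≤ w -> t ∉ A
   highGap t = descend (\t -> t ∉ A) y (not-true w∉) (\t a b ih -> case x <? t of \ where
    (yes x<t) -> prev-hole t x<t (≤-<-trans a w<n) ih
    (no x≮t) -> holes (t - + 1) (lia 2 (\t y -> y :< t => y <= t :- #1) t y b) (lia 2 (\t x -> ~ x :< t => t :- #1 <= x) t x x≮t))
   gap : ∀ t -> h ≤ t -> t ≤ w -> t ∉ A
   gap t a b with t ≤? x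
   ... | yes t≤x = lowGap t a t≤x
   ... | no t≰x = highGap t (lia 3 (\t x y -> ~ t <= x => y :< x => y <= t) t x y t≰x y<x) b
   h≤w+1 : h ≤ w + + 1
   h≤w+1 with h ≤? w + + 1
   ... | yes e = e
   ... | no e = clash (down (w) (≤t 0≤y y≤w) (lia 2 (\h w -> ~ h <= w :+ #1 => w :< h) h w e)) (not-true w∉)
   0≤w+1 = ≤t 0≤h h≤w+1
   w+1≤n+1 = x<y⇒x+1≤y+1 w<n
   cover : ∀ t -> t ∈ A -> (Σ ℤ \i -> 0z ≤ i × i ≤ h - + 1 × t ≡ 0z + + 1 * i) ⊎ (Σ ℤ \i -> 0z ≤ i × i ≤ n - w - + 1 × t ≡ w + + 1 + + 1 * i)
   cover t t∈ with t <? h | t ≤? w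
   ... | yes a | _ = inl (t , fst (supp t∈) , x<y⇒x≤y-1 a , x≡0+1x)
   ... | no a | yes b = clash t∈ (gap t (≮⇒≥ a) b)
   ... | no a | no b = inr (t - w - + 1 , lia 2 (\t w -> ~ t <= w => #0 <= t :- w :- #1) t w b , lia 3 (\t w n -> t <= n => t :- w :- #1 <= n :- w :- #1) t w n (snd (supp t∈)) , lia 2 (\t w -> t == w :+ #1 :+ 1 *: (t :- w :- #1)) t w)
 intervals-or-V : TwoAP A k ⊎ (M ≡ + 2 × Σ ℤ \z1 -> Σ ℤ \z2 -> z1 < z2 × V z1 × V z2)
 intervals-or-V = [ (\F1 -> [ (\F2 -> inl (TwoIntervals.shape F1 F2)) , (\(e , z , x<z , v) -> inr (e , x , z , x<z , Vx e , v)) ]′ last?) , (\(e , z , z<x , v) -> inr (e , z , x , z<x , v , Vx e)) ]′ first?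

-- Removing n lowers the final balance to 1 and turns the positions `V` into uncovered residues, so
-- the periodic analysis applies to the rest. Its hypothesis of a negative total needs three lost
-- sums.
module TwoGaps {n : ℤ} (X : NSet n) (two : OnSet.φ X (n + + 1) ≡ + 2) (small : OnSet.dd X ≤ + 3 * OnSet.k X - + 3)
 (single : ∀ z -> 0z ≤ z -> z < n -> z ∉ NSet.A X -> OnSet.ex X z ≡ 0z) where
 open OnSet X
 V : ℤ -> Set
 V z = 0z < z × z < n × z ∉ D × z - + 1 + n ∉ D
 record Gap (z : ℤ) : Set where
  field
   after : φ (z + + 1) ≡ 0z
   before : φ (z - + 1) ≡ + 2
   hole : z ∉ A
   hole' : z - + 1 ∉ A
   aL : Anti A 0z z
   aR : Anti A (z - + 1) n
 gap0 : ∀ z -> V z -> Gap z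
 gap0 z (0<z , z<n , p , q) = record { after = e₂ ; before = e0 ; hole = h ; hole' = h' ; aL = antiL 0≤z p (≡⇒≤ (sym e₂))
   ; aR = antiR 0≤z-1 z-1≤ q (≡⇒≤ (tr e0 (sym two))) }
  where
  0≤z = <⇒≤ 0<z
  0≤z-1 = lia 1 (\z -> #0 :< z => #0 <= z :- #1) z 0<z
  z-1≤ = lia 2 (\z n -> z :< n => z :- #1 <= n :+ #1) z n z<n
  l = lowφ 0≤z p
  hh = subst (_≤ φ (z - + 1)) two (highφ 0≤z-1 z-1≤ q)
  ez = cong φ x-1+1≡x
  steps : (z ∉ A × z - + 1 ∉ A) × (φ (z + + 1) ≡ 0z × φ (z - + 1) ≡ + 2)
  steps with φ-case X z 0≤z | φ-case X (z - + 1) 0≤z-1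
  ... | inr (a , e) | inr (b , e') = (a , b) , lia 4 (\u v v' w -> w == v :- #1 => v' == u :- #1 => v' == v => w <= #0 => #2 <= u => w == #0 :∧ u == #2) _ _ _ _ e e' ez l hh
  ... | inl (a , e) | inr (b , e') = ⊥e (lia 4 (\u v v' w -> w == v :+ #1 => v' == u :- #1 => v' == v => w <= #0 => #2 <= u => ff) _ _ _ _ e e' ez l hh)
  ... | inl (a , e) | inl (b , e') = ⊥e (lia 4 (\u v v' w -> w == v :+ #1 => v' == u :+ #1 => v' == v => w <= #0 => #2 <= u => ff) _ _ _ _ e e' ez l hh)
  ... | inr (a , e) | inl (b , e') = ⊥e (lia 4 (\u v v' w -> w == v :- #1 => v' == u :+ #1 => v' == v => w <= #0 => #2 <= u => ff) _ _ _ _ e e' ez l hh)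
  h = fst (fst steps)
  h' = snd (fst steps)
  e₂ = fst (snd steps)
  e0 = snd (snd steps)
 abstract
  gap : ∀ z -> V z -> Gap z
  gap = gap0
 module _ (z1 z2 : ℤ) (z1<z2 : z1 < z2) (v1 : V z1) (v₂ : V z2) where
  private
   module G1 = Gap (gap z1 v1)
   module G2 = Gap (gap z2 v₂)
   0<z1 = fst v1
   0<z2 = fst v₂
   z2<n = fst (snd v₂)
   1∈ = move A (snd G2.aL (z2 - + 1) (lia 1 (\z -> #0 :< z => #0 <= z :- #1) _ 0<z2) x-1≤x G2.hole') (lia 1 (\z -> #0 :+ z :- (z :- #1) == #1) z2)
   n-1∈ = move A (snd G2.aR z2 x-1≤x (<⇒≤ z2<n) G2.hole) (lia 2 (\z n -> z :- #1 :+ n :- z == n :- #1) z2 n)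
   z<n-1 : ∀ z -> z < n -> z ∉ A -> z < n - + 1
   z<n-1 z z<n z∉ = lia 2 (\z n -> z :< n => ~ z == n :- #1 => z :< n :- #1) z n z<n \e -> clash (move A n-1∈ (sym e)) z∉
   -- If n - 2 were a member, z2 + 1 would be a hole missing from 2A. The reflections in z2 and z2 +
   -- 1 would then carry the hole z1 step by step up to z2, leaving a void between two zeros of the
   -- balance.
   n-2∉ : n - + 2 ∉ A
   n-2∉ = out \p -> absurd p
    where
    module _ (p : n - + 2 ∈ A) where
     s∉ = D-not {z2 - + 1 + n} (snd (snd (snd v₂))) p (lia 2 (\z n -> n :- #2 :+ (z :+ #1) == z :- #1 :+ n) z2 n)
     s<n = lia 2 (\z n -> z :< n :- #1 => z :+ #1 :< n) _ n (z<n-1 z2 z2<n G2.hole)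
     0≤s = lia 1 (\z -> #0 :< z => #0 <= z :+ #1) _ 0<z2
     s∉D = χ-out⁻ (x≡0⇒x≡y+z-1⇒z≡1⇒y≤0 (single (z2 + + 1) 0≤s s<n s∉) (ex-hole s∉)
      (χ-in (high 0≤s (x<y⇒x≤y+1 s<n) (lia 2 (\u v -> u == #0 => v == #2 => u :< v) _ _ G2.after two))))
     down : ∀ c -> 0z ≤ c -> c < z2 -> c ∉ A -> c + + 1 ∉ A
     down c a b c∉ = out \q -> clash (snd G2.aL c a (<⇒≤ b) c∉) (D-not {z2 + + 1} s∉D q (lia 2 (\c z -> c :+ #1 :+ (#0 :+ z :- c) == z :+ #1) c z2))
     gapHoles : ∀ c -> z1 ≤ c -> c ≤ z2 -> c ∉ A
     gapHoles c = climb (\c -> c ∉ A) z2 G1.hole (\c a b ih -> down c (≤t (<⇒≤ 0<z1) a) b ih)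
     absurd = lia 5 (\u v b s t -> v == u :+ b => u == #0 => v == #0 => b == (s :+ #1) :- (t :+ #1) => s :< t => ff) _ _ _ _ _
      (φ-split (lia 1 (\z -> #0 :< z => #0 <= z :+ #1) _ 0<z1) le) G1.after G2.after (bal-void A le (\c a b -> gapHoles c (lia 2 (\c z -> z :+ #1 <= c => z <= c) c _ a) (x<y+1⇒x≤y b))) z1<z2
      where
      le = +-monoˡ-≤ (+ 1) (<⇒≤ z1<z2)
   Y = cut X (n - + 1) n-1∈
   module Y = OnSet Y
   open Cut X (n - + 1) n-1∈
   0<n-1 = lia 2 (\z n -> #0 :< z => z :< n :- #1 => #0 :< n :- #1) _ n 0<z2 (z<n-1 z2 z2<n G2.hole)
   abstract
    pred : Greatest A 0z (n - + 1)
    pred = [ (\g -> g) , (\none -> clash lo (none 0z ≤r 0<n-1)) ]′ (greatest A {0z} {n - + 1} (<⇒≤ 0<n-1))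
   b = fst pred
   b<n-1 = fst (snd (snd pred))
   b∈ = fst (snd (snd (snd pred)))
   b≤n-3 = lia 2 (\b n -> b :< n :- #1 => ~ b == n :- #2 => b :< n :- #2) b n b<n-1 \e -> clash (move A b∈ e) n-2∉
   split : ∀ {a} -> a ∈ Y.A -> a ≤ b ⊎ a ≡ n - + 1
   split {a} p = case a ≤? b of \ where
    (yes h) -> inl h
    (no h) -> case a <? n - + 1 of \ where
     (yes h') -> clash (cut-out p) (snd (snd (snd (snd pred))) a (≰⇒> h) h')
     (no h') -> inr (≤≥ (snd (Y.supp p)) (≮⇒≥ h'))
   -- The number n + b lies strictly between n - 1 + b and 2(n - 1), the two largest sums of the
   -- truncated set.
   new : n + b ∉ Y.D
   new = out \p -> case Y.D-out p of \ where
    (a , a' , a∈ , a'∈ , e) -> lia 4 (\a c b n -> (a <= b :∨ a == n :- #1) => (c <= b :∨ c == n :- #1) => a <= n :- #1 => c <= n :- #1 => a :+ c == n :+ b => b :< n :- #2 => ff) a _ b n (split a∈) (split a'∈) (snd (Y.supp a∈)) (snd (Y.supp a'∈)) e b≤n-3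
   dd-bound = lia 5 (\y a b c d -> a == y :+ #1 => b == a :+ #1 => c == b :+ #1 => c <= d => y :+ #3 <= d) Y.dd _ _ _ _
    (tr (count-ins c1 Y.D new (+≤ 0≤n (fst (supp b∈))) (lia 2 (\n b -> b :< n :- #2 => n :+ b :< n :+ n :+ #1) n b b≤n-3)) (cong (_+ + 1) (sym dd-cut)))
    (count-ins c2 P1 (ins-not c1 Y.D (big2 ≤r) \e -> lia 2 (\n b -> n :+ (n :- #1) == n :+ b => b :< n :- #2 => ff) n b e b≤n-3)
     (lia 1 (\n -> #0 :< n :- #1 => #0 <= n :+ (n :- #1)) n 0<n-1) (lia 1 (\n -> n :+ (n :- #1) :< n :+ n :+ #1) n))
    (count-ins c3 P2 (ins-not c2 P1 (ins-not c1 Y.D (big2 (lia 1 (\n -> n :+ (n :- #1) <= n :+ n) n)) \e -> lia 2 (\n b -> n :+ n == n :+ b => b :< n :- #2 => ff) n b e b≤n-3) \e -> lia 1 (\n -> n :+ n == n :+ (n :- #1) => ff) n e)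
     (+≤ 0≤n 0≤n) (lia 1 (\n -> n :+ n :< n :+ n :+ #1) n))
    (count-⊂ P3 D 0≤N \p -> case ins-out c3 P2 p of \ where
     (inr refl) -> n+A⊂D hi
     (inl p) -> case ins-out c2 P1 p of \ where
      (inr refl) -> D-in hi n-1∈ refl
      (inl p) -> case ins-out c1 Y.D p of \ where
       (inr refl) -> D-in hi b∈ refl
       (inl p) -> D⊂ p)
    where
    N c1 c2 c3 : ℤ
    N = n + n + + 1
    c1 = n + b
    c2 = n + (n - + 1)
    c3 = n + n
    P1 P2 P3 : 𝔹
    P1 = ins c1 Y.D
    P2 = ins c2 P1
    P3 = ins c3 P2
    0≤N = 0≤x⇒0≤x+x+1 0≤n
    big2 : ∀ {t} -> n + (n - + 1) ≤ t -> t ∉ Y.D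
    big2 {t} le = out \p -> lia 2 (\n t -> n :+ (n :- #1) <= t => t <= n :- #1 :+ (n :- #1) => ff) n t le (snd (Y.D-supp p))
   halfY = tr (φ-cut (n - + 1 + + 1) (lia 1 (\n -> #0 :< n :- #1 => #0 <= n :- #1 :+ #1) n 0<n-1) ≤r) (tr (cong φ (x-1+1≡x)) (lia 2 (\u v -> v == u :+ #1 => v == #2 => u == #1) _ _ φn two))
   kY = tr k-split (cong (\s -> Y.k + s) (tr (cong (\s -> count A s (n + + 1)) (x-1+1≡x)) (tr (∑-one (χ A) n) (χ-in hi))))
   smallY = lia 7 (\s y d k k' n f -> s == y :- (n :- #1) :- k' => y :+ #3 <= d => d <= 3 *: k :- #3 => k == k' :+ #1 => f == 2 *: k :- n :- #1 => f == #2 => s <= con (- + 1)) _ Y.dd _ k Y.k n _ Y.∑ex dd-bound small kY φend two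
   toU : ∀ z -> V z -> Periods.U Y z
   toU z v = out (\p -> clash (D⊂ p) (fst (snd (snd v)))) , out (\p -> clash (move D (D⊂ p) (lia 2 (\z n -> z :+ (n :- #1) == z :- #1 :+ n) z n)) (snd (snd (snd v))))
   L = Periods.lattice Y halfY (<⇒≤ 0<z1) z1<z2 (z<n-1 z2 z2<n G2.hole) (toU z1 v1) (toU z2 v₂)
   1∈Y = cut-in 1∈ (lia 1 (\n -> #0 :< n :- #1 => #1 <= n :- #1) n 0<n-1)
   -- As 1 is a member, ρ is 1, and the removed n = 4m + 1 completes the second class.
   fromFour : Four Y -> TwoAP A k
   fromFour F = record { u = 0z ; v = + 1 ; δ = + 4 ; p = m ; q = m ; δ≥1 = +≤+ (ℕ.s≤s ℕ.z≤n) ; p≥0 = ≤t 0≤+ m≥1 ; q≥0 = ≤t 0≤+ m≥1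
     ; size≡ = lia 4 (\m n k f -> n :- #1 == 4 *: m => f == 2 *: k :- n :- #1 => f == #2 => m :+ m :+ #2 == k) m n k _ n≡4m φend two
     ; cover = cover
     ; in0 = \i a b -> move A (cut-out (in-0 i a b)) (sym (0+ _))
     ; in1 = in1 }
    where
    open Four F
    ρ≡1 : ρ ≡ + 1
    ρ≡1 = [ (\e -> e) , (\e -> ⊥e ([ (\(i , _ , _ , e') -> lia 1 (\i -> #1 == 4 *: i => ff) i e') , (\(i , _ , _ , e') -> lia 2 (\r i -> r == #3 => #1 == r :+ 4 *: i => ff) ρ i e e') ]′ (cls (+ 1) 1∈Y))) ]′ ρ≡
    in1 : ∀ i -> 0z ≤ i -> i ≤ m -> + 1 + + 4 * i ∈ A
    in1 i a b = case i ≟ m of \ where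
     (yes e) -> move A hi (lia 3 (\n m i -> n :- #1 == 4 *: m => i == m => n == #1 :+ 4 *: i) n m i n≡4m e)
     (no ne) -> move A (cut-out (in-ρ i a (x≤y⇒x≢y⇒x≤y-1 b ne))) (cong (_+ + 4 * i) ρ≡1)
    cover : ∀ x -> x ∈ A -> (Σ ℤ \i -> 0z ≤ i × i ≤ m × x ≡ 0z + + 4 * i) ⊎ (Σ ℤ \i -> 0z ≤ i × i ≤ m × x ≡ + 1 + + 4 * i)
    cover x x∈ = case x ≟ n of \ where
     (yes e) -> inr (m , ≤t 0≤+ m≥1 , ≤r , lia 3 (\x n m -> x == n => n :- #1 == 4 *: m => x == #1 :+ 4 *: m) x n m e n≡4m)
     (no ne) -> case cls x (cut-in x∈ (x≤y⇒x≢y⇒x≤y-1 (snd (supp x∈)) ne)) of \ where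
      (inl (i , a , b , e)) -> inl (i , a , b , tr e (sym (0+ _)))
      (inr (i , a , b , e)) -> inr (i , a , lia 2 (\i m -> i <= m :- #1 => i <= m) i m b , tr e (cong (_+ + 4 * i) ρ≡1))
  abstract
   twoAP : TwoAP A k
   twoAP = [ (\ev -> case ev (+ 1) 1∈Y of \(i , e) -> ⊥e (lia 1 (\i -> #1 == 2 *: i => ff) i e)) , fromFour ]′ (FourPeriodic.even-or-four Y halfY smallY L)

abstract
 overlap-twoAP : ∀ {n} (X : NSet n) -> let open OnSet X in + 2 ≤ φ (n + + 1) -> Overlaps.Overlap X -> dd ≤ + 3 * k - + 3 -> TwoAP A k
 overlap-twoAP {n} X big ov small = [ (\t -> t) , (\(e , z1 , z2 , lt , v1 , v₂) -> TwoGaps.twoAP X e small (single' e) z1 z2 lt v1 v₂) ]′ (RangeIShape.intervals-or-V X big ov small)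
  where
  open OnSet X
  open RangeI X big ov
  open Tight small
  single' : φ (n + + 1) ≡ + 2 -> ∀ z -> 0z ≤ z -> z < n -> z ∉ A -> ex z ≡ 0z
  single' e z a b z∉ = single z a b z∉ (lia 2 (\f m -> m == #2 => f <= #1 :∨ m <= f) _ _ e)
 overlap-dd : ∀ {n} (X : NSet n) -> let open OnSet X in + 2 ≤ φ (n + + 1) -> Overlaps.Overlap X -> + 3 * k - + 3 ≤ dd
 overlap-dd X big ov = RangeI.dd≥ X big ov

-- A single uncovered hole when n = 2|A| - 2

record Solo {n : ℤ} (X : NSet n) : Set where
 open OnSet X
 field
  half : φ (n + + 1) ≡ + 1
  z0 : ℤ
  0≤z0 : 0z ≤ z0
  z0<n : z0 < n
  low∉ : z0 ∉ D
  high∉ : z0 + n ∉ D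
  single : ∀ z -> 0z ≤ z -> z < n -> ¬ z ≡ z0 -> ex z ≡ 0z

∧-false : ∀ {a b} -> a ∧ b ≡ false -> b ≡ true -> a ≡ false
∧-false {false} _ _ = refl
∧-false {true} e refl = e

module HalfSplit {n : ℤ} (X : NSet n) (half : OnSet.φ X (n + + 1) ≡ + 1) (tot : ∑ (OnSet.ex X) 0z n ≡ - + 1) where
 open OnSet X
 open Periods X
 private
  covered : ∀ z -> 0z ≤ z -> z < n -> isU z ≡ false -> 0z ≤ ex z
  covered z 0≤z z<n ¬u = case mem? A z of \ where
   (inl p) -> ≡⇒≤ (sym (ex-in p))
   (inr p) -> case mem? D z of \ where
    (inl q) -> lia 3 (\w u v -> w == u :+ v :- #1 => u == #1 => #0 <= v => #0 <= w) _ _ _ (ex-hole p) (χ-in q) (χ≥0 D _)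
    (inr q) -> case mem? D (z + n) of \ where
     (inl q') -> lia 3 (\w u v -> w == u :+ v :- #1 => v == #1 => #0 <= u => #0 <= w) _ _ _ (ex-hole p) (χ-in q') (χ≥0 D _)
     (inr q') -> clash (in-isU (q , q')) ¬u
  -- Adding 1 at z0 makes all terms nonnegative, and their total is then -1 + 1 = 0.
  solo : ∀ z0 -> 0z ≤ z0 -> z0 < n -> U z0 -> (∀ z -> 0z ≤ z -> z < n -> (isU z ∧ not (bool (z ≟ z0))) ≡ false) -> Solo X
  solo z0 0≤z0 z0<n (p , q) none = record { half = half ; z0 = z0 ; 0≤z0 = 0≤z0 ; z0<n = z0<n ; low∉ = p ; high∉ = q
   ; single = \z a b ne -> lia 2 (\e p -> e :+ p == #0 => p == #0 => e == #0) _ _ (∑-zeros g nonneg (≡⇒≤ sum) z a b) (χ-out (out-bool (z ≟ z0) ne)) }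
   where
   g : ℤ -> ℤ
   g z = ex z + χ (point z0) z
   nonneg : ∀ z -> 0z ≤ z -> z < n -> 0z ≤ g z
   nonneg z a b = case z ≟ z0 of \ where
    (yes e) -> lia 4 (\w p u v -> w == u :+ v :- #1 => #0 <= u => #0 <= v => p == #1 => #0 <= w :+ p) _ _ _ _ (ex-hole (out \r -> clash (A⊂D r) (move D p (sym e)))) (χ≥0 D _) (χ≥0 D _) (χ-in (in-bool (z ≟ z0) e))
    (no ne) -> +≤ (covered z a b (∧-false (none z a b) (cong not (out-bool (z ≟ z0) ne)))) (χ≥0 (point z0) z)
   sum = tr (∑-+ ex (χ (point z0)) 0≤n) (cong₂ _+_ tot (count-point z0 0≤z0 z0<n))
  second : ∀ z0 -> 0z ≤ z0 -> z0 < n -> U z0 -> ∀ z -> 0z ≤ z -> z < n -> (isU z ∧ not (bool (z ≟ z0))) ≡ true -> Lattice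
  second z0 a b u z c d p = case <-cmp z z0 of \ where
   (tri< l _ _) -> lattice half c l b (isU-in (fst (∧-in p))) u
   (tri≈ _ e _) -> clash (snd (∧-in {isU z} p)) (cong not (in-bool (z ≟ z0) e))
   (tri> _ _ g) -> lattice half a g d u (isU-in (fst (∧-in p)))
 abstract
  halfSplit : Even X ⊎ Four X ⊎ Solo X
  halfSplit = case ∃? isU {0z} {n} 0≤n of \ where
   (inr none) -> ⊥e (lia 1 (\s -> s == con (- + 1) => #0 <= s => ff) _ tot (∑-nonneg ex 0≤n \z a b -> covered z a b (none z a b)))
   (inl (z0 , a , b , p)) -> case ∃? (\z -> isU z ∧ not (bool (z ≟ z0))) {0z} {n} 0≤n of \ where
    (inr none) -> inr (inr (solo z0 a b (isU-in p) none))
    (inl (z , c , d , q)) -> [ inl , (\f -> inr (inl f)) ]′ (FourPeriodic.even-or-four X half (≡⇒≤ tot) (second z0 a b (isU-in p) z c d q))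

soloRev : ∀ {n} (X : NSet n) (S : Solo X) -> Solo (rev X)
soloRev {n} X S = record
 { half = tr (φ-rev (n + + 1) X.0≤n+1 ≤r) (lia 3 (\a b c -> a == #1 => b == c => c == #0 => a :- b == #1) _ _ _ half (cong X.φ (lia 1 (\n -> n :+ #1 :- (n :+ #1) == #0) n)) X.φ0)
 ; z0 = n - z0 ; 0≤z0 = lia 2 (\z n -> z :< n => #0 <= n :- z) _ n z0<n
 ; z0<n = lia 2 (\z n -> #0 <= z => ~ z == #0 => n :- z :< n) _ n 0≤z0 (\e -> clash (X.A⊂D (X.lo)) (move X.D low∉ e))
 ; low∉ = tr (D-rev (n - z0)) (move X.D high∉ (lia 2 (\z n -> z :+ n == n :+ n :- (n :- z)) z0 n))
 ; high∉ = tr (D-rev (n - z0 + n)) (move X.D low∉ (lia 2 (\z n -> z == n :+ n :- (n :- z :+ n)) _ n))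
 ; single = \z a b ne -> case z ≟ 0z of \ where
   (yes e) -> Y.ex-in (move Y.A Y.lo (sym e))
   (no nz) -> tr (ex-rev z) (single (n - z) (lia 2 (\z n -> z :< n => #0 <= n :- z) z n b) (lia 2 (\z n -> #0 <= z => ~ z == #0 => n :- z :< n) z n a nz) (\e -> ne (lia 3 (\z w n -> n :- z == w => z == n :- w) z _ n e))) }
 where
 open Solo S
 module X = OnSet X
 module Y = OnSet (rev X)
 open Rev X
 ex-rev : ∀ z -> Y.ex z ≡ X.ex (n - z)
 ex-rev z = lia 6 (\a b c a' b' c' -> a == b' => b == a' => c == c' => a :+ b :- #1 :- c == a' :+ b' :- #1 :- c') _ _ _ _ _ _
  (cong bit (tr (D-rev z) (cong X.D (lia 2 (\z n -> n :+ n :- z == n :- z :+ n) z n)))) (cong bit (tr (D-rev (z + n)) (cong X.D (lia 2 (\z n -> n :+ n :- (z :+ n) == n :- z) z n)))) (cong bit (A-rev X z))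

module SoloFacts {n : ℤ} (X : NSet n) (S : Solo X) where
 open OnSet X public
 open Solo S public
 abstract
  crit : Periods.Critical X z0
  crit = Periods.critical X half 0≤z0 z0<n (low∉ , high∉)
 open Periods.Critical crit public
 z0≥1 = 0≤x⇒x≢0⇒1≤x 0≤z0 \e -> clash lo (move A hole e)
 -- A hole is R if z + n is not a sum, L if z is not a sum; away from z0 it is exactly one of the two.
 posR : ∀ z -> 0z ≤ z -> z < n -> z ∉ A -> + 2 ≤ φ z -> z + n ∉ D
 posR z a b p h = χ-out⁻ (x≡0⇒x≡y+z-1⇒y≡1⇒z≤0 (single z a b \e -> lia 3 (\f g z -> f == g => g == #1 => #2 <= f => ff) _ _ z (cong φ e) prior h) (ex-hole p)
  (χ-in (low a (lia 2 (\f g -> g == f :- #1 => #2 <= f => #1 <= g) _ _ (φ-out a p) h))))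
 negL : ∀ z -> 0z ≤ z -> z < n -> z ∉ A -> φ z ≤ 0z -> z ∉ D
 negL z a b p h = χ-out⁻ (x≡0⇒x≡y+z-1⇒z≡1⇒y≤0 (single z a b \e -> lia 3 (\f g z -> f == g => g == #1 => f <= #0 => ff) _ _ z (cong φ e) prior h) (ex-hole p)
  (χ-in (high a (x<y⇒x≤y+1 b) (lia 2 (\f m -> f <= #0 => m == #1 => f :< m) _ _ h half))))
 LorR : ∀ z -> 0z ≤ z -> z < n -> z ∉ A -> ¬ z ≡ z0 -> z ∉ D ⊎ z + n ∉ D
 LorR z a b p ne = case mem? D z of \ where
  (inr q) -> inl q
  (inl q) -> inr (χ-out⁻ (x≡0⇒x≡y+z-1⇒y≡1⇒z≤0 (single z a b ne) (ex-hole p) (χ-in q)))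
 notBoth : ∀ z -> 0z ≤ z -> z < n -> z ∉ A -> ¬ z ≡ z0 -> z ∈ D -> z + n ∈ D -> ⊥
 notBoth z a b p ne q q' = lia 3 (\w u v -> w == #0 => w == u :+ v :- #1 => u == #1 => v == #1 => ff) _ _ _ (single z a b ne) (ex-hole p) (χ-in q) (χ-in q')
 firstZero : ∀ a b -> 0z ≤ a -> a ≤ b -> + 1 ≤ φ a ->
  (Σ ℤ \z -> a ≤ z × z < b × z ∉ A × φ z ≡ + 1 × φ (z + + 1) ≡ 0z × (∀ t -> a ≤ t -> t ≤ z -> + 1 ≤ φ t)) ⊎ (∀ t -> a ≤ t -> t ≤ b -> + 1 ≤ φ t)
 firstZero a b 0≤a a≤b fa = case least (\z -> bool (φ (z + + 1) ≤? 0z)) {a} {b} a≤b of \ where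
   (inr none) -> inr \t c d -> pos none t c d
   (inl (z , a≤z , z<b , p , before)) -> inl (z , a≤z , z<b , at z a≤z (pos before z a≤z ≤r) (bool-in (φ (z + + 1) ≤? 0z) p) (pos before))
  where
  pos : ∀ {c} -> (∀ x -> a ≤ x -> x < c -> bool (φ (x + + 1) ≤? 0z) ≡ false) -> ∀ t -> a ≤ t -> t ≤ c -> + 1 ≤ φ t
  pos {c} h t a≤t t≤c = case t ≟ a of \ where
   (yes e) -> subst (\s -> + 1 ≤ φ s) (sym e) fa
   (no ne) -> x≰0⇒1≤x \q -> bool-out (φ (t - + 1 + + 1) ≤? 0z) (h (t - + 1) (lia 2 (\t a -> a <= t => ~ t == a => a <= t :- #1) t a a≤t ne) (x≤y⇒x-1<y t≤c)) (subst (\e -> φ e ≤ 0z) x≡x-1+1 q)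
  at : ∀ z -> a ≤ z -> + 1 ≤ φ z -> φ (z + + 1) ≤ 0z -> (∀ t -> a ≤ t -> t ≤ z -> + 1 ≤ φ t) -> z ∉ A × φ z ≡ + 1 × φ (z + + 1) ≡ 0z × (∀ t -> a ≤ t -> t ≤ z -> + 1 ≤ φ t)
  at z a≤z f≥1 g≤0 h = case φ-case X z (≤t 0≤a a≤z) of \ where
   (inl (_ , e)) -> ⊥e (lia 2 (\f g -> g == f :+ #1 => #1 <= f => g <= #0 => ff) _ _ e f≥1 g≤0)
   (inr (p , e)) -> p , lia 2 (\f g -> g == f :- #1 => #1 <= f => g <= #0 => f == #1) _ _ e f≥1 g≤0 , lia 2 (\f g -> g == f :- #1 => #1 <= f => g <= #0 => g == #0) _ _ e f≥1 g≤0 , h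
 prevHole : ∀ z -> + 1 ≤ z -> φ z ≡ + 1 -> + 1 ≤ φ (z - + 1) -> z - + 1 ∉ A × φ (z - + 1) ≡ + 2
 prevHole z z≥1 e h = case φ-case X (z - + 1) (1≤x⇒0≤x-1 z≥1) of \ where
   (inl (_ , e')) -> ⊥e (lia 2 (\f g -> g == f :+ #1 => g == #1 => #1 <= f => ff) _ _ e' ez h)
   (inr (p , e')) -> p , lia 2 (\f g -> g == f :- #1 => g == #1 => f == #2) _ _ e' ez
  where
  ez = tr (cong φ (x-1+1≡x)) e

∑-two : ∀ g {a b} x -> (∀ x -> a ≤ x -> x < b -> 0z ≤ g x) -> a < x -> x < b -> g a + g x ≤ ∑ g a b
∑-two g {a} {b} x h a<x x<b = lia 4 (\s u v w -> s == u :+ w => v <= w => u :+ v <= s) _ (g a) _ _ (∑-step-low g (<-trans a<x x<b))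
 (∑-term≤ g x (\y p q -> h y (x+1≤y⇒x≤y p) q) (x<y⇒x+1≤y a<x) x<b)

module OneIn {n : ℤ} (X : NSet n) (S : Solo X) (1∈ : + 1 ∈ NSet.A X) where
 open SoloFacts X S
 private
  z0≥2 = 1≤x⇒x≢1⇒2≤x z0≥1 \e -> clash 1∈ (move A hole e)
  0≤z0-1 = 1≤x⇒0≤x-1 z0≥1
  z0-1∉ = move A (fst left (+ 1) 0≤+ z0≥1 1∈) (lia 1 (\z -> #0 :+ z :- #1 == z :- #1) z0)
  -- The hole z0 - 1 is at level 2, so z0 - 1 + n is missing: a second centre right beside z0 + n.
  R = posR (z0 - + 1) 0≤z0-1 (lia 2 (\z n -> z :< n => z :- #1 :< n) _ n z0<n) z0-1∉
   (lia 2 (\f g -> g == f :- #1 => g == #1 => #2 <= f) _ _ (φ-out 0≤z0-1 z0-1∉) (tr (cong φ (x-1+1≡x)) prior))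
  -- The missing sum z0 - 1 + n sends the member c to a hole, and the antisymmetry around z0 + n
  -- sends that hole to the member c + 1.
  upClosed : ∀ c -> c ∈ A -> z0 ≤ c -> c < n -> c + + 1 ∈ A
  upClosed c c∈ a b = move A (snd right (z0 - + 1 + n - c) (lia 3 (\z n c -> c :< n => z <= z :- #1 :+ n :- c) _ n c b) (lia 3 (\z n c -> z <= c => z :- #1 :+ n :- c <= n) _ n c a)
   (D-not R c∈ (lia 3 (\z n c -> c :+ (z :- #1 :+ n :- c) == z :- #1 :+ n) z0 n c))) (lia 3 (\z n c -> z :+ n :- (z :- #1 :+ n :- c) == c :+ #1) z0 n c)
 module _ (z0<n-1 : z0 < n - + 1) where
  private
   0≤z0+1 = 0≤x⇒0≤x+1 0≤z0
   n-1∈ : n - + 1 ∈ A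
   n-1∈ = case mem? A (z0 + + 1) of \ where
    (inr p) -> move A (snd right (z0 + + 1) x≤x+1 (x<y⇒x+1≤y z0<n) p) (lia 2 (\z n -> z :+ n :- (z :+ #1) == n :- #1) z0 n)
    (inl p) -> climb (\c -> c ∈ A) (n - + 1) p (\c a b ih -> upClosed c ih (x+1≤y⇒x≤y a) (lia 2 (\c n -> c :< n :- #1 => c :< n) c n b)) (lia 2 (\z n -> z :< n :- #1 => z :+ #1 <= n :- #1) _ n z0<n-1) ≤r
   z0+1∉ = move A (fst right (n - + 1) (<⇒≤ z0<n-1) x-1≤x n-1∈) (lia 2 (\z n -> z :+ n :- (n :- #1) == z :+ #1) z0 n)
   L = negL (z0 + + 1) 0≤z0+1 (lia 2 (\z n -> z :< n :- #1 => z :+ #1 :< n) _ n z0<n-1) z0+1∉ (≡⇒≤ next)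
   -- The same on the left of z0, with the missing sum z0 + 1 as the second centre.
   upHole : ∀ c -> 0z ≤ c -> c < z0 -> c ∉ A -> c + + 1 ∉ A
   upHole c a b p = out \q -> clash (snd left c a (<⇒≤ b) p) (D-not L q (lia 2 (\z c -> c :+ #1 :+ (#0 :+ z :- c) == z :+ #1) z0 c))
   downHole : ∀ c -> z0 < c -> c ≤ n -> c ∉ A -> c - + 1 ∉ A
   downHole c a b p = out \q -> clash (move A (upClosed (c - + 1) q (x<y⇒x≤y-1 a) (x≤y⇒x-1<y b)) (x-1+1≡x)) p
  private
   abstract
    lowest : Least (\z -> not (A z)) 0z (z0 + + 1)
    lowest = [ (\g -> g) , (\none -> clash (not-false (none z0 0≤z0 (x<x+1))) hole) ]′ (least (\z -> not (A z)) {0z} {z0 + + 1} 0≤z0+1)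
    topmost : Greatest (\z -> not (A z)) z0 n
    topmost = [ (\g -> g) , (\none -> clash (not-false (none z0 ≤r z0<n)) hole) ]′ (greatest (\z -> not (A z)) {z0} {n} (<⇒≤ z0<n))
   h w : ℤ
   h = fst lowest
   w = fst topmost
   0≤h = fst (snd lowest)
   h≤z0 : h ≤ z0
   h≤z0 = x<y+1⇒x≤y (fst (snd (snd lowest)))
   h∉ = not-true (fst (snd (snd (snd lowest))))
   z0≤w = fst (snd topmost)
   w<n = fst (snd (snd topmost))
   w∉ = not-true (fst (snd (snd (snd topmost))))
   down : ∀ t -> 0z ≤ t -> t < h -> t ∈ A
   down t a b = not-false (snd (snd (snd (snd lowest))) t a b)
   up : ∀ t -> w < t -> t ≤ n -> t ∈ A
   up t a b = case t ≟ n of \ where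
    (yes e) -> move A hi (sym e)
    (no ne) -> not-false (snd (snd (snd (snd topmost))) t a (x≤y⇒x≢y⇒x<y b ne))
   gap : ∀ t -> h ≤ t -> t ≤ w -> t ∉ A
   gap t a b = case t ≤? z0 of \ where
    (yes c) -> climb (\c -> c ∉ A) z0 h∉ (\c p q ih -> upHole c (≤t 0≤h p) q ih) a c
    (no c) -> descend (\c -> c ∉ A) z0 w∉ (\c p q ih -> downHole c q (≤t p (<⇒≤ w<n)) ih) (<⇒≤ (≰⇒> c)) b
   h≥1 = 0≤x⇒x≢0⇒1≤x 0≤h \e -> clash lo (move A h∉ e)
   h≤w+1 : h ≤ w + + 1
   h≤w+1 = lia 3 (\h z w -> h <= z => z <= w => h <= w :+ #1) h _ w h≤z0 z0≤w
   w+1≤n+1 = x<y⇒x+1≤y+1 w<n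
   cover : ∀ t -> t ∈ A -> (Σ ℤ \i -> 0z ≤ i × i ≤ h - + 1 × t ≡ 0z + + 1 * i) ⊎ (Σ ℤ \i -> 0z ≤ i × i ≤ n - w - + 1 × t ≡ w + + 1 + + 1 * i)
   cover t t∈ = case t <? h of \ where
    (yes a) -> inl (t , fst (supp t∈) , x<y⇒x≤y-1 a , x≡0+1x)
    (no a) -> case t ≤? w of \ where
     (yes b) -> clash t∈ (gap t (≮⇒≥ a) b)
     (no b) -> inr (t - w - + 1 , lia 2 (\t w -> ~ t <= w => #0 <= t :- w :- #1) t w b , lia 3 (\t w n -> t <= n => t :- w :- #1 <= n :- w :- #1) t w n (snd (supp t∈)) , lia 2 (\t w -> t == w :+ #1 :+ 1 *: (t :- w :- #1)) t w)
  abstract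
   twoIntervals : TwoAP A k
   twoIntervals = record
    { u = 0z ; v = w + + 1 ; δ = + 1 ; p = h - + 1 ; q = n - w - + 1 ; δ≥1 = ≤r ; p≥0 = 1≤x⇒0≤x-1 h≥1 ; q≥0 = lia 2 (\n w -> w :< n => #0 <= n :- w :- #1) n w w<n
    ; size≡ = lia 8 (\a b c d h w n k -> d == c :+ (n :- w) => c == a :+ b => b == h :- (w :+ #1) => a == h :- #0 => d == 2 *: k :- n :- #1 => h :- #1 :+ (n :- w :- #1) :+ #2 == k)
      _ _ _ _ h w n k
      (tr (φ-split (≤t 0≤h h≤w+1) w+1≤n+1) (cong (\s -> φ (w + + 1) + s) (tr (bal-full A w+1≤n+1 \t a b -> up t (x+1≤y⇒x<y a) (x<y+1⇒x≤y b)) (lia 2 (\n w -> n :+ #1 :- (w :+ #1) == n :- w) n w))))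
      (φ-split 0≤h h≤w+1) (bal-void A h≤w+1 \t a b -> gap t a (x<y+1⇒x≤y b)) (bal-full A 0≤h \t a b -> down t a b) φend
    ; cover = cover
    ; in0 = \i a b -> move A (down i a (lia 2 (\i h -> i <= h :- #1 => i :< h) i h b)) x≡0+1x
    ; in1 = \i a b -> up (w + + 1 + + 1 * i) (lia 2 (\w i -> #0 <= i => w :< w :+ #1 :+ 1 *: i) w i a) (lia 3 (\w i n -> i <= n :- w :- #1 => w :+ #1 :+ 1 *: i <= n) w i n b) }
 -- z0 = n - 1: a first descent z < n - 1 is impossible, by comparing A ∩ [z,n-1] with its translate by -z.
 module _ (e0 : z0 ≡ n - + 1) where
  private
   n≥2 = lia 2 (\z n -> z == n :- #1 => #2 <= z => #3 <= n) _ n e0 z0≥2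
   φn≡0 = tr (cong φ (lia 2 (\z n -> z == n :- #1 => n == z :+ #1) _ n e0)) next
   sym0 : ∀ w -> 0z ≤ w -> w ≤ n -> φ w ≡ φ (n - w)
   sym0 w a b = tr (symL 0≤z0 left next w a (lia 3 (\w z n -> z == n :- #1 => w <= n => w <= z :+ #1) w _ n e0 b)) (cong φ (lia 3 (\w z n -> z == n :- #1 => z :+ #1 :- w == n :- w) w _ n e0))
   flip : ∀ x y -> 0z ≤ x -> x ≤ n - + 1 -> x ∉ A -> n - + 1 - x ≡ y -> y ∈ A
   flip x y a b p e = move A (snd left x a (subst (x ≤_) (sym e0) b) p) (tr (cong (\z -> 0z + z - x) e0) (tr (cong (_- x) (0+ (n - + 1))) e))
   n-1∉ = move A hole e0
   φ2 = tr (φ-in 1∈) (cong (_+ + 1) φ1)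
   module _ (z : ℤ) (z≥1 : + 1 ≤ z) (z<n-1 : z < n - + 1) (z∉ : z ∉ A) (e₁ : φ z ≡ + 1) (e₂ : φ (z + + 1) ≡ 0z) (pos : ∀ t -> + 1 ≤ t -> t ≤ z -> + 1 ≤ φ t) where
    d = n - + 1 - z
    d≥1 = lia 2 (\z n -> z :< n :- #1 => #1 <= n :- #1 :- z) z n z<n-1
    0≤d = ≤t 0≤+ d≥1
    z≥2 = 1≤x⇒x≢1⇒2≤x z≥1 \e -> clash 1∈ (move A z∉ e)
    prev = prevHole z z≥1 e₁ (pos (z - + 1) (lia 1 (\z -> #2 <= z => #1 <= z :- #1) z z≥2) (x-1≤x))
    R' = posR (z - + 1) (1≤x⇒0≤x-1 z≥1) (lia 2 (\z n -> z :< n :- #1 => z :- #1 :< n) z n z<n-1) (fst prev) (≡⇒≤ (sym (snd prev)))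
    -- The missing sum z - 1 + n sends x + z to the hole n - 1 - x, which the antisymmetry of
    -- [0,n - 1] sends to x.
    sh : ∀ x -> 0z ≤ x -> x ≤ d -> x + z ∈ A -> x ∈ A
    sh x a b p = flip (n - + 1 - x) x (lia 3 (\x z n -> x <= n :- #1 :- z => #1 <= z => #0 <= n :- #1 :- x) x z n b z≥1) (lia 2 (\x n -> #0 <= x => n :- #1 :- x <= n :- #1) x n a)
     (D-not R' p (lia 3 (\x z n -> x :+ z :+ (n :- #1 :- x) == z :- #1 :+ n) x z n)) (lia 2 (\x n -> n :- #1 :- (n :- #1 :- x) == x) x n)
    g : ℤ -> ℤ
    g x = χ A x - χ A (x + z)
    g≥0 : ∀ x -> 0z ≤ x -> x < d + + 1 -> 0z ≤ g x
    g≥0 x a b = x≤y⇒0≤y-x (χ-mono {A} {A} (sh x a (x<y+1⇒x≤y b)))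
    -- The two counts differ by exactly one, and the position 0 alone accounts for it.
    cnt = lia 8 (\s a b f m fn fz z -> s == a :- b => f == 2 *: a :- m => fn == fz :+ (2 *: b :- m) => f == #1 => fn == #0 => fz == #1 => s == #1) _ (count A 0z (d + + 1)) (count A z n) _ (d + + 1) _ _ z
     (tr (∑-sub (χ A) (\x -> χ A (x + z)) 0≤d+1) (cong (\s -> count A 0z (d + + 1) - s) (tr (∑-shift (χ A) z 0≤d+1) (cong₂ (count A) (0+ z) (lia 2 (\z n -> n :- #1 :- z :+ #1 :+ z == n) z n)))))
     (tr (bal-count A 0≤d+1) (cong (\m -> + 2 * count A 0z (d + + 1) - m) (+0 (d + + 1))))
     (tr (φ-split (≤t 0≤+ z≥1) z≤n) (cong (\s -> φ z + s) (tr (bal-count A z≤n) (cong (\m -> + 2 * count A z n - m) (lia 2 (\z n -> n :- z == n :- #1 :- z :+ #1) z n)))))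
     (tr (sym0 (d + + 1) 0≤d+1 (lia 2 (\z n -> #1 <= z => n :- #1 :- z :+ #1 <= n) z n z≥1)) (tr (cong φ (lia 2 (\z n -> n :- (n :- #1 :- z :+ #1) == z) z n)) e₁)) φn≡0 e₁
     where
     0≤d+1 = lia 1 (\d -> #1 <= d => #0 <= d :+ #1) d d≥1
     z≤n = lia 2 (\z n -> z :< n :- #1 => z <= n) z n z<n-1
    g0 = lia 2 (\u v -> u == #1 => v == #0 => u :- v == #1) _ _ (χ-in lo) (χ-out (move A z∉ (sym (0+ z))))
    -- At d the difference is 1 again: d is a member as the mirror image of the hole z, and its
    -- translate n - 1 is a hole.
    caseL : z ∉ D -> ⊥
    caseL L = lia 3 (\s u v -> u :+ v <= s => s == #1 => u == #1 => v == #1 => ff) _ _ _ (∑-two g d g≥0 (1≤x⇒0<x d≥1) (x<x+1)) cnt g0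
     (lia 2 (\u v -> u == #1 => v == #0 => u :- v == #1) _ _ (χ-in d∈) (χ-out (move A n-1∉ (lia 2 (\z n -> n :- #1 == n :- #1 :- z :+ z) z n))))
     where
     d∈ = flip z d (≤t 0≤+ z≥1) (<⇒≤ z<n-1) z∉ refl
    -- With z + n missing, the shift by z + 1 works as well and loses nothing. Together the two
    -- shifts carry membership from t to t + 1, so [0,d] is full although its balance is 0.
    caseR : z + n ∉ D -> ⊥
    caseR Rz = lia 3 (\f d b -> f == b => b == d :- #0 => f == #0 => #1 <= d => ff) _ d _ refl (bal-full A 0≤d \t a b -> full t a (<⇒≤ b)) φd d≥1
     where
     φd = tr (sym0 d 0≤d (lia 2 (\z n -> #1 <= z => n :- #1 :- z <= n) z n z≥1)) (tr (cong φ (lia 2 (\z n -> n :- (n :- #1 :- z) == z :+ #1) z n)) e₂)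
     eqz : ∀ x -> + 1 ≤ x -> x ≤ d -> g x ≡ 0z
     eqz x a b = ≤≥ (lia 3 (\s u v -> u :+ v <= s => s == #1 => u == #1 => v <= #0) _ _ _ (∑-two g x g≥0 (1≤x⇒0<x a) (x≤y⇒x<y+1 b)) cnt g0) (g≥0 x (≤t 0≤+ a) (x≤y⇒x<y+1 b))
     sh' : ∀ x -> 0z ≤ x -> x < d -> x + z + + 1 ∈ A -> x ∈ A
     sh' x a b p = flip (n - + 1 - x) x (lia 3 (\x z n -> x :< n :- #1 :- z => #1 <= z => #0 <= n :- #1 :- x) x z n b z≥1) (lia 2 (\x n -> #0 <= x => n :- #1 :- x <= n :- #1) x n a)
      (D-not Rz p (lia 3 (\x z n -> x :+ z :+ #1 :+ (n :- #1 :- x) == z :+ n) x z n)) (lia 2 (\x n -> n :- #1 :- (n :- #1 :- x) == x) x n)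
     g' : ℤ -> ℤ
     g' x = χ A x - χ A (x + (z + + 1))
     g'≥0 : ∀ x -> 0z ≤ x -> x < d -> 0z ≤ g' x
     g'≥0 x a b = x≤y⇒0≤y-x (χ-mono {A} {A} (\p -> sh' x a b (move A p (sym (+-assoc x z (+ 1))))))
     cnt' = lia 7 (\s a b f m fn fz -> s == a :- b => f == 2 *: a :- m => fn == fz :+ (2 *: b :- m) => f == #0 => fn == #0 => fz == #0 => s <= #0) _ (count A 0z d) (count A (z + + 1) n) _ d _ _
      (tr (∑-sub (χ A) (\x -> χ A (x + (z + + 1))) 0≤d) (cong (\s -> count A 0z d - s) (tr (∑-shift (χ A) (z + + 1) 0≤d) (cong₂ (count A) (0+ (z + + 1)) (lia 2 (\z n -> n :- #1 :- z :+ (z :+ #1) == n) z n)))))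
      (tr (bal-count A 0≤d) (cong (\m -> + 2 * count A 0z d - m) (+0 d)))
      (tr (φ-split (lia 1 (\z -> #1 <= z => #0 <= z :+ #1) z z≥1) z+1≤n) (cong (\s -> φ (z + + 1) + s) (tr (bal-count A z+1≤n) (cong (\m -> + 2 * count A (z + + 1) n - m) (lia 2 (\z n -> n :- (z :+ #1) == n :- #1 :- z) z n)))))
      φd φn≡0 e₂
      where
      z+1≤n = lia 2 (\z n -> z :< n :- #1 => z :+ #1 <= n) z n z<n-1
     full : ∀ t -> 0z ≤ t -> t ≤ d -> t ∈ A
     full t = climb (\t -> t ∈ A) d lo (\t a b ih -> χ-in⁻ (lia 5 (\u v w x y -> u :- v == #0 => w :- x == #0 => u == #1 => v == x => #0 <= #0 => #1 <= w) _ _ _ _ 0z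
      (∑-zeros g' g'≥0 cnt' t a b) (eqz (t + + 1) (0≤x⇒1≤x+1 a) (x<y⇒x+1≤y b)) (χ-in ih) (cong (\y -> bit (A y)) (lia 2 (\t z -> t :+ (z :+ #1) == t :+ #1 :+ z) t z)) 0≤+))
  abstract
   positive : ∀ t -> + 1 ≤ t -> t ≤ n - + 1 -> + 1 ≤ φ t
   positive = case firstZero (+ 1) (n - + 1) 0≤+ (lia 1 (\n -> #3 <= n => #1 <= n :- #1) n n≥2) (≡⇒≤ (sym φ1)) of \ where
    (inr h) -> h
    (inl (z , a , b , z∉ , e₁ , e₂ , pos)) -> ⊥e ([ caseL z a b z∉ e₁ e₂ pos , caseR z a b z∉ e₁ e₂ pos ]′ (LorR z (≤t 0≤+ a) (lia 2 (\z n -> z :< n :- #1 => z :< n) z n b) z∉ (\e -> lia 3 (\z w n -> z :< n :- #1 => z == w => w == n :- #1 => ff) z _ n b e e0)))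

∉-≡ : ∀ (P : 𝔹) {x y} -> x ∉ P -> y ∉ P -> P x ≡ P y
∉-≡ P p q = tr p (sym q)

differ : ∀ {a b : Bool} -> a ≡ b ⊎ (a ≡ true × b ≡ false) ⊎ (a ≡ false × b ≡ true)
differ {true} {true} = inl refl
differ {false} {false} = inl refl
differ {true} {false} = inr (inl (refl , refl))
differ {false} {true} = inr (inr (refl , refl))

sameᵇ : Bool -> Bool -> Bool
sameᵇ true b = b
sameᵇ false b = not b

sameᵇ-≡ : ∀ {a b} -> sameᵇ a b ≡ true -> a ≡ b
sameᵇ-≡ {true} {true} _ = refl
sameᵇ-≡ {false} {false} _ = refl

sameᵇ-≢ : ∀ {a b} -> sameᵇ a b ≡ false -> (a ≡ true × b ≡ false) ⊎ (a ≡ false × b ≡ true)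
sameᵇ-≢ {true} {false} _ = inl (refl , refl)
sameᵇ-≢ {false} {true} _ = inr (refl , refl)

-- The uncovered hole when neither 1 nor n - 1 belongs to A

Alt : 𝔹 -> ℤ -> ℤ -> Set
Alt P a b = ∀ t -> a ≤ t -> t + + 2 ≤ b -> P t ≡ P (t + + 2)

alt-run : ∀ P {a b} -> Alt P a b -> ∀ {i} -> 0z ≤ i -> ∀ c -> a ≤ c -> c + + 2 * i ≤ b -> P c ≡ P (c + + 2 * i)
alt-run P {a} {b} alt = rise (\i -> ∀ c -> a ≤ c -> c + + 2 * i ≤ b -> P c ≡ P (c + + 2 * i))
 (\c _ _ -> cong P (sym (+0 c)))
 (\i 0≤i ih c a≤c le -> tr (ih c a≤c (lia 3 (\c i b -> c :+ 2 *: (i :+ #1) <= b => c :+ 2 *: i <= b) c i b le))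
  (tr (alt (c + + 2 * i) (lia 3 (\a c i -> a <= c => #0 <= i => a <= c :+ 2 *: i) a c i a≤c 0≤i) (lia 3 (\c i b -> c :+ 2 *: (i :+ #1) <= b => c :+ 2 *: i :+ #2 <= b) c i b le))
   (cong P (lia 2 (\c i -> c :+ 2 *: i :+ #2 == c :+ 2 *: (i :+ #1)) c i))))

half : ∀ {x} -> 0z ≤ x -> (Σ ℤ \i -> 0z ≤ i × x ≡ + 2 * i) ⊎ (Σ ℤ \i -> 0z ≤ i × x ≡ + 2 * i + + 1)
half {x} 0≤x = case divide {+ 2} 1≤+ 0≤x of \ where
 (r , i , a , b , c , e) -> case lia 1 (\r -> #0 <= r => r :< #2 => r == #0 :∨ r == #1) r a b of \ where
  (inl e') -> inl (i , c , lia 3 (\x r i -> x == r :+ 2 *: i => r == #0 => x == 2 *: i) x r i e e')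
  (inr e') -> inr (i , c , lia 3 (\x r i -> x == r :+ 2 *: i => r == #1 => x == 2 *: i :+ #1) x r i e e')

module RightSide {n : ℤ} (X : NSet n) (S : Solo X) (1∉ : + 1 ∉ NSet.A X) (n-1∉ : n - + 1 ∉ NSet.A X) where
 open SoloFacts X S hiding (half)
 Pos = ∀ t -> z0 + + 2 ≤ t -> t ≤ n - + 1 -> + 1 ≤ φ t
 halfφ = Solo.half S
 z0+1∈ : z0 + + 1 ∈ A
 z0+1∈ = case z0 ≟ n - + 1 of \ where
  (yes e) -> move A hi (lia 2 (\z n -> z == n :- #1 => n == z :+ #1) _ n e)
  (no ne) -> move A (snd right (n - + 1) (x<y⇒x≤y-1 z0<n) x-1≤x n-1∉) (lia 2 (\z n -> z :+ n :- (n :- #1) == z :+ #1) z0 n)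
 z0-1∈ = move A (snd left (+ 1) 0≤+ z0≥1 1∉) (lia 1 (\z -> #0 :+ z :- #1 == z :- #1) z0)
 private
  0≤z0+1 = 0≤x⇒0≤x+1 0≤z0
  φ2 = tr (φ-out 0≤+ 1∉) (cong (_- + 1) φ1)
  φ-start = tr (cong φ (lia 1 (\z -> z :+ #2 == z :+ #1 :+ #1) z0)) (tr (φ-in z0+1∈) (cong (_+ + 1) next))
  module _ (z : ℤ) (z0+2≤z : z0 + + 2 ≤ z) (z<n-1 : z < n - + 1) (z∉ : z ∉ A) (e₁ : φ z ≡ + 1) (e₂ : φ (z + + 1) ≡ 0z) (pos : ∀ t -> z0 + + 2 ≤ t -> t ≤ z -> + 1 ≤ φ t) where
   0≤z = lia 2 (\w z -> #0 <= w => w :+ #2 <= z => #0 <= z) _ z 0≤z0 z0+2≤z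
   z<n = lia 2 (\z n -> z :< n :- #1 => z :< n) z n z<n-1
   z≤n+1 = x<y⇒x≤y+1 z<n
   module Far (far : z0 + + 3 ≤ z) where
    prev = prevHole z (lia 2 (\w z -> #0 <= w => w :+ #2 <= z => #1 <= z) _ z 0≤z0 z0+2≤z) e₁ (pos (z - + 1) (lia 2 (\w z -> w :+ #3 <= z => w :+ #2 <= z :- #1) z0 z far) (x-1≤x))
    0≤z-1 = lia 2 (\w z -> #0 <= w => w :+ #2 <= z => #0 <= z :- #1) _ z 0≤z0 z0+2≤z
    R = posR (z - + 1) 0≤z-1 (lia 2 (\z n -> z :< n => z :- #1 :< n) z n z<n) (fst prev) (≡⇒≤ (sym (snd prev)))
    -- The symmetry of the balance on [0,z] identifies the level at z - 1, which is 2, with the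
    -- level at 2, which is 0.
    caseL : z ∉ D -> ⊥
    caseL L = lia 2 (\f g -> f == #2 => g == #0 => f == g => ff) _ _ (snd prev) φ2
     (tr (symL 0≤z (antiL 0≤z L (≡⇒≤ (sym e₂))) e₂ (z - + 1) 0≤z-1 (lia 1 (\z -> z :- #1 <= z :+ #1) z)) (cong φ (lia 1 (\z -> z :+ #1 :- (z :- #1) == #2) z)))
    -- The neighbouring centres z - 1 + n and z + n move members from z on up by one, so the member
    -- z + 1 would force n - 1 to be one.
    caseR : z + n ∉ D -> ⊥
    caseR Rz = clash (climb (\x -> x ∈ A) (n - + 1) z+1∈ (\x a b ih -> step' x (x+1≤y⇒x≤y a) b ih) (lia 2 (\z n -> z :< n :- #1 => z :+ #1 <= n :- #1) z n z<n-1) ≤r) n-1∉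
     where
     aR = antiR 0≤z z≤n+1 Rz (≡⇒≤ (tr e₁ (sym halfφ)))
     z+1∈ = move A (snd aR (n - + 1) (<⇒≤ z<n-1) x-1≤x n-1∉) (lia 2 (\z n -> z :+ n :- (n :- #1) == z :+ #1) z n)
     step' : ∀ x -> z ≤ x -> x < n - + 1 -> x ∈ A -> x + + 1 ∈ A
     step' x a b x∈ = move A (snd aR (z + n - (x + + 1)) (lia 3 (\x z n -> x :< n :- #1 => z <= z :+ n :- (x :+ #1)) x z n b) (lia 3 (\x z n -> z <= x => z :+ n :- (x :+ #1) <= n) x z n a)
      (move A (fst right y y≥ y≤ y∈) (lia 4 (\x z w n -> w :+ n :- (x :- (z :- #1 :- w)) == z :+ n :- (x :+ #1)) x z z0 n))) (lia 3 (\x z n -> z :+ n :- (z :+ n :- (x :+ #1)) == x :+ #1) x z n)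
      where
      y = x - (z - + 1 - z0)
      y≥ = lia 3 (\x z w -> z <= x => w <= x :- (z :- #1 :- w)) x z _ a
      y≤ = lia 4 (\x z w n -> w :+ #2 <= z => x :< n :- #1 => x :- (z :- #1 :- w) <= n) x z z0 n z0+2≤z b
      y∈ = move A (snd right (z - + 1 + n - x) (lia 4 (\x z w n -> w :+ #2 <= z => x :< n :- #1 => w <= z :- #1 :+ n :- x) x z _ n z0+2≤z b) (lia 3 (\x z n -> z <= x => z :- #1 :+ n :- x <= n) x z n a)
       (D-not R x∈ (lia 3 (\x z n -> x :+ (z :- #1 :+ n :- x) == z :- #1 :+ n) x z n))) (lia 4 (\x z w n -> w :+ n :- (z :- #1 :+ n :- x) == x :- (z :- #1 :- w)) x z z0 n)
   module Near (near : z ≡ z0 + + 2) where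
    -- The centres z0 + n and z + n are 2 apart, so their reflections compose to a shift by 2.
    alternates : z + n ∉ D -> Alt A z0 n
    alternates Rz t a b = tr (anti-not A right a (lia 2 (\t n -> t :+ #2 <= n => t <= n) t n b) refl) (sym (anti-not A aR (lia 3 (\t z w -> z == w :+ #2 => w <= t => z <= t :+ #2) t z _ near a) b (lia 4 (\t z w n -> z == w :+ #2 => w :+ n :- t == z :+ n :- (t :+ #2)) t z z0 n near)))
     where
     aR = antiR 0≤z z≤n+1 Rz (≡⇒≤ (tr e₁ (sym halfφ)))
    module _ (L : z ∉ D) where
     aL = antiL 0≤z L (≡⇒≤ (sym e₂))
     alt0 : Alt A 0z z
     alt0 t a b = tr (anti-not A left a (lia 3 (\t z w -> z == w :+ #2 => t :+ #2 <= z => t <= w) t z _ near b) refl) (sym (anti-not A aL (lia 1 (\t -> #0 <= t => #0 <= t :+ #2) t a) b (lia 3 (\t z w -> z == w :+ #2 => #0 :+ w :- t == #0 :+ z :- (t :+ #2)) t z z0 near)))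
     evenFrom : Alt A 0z n -> Even X
     evenFrom alt x p = case half (fst (supp p)) of \ where
      (inl (i , _ , e)) -> i , e
      (inr (i , 0≤i , e)) -> clash p (tr (cong A (tr e (+-comm (+ 2 * i) (+ 1)))) (tr (sym (alt-run A alt 0≤i (+ 1) 0≤+ (subst (_≤ n) (tr e (+-comm (+ 2 * i) (+ 1))) (snd (supp p))))) 1∉))
     -- Where the alternation first breaks, a hole other than z0 is covered twice: t itself if t - 2
     -- is a member, and its mirror image z0 + n - t otherwise.
     failure : ∀ t -> z + + 1 ≤ t -> t ≤ n -> Alt A 0z (t - + 1) -> sameᵇ (A (t - + 2)) (A t) ≡ false -> ⊥
     failure t z<t t≤n alt diff = [ even , odd ]′ (sameᵇ-≢ diff)
      where
      t≥4 = lia 3 (\t z w -> z == w :+ #2 => #1 <= w => z :+ #1 <= t => #4 <= t) t z _ near z0≥1 z<t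
      2∈ = tr (sym (alt 0z ≤r (lia 1 (\t -> #4 <= t => #2 <= t :- #1) t t≥4))) lo
      z0∉ = hole
      parity : ∀ c -> 0z ≤ c -> c ≤ t - + 1 -> (c ∈ A × Σ ℤ \i -> c ≡ + 2 * i) ⊎ (c ∉ A × Σ ℤ \i -> c ≡ + 2 * i + + 1)
      parity c a b = case half a of \ where
       (inl (i , 0≤i , e)) -> inl (tr (cong A (tr e (sym (0+ _)))) (tr (sym (alt-run A alt 0≤i 0z ≤r (subst (_≤ t - + 1) (tr e (sym (0+ _))) b))) lo) , i , e)
       (inr (i , 0≤i , e)) -> inr (tr (cong A (tr e (+-comm (+ 2 * i) (+ 1)))) (tr (sym (alt-run A alt 0≤i (+ 1) 0≤+ (subst (_≤ t - + 1) (tr e (+-comm (+ 2 * i) (+ 1))) b))) 1∉) , i , e)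
      0≤t-2 = lia 1 (\t -> #4 <= t => #0 <= t :- #2) t t≥4
      0≤t-1 = lia 1 (\t -> #4 <= t => #0 <= t :- #1) t t≥4
      0≤t = ≤t 0≤+ t≥4
      p2 = parity (t - + 2) 0≤t-2 (lia 1 (\t -> t :- #2 <= t :- #1) t)
      p₁ = parity (t - + 1) 0≤t-1 ≤r
      φpar = rise (\i -> + 2 * i ≤ t - + 1 -> φ (+ 2 * i) ≡ 0z) (\_ -> φ0)
       (\i 0≤i ih le -> let
         le' = lia 2 (\i t -> 2 *: (i :+ #1) <= t :- #1 => 2 *: i <= t :- #1) i t le
         0≤2i = lia 1 (\i -> #0 <= i => #0 <= 2 *: i) i 0≤i
         in∈ = [ fst , (\(_ , j , e) -> ⊥e (lia 2 (\i j -> 2 *: i == 2 *: j :+ #1 => ff) i j e)) ]′ (parity (+ 2 * i) 0≤2i le')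
         out∉ = [ (\(_ , j , e) -> ⊥e (lia 2 (\i j -> 2 *: i :+ #1 == 2 *: j => ff) i j e)) , fst ]′ (parity (+ 2 * i + + 1) (lia 1 (\i -> #0 <= i => #0 <= 2 *: i :+ #1) i 0≤i) (lia 2 (\i t -> 2 *: (i :+ #1) <= t :- #1 => 2 *: i :+ #1 <= t :- #1) i t le))
        in lia 4 (\a b c d -> b == a :+ #1 => c == b :- #1 => a == #0 => d == c => d == #0) _ _ _ _
         (φ-in in∈) (φ-out (lia 1 (\i -> #0 <= i => #0 <= 2 *: i :+ #1) i 0≤i) out∉) (ih le') (cong φ (lia 1 (\i -> 2 *: (i :+ #1) == 2 *: i :+ #1 :+ #1) i)))
      even : A (t - + 2) ≡ true × A t ≡ false -> ⊥
      even (t-2∈ , t∉) = notBoth t 0≤t t<n t∉ (\e -> lia 4 (\t z w n -> t == w => z == w :+ #2 => z :+ #1 <= t => ff) t z _ n e near z<t)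
        (D-in 2∈ t-2∈ (lia 1 (\t -> #2 :+ (t :- #2) == t) t)) (high 0≤t (lia 2 (\t n -> t <= n => t <= n :+ #1) t n t≤n) (lia 2 (\f m -> f == #0 => m == #1 => f :< m) _ _ φt halfφ))
       where
       t<n = x≤y⇒x≢y⇒x<y t≤n \e -> clash (move A hi (sym e)) t∉
       t-1∉ : ∀ i -> t - + 2 ≡ + 2 * i -> t - + 1 ∉ A
       t-1∉ i e = [ (\(_ , j , e') -> ⊥e (lia 3 (\t i j -> t :- #2 == 2 *: i => t :- #1 == 2 *: j => ff) t i j e e')) , fst ]′ p₁
       φt : φ t ≡ 0z
       φt = case p2 of \ where
        (inr (q , _)) -> clash t-2∈ q
        (inl (_ , i , e)) -> lia 4 (\a b c d -> b == a :+ #1 => c == b :- #1 => a == #0 => d == c => d == #0) _ _ _ _ (φ-in t-2∈)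
          (tr (φ-out 0≤t-1 (t-1∉ i e)) (cong (\s -> φ s - + 1) (lia 1 (\t -> t :- #1 == t :- #2 :+ #1) t)))
          (tr (cong φ e) (φpar (lia 2 (\i t -> t :- #2 == 2 *: i => #4 <= t => #0 <= i) i t e t≥4) (lia 2 (\i t -> t :- #2 == 2 *: i => 2 *: i <= t :- #1) i t e))) (cong φ (x≡x-1+1))
      odd : A (t - + 2) ≡ false × A t ≡ true -> ⊥
      odd (t-2∉ , t∈) = notBoth y 0≤y y<n y∉ y≢ y∈D (D-in y+2∈ n-2∈ (lia 2 (\y n -> y :+ #2 :+ (n :- #2) == y :+ n) y n))
       where
       y = z0 + n - t
       i = [ (\(q , _) -> clash q t-2∉) , (\(_ , i , _) -> i) ]′ p2
       t-1∈ : t - + 1 ∈ A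
       t-1∈ = case p2 of \ where
        (inl (q , _)) -> clash q t-2∉
        (inr (_ , i , e)) -> [ fst , (\(_ , j , e') -> ⊥e (lia 3 (\t i j -> t :- #2 == 2 *: i :+ #1 => t :- #1 == 2 *: j :+ #1 => ff) t i j e e')) ]′ p₁
       t≢n = x≤y⇒x≢y⇒x<y t≤n \e -> clash (move A t-1∈ (lia 2 (\t n -> t == n => t :- #1 == n :- #1) t n e)) n-1∉
       z0<y = lia 3 (\z t n -> t :< n => z :< z :+ n :- t) _ t n t≢n
       0≤y = ≤t 0≤z0 (<⇒≤ z0<y)
       z0≤t = lia 3 (\t z w -> z == w :+ #2 => z :+ #1 <= t => w :+ #2 <= t) t z z0 near z<t
       y<n = lia 3 (\z t n -> z :+ #2 <= t => z :+ n :- t :< n) z0 t n z0≤t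
       y≢ : ¬ y ≡ z0
       y≢ e = <-irrefl (sym e) z0<y
       y∉ = fst right t (lia 2 (\z t -> z :+ #2 <= t => z <= t) _ t z0≤t) t≤n t∈
       y+2∈ = move A (snd right (t - + 2) (lia 2 (\z t -> z :+ #2 <= t => z <= t :- #2) _ t z0≤t) (lia 2 (\t n -> t <= n => t :- #2 <= n) t n t≤n) t-2∉) (lia 3 (\z t n -> z :+ n :- (t :- #2) == z :+ n :- t :+ #2) z0 t n)
       n-2∈ = move A (snd right z (lia 2 (\z w -> z == w :+ #2 => w <= z) z _ near) (<⇒≤ z<n) z∉) (lia 3 (\z w n -> z == w :+ #2 => w :+ n :- z == n :- #2) z z0 n near)
       φt+1 : φ (t + + 1) ≡ + 2
       φt+1 = case p2 of \ where
        (inl (q , _)) -> clash q t-2∉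
        (inr (_ , i , e)) -> lia 4 (\a b c d -> b == a :+ #1 => c == b => d == c :+ #1 => a == #0 => d == #2) _ _ _ _ (φ-in t-1∈) (cong φ (x≡x-1+1)) (φ-in t∈)
         (tr (cong φ (lia 2 (\t i -> t :- #2 == 2 *: i :+ #1 => t :- #1 == 2 *: (i :+ #1)) t i e)) (φpar (lia 2 (\i t -> t :- #2 == 2 *: i :+ #1 => #4 <= t => #0 <= i :+ #1) i t e t≥4) (lia 2 (\i t -> t :- #2 == 2 *: i :+ #1 => 2 *: (i :+ #1) <= t :- #1) i t e)))
       y∈D = low 0≤y (lia 4 (\a b c d -> b == a :- #1 => a == c => c == #2 => #1 <= b) _ _ _ 0z (φ-out 0≤y y∉)
        (tr (symR 0≤z0 (<⇒≤ z0<n) right (tr prior (sym halfφ)) y (<⇒≤ z0<y) (x<y⇒x≤y+1 y<n)) (cong φ (lia 3 (\z t n -> z :+ n :+ #1 :- (z :+ n :- t) == t :+ #1) z0 t n))) φt+1)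
     caseL : Even X
     caseL = case least (\t -> not (sameᵇ (A (t - + 2)) (A t))) {z + + 1} {n + + 1} (x<y⇒x+1≤y+1 z<n) of \ where
       (inr none) -> evenFrom (extend n none)
       (inl (t , a , b , p , before)) -> ⊥e (failure t a (x<y+1⇒x≤y b) (extend (t - + 1) (\s c d -> before s c (lia 2 (\s t -> s :< t :- #1 :+ #1 => s :< t) s t d))) (not-true p))
      where
      extend : ∀ b -> (∀ s -> z + + 1 ≤ s -> s < b + + 1 -> not (sameᵇ (A (s - + 2)) (A s)) ≡ false) -> Alt A 0z b
      extend b h t a le = case t + + 2 ≤? z of \ where
       (yes c) -> alt0 t a c
       (no c) -> tr (cong A (lia 1 (\t -> t == t :+ #2 :- #2) t)) (sameᵇ-≡ (not-false (h (t + + 2) (lia 2 (\t z -> ~ t :+ #2 <= z => z :+ #1 <= t :+ #2) t z c) (lia 2 (\t b -> t :+ #2 <= b => t :+ #2 :< b :+ #1) t b le))))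
   crossed : Alt A z0 n ⊎ Even X
   crossed = case z ≟ z0 + + 2 of \ where
     (yes e) -> [ (\L -> inr (Near.caseL e L)) , (\Rz -> inl (Near.alternates e Rz)) ]′ lr
     (no ne) -> let far = lia 2 (\z w -> w :+ #2 <= z => ~ z == w :+ #2 => w :+ #3 <= z) z z0 z0+2≤z ne in ⊥e ([ Far.caseL far , Far.caseR far ]′ lr)
    where
    lr = LorR z 0≤z z<n z∉ (\e -> lia 2 (\z w -> w :+ #2 <= z => z == w => ff) z _ z0+2≤z e)
 abstract
  rightShape : Pos ⊎ Alt A z0 n ⊎ Even X
  rightShape = case z0 + + 2 ≤? n - + 1 of \ where
   (no h) -> inl \t a b -> ⊥e (h (≤t a b))
   (yes h) -> case firstZero (z0 + + 2) (n - + 1) (lia 1 (\z -> #0 <= z => #0 <= z :+ #2) _ 0≤z0) h (≡⇒≤ (sym φ-start)) of \ where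
    (inr p) -> inl p
    (inl (z , a , b , z∉ , e₁ , e₂ , pos)) -> inr (crossed z a b z∉ e₁ e₂ pos)

module Pieces where
 Neg : ∀ {n} (X : NSet n) -> ℤ -> Set
 Neg X z = ∀ s -> + 2 ≤ s -> s ≤ z - + 1 -> OnSet.φ X s ≤ 0z
 Pos : ∀ {n} (X : NSet n) -> ℤ -> Set
 Pos {n} X z = ∀ t -> z + + 2 ≤ t -> t ≤ n - + 1 -> + 1 ≤ OnSet.φ X t

-- The last three names describe the two sides of z0: alternating membership, or a balance of
-- constant sign. The distances of 5 become the ranges of k and u in T and S; a shorter side counts
-- as alternating.
data HalfKind {n : ℤ} (X : NSet n) : Set where
 even : Even X -> HalfKind X
 aps : TwoAP (NSet.A X) (OnSet.k X) -> HalfKind X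
 top : (S : Solo X) -> Solo.z0 S ≡ n - + 1 -> + 1 ∈ NSet.A X -> (∀ t -> + 1 ≤ t -> t ≤ n - + 1 -> + 1 ≤ OnSet.φ X t) -> HalfKind X
 bottom : (S : Solo (rev X)) -> Solo.z0 S ≡ n - + 1 -> + 1 ∈ NSet.A (rev X) -> (∀ t -> + 1 ≤ t -> t ≤ n - + 1 -> + 1 ≤ OnSet.φ (rev X) t) -> HalfKind X
 altPos : (S : Solo X) -> + 1 ∉ NSet.A X -> n - + 1 ∉ NSet.A X -> Alt (NSet.A X) 0z (Solo.z0 S) -> Pieces.Pos X (Solo.z0 S) -> Solo.z0 S ≤ n - + 5 -> HalfKind X
 negAlt : (S : Solo X) -> + 1 ∉ NSet.A X -> n - + 1 ∉ NSet.A X -> Pieces.Neg X (Solo.z0 S) -> + 5 ≤ Solo.z0 S -> Alt (NSet.A X) (Solo.z0 S) n -> HalfKind X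
 negPos : (S : Solo X) -> + 1 ∉ NSet.A X -> n - + 1 ∉ NSet.A X -> Pieces.Neg X (Solo.z0 S) -> + 5 ≤ Solo.z0 S -> Pieces.Pos X (Solo.z0 S) -> Solo.z0 S ≤ n - + 5 -> HalfKind X

four-twoAP : ∀ {n} (X : NSet n) -> OnSet.φ X (n + + 1) ≡ + 1 -> Four X -> TwoAP (NSet.A X) (OnSet.k X)
four-twoAP {n} X h F = record { u = 0z ; v = ρ ; δ = + 4 ; p = m ; q = m - + 1 ; δ≥1 = +≤+ (ℕ.s≤s ℕ.z≤n) ; p≥0 = ≤t 0≤+ m≥1 ; q≥0 = 1≤x⇒0≤x-1 m≥1
 ; size≡ = lia 4 (\m n k f -> n == 4 *: m => f == 2 *: k :- n :- #1 => f == #1 => m :+ (m :- #1) :+ #2 == k) m n k _ n≡4m φend h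
 ; cover = \x p -> [ (\(i , a , b , e) -> inl (i , a , b , tr e (sym (0+ _)))) , inr ]′ (cls x p)
 ; in0 = \i a b -> move A (in-0 i a b) (sym (0+ _)) ; in1 = in-ρ }
 where
 open OnSet X
 open Four F

twoAP-rev : ∀ {n} (X : NSet n) {s} -> TwoAP (NSet.A (rev X)) s -> TwoAP (NSet.A X) s
twoAP-rev {n} X T = record { u = n - (u + δ * p) ; v = n - (v + δ * q) ; δ = δ ; p = p ; q = q ; δ≥1 = δ≥1 ; p≥0 = p≥0 ; q≥0 = q≥0 ; size≡ = size≡
 ; cover = \x x∈ -> [ (\(i , a , b , e) -> inl (p - i , x≤y⇒0≤y-x b , 0≤x⇒y-x≤y a , flip x u p i e))
          , (\(i , a , b , e) -> inr (q - i , x≤y⇒0≤y-x b , 0≤x⇒y-x≤y a , flip x v q i e)) ]′ (cover (n - x) (in-rev x∈ refl))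
 ; in0 = \i a b -> move A (rev-out (in0 (p - i) (x≤y⇒0≤y-x b) (0≤x⇒y-x≤y a))) (ring n u δ p i)
 ; in1 = \i a b -> move A (rev-out (in1 (q - i) (x≤y⇒0≤y-x b) (0≤x⇒y-x≤y a))) (ring n v δ q i) }
 where
 open TwoAP T
 open Rev X
 open NSet X
 ring : ∀ n u δ p i -> n - (u + δ * (p - i)) ≡ n - (u + δ * p) + δ * i
 ring = solve
 ring' : ∀ n u δ p i -> n - (n - (u + δ * i)) ≡ n - (n - (u + δ * p) + δ * (p - i))
 ring' = solve
 flip : ∀ x u p i -> n - x ≡ u + δ * i -> x ≡ n - (u + δ * p) + δ * (p - i)
 flip x u p i e = tr (tr (x≡y-[y-x] n) (cong (\y -> n - y) e)) (ring'' n u δ p i)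
  where
  ring'' : ∀ n u δ p i -> n - (u + δ * i) ≡ n - (u + δ * p) + δ * (p - i)
  ring'' = solve

even-rev : ∀ {n} (X : NSet n) -> Even (rev X) -> Even X
even-rev {n} X ev x x∈ = case ev (n - x) (in-rev x∈ refl) of \ where
  (i , e) -> case ev n (in-rev {0z} lo (+0 n)) of \ where
   (j , e') -> j - i , lia 4 (\x n i j -> n :- x == 2 *: i => n == 2 *: j => x == 2 *: (j :- i)) x n i j e e'
 where
 open Rev X
 open NSet X

module Classify {n : ℤ} (X : NSet n) (S : Solo X) where
 open SoloFacts X S hiding (half)
 module Neither (1∉ : + 1 ∉ A) (n-1∉ : n - + 1 ∉ A) where
  private
   module R = RightSide X S 1∉ n-1∉
   1∉' = tr (A-rev X (+ 1)) n-1∉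
   n-1∉' = tr (A-rev X (n - + 1)) (move A 1∉ (lia 1 (\n -> #1 == n :- (n :- #1)) n))
   module LS = RightSide (rev X) (soloRev X S) 1∉' n-1∉'
   open Rev X
   z0-odd : Σ ℤ \c -> z0 + + 1 ≡ + 2 * c
   z0-odd = count A 0z (z0 + + 1) , lia 3 (\z c f -> f == 2 *: c :- (z :+ #1 :- #0) => f == #0 => z :+ #1 == 2 *: c) z0 (count A 0z (z0 + + 1)) _ (bal-count A (0≤x⇒0≤x+1 0≤z0)) next
   n-even : n ≡ + 2 * (k - + 1)
   n-even = lia 3 (\n k f -> f == 2 *: k :- n :- #1 => f == #1 => n == 2 *: (k :- #1)) n k _ φend R.halfφ
   leftNeg : LS.Pos -> Pieces.Neg X z0
   leftNeg pos s a b = lia 4 (\f g h e -> g == e :- h => h == f => #1 <= g => e == #1 => f <= #0) _ _ _ _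
    (φ-rev (n + + 1 - s) (lia 3 (\s z n -> s <= z :- #1 => z :< n => #0 <= n :+ #1 :- s) s _ n b z0<n) (lia 2 (\s n -> #2 <= s => n :+ #1 :- s <= n :+ #1) s n a)) (cong φ (lia 2 (\s n -> n :+ #1 :- (n :+ #1 :- s) == s) s n))
    (pos (n + + 1 - s) (lia 3 (\s z n -> s <= z :- #1 => n :- z :+ #2 <= n :+ #1 :- s) s z0 n b) (lia 2 (\s n -> #2 <= s => n :+ #1 :- s <= n :- #1) s n a)) R.halfφ
   leftAlt : Alt (NSet.A (rev X)) (n - z0) n -> Alt A 0z z0
   leftAlt alt t a b = sym (tr (move' (n - (t + + 2)) (t + + 2) (lia 2 (\t n -> n :- (n :- (t :+ #2)) == t :+ #2) t n)) (tr (alt (n - (t + + 2)) (lia 3 (\t z n -> t :+ #2 <= z => n :- z <= n :- (t :+ #2)) t _ n b) (lia 2 (\t n -> #0 <= t => n :- (t :+ #2) :+ #2 <= n) t n a))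
     (sym (move' (n - (t + + 2) + + 2) t (lia 2 (\t n -> n :- (n :- (t :+ #2) :+ #2) == t) t n)))))
    where
    move' : ∀ x y -> n - x ≡ y -> A y ≡ NSet.A (rev X) x
    move' x y refl = sym (A-rev X x)
   left? : Alt A 0z z0 ⊎ (Pieces.Neg X z0 × + 5 ≤ z0) ⊎ Even X
   left? = case + 5 ≤? z0 of \ where
     (yes h) -> [ (\p -> inr (inl (leftNeg p , h))) , [ (\a -> inl (leftAlt a)) , (\e -> inr (inr (even-rev X e))) ]′ ]′ LS.rightShape
     -- As z0 is odd, it is 1 or 3 here, and the alternation amounts to 1 being a hole and z0 - 1 a
     -- member.
     (no h) -> inl \t a b -> small t a b (lia 3 (\t z c -> z :+ #1 == 2 *: c => ~ #5 <= z => #0 <= t => t :+ #2 <= z => z == #3 :∧ (t == #0 :∨ t == #1)) t _ (fst z0-odd) (snd z0-odd) h a b)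
    where
    small : ∀ t -> 0z ≤ t -> t + + 2 ≤ z0 -> z0 ≡ + 3 × (t ≡ 0z ⊎ t ≡ + 1) -> A t ≡ A (t + + 2)
    small t _ _ (e , inl e') = tr (tr (cong A e') lo) (sym (tr (cong A (lia 2 (\t z -> z == #3 => t == #0 => t :+ #2 == z :- #1) t _ e e')) R.z0-1∈))
    small t _ _ (e , inr e') = tr (tr (cong A e') 1∉) (sym (tr (cong A (lia 2 (\t z -> z == #3 => t == #1 => t :+ #2 == z) t _ e e')) hole))
   right? : Alt A z0 n ⊎ (Pieces.Pos X z0 × z0 ≤ n - + 5) ⊎ Even X
   right? = case z0 ≤? n - + 5 of \ where
     (yes h) -> [ (\p -> inr (inl (p , h))) , [ inl , (\e -> inr (inr e)) ]′ ]′ R.rightShape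
     (no h) -> inl \t a b -> small t a b (lia 5 (\t z n c k -> z :+ #1 == 2 *: c => n == 2 *: (k :- #1) => ~ z <= n :- #5 => z <= t => t :+ #2 <= n => z == n :- #3 :∧ (t == z :∨ t == z :+ #1)) t _ n (fst z0-odd) k (snd z0-odd) n-even h a b)
    where
    small : ∀ t -> z0 ≤ t -> t + + 2 ≤ n -> z0 ≡ n - + 3 × (t ≡ z0 ⊎ t ≡ z0 + + 1) -> A t ≡ A (t + + 2)
    small t _ _ (e , inl e') = tr (tr (cong A e') hole) (sym (tr (cong A (lia 3 (\t z n -> z == n :- #3 => t == z => t :+ #2 == n :- #1) t _ n e e')) n-1∉))
    small t _ _ (e , inr e') = tr (tr (cong A e') R.z0+1∈) (sym (tr (cong A (lia 3 (\t z n -> z == n :- #3 => t == z :+ #1 => t :+ #2 == n) t _ n e e')) hi))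
   bothAlt : Alt A 0z z0 -> Alt A z0 n -> Even X
   bothAlt l r x x∈ = case half (fst (supp x∈)) of \ where
    (inl (i , _ , e)) -> i , e
    (inr (i , 0≤i , e)) -> clash x∈ (case x ≤? z0 of \ where
     (yes h) -> tr (cong A (tr e (+-comm (+ 2 * i) (+ 1)))) (tr (sym (alt-run A l 0≤i (+ 1) 0≤+ (subst (_≤ z0) (tr e (+-comm (+ 2 * i) (+ 1))) h))) 1∉)
     (no h) -> let
       j = i + + 1 - fst z0-odd
       e₁ = lia 4 (\x i z c -> x == 2 *: i :+ #1 => z :+ #1 == 2 *: c => x == z :+ 2 *: (i :+ #1 :- c)) x i z0 (fst z0-odd) e (snd z0-odd)
      in tr (cong A e₁) (tr (sym (alt-run A r {j} (lia 4 (\x z i c -> ~ x <= z => x == 2 *: i :+ #1 => z :+ #1 == 2 *: c => #0 <= i :+ #1 :- c) x _ i (fst z0-odd) h e (snd z0-odd)) z0 ≤r (subst (_≤ n) e₁ (snd (supp x∈))))) hole))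
  abstract
   neither : HalfKind X
   neither = [ (\la -> [ (\ra -> even (bothAlt la ra)) , [ (\(p , h) -> altPos S 1∉ n-1∉ la p h) , even ]′ ]′ right?)
    , [ (\(ng , h) -> [ (\ra -> negAlt S 1∉ n-1∉ ng h ra) , [ (\(p , h') -> negPos S 1∉ n-1∉ ng h p h') , even ]′ ]′ right?) , even ]′ ]′ left?
 abstract
  classify : HalfKind X
  classify = case mem? A (+ 1) of \ where
   (inl 1∈) -> case z0 ≟ n - + 1 of \ where
    (yes e) -> top S e 1∈ (OneIn.positive X S 1∈ e)
    (no ne) -> aps (OneIn.twoIntervals X S 1∈ (lia 2 (\z n -> z :< n => ~ z == n :- #1 => z :< n :- #1) _ n z0<n ne))
   (inr 1∉) -> case mem? A (n - + 1) of \ where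
    (inr n-1∉) -> Neither.neither 1∉ n-1∉
    (inl n-1∈) -> let
      S' = soloRev X S
      1∈' : + 1 ∈ NSet.A (rev X)
      1∈' = tr (A-rev X (+ 1)) n-1∈
     in case n - z0 ≟ n - + 1 of \ where
     (yes e) -> bottom S' e 1∈' (OneIn.positive (rev X) S' 1∈' e)
     (no ne) -> aps (subst (TwoAP A) (Rev.k-rev X) (twoAP-rev X (OneIn.twoIntervals (rev X) S' 1∈' (lia 2 (\z n -> #1 <= z => ~ n :- z == n :- #1 => n :- z :< n :- #1) _ n z0≥1 ne))))

abstract
 halfKind : ∀ {n} (X : NSet n) -> n ≡ + 2 * OnSet.k X - + 2 -> OnSet.dd X ≡ + 3 * OnSet.k X - + 3 -> HalfKind X
 halfKind {n} X e e' = [ even , [ (\f -> aps (four-twoAP X h f)) , Classify.classify X ]′ ]′ (HalfSplit.halfSplit X h tot)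
  where
  open OnSet X
  h : φ (n + + 1) ≡ + 1
  h = tr φend (lia 2 (\n k -> n == 2 *: k :- #2 => 2 *: k :- n :- #1 == #1) n k e)
  tot : ∑ ex 0z n ≡ - + 1
  tot = tr ∑ex (lia 3 (\n k d -> n == 2 *: k :- #2 => d == 3 *: k :- #3 => d :- n :- k == con (- + 1)) n k _ e e')

-- Arithmetic progressions, common divisors and generation by sums

ap : ℤ -> ℤ -> ℤ -> 𝔹
ap u δ p x = some (\i -> bool (x ≟ u + δ * i)) 0z (p + + 1)

in-ap : ∀ u δ p {x} i -> 0z ≤ i -> i ≤ p -> x ≡ u + δ * i -> x ∈ ap u δ p
in-ap u δ p {x} i a b e = in-some _ i a (x≤y⇒x<y+1 b) (in-bool (x ≟ u + δ * i) e)

ap-out : ∀ u δ p {x} -> x ∈ ap u δ p -> Σ ℤ \i -> 0z ≤ i × i ≤ p × x ≡ u + δ * i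
ap-out u δ p {x} q = case some-in _ q of \ where
 (i , a , b , c) -> i , a , x<y+1⇒x≤y b , bool-in (x ≟ u + δ * i) c

count-ins≤ : ∀ c P {a b} -> a ≤ b -> count (ins c P) a b ≤ count P a b + + 1
count-ins≤ c P {a} {b} a≤b = ≤t (∑-mono (χ (ins c P)) (\x -> χ P x + χ (point c) x) a≤b (\x _ _ -> pt x)) (subst (_≤ count P a b + + 1) (sym (∑-+ (χ P) (χ (point c)) a≤b)) (+-monoʳ-≤ (count P a b) one))
 where
 pt : ∀ x -> χ (ins c P) x ≤ χ P x + χ (point c) x
 pt x with P x
 ... | false = ≡⇒≤ (sym (0+ _))
 ... | true = lia 1 (\p -> #0 <= p => #1 <= #1 :+ p) _ (χ≥0 (point c) x)
 one : count (point c) a b ≤ + 1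
 one = case a ≤? c of \ where
   (yes p) -> case c <? b of \ where
    (yes q) -> ≡⇒≤ (count-point c p q)
    (no q) -> none \x d e f -> q (subst (_< b) f e)
   (no p) -> none \x d e f -> p (subst (a ≤_) f d)
  where
  none : (∀ x -> a ≤ x -> x < b -> ¬ x ≡ c) -> count (point c) a b ≤ + 1
  none h = ≤t (≡⇒≤ (tr (∑-cong (χ (point c)) (\_ -> 0z) a≤b (\x p q -> χ-out (out-bool (x ≟ c) (h x p q)))) (∑-zero a≤b))) 0≤+

count-ap : ∀ u δ {a b} -> a ≤ b -> ∀ {p} -> 0z ≤ p -> count (ap u δ p) a b ≤ p + + 1
count-ap u δ {a} {b} a≤b = rise (\p -> count (ap u δ p) a b ≤ p + + 1)
 (≤t (count-⊂ (ap u δ 0z) (ins (u + δ * 0z) (\_ -> false)) a≤b (\{x} q -> case ap-out u δ 0z q of \ where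
   (i , c , d , e) -> tr (cong (\t -> bool (x ≟ t)) refl) (in-bool (x ≟ u + δ * 0z) (tr e (cong (\j -> u + δ * j) (≤≥ d c))))))
  (≤t (count-ins≤ (u + δ * 0z) (\_ -> false) a≤b) (≡⇒≤ (cong (_+ + 1) (∑-zero a≤b)))))
 (\p 0≤p ih -> ≤t (count-⊂ (ap u δ (p + + 1)) (ins (u + δ * (p + + 1)) (ap u δ p)) a≤b (\{x} q -> case ap-out u δ (p + + 1) q of \ where
   (i , c , d , e) -> case i ≤? p of \ where
    (yes h) -> ∨-l (in-ap u δ p i c h e)
    (no h) -> ∨-r (ap u δ p x) (in-bool (x ≟ u + δ * (p + + 1)) (tr e (cong (\j -> u + δ * j) (lia 2 (\i p -> i <= p :+ #1 => ~ i <= p => i == p :+ #1) i p d h))))))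
  (≤t (count-ins≤ (u + δ * (p + + 1)) (ap u δ p) a≤b) (+-monoˡ-≤ (+ 1) ih)))
 where
 ∨-l : ∀ {a b} -> a ≡ true -> a ∨ b ≡ true
 ∨-l refl = refl
 ∨-r : ∀ a {b} -> b ≡ true -> a ∨ b ≡ true
 ∨-r true _ = refl
 ∨-r false e = e

record BiAP (P : 𝔹) (size : ℤ) : Set where
 field
  two : TwoAP P size
 open TwoAP two public
 field
  d01 : ∀ {x} -> x ∈ ap (u + u) δ (p + p) -> x ∈ ap (u + v) δ (p + q) -> ⊥
  d02 : ∀ {x} -> x ∈ ap (u + u) δ (p + p) -> x ∈ ap (v + v) δ (q + q) -> ⊥
  d12 : ∀ {x} -> x ∈ ap (u + v) δ (p + q) -> x ∈ ap (v + v) δ (q + q) -> ⊥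

abstract
 -- Three progressions with (2p + 1) + (p + q + 1) + (2q + 1) = 3k - 3 terms cover 2A. If 2A is no
 -- smaller, no integer lies in two of them.
 twoAP-biAP : ∀ {n} (X : NSet n) -> TwoAP (NSet.A X) (OnSet.k X) -> + 3 * OnSet.k X - + 3 ≤ OnSet.dd X -> BiAP (NSet.A X) (OnSet.k X)
 twoAP-biAP {n} X T big = record { two = T
   ; d01 = \{x} a b -> tooSmall x (D0 a) (lia 3 (\a b c -> a == #1 => b == #1 => #0 <= c => #2 <= a :+ b :+ c) _ _ _ (χ-in a) (χ-in b) (χ≥0 U2 x))
   ; d02 = \{x} a b -> tooSmall x (D0 a) (lia 3 (\a b c -> a == #1 => c == #1 => #0 <= b => #2 <= a :+ b :+ c) _ _ _ (χ-in a) (χ-in b) (χ≥0 U1 x))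
   ; d12 = \{x} a b -> tooSmall x (D1 a) (lia 3 (\a b c -> b == #1 => c == #1 => #0 <= a => #2 <= a :+ b :+ c) _ _ _ (χ-in a) (χ-in b) (χ≥0 U0 x)) }
  where
  open OnSet X
  open TwoAP T
  U0 U1 U2 : 𝔹
  U0 = ap (u + u) δ (p + p)
  U1 = ap (u + v) δ (p + q)
  U2 = ap (v + v) δ (q + q)
  N : ℤ
  N = n + n + + 1
  0≤N : 0z ≤ N
  0≤N = 0≤x⇒0≤x+x+1 0≤n
  ring : ∀ u v δ i j -> u + δ * i + (v + δ * j) ≡ u + v + δ * (i + j)
  ring = solve
  sum≤ : ∀ i p j q -> i ≤ p -> j ≤ q -> i + j ≤ p + q
  sum≤ _ _ _ _ = +≤
  indices : ∀ p q i -> 0z ≤ p -> 0z ≤ q -> 0z ≤ i -> i ≤ p + q -> Σ ℤ \a -> Σ ℤ \b -> (0z ≤ a × a ≤ p) × (0z ≤ b × b ≤ q) × a + b ≡ i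
  indices p q i 0≤p 0≤q a b = case i ≤? p of \ where
   (yes h) -> i , 0z , (a , h) , (≤r , 0≤q) , +0 i
   (no h) -> p , i - p , (0≤p , ≤r) , (lia 2 (\i p -> ~ i <= p => #0 <= i :- p) i p h , lia 3 (\i p q -> i <= p :+ q => i :- p <= q) i p q b) , lia 2 (\i p -> p :+ (i :- p) == i) i p
  D0 : ∀ {x} -> x ∈ U0 -> x ∈ D
  D0 h = case ap-out (u + u) δ (p + p) h of \ where
   (i , a , b , e) -> case indices p p i p≥0 p≥0 a b of \ where
    (c , d , (c1 , c2) , (d₁ , d2) , e') -> D-in (in0 c c1 c2) (in0 d d₁ d2) (tr (ring u u δ c d) (tr (cong (\j -> u + u + δ * j) e') (sym e)))
  D1 : ∀ {x} -> x ∈ U1 -> x ∈ D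
  D1 h = case ap-out (u + v) δ (p + q) h of \ where
   (i , a , b , e) -> case indices p q i p≥0 q≥0 a b of \ where
    (c , d , (c1 , c2) , (d₁ , d2) , e') -> D-in (in0 c c1 c2) (in1 d d₁ d2) (tr (ring u v δ c d) (tr (cong (\j -> u + v + δ * j) e') (sym e)))
  covers : ∀ x -> x ∈ D -> + 1 ≤ χ U0 x + χ U1 x + χ U2 x
  covers x h = case D-out h of \ where
   (a , b , a∈ , b∈ , e) -> case cover a a∈ of \ where
    (inl (i , i1 , i2 , e₁)) -> case cover b b∈ of \ where
     (inl (j , j1 , j₂ , e₂)) -> lia 3 (\a b c -> a == #1 => #0 <= b => #0 <= c => #1 <= a :+ b :+ c) _ _ _ (χ-in (in-ap (u + u) δ (p + p) (i + j) (+≤ i1 j1) (+≤ i2 j₂) (tr (sym e) (tr (cong₂ _+_ e₁ e₂) (ring u u δ i j))))) (χ≥0 U1 x) (χ≥0 U2 x)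
     (inr (j , j1 , j₂ , e₂)) -> lia 3 (\a b c -> b == #1 => #0 <= a => #0 <= c => #1 <= a :+ b :+ c) _ _ _ (χ-in (in-ap (u + v) δ (p + q) (i + j) (+≤ i1 j1) (+≤ i2 j₂) (tr (sym e) (tr (cong₂ _+_ e₁ e₂) (ring u v δ i j))))) (χ≥0 U0 x) (χ≥0 U2 x)
    (inr (i , i1 , i2 , e₁)) -> case cover b b∈ of \ where
     (inl (j , j1 , j₂ , e₂)) -> lia 3 (\a b c -> b == #1 => #0 <= a => #0 <= c => #1 <= a :+ b :+ c) _ _ _ (χ-in (in-ap (u + v) δ (p + q) (j + i) (+≤ j1 i1) (+≤ j₂ i2) (tr (sym e) (tr (+-comm a b) (tr (cong₂ _+_ e₂ e₁) (ring u v δ j i)))))) (χ≥0 U0 x) (χ≥0 U2 x)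
     (inr (j , j1 , j₂ , e₂)) -> lia 3 (\a b c -> c == #1 => #0 <= a => #0 <= b => #1 <= a :+ b :+ c) _ _ _ (χ-in (in-ap (v + v) δ (q + q) (i + j) (+≤ i1 j1) (+≤ i2 j₂) (tr (sym e) (tr (cong₂ _+_ e₁ e₂) (ring v v δ i j))))) (χ≥0 U0 x) (χ≥0 U1 x)
  three : ∑ (\x -> χ U0 x + χ U1 x + χ U2 x) 0z N ≤ + 3 * k - + 3
  three = subst (_≤ + 3 * k - + 3) (sym (tr (∑-+ (\x -> χ U0 x + χ U1 x) (χ U2) 0≤N) (cong (_+ count U2 0z N) (∑-+ (χ U0) (χ U1) 0≤N))))
   (lia 6 (\a b c p q k -> a <= p :+ p :+ #1 => b <= p :+ q :+ #1 => c <= q :+ q :+ #1 => p :+ q :+ #2 == k => a :+ b :+ c <= 3 *: k :- #3) _ _ _ p q k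
    (count-ap (u + u) δ 0≤N (+≤ p≥0 p≥0)) (count-ap (u + v) δ 0≤N (+≤ p≥0 q≥0)) (count-ap (v + v) δ 0≤N (+≤ q≥0 q≥0)) size≡)
  tooSmall : ∀ x -> x ∈ D -> + 2 ≤ χ U0 x + χ U1 x + χ U2 x -> ⊥
  tooSmall x x∈ h = lia 5 (\d s c t k -> s == d :+ c => c == #1 => s <= t => t <= 3 *: k :- #3 => 3 *: k :- #3 <= d => ff) _ _ _ _ k
   (∑-+ (χ D) (χ (point x)) 0≤N) (count-point x (fst (D-supp x∈)) (x≤y⇒x<y+1 (snd (D-supp x∈)))) (∑-mono _ _ 0≤N (\y _ _ -> ptwise y)) three big
   where
   ptwise : ∀ y -> χ D y + χ (point x) y ≤ χ U0 y + χ U1 y + χ U2 y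
   ptwise y = case y ≟ x of \ where
    (yes e) -> lia 5 (\d p a b c -> d <= #1 => p <= #1 => #2 <= a :+ b :+ c => d :+ p <= a :+ b :+ c) _ _ (χ U0 y) (χ U1 y) (χ U2 y) (χ≤1 D y) (χ≤1 (point x) y) (subst (\y -> + 2 ≤ χ U0 y + χ U1 y + χ U2 y) (sym e) h)
    (no ne) -> case mem? D y of \ where
     (inl y∈) -> lia 5 (\d p a b c -> d <= #1 => p == #0 => #1 <= a :+ b :+ c => d :+ p <= a :+ b :+ c) _ _ (χ U0 y) (χ U1 y) (χ U2 y) (χ≤1 D y) (χ-out (out-bool (y ≟ x) ne)) (covers y y∈)
     (inr y∉) -> lia 5 (\d p a b c -> d == #0 => p == #0 => #0 <= a => #0 <= b => #0 <= c => d :+ p <= a :+ b :+ c) _ _ _ _ _ (χ-out y∉) (χ-out (out-bool (y ≟ x) ne)) (χ≥0 U0 y) (χ≥0 U1 y) (χ≥0 U2 y)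

Fresh : 𝔹 -> List ℤ -> Set
Fresh P [] = ⊤
Fresh P (c ∷ cs) = c ∉ P × All (\d -> ¬ c ≡ d) cs × Fresh P cs

insAll : List ℤ -> 𝔹 -> 𝔹
insAll [] P = P
insAll (c ∷ cs) P = ins c (insAll cs P)

insAll-not : ∀ cs P {x} -> x ∉ P -> All (\d -> ¬ x ≡ d) cs -> x ∉ insAll cs P
insAll-not [] P p _ = p
insAll-not (c ∷ cs) P p (n ∷ ns) = ins-not c (insAll cs P) (insAll-not cs P p ns) n

count-extra : ∀ P Q {a b} cs -> a ≤ b -> Fresh P cs -> All (\c -> (a ≤ c × c < b) × c ∈ Q) cs -> (∀ {x} -> x ∈ P -> x ∈ Q) -> count P a b + + length cs ≤ count Q a b
count-extra P Q {a} {b} cs a≤b fr ws sub = ≤t (≡⇒≤ (sym (size cs fr ws))) (count-⊂ (insAll cs P) Q a≤b (inQ cs ws))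
 where
 size : ∀ cs -> Fresh P cs -> All (\c -> (a ≤ c × c < b) × c ∈ Q) cs -> count (insAll cs P) a b ≡ count P a b + + length cs
 size [] _ _ = sym (+0 _)
 size (c ∷ cs) (p , ns , fr) (((l , h) , _) ∷ ws) = tr (count-ins c (insAll cs P) (insAll-not cs P p ns) l h)
  (lia 3 (\s t m -> s == t :+ m => s :+ #1 == t :+ (#1 :+ m)) _ (count P a b) (+ length cs) (size cs fr ws))
 inQ : ∀ cs -> All (\c -> (a ≤ c × c < b) × c ∈ Q) cs -> ∀ {x} -> x ∈ insAll cs P -> x ∈ Q
 inQ [] _ p = sub p
 inQ (c ∷ cs) ((_ , q) ∷ ws) p = [ inQ cs ws , (\e -> move Q q (sym e)) ]′ (ins-out c (insAll cs P) p)

count-ap≡ : ∀ u δ {a b} -> + 1 ≤ δ -> a ≤ u -> ∀ {p} -> 0z ≤ p -> u + δ * p < b -> count (ap u δ p) a b ≡ p + + 1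
count-ap≡ u δ {a} {b} δ≥1 a≤u {p} 0≤p lt = ≤≥ (count-ap u δ a≤b 0≤p) (lower 0≤p lt)
 where
 0≤δ = ≤t 0≤+ δ≥1
 a≤b = lia 4 (\a u m b -> a <= u => #0 <= m => u :+ m :< b => a <= b) a u _ b a≤u (*-nonneg 0≤δ 0≤p) lt
 lower = rise (\p -> u + δ * p < b -> p + + 1 ≤ count (ap u δ p) a b)
  (\lt -> subst (_≤ count (ap u δ 0z) a b) (count-point u a≤u (subst (_< b) (u0) lt)) (count-⊂ (point u) (ap u δ 0z) a≤b (\{x} q -> in-ap u δ 0z 0z ≤r ≤r (tr (bool-in (x ≟ u) q) (sym u0)))))
  (\p 0≤p ih lt -> let
    lt' = lia 5 (\u m m' d b -> u :+ m' :< b => m' == m :+ d => #1 <= d => u :+ m :< b) u (δ * p) _ δ b lt (*-step δ p) δ≥1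
    c = u + δ * (p + + 1)
   in ≤t (+-monoˡ-≤ (+ 1) (ih lt')) (≤t (≡⇒≤ (sym (count-ins c (ap u δ p) (out \q -> fresh p q) (lia 3 (\a u m -> a <= u => #0 <= m => a <= u :+ m) a u _ a≤u (*-nonneg 0≤δ (0≤x⇒0≤x+1 0≤p))) lt)))
    (count-⊂ (ins c (ap u δ p)) (ap u δ (p + + 1)) a≤b (\q -> [ (\r -> case ap-out u δ p r of \(i , x , y , e) -> in-ap u δ (p + + 1) i x (lia 2 (\i p -> i <= p => i <= p :+ #1) i p y) e) , (\e -> in-ap u δ (p + + 1) (p + + 1) (0≤x⇒0≤x+1 0≤p) ≤r e) ]′ (ins-out c (ap u δ p) q)))))
  where
  u0 = tr (cong (\m -> u + m) (*0 δ)) (+0 u)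
  fresh : ∀ p -> u + δ * (p + + 1) ∈ ap u δ p -> ⊥
  fresh p q = case ap-out u δ p q of \ where
    (i , _ , b , e) -> lia 4 (\u m m' d -> u :+ m == u :+ m' => #0 <= m :- m' :- d => #1 <= d => ff) u (δ * (p + + 1)) (δ * i) δ e (subst (0z ≤_) (ring δ p i) (*-nonneg 0≤δ (x≤y⇒0≤y-x b))) δ≥1
   where
   ring : ∀ δ p i -> δ * (p - i) ≡ δ * (p + + 1) - δ * i - δ
   ring = solve

mkTwoAP : ∀ {n} (X : NSet n) u v δ p q -> + 1 ≤ δ -> 0z ≤ p -> 0z ≤ q ->
 (∀ x -> x ∈ NSet.A X -> (Σ ℤ \i -> 0z ≤ i × i ≤ p × x ≡ u + δ * i) ⊎ (Σ ℤ \i -> 0z ≤ i × i ≤ q × x ≡ v + δ * i)) ->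
 (∀ i -> 0z ≤ i -> i ≤ p -> u + δ * i ∈ NSet.A X) -> (∀ i -> 0z ≤ i -> i ≤ q -> v + δ * i ∈ NSet.A X) ->
 (∀ i j -> 0z ≤ i -> i ≤ p -> 0z ≤ j -> j ≤ q -> ¬ u + δ * i ≡ v + δ * j) -> TwoAP (NSet.A X) (OnSet.k X)
mkTwoAP {n} X u v δ p q δ≥1 p≥0 q≥0 cover in0 in1 disj = record { u = u ; v = v ; δ = δ ; p = p ; q = q ; δ≥1 = δ≥1 ; p≥0 = p≥0 ; q≥0 = q≥0 ; cover = cover ; in0 = in0 ; in1 = in1
 ; size≡ = lia 5 (\k a b p q -> k == a :+ b => a == p :+ #1 => b == q :+ #1 => p :+ q :+ #2 == k) k _ _ p q
   (tr (∑-cong (χ A) (\x -> χ P x + χ Q x) 0≤n+1 (\x _ _ -> pt x)) (∑-+ (χ P) (χ Q) 0≤n+1)) (size u p p≥0 in0) (size v q q≥0 in1) }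
 where
 open OnSet X
 N = n + + 1
 P Q : 𝔹
 P = ap u δ p
 Q = ap v δ q
 size : ∀ u p -> 0z ≤ p -> (∀ i -> 0z ≤ i -> i ≤ p -> u + δ * i ∈ A) -> count (ap u δ p) 0z N ≡ p + + 1
 size u p p≥0 h = count-ap≡ u δ δ≥1 (fst (supp (move A (h 0z ≤r p≥0) (tr (cong (\m -> u + m) (*0 δ)) (+0 u))))) p≥0 (x≤y⇒x<y+1 (snd (supp (h p p≥0 ≤r))))
 pt : ∀ x -> χ A x ≡ χ P x + χ Q x
 pt x = case mem? P x of \ where
  (inl a) -> case mem? Q x of \ where
   (inl b) -> case ap-out u δ p a of \(i , i1 , i2 , e) -> case ap-out v δ q b of \(j , j1 , j₂ , e') -> ⊥e (disj i j i1 i2 j1 j₂ (tr (sym e) e'))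
   (inr b) -> tr (χ-in (case ap-out u δ p a of \(i , i1 , i2 , e) -> move A (in0 i i1 i2) (sym e))) (sym (cong₂ _+_ (χ-in a) (χ-out b)))
  (inr a) -> case mem? Q x of \ where
   (inl b) -> tr (χ-in (case ap-out v δ q b of \(i , i1 , i2 , e) -> move A (in1 i i1 i2) (sym e))) (sym (cong₂ _+_ (χ-out a) (χ-in b)))
   (inr b) -> tr (χ-out (out \c -> [ (\(i , i1 , i2 , e) -> clash (in-ap u δ p i i1 i2 e) a) , (\(i , i1 , i2 , e) -> clash (in-ap v δ q i i1 i2 e) b) ]′ (cover x c))) (sym (cong₂ _+_ (χ-out a) (χ-out b)))

Div : ℤ -> ℤ -> Set
Div d a = Σ ℤ \q -> a ≡ d * q

div? : ∀ d a -> + 1 ≤ d -> 0z ≤ a -> Dec (Div d a)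
div? d a d≥1 0≤a = case divide d≥1 0≤a of \ where
  (r , i , 0≤r , r<d , _ , e) -> case r ≟ 0z of \ where
   (yes z) -> yes (i , tr e (tr (cong (_+ d * i) z) (0+ _)))
   (no nz) -> no \(j , e') -> nz (unique d r (j - i) d≥1 0≤r r<d (lia 4 (\a r m m' -> a == r :+ m => a == m' => r == m' :- m) a r (d * i) _ e e' |> \h -> tr h (ring d i j)))
 where
 ring : ∀ d i j -> d * j - d * i ≡ d * (j - i)
 ring = solve
 unique : ∀ d r m -> + 1 ≤ d -> 0z ≤ r -> r < d -> r ≡ d * m -> r ≡ 0z
 unique d r m d≥1 0≤r r<d e = case <-cmp m 0z of \ where
   (tri≈ _ z _) -> tr e (tr (cong (d *_) z) (*0 d))
   (tri> _ _ m>0) -> ⊥e (lia 3 (\r d w -> r == w => r :< d => #0 <= w :- d => ff) r d _ e r<d (subst (0z ≤_) (ring1 d m) (*-nonneg (≤t 0≤+ d≥1) (lia 1 (\m -> #0 :< m => #0 <= m :- #1) m m>0))))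
   (tri< m<0 _ _) -> ⊥e (lia 3 (\r d w -> r == w => #0 <= r => #1 <= d => #0 <= #0 :- w :- d => ff) r d _ e 0≤r d≥1 (subst (0z ≤_) (ring2 d m) (*-nonneg (≤t 0≤+ d≥1) (lia 1 (\m -> m :< #0 => #0 <= #0 :- m :- #1) m m<0))))
  where
  ring1 : ∀ d m -> d * (m - + 1) ≡ d * m - d
  ring1 = solve
  ring2 : ∀ d m -> d * (0z - m - + 1) ≡ 0z - d * m - d
  ring2 = solve

Coprime : ∀ {n} -> NSet n -> Set
Coprime X = ∀ d -> + 2 ≤ d -> (∀ a -> a ∈ NSet.A X -> Div d a) -> ⊥

-- A common divisor divides n, so the search may stop at n.
coprime? : ∀ {n} (X : NSet n) -> + 1 ≤ n -> Coprime X ⊎ (Σ ℤ \d -> + 2 ≤ d × (∀ a -> a ∈ NSet.A X -> Div d a))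
coprime? {n} X n≥1 = case ∃? common {+ 2} {n + + 1} (lia 1 (\n -> #1 <= n => #2 <= n :+ #1) n n≥1) of \ where
   (inl (d , a , _ , p)) -> inr (d , a , \x x∈ -> decidable-stable (div? d x (d≥1 a) (fst (supp x∈))) \nd -> clash (in-some _ x (fst (supp x∈)) (x≤y⇒x<y+1 (snd (supp x∈))) (in-∧ x∈ (in-bad d x nd))) (not-true p))
   (inr none) -> inl \d a h -> case d ≤? n of \ where
    (yes le) -> case some-in (bad d) {0z} {n + + 1} (not-false (none d a (x≤y⇒x<y+1 le))) of \(x , _ , _ , q) -> bad-out d x (d≥1 a) (fst (supp (fst (∧-in {A x} q)))) (h x (fst (∧-in q))) (snd (∧-in {A x} q))
    (no gt) -> case h n hi of \(q , e) -> case + 1 ≤? q of \ where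
      (yes q≥1) -> lia 3 (\d n w -> n == w => #0 <= w :- d => ~ d <= n => ff) d n _ e (subst (0z ≤_) (ring d q) (*-nonneg (≤t 0≤+ a) (1≤x⇒0≤x-1 q≥1))) gt
      (no q<1) -> q<1 (*-pos⁻ d q (≤t 1≤+ a) (lia 2 (\n w -> n == w => #1 <= n => #0 :< w) n _ e n≥1))
 where
 open NSet X
 d≥1 : ∀ {d} -> + 2 ≤ d -> + 1 ≤ d
 d≥1 = ≤t 1≤+
 ring : ∀ d q -> d * (q - + 1) ≡ d * q - d
 ring = solve
 notDiv : ℤ -> 𝔹
 notDiv d x with + 1 ≤? d | 0z ≤? x
 ... | yes p | yes q = not (bool (div? d x p q))
 ... | _ | _ = true
 bad : ℤ -> 𝔹
 bad d x = A x ∧ notDiv d x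
 in-bad : ∀ d x -> ¬ Div d x -> notDiv d x ≡ true
 in-bad d x nd with + 1 ≤? d | 0z ≤? x
 ... | yes p | yes q = cong not (out-bool (div? d x p q) nd)
 ... | no _ | yes _ = refl
 ... | yes _ | no _ = refl
 ... | no _ | no _ = refl
 bad-out : ∀ d x -> + 1 ≤ d -> 0z ≤ x -> Div d x -> notDiv d x ≡ true -> ⊥
 bad-out d x d≥1 0≤x dv e with + 1 ≤? d | 0z ≤? x
 ... | yes p | yes q = clash (in-bool (div? d x p q) dv) (not-true e)
 ... | no p | _ = p d≥1
 ... | yes _ | no q = q 0≤x
 common : 𝔹
 common d = not (some (bad d) 0z (n + + 1))

Gen : ∀ {n} -> NSet n -> ℤ -> Set
Gen X x = Σ ℤ \a -> Σ ℤ \b -> (a ∈ NSet.A X × 0z < a) × (b ∈ NSet.A X × 0z < b) × a + b ≡ x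

-- Strong induction: both summands are positive, hence smaller than x.
multiples : ∀ {n} (X : NSet n) g -> (∀ x -> x ∈ NSet.A X -> 0z < x -> ¬ x ≡ g -> Gen X x) -> ∀ x -> x ∈ NSet.A X -> Div g x
multiples X g gen x x∈ = go (∣ x ∣) x x∈ (≡⇒≤ (sym (∣+∣ (fst (supp x∈)))))
 where
 open NSet X
 go : ∀ m x -> x ∈ A -> x ≤ + m -> Div g x
 go m x x∈ le = case x ≟ 0z of \ where
   (yes z) -> 0z , tr z (sym (*0 g))
   (no nz) -> case x ≟ g of \ where
    (yes e) -> + 1 , tr e (sym (*1 g))
    (no ne) -> rec m le (gen x x∈ (≤≢⇒< (fst (supp x∈)) (\e -> nz (sym e))) ne)
  where
  rec : ∀ m -> x ≤ + m -> Gen X x -> Div g x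
  rec zero le (a , b , (_ , 0<a) , (_ , 0<b) , e) = ⊥e (lia 3 (\a b x -> x <= #0 => #0 :< a => #0 :< b => a :+ b == x => ff) a b x le 0<a 0<b e)
  rec (suc m) le (a , b , (a∈ , 0<a) , (b∈ , 0<b) , e) = case go m a a∈ (lia 4 (\a b x m -> x <= #1 :+ m => #0 :< b => a :+ b == x => a <= m) a b x _ le 0<b e) of \ where
   (i , e₁) -> case go m b b∈ (lia 4 (\a b x m -> x <= #1 :+ m => #0 :< a => a :+ b == x => b <= m) a b x _ le 0<a e) of \ where
    (j , e₂) -> i + j , tr (sym e) (tr (cong₂ _+_ e₁ e₂) (sym (*-distribˡ-+ g i j)))

-- Removing the maximum

module Peel {n : ℤ} (X : NSet n) (k≥2 : + 2 ≤ OnSet.k X) where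
 open OnSet X
 n≥1 = lia 2 (\n k -> #2 <= k => k <= n :+ #1 => #1 <= n) n k k≥2 k≤n+1
 abstract
  pred : Greatest A 0z n
  pred = [ (\g -> g) , (\none -> clash lo (none 0z ≤r (1≤x⇒0<x n≥1))) ]′ (greatest A {0z} {n} 0≤n)
 n' = fst pred
 n'<n = fst (snd (snd pred))
 n'∈ = fst (snd (snd (snd pred)))
 gap = snd (snd (snd (snd pred)))
 g = n - n'
 Y = cut X n' n'∈
 module Y = OnSet Y
 open Cut X n' n'∈ public
 split : ∀ {a} -> a ∈ A -> a ≡ n ⊎ a ∈ Y.A
 split {a} p = case a ≤? n' of \ where
  (yes h) -> inr (cut-in p h)
  (no h) -> case a <? n of \ where
   (yes h') -> clash p (gap a (≰⇒> h) h')
   (no h') -> inl (≤≥ (snd (supp p)) (≮⇒≥ h'))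
 kY = tr k-split (cong (\s -> Y.k + s) (tr (∑-step (χ A) (n' + + 1) n le) (cong₂ _+_ (tr (∑-cong (χ A) (\_ -> 0z) le (\x a b -> χ-out (gap x (lia 2 (\x m -> m :+ #1 <= x => m :< x) x _ a) b))) (∑-zero le)) (χ-in hi))))
  where
  le = x<y⇒x+1≤y n'<n
 D-split : ∀ {x} -> x ∈ D -> x ∈ Y.D ⊎ Σ ℤ \a -> a ∈ A × x ≡ n + a
 D-split p = case D-out p of \ where
  (a , b , a∈ , b∈ , e) -> case split a∈ of \ where
   (inl e') -> inr (b , b∈ , tr (sym e) (cong (_+ b) e'))
   (inr a∈') -> case split b∈ of \ where
    (inl e') -> inr (a , a∈ , tr (sym e) (tr (+-comm a b) (cong (_+ a) e')))
    (inr b∈') -> inl (Y.D-in a∈' b∈' e)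
 private
  0≤N = 0≤x⇒0≤x+x+1 0≤n
  big : ∀ {x} -> n + n' ≤ x -> x ∉ Y.D
  big {x} le = out \p -> lia 3 (\n m x -> n :+ m <= x => x <= m :+ m => m :< n => ff) n _ x le (snd (Y.D-supp p)) n'<n
  win : ∀ {c} -> c ∈ A -> (0z ≤ n + c × n + c < n + n + + 1) × n + c ∈ D
  win {c} p = (+≤ 0≤n (fst (supp p)) , lia 2 (\n c -> c <= n => n :+ c :< n :+ n :+ #1) n c (snd (supp p))) , D-in hi p refl
  ≢+ : ∀ {c d} -> ¬ c ≡ d -> ¬ n + c ≡ n + d
  ≢+ {c} {d} ne e = ne (lia 3 (\n c d -> n :+ c == n :+ d => c == d) n c d e)
  n≢n' : ¬ n ≡ n'
  n≢n' e = <-irrefl (sym e) n'<n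
 -- The sums n + n and n + n' exceed all of 2Y and are lost in any case; this describes one that is
 -- lost in addition.
 New : ℤ -> Set
 New c = c ∈ A × ¬ c ≡ n × ¬ c ≡ n' × n + c ∉ Y.D
 two-new = subst (\d -> d + + 2 ≤ dd) (sym dd-cut) (count-extra Y.D D (n + n ∷ n + n' ∷ []) 0≤N
  (big (+-monoʳ-≤ n (<⇒≤ n'<n)) , ≢+ n≢n' ∷ [] , big ≤r , [] , tt) (win hi ∷ win n'∈ ∷ []) D⊂)
 three-new : ∀ c -> New c -> Y.dd + + 3 ≤ dd
 three-new c (c∈ , c≢n , c≢n' , c∉) = subst (\d -> d + + 3 ≤ dd) (sym dd-cut) (count-extra Y.D D (n + n ∷ n + n' ∷ n + c ∷ []) 0≤N
  (big (+-monoʳ-≤ n (<⇒≤ n'<n)) , ≢+ n≢n' ∷ ≢+ (\e -> c≢n (sym e)) ∷ [] , big ≤r , ≢+ (\e -> c≢n' (sym e)) ∷ [] , c∉ , [] , tt) (win hi ∷ win n'∈ ∷ win c∈ ∷ []) D⊂)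
 four-new : ∀ c d -> New c -> New d -> ¬ c ≡ d -> Y.dd + + 4 ≤ dd
 four-new c d (c∈ , c≢n , c≢n' , c∉) (d∈ , d≢n , d≢n' , d∉) c≢d = subst (\e -> e + + 4 ≤ dd) (sym dd-cut) (count-extra Y.D D (n + n ∷ n + n' ∷ n + c ∷ n + d ∷ []) 0≤N
  (big (+-monoʳ-≤ n (<⇒≤ n'<n)) , ≢+ n≢n' ∷ ≢+ (\e -> c≢n (sym e)) ∷ ≢+ (\e -> d≢n (sym e)) ∷ [] , big ≤r , ≢+ (\e -> c≢n' (sym e)) ∷ ≢+ (\e -> d≢n' (sym e)) ∷ [] , c∉ , ≢+ c≢d ∷ [] , d∉ , [] , tt)
  (win hi ∷ win n'∈ ∷ win c∈ ∷ win d∈ ∷ []) D⊂)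
 -- A sum n + a that is not new makes n - a a sum of two positive elements of n - A.
 old-gen : ∀ {a} -> n + a ∈ Y.D -> Gen (rev X) (n - a)
 old-gen {a} p = case Y.D-out p of \ where
  (b , c , b∈ , c∈ , e) -> n - b , n - c , (Rev.in-rev X (cut-out b∈) refl , lia 3 (\b m n -> b <= m => m :< n => #0 :< n :- b) b _ n (snd (Y.supp b∈)) n'<n)
   , (Rev.in-rev X (cut-out c∈) refl , lia 3 (\b m n -> b <= m => m :< n => #0 :< n :- b) c _ n (snd (Y.supp c∈)) n'<n)
   , lia 4 (\a b c n -> b :+ c == n :+ a => n :- b :+ (n :- c) == n :- a) a b c n e
 private
  isNew : 𝔹
  isNew c = A c ∧ (not (bool (c ≟ n')) ∧ not (Y.D (n + c)))
  in-new : ∀ c -> c ∈ A -> ¬ c ≡ n' -> n + c ∉ Y.D -> isNew c ≡ true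
  in-new c p q r = in-∧ p (in-∧ (cong not (out-bool (c ≟ n') q)) (cong not r))
  not-new : ∀ c -> c ∈ A -> ¬ c ≡ n' -> isNew c ≡ false -> n + c ∈ Y.D
  not-new c p q r = case mem? Y.D (n + c) of \ where
   (inl s) -> s
   (inr s) -> clash (in-new c p q s) r
  new-out : ∀ c -> c < n -> isNew c ≡ true -> New c
  new-out c c<n p = fst (∧-in p) , (\e -> <-irrefl e c<n) , (\e -> clash (fst (∧-in {not (bool (c ≟ n'))} q)) (cong not (in-bool (c ≟ n') e))) , not-true (snd (∧-in {not (bool (c ≟ n'))} q))
   where
   q = snd (∧-in {A c} p)
  back = Rev.rev-out X
  nn : ∀ x -> n - (n - x) ≡ x
  nn x = lia 2 (\x n -> n :- (n :- x) == x) x n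
 gen-all : dd ≤ Y.dd + + 2 -> ∀ x -> x ∈ NSet.A (rev X) -> 0z < x -> ¬ x ≡ g -> Gen (rev X) x
 gen-all small x x∈ 0<x ne = subst (Gen (rev X)) (nn x) (old-gen (case mem? Y.D (n + (n - x)) of \ where
  (inl p) -> p
  (inr p) -> ⊥e (lia 2 (\d y -> d <= y :+ #2 => y :+ #3 <= d => ff) _ Y.dd small (three-new (n - x) (back x∈ , (\e -> lia 2 (\n x -> n :- x == n => #0 :< x => ff) n x e 0<x) , (\e -> ne (x-y≡z⇒y≡x-z n e)) , p)))))
 -- Two additional lost sums would make four, so c is the partner of the only one. If there is none,
 -- c is n', which is excluded anyway.
 old-but-one : dd ≤ Y.dd + + 3 -> Σ ℤ \c -> ∀ a -> a ∈ Y.A -> ¬ a ≡ n' -> ¬ a ≡ c -> n + a ∈ Y.D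
 old-but-one small = case ∃? isNew {0z} {n} 0≤n of \ where
  (inr none) -> n' , \a a∈ ne _ -> not-new a (cut-out a∈) ne (none a (fst (Y.supp a∈)) (≤-<-trans (snd (Y.supp a∈)) n'<n))
  (inl (c , _ , c<n , p)) -> c , \a a∈ ne ne' -> case mem? Y.D (n + a) of \ where
   (inl q) -> q
   (inr q) -> ⊥e (lia 2 (\d y -> d <= y :+ #3 => y :+ #4 <= d => ff) _ Y.dd small (four-new a c (cut-out a∈ , (\e -> <-irrefl e (≤-<-trans (snd (Y.supp a∈)) n'<n)) , ne , q) (new-out c c<n p) ne'))

record AP {n : ℤ} (X : NSet n) : Set where
 open NSet X
 field
  δ m : ℤ
  δ≥1 : + 1 ≤ δ
  m≥0 : 0z ≤ m
  n≡ : n ≡ δ * m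
  all : ∀ x -> x ∈ A -> Σ ℤ \i -> 0z ≤ i × i ≤ m × x ≡ δ * i
  mem : ∀ i -> 0z ≤ i -> i ≤ m -> δ * i ∈ A

*-cancel-≤ : ∀ {δ i m} -> + 1 ≤ δ -> δ * i ≤ δ * m -> i ≤ m
*-cancel-≤ {δ} {i} {m} δ≥1 h = case i ≤? m of \ where
    (yes p) -> p
    (no p) -> ⊥e (lia 3 (\d u v -> u <= v => #0 <= u :- v :- d => #1 <= d => ff) δ _ _ h (subst (0z ≤_) (ring δ i m) (*-nonneg (≤t 0≤+ δ≥1) (lia 2 (\i m -> ~ i <= m => #0 <= i :- m :- #1) i m p))) δ≥1)
 where
 ring : ∀ δ i m -> δ * (i - m - + 1) ≡ δ * i - δ * m - δ
 ring = solve

module Small {n : ℤ} (X : NSet n) where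
 open OnSet X
 private
  base : ∀ z -> 0z ≤ z -> z < n -> 0z ≤ cov z - + 2 * χ A z
  base z _ _ = case mem? A z of \ where
   (inl p) -> lia 3 (\a b c -> a == #1 => b == #1 => c == #1 => #0 <= a :+ b :- 2 *: c) _ _ _ (χ-in (A⊂D p)) (χ-in (n+A⊂D p)) (χ-in p)
   (inr p) -> lia 3 (\a b c -> #0 <= a => #0 <= b => c == #0 => #0 <= a :+ b :- 2 *: c) _ _ _ (χ≥0 D _) (χ≥0 D _) (χ-out p)
  sum = lia 6 (\s c t a d k -> s == c :- t => t == 2 *: a => k == a :+ #1 => d == c :+ #1 => #0 <= #0 => s == d :- (2 *: k :- #1)) _ (∑ cov 0z n) _ (count A 0z n) _ k
   (∑-sub cov (\z -> + 2 * χ A z) 0≤n) (double 0≤n) (tr (∑-step (χ A) 0z n 0≤n) (cong (\s -> count A 0z n + s) (χ-in hi))) dd-cov 0≤+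
   where
   double = rise (\b -> ∑ (\z -> + 2 * χ A z) 0z b ≡ + 2 * count A 0z b) (tr (∑-empty _ 0z) (sym (cong (+ 2 *_) (∑-empty _ 0z))))
    (\b 0≤b ih -> lia 5 (\s s' c c' x -> s' == s :+ 2 *: x => c' == c :+ x => s == 2 *: c => s' == 2 *: c') _ _ (count A 0z b) _ (χ A b) (∑-step (\z -> + 2 * χ A z) 0z b 0≤b) (∑-step (χ A) 0z b 0≤b) ih)
 -- Each member z of [0,n) brings the sums z and z + n, and 2n comes on top: 2(k - 1) + 1.
 dd≥2k-1 : + 2 * k - + 1 ≤ dd
 dd≥2k-1 = lia 3 (\s d e -> s == d :- e => #0 <= s => e <= d) _ _ _ sum (∑-nonneg _ 0≤n base)
 module _ (small : dd ≤ + 2 * k - + 1) (n≥1 : + 1 ≤ n) where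
  private
   holes : ∀ z -> 0z ≤ z -> z < n -> z ∉ A -> z ∉ D × z + n ∉ D
   holes z a b p = χ-out⁻ (lia 3 (\a b c -> a :+ b :- 2 *: c == #0 => c == #0 => #0 <= b => a <= #0) _ _ _ e (χ-out p) (χ≥0 D _)) , χ-out⁻ (lia 3 (\a b c -> a :+ b :- 2 *: c == #0 => c == #0 => #0 <= a => b <= #0) _ _ _ e (χ-out p) (χ≥0 D _))
    where
    e = ∑-zeros _ base (lia 3 (\s d e -> s == d :- e => d <= e => s <= #0) _ _ _ sum small) z a b
   abstract
    first : Least A (+ 1) (n + + 1)
    first = [ (\g -> g) , (\none -> clash hi (none n n≥1 (x<x+1))) ]′ (least A {+ 1} {n + + 1} (lia 1 (\n -> #1 <= n => #1 <= n :+ #1) n n≥1))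
   δ = fst first
   δ≥1 = fst (snd first)
   δ∈ = fst (snd (snd (snd first)))
   before = snd (snd (snd (snd first)))
   -- With only 2k - 1 sums a hole contributes none. So a + δ is no hole, and it cannot exceed n,
   -- because a + δ - n would be a hole below δ.
   next : ∀ a -> a ∈ A -> a < n -> a + δ ∈ A × a + δ ≤ n
   next a a∈ a<n = case <-cmp (a + δ) n of \ where
       (tri< l _ _) -> (case mem? A (a + δ) of \ where
        (inl p) -> p
        (inr p) -> clash (D-in a∈ δ∈ refl) (fst (holes (a + δ) (+≤ 0≤a (≤t 0≤+ δ≥1)) l p))) , <⇒≤ l
       (tri≈ _ e _) -> move A hi (sym e) , ≡⇒≤ e
       (tri> _ _ h) -> let y = a + δ - n in clash (D-in a∈ δ∈ (lia 3 (\a d n -> a :+ d == a :+ d :- n :+ n) a δ n))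
        (snd (holes y (lia 2 (\s n -> n :< s => #0 <= s :- n) _ n h) (lia 4 (\a d n m -> a :< n => d <= n => a :+ d :- n :< n) a δ n 0z a<n (snd (supp δ∈))) (before y (y<x⇒1≤x-y h) (lia 3 (\a d n -> a :< n => a :+ d :- n :< d) a δ n a<n))))
    where
    0≤a = fst (supp a∈)
   back : ∀ m a -> a ∈ A -> n - a ≤ + m -> Σ ℤ \j -> 0z ≤ j × n ≡ a + δ * j
   back m a a∈ le = case a ≟ n of \ where
       (yes e) -> 0z , ≤r , lia 3 (\a n z -> a == n => z == #0 => n == a :+ z) a n _ e (*0 δ)
       (no ne) -> go m le (≤≢⇒< (snd (supp a∈)) ne)
    where
    go : ∀ m -> n - a ≤ + m -> a < n -> Σ ℤ \j -> 0z ≤ j × n ≡ a + δ * j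
    go zero le lt = ⊥e (lia 2 (\a n -> n :- a <= #0 => a :< n => ff) a n le lt)
    go (suc m) le lt = case back m (a + δ) (fst (next a a∈ lt)) (lia 4 (\a n d m -> n :- a <= #1 :+ m => #1 <= d => n :- (a :+ d) <= m) a n δ _ le δ≥1) of \ where
     (j , 0≤j , e) -> j + + 1 , 0≤x⇒0≤x+1 0≤j , lia 5 (\a n d u v -> n == a :+ d :+ u => v == u :+ d => n == a :+ v) a n δ (δ * j) _ e (*-step δ j)
   back' : ∀ a -> a ∈ A -> Σ ℤ \j -> 0z ≤ j × n ≡ a + δ * j
   back' a a∈ = back (∣ n - a ∣) a a∈ (≡⇒≤ (sym (∣+∣ (0≤- (snd (supp a∈))))))
  sumAP0 : AP X
  sumAP0 = record { δ = δ ; m = m ; δ≥1 = δ≥1 ; m≥0 = m≥0 ; n≡ = n≡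
    ; all = \x x∈ -> case back' x x∈ of \(j , 0≤j , e) -> m - j , *-cancel-≤ {δ} {0z} δ≥1 (subst (δ * 0z ≤_) (ring δ m j) (lia 5 (\x n u w z -> n == x :+ u => n == w => #0 <= x => z == #0 => z <= w :- u) x n (δ * j) _ _ e n≡ (fst (supp x∈)) (*0 δ))) , 0≤x⇒y-x≤y 0≤j , tr (lia 4 (\x n u w -> n == x :+ u => n == w => x == w :- u) x n (δ * j) _ e n≡) (ring δ m j)
    ; mem = \i 0≤i -> rise (\i -> i ≤ m -> δ * i ∈ A) (\_ -> move A lo (sym (*0 δ))) (\i 0≤i ih le -> move A (fst (next (δ * i) (ih (x+1≤y⇒x≤y le)) (lt i le))) (sym (*-step δ i))) 0≤i }
   where
   m = fst (back' 0z lo)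
   m≥0 = fst (snd (back' 0z lo))
   n≡ = tr (snd (snd (back' 0z lo))) (0+ _)
   ring : ∀ δ m j -> δ * m - δ * j ≡ δ * (m - j)
   ring = solve
   lt : ∀ i -> i + + 1 ≤ m -> δ * i < n
   lt i le = lia 4 (\u w n d -> n == w => #0 <= w :- u :- d => #1 <= d => u :< n) _ _ n δ n≡ (subst (0z ≤_) (ring' δ m i) (*-nonneg (≤t 0≤+ δ≥1) (lia 2 (\i m -> i :+ #1 <= m => #0 <= m :- i :- #1) i m le))) δ≥1
    where
    ring' : ∀ δ m i -> δ * (m - i - + 1) ≡ δ * m - δ * i - δ
    ring' = solve
  abstract
   sumAP : AP X
   sumAP = sumAP0

module PeelCommon {n : ℤ} (X : NSet n) (k≥2 : + 2 ≤ OnSet.k X) (cop : Coprime X) where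
 open OnSet X
 open Peel X k≥2
 module _ (d : ℤ) (d≥2 : + 2 ≤ d) (div : ∀ a -> a ∈ Y.A -> Div d a) where
  private
   notn : ¬ Div d n
   notn dn = cop d d≥2 \a a∈ -> [ (\e -> subst (Div d) (sym e) dn) , div a ]′ (split a∈)
   -- All of Y is divisible by d and n is not, so 2Y cannot meet n + Y; and 2n is too large for 2Y.
   disjoint : ∀ x -> x ∈ Y.D -> x - n ∈ A -> ⊥
   disjoint x p q = case split q of \ where
       (inl e) -> lia 3 (\x n m -> x :- n == n => x <= m :+ m => m :< n => ff) x n _ e (snd (Y.D-supp p)) n'<n
       (inr q') -> case Y.D-out p of \(a , b , a∈ , b∈ , e) -> case div a a∈ of \(i , e₁) -> case div b b∈ of \(j , e₂) -> case div (x - n) q' of \(l , e3) ->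
        notn (i + j - l , tr (lia 7 (\x n a b u v w -> a :+ b == x => a == u => b == v => x :- n == w => n == u :+ v :- w) x n a b _ _ _ e e₁ e₂ e3) (ring d i j l))
    where
    ring : ∀ d i j l -> d * i + d * j - d * l ≡ d * (i + j - l)
    ring = solve
   N = n + n + + 1
   0≤N = 0≤x⇒0≤x+x+1 0≤n
   shifted = tr (∑-shift (χ A) (- n) 0≤N) (tr (cong₂ (count A) (0+ (- n)) (ring n)) (∑-widen (χ A) (neg-mono-≤ 0≤n) 0≤n+1 ≤r (\x _ h -> χ-out (below h)) (\x a b -> ⊥e (≤⇒≯ a b))))
    where
    ring : ∀ n -> n + n + + 1 + - n ≡ n + + 1
    ring = solve
  dd-large = subst₂ (\a b -> a + b ≤ dd) (sym dd-cut) shifted (subst (_≤ dd) (∑-+ (χ Y.D) (\x -> χ A (x + - n)) 0≤N) (∑-mono (\x -> χ Y.D x + χ A (x + - n)) (χ D) 0≤N (\x _ _ -> pt x)))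
   where
   pt : ∀ x -> χ Y.D x + χ A (x + - n) ≤ χ D x
   pt x = case mem? Y.D x of \ where
    (inl p) -> lia 3 (\a b c -> a == #1 => b == #0 => c == #1 => a :+ b <= c) _ _ _ (χ-in p) (χ-out (out (disjoint x p))) (χ-in (D⊂ p))
    (inr p) -> case mem? A (x - n) of \ where
     (inl q) -> lia 3 (\a b c -> a == #0 => b == #1 => c == #1 => a :+ b <= c) _ _ _ (χ-out p) (χ-in q) (χ-in (D-in hi q (lia 2 (\x n -> n :+ (x :- n) == x) x n)))
     (inr q) -> lia 3 (\a b c -> a == #0 => b == #0 => #0 <= c => a :+ b <= c) _ _ _ (χ-out p) (χ-out q) (χ≥0 D x)
  -- The disjoint sets 2Y and n + A have at least 2(k - 1) - 1 and exactly k elements.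
  lower : + 3 * k - + 3 ≤ dd
  lower = lia 4 (\k k' d d' -> d' :+ k <= d => 2 *: k' :- #1 <= d' => k == k' :+ #1 => 3 *: k :- #3 <= d) k Y.k _ _ dd-large (Small.dd≥2k-1 Y) kY
  tight : dd ≤ + 3 * k - + 3 -> TwoAP A k
  tight small = mkTwoAP X 0z n P.δ P.m 0z P.δ≥1 P.m≥0 ≤r
    (\x x∈ -> [ (\e -> inr (0z , ≤r , ≤r , lia 3 (\x n z -> x == n => z == #0 => x == n :+ z) x n _ e (*0 P.δ))) , (\x∈' -> inl (case P.all x x∈' of \(i , a , b , e) -> i , a , b , tr e (sym (0+ _)))) ]′ (split x∈))
    (\i a b -> move A (cut-out (P.mem i a b)) (sym (0+ _)))
    (\i a b -> move A hi (lia 3 (\n z i -> z == #0 => n == n :+ z) n _ i (tr (cong (P.δ *_) (≤≥ b a)) (*0 P.δ))))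
    (\i j a b c d e -> lia 4 (\u n z m -> #0 :+ u == n :+ z => z == #0 => u <= m => m :< n => ff) _ n _ _ e (tr (cong (P.δ *_) (≤≥ d c)) (*0 P.δ)) (snd (Y.supp (P.mem i a b))) n'<n)
   where
   smallY = lia 4 (\k k' d d' -> d' :+ k <= d => d <= 3 *: k :- #3 => k == k' :+ #1 => d' <= 2 *: k' :- #1) k Y.k _ _ dd-large small kY
   apY0 : AP Y
   apY0 = case + 1 ≤? n' of \ where
    (yes h) -> Small.sumAP Y smallY h
    (no h) -> let n'≡0 = lia 1 (\m -> #0 <= m => ~ #1 <= m => m == #0) _ Y.0≤n h in
     record { δ = + 1 ; m = 0z ; δ≥1 = ≤r ; m≥0 = ≤r ; n≡ = n'≡0
      ; all = \x x∈ -> 0z , ≤r , ≤r , ≤≥ (subst (x ≤_) n'≡0 (snd (Y.supp x∈))) (fst (Y.supp x∈))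
      ; mem = \i a b -> move Y.A Y.lo (lia 1 (\i -> #0 <= i => i <= #0 => #0 == 1 *: i) i a b) }
   abstract
    apY : AP Y
    apY = apY0
   module P = AP apY

none-left : ∀ a u v c d -> bit c + bit d ≡ bit a + (bit u + bit v) -> u ≡ false -> v ≡ false -> (a ≡ true -> c ≡ true) -> (a ≡ true -> d ≡ true) -> c ≡ false × d ≡ false
none-left true _ _ c d e refl refl f g with f refl | g refl
none-left true _ _ _ _ () refl refl f g | refl | refl
none-left false _ _ true true () refl refl f g
none-left false _ _ true false () refl refl f g
none-left false _ _ false true () refl refl f g
none-left false _ _ false false e refl refl f g = refl , refl

one-left : ∀ a u v c d -> bit c + bit d ≡ bit a + (bit u + bit v) -> a ≡ true -> u ≡ false -> c ≡ true -> d ≡ true -> v ≡ true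
one-left _ _ true _ _ _ refl refl refl refl = refl

module PeelInterval {n : ℤ} (X : NSet n) (k≥2 : + 2 ≤ OnSet.k X) (J? : HasInterval (OnSet.D (Peel.Y X k≥2)) (+ 2 * OnSet.k (Peel.Y X k≥2) - + 1)) (n≥ : + 2 * OnSet.k (Peel.Y X k≥2) ≤ n) where
 open OnSet X
 open Peel X k≥2
 private
  α ℓ : ℤ
  α = fst J?
  ℓ = + 2 * Y.k - + 1
  ℓ≥1 : + 1 ≤ ℓ
  ℓ≥1 = lia 1 (\k -> #1 <= k => #1 <= 2 *: k :- #1) _ Y.k≥1
  Jₛ : 𝔹
  Jₛ = ap α (+ 1) (ℓ - + 1)
  J-in : ∀ {x} -> α ≤ x -> x < α + ℓ -> x ∈ Jₛ
  J-in {x} a b = in-ap α (+ 1) (ℓ - + 1) (x - α) (0≤- a) (lia 3 (\x s l -> x :< s :+ l => x :- s <= l :- #1) x α ℓ b) (lia 2 (\x s -> x == s :+ 1 *: (x :- s)) x α)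
  J-out : ∀ {x} -> x ∈ Jₛ -> α ≤ x × x < α + ℓ
  J-out {x} p = case ap-out α (+ 1) (ℓ - + 1) p of \(i , a , b , e) -> lia 3 (\x s i -> x == s :+ 1 *: i => #0 <= i => s <= x) x α i e a , lia 4 (\x s i l -> x == s :+ 1 *: i => i <= l :- #1 => x :< s :+ l) x α i ℓ e b
  J⊂ : ∀ {x} -> x ∈ Jₛ -> x ∈ Y.D
  J⊂ {x} p = snd J? x (fst (J-out p)) (snd (J-out p))
  0≤α : 0z ≤ α
  0≤α = fst (Y.D-supp (snd J? α ≤r (1≤y⇒x<x+y ℓ≥1)))
  αtop : α + ℓ - + 1 ≤ n' + n'
  αtop = snd (Y.D-supp (snd J? (α + ℓ - + 1) (lia 2 (\s l -> #1 <= l => s <= s :+ l :- #1) α ℓ ℓ≥1) (lia 2 (\s l -> s :+ l :- #1 :< s :+ l) α ℓ)))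
  Jz : ℤ -> ℤ
  Jz z = χ Jₛ z + χ Jₛ (z + n)
  sumJ : ∑ Jz 0z n ≡ ℓ
  sumJ = tr (∑-+ (χ Jₛ) (\z -> χ Jₛ (z + n)) 0≤n) (tr (cong (\s -> count Jₛ 0z n + s) (tr (∑-shift (χ Jₛ) n 0≤n) (cong (\e -> count Jₛ e (n + n)) (0+ n))))
   (tr (sym (∑-split (χ Jₛ) 0≤n (lia 1 (\n -> #0 <= n => n <= n :+ n) n 0≤n))) (tr (count-ap≡ α (+ 1) ≤r 0≤α (1≤x⇒0≤x-1 ℓ≥1) (lia 4 (\s l m n -> s :+ l :- #1 <= m :+ m => m :< n => s :+ 1 *: (l :- #1) :< n :+ n) α ℓ _ n αtop n'<n)) (x-1+1≡x))))
  -- The interval is shorter than n, so it meets each residue at most once, while a member has two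
  -- sums above it. Writing k' for |Y|, the folding yields k' + (2k' - 1) + 1 = 3k - 3 sums.
  pt : ∀ z -> 0z ≤ z -> z < n -> χ A z + Jz z ≤ cov z
  pt z _ _ = case mem? A z of \ where
      (inl p) -> lia 5 (\a u v c d -> a == #1 => c == #1 => d == #1 => u :+ v <= #1 => a :+ (u :+ v) <= c :+ d) _ (χ Jₛ z) (χ Jₛ (z + n)) _ _ (χ-in p) (χ-in (A⊂D p)) (χ-in (n+A⊂D p)) one
      (inr p) -> lia 5 (\a u v c d -> a == #0 => u <= c => v <= d => a :+ (u :+ v) <= c :+ d) _ _ _ _ _ (χ-out p) (χ-mono {Jₛ} {D} (\q -> D⊂ (J⊂ q))) (χ-mono {Jₛ} {D} (\q -> D⊂ (J⊂ q)))
   where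
   one : χ Jₛ z + χ Jₛ (z + n) ≤ + 1
   one = case mem? Jₛ z of \ where
    (inr q) -> lia 2 (\u v -> u == #0 => v <= #1 => u :+ v <= #1) _ _ (χ-out q) (χ≤1 Jₛ _)
    (inl q) -> case mem? Jₛ (z + n) of \ where
     (inr r) -> lia 2 (\u v -> v == #0 => u <= #1 => u :+ v <= #1) _ _ (χ-out r) (χ≤1 Jₛ _)
     (inl r) -> ⊥e (lia 4 (\z n s k -> s <= z => z :+ n :< s :+ (2 *: k :- #1) => 2 *: k <= n => ff) z n α Y.k (fst (J-out q)) (snd (J-out r)) n≥)
  kk : count A 0z n ≡ Y.k
  kk = lia 3 (\c k k' -> k == c :+ #1 => k == k' :+ #1 => c == k') _ k _ (tr (∑-step (χ A) 0z n 0≤n) (cong (\s -> count A 0z n + s) (χ-in hi))) kY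
  left : ∑ (\z -> χ A z + Jz z) 0z n ≡ Y.k + ℓ
  left = tr (∑-+ (χ A) Jz 0≤n) (cong₂ _+_ kk sumJ)
 lower : + 3 * k - + 3 ≤ dd
 lower = lia 6 (\s c d k k' l -> s == k' :+ (2 *: k' :- #1) => s <= c => d == c :+ #1 => k == k' :+ #1 => 3 *: k :- #3 <= d) _ _ _ k Y.k ℓ left (∑-mono _ cov 0≤n pt) dd-cov kY
 module _ (small : dd ≤ + 3 * k - + 3) (n> : + 2 * Y.k < n) (n'≤ : n' ≤ + 2 * Y.k - + 1) where
  private
   exact : ∀ z -> 0z ≤ z -> z < n -> cov z ≡ χ A z + Jz z
   exact z a b = lia 2 (\u v -> u :- v == #0 => u == v) _ _ (∑-zeros (\z -> cov z - (χ A z + Jz z)) (\z a b -> 0≤- (pt z a b))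
    (lia 6 (\t s c d k k' -> t == c :- s => s == k' :+ (2 *: k' :- #1) => d == c :+ #1 => k == k' :+ #1 => d <= 3 *: k :- #3 => t <= #0) _ _ (∑ cov 0z n) _ k Y.k (∑-sub cov (\z -> χ A z + Jz z) 0≤n) left dd-cov kY small) z a b)
   empty : ∀ γ -> 0z ≤ γ -> γ < n -> γ ∉ Jₛ -> γ + n ∉ Jₛ -> γ ∉ D × γ + n ∉ D
   empty γ a b p q = none-left (A γ) (Jₛ γ) (Jₛ (γ + n)) (D γ) (D (γ + n)) (exact γ a b) p q A⊂D n+A⊂D
   c : ℤ
   c = n - ℓ
   c≥2 = lia 2 (\n k -> 2 *: k :< n => #2 <= n :- (2 *: k :- #1)) n Y.k n>
   c≤n = lia 2 (\n l -> #1 <= l => n :- l :< n) n ℓ ℓ≥1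
   -- When the count is exact, a residue outside the interval carries no sum at all. These residues
   -- are c = n - ℓ consecutive positions, of which e is the last.
   record Gap : Set where
    field
     e : ℤ
     e≥ : c - + 1 ≤ e
     e<n : e < n
     free : ∀ i -> 0z ≤ i -> i < c -> e - i ∉ D × e - i + n ∉ D
   gap0 : Gap
   gap0 = case mem? Jₛ 0z of \ where
    (inl p) -> let α≡0 = ≤≥ (fst (J-out p)) 0≤α in record { e = n - + 1 ; e≥ = lia 2 (\c n -> c :< n => c :- #1 <= n :- #1) c n c≤n ; e<n = x-1<x
     ; free = \i a b -> empty (n - + 1 - i) (lia 3 (\n i c -> i :< c => c :< n => #0 <= n :- #1 :- i) n i c b c≤n) (lia 2 (\n i -> #0 <= i => n :- #1 :- i :< n) n i a)
      (out \q -> lia 4 (\n i l s -> n :- #1 :- i :< s :+ l => s == #0 => i :< n :- l => ff) n i ℓ α (snd (J-out q)) α≡0 b)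
      (out \q -> lia 4 (\n i l s -> n :- #1 :- i :+ n :< s :+ l => s == #0 => i :< n :- l => #0 <= n => ff) n i ℓ α (snd (J-out q)) α≡0 b 0≤n) }
    (inr p) -> let n∈J = J-out (one-left (A 0z) (Jₛ 0z) (Jₛ (0z + n)) (D 0z) (D (0z + n)) (exact 0z ≤r (1≤x⇒0<x n≥1)) lo p (A⊂D lo) (n+A⊂D lo)) in
     record { e = α - + 1 ; e≥ = lia 3 (\n l s -> #0 :+ n :< s :+ l => n :- l :- #1 <= s :- #1) n ℓ α (snd n∈J) ; e<n = lia 2 (\n s -> s <= #0 :+ n => s :- #1 :< n) n α (fst n∈J)
     ; free = \i a b -> empty (α - + 1 - i) (lia 4 (\n l s i -> #0 :+ n :< s :+ l => i :< n :- l => #0 <= s :- #1 :- i) n ℓ α i (snd n∈J) b) (lia 3 (\n s i -> s <= #0 :+ n => #0 <= i => s :- #1 :- i :< n) n α i (fst n∈J) a)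
      (out \q -> lia 2 (\s i -> s <= s :- #1 :- i => #0 <= i => ff) α i (fst (J-out q)) a)
      (out \q -> lia 4 (\n l s i -> s :- #1 :- i :+ n :< s :+ l => i :< n :- l => ff) n ℓ α i (snd (J-out q)) b) }
   abstract
    theGap : Gap
    theGap = gap0
   open Gap theGap
   miss : ∀ i -> 0z ≤ i -> i < c -> ∀ {a b} -> a ∈ A -> a + b ≡ e - i -> b ∉ A
   miss i p q a∈ eq = D-not (fst (free i p q)) a∈ eq
   miss' : ∀ i -> 0z ≤ i -> i < c -> ∀ {a b} -> a ∈ A -> a + b ≡ e - i + n -> b ∉ A
   miss' i p q a∈ eq = D-not (snd (free i p q)) a∈ eq
   0<c = lia 1 (\c -> #2 <= c => #0 :< c) c c≥2
   1<c = lia 1 (\c -> #2 <= c => #1 :< c) c c≥2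
   module _ (a : ℤ) (a∈ : a ∈ Y.A) (a<n' : a < n') (a+1∉ : a + + 1 ∉ A) where
    R = ap (n' + + 1) (+ 1) (c - + 2)
    f : ℤ -> ℤ
    f x = χ Y.A (e - x) + χ Y.A (e + n - x)
    -- Counts Y, the point a + 1, the c - 1 positions after n', and the reflection of Y in e modulo
    -- n. The first three lie at most c - 1 above members of Y, so by the gap they avoid the fourth.
    -- Altogether there are n + 1 points in [0,n), which is absurd.
    W : ℤ -> ℤ
    W x = χ Y.A x + χ (point (a + + 1)) x + χ R x + f x
    outs : ∀ x -> e - x ∉ A -> e + n - x ∉ A -> f x ≡ 0z
    outs x p q = cong₂ _+_ (χ-out (out \r -> clash (cut-out r) p)) (χ-out (out \r -> clash (cut-out r) q))
    W≤1 : ∀ x -> 0z ≤ x -> x < n -> W x ≤ + 1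
    W≤1 x 0≤x x<n = case mem? Y.A x of \ where
        (inl p) -> lia 4 (\y q r f -> y <= #1 => q == #0 => r == #0 => f == #0 => y :+ q :+ r :+ f <= #1) _ _ _ _ (χ≤1 Y.A x) (χ-out (out-bool (x ≟ a + + 1) \h -> clash (cut-out p) (move A a+1∉ (sym h)))) (χ-out (notR (snd (Y.supp p))))
         (outs x (miss 0z ≤r 0<c (cut-out p) (lia 2 (\x e -> x :+ (e :- x) == e :- #0) x e)) (miss' 0z ≤r 0<c (cut-out p) (lia 3 (\x e n -> x :+ (e :+ n :- x) == e :- #0 :+ n) x e n)))
        (inr p) -> case x ≟ a + + 1 of \ where
         (yes h) -> lia 4 (\y q r f -> y == #0 => q <= #1 => r == #0 => f == #0 => y :+ q :+ r :+ f <= #1) _ _ _ _ (χ-out p) (χ≤1 (point (a + + 1)) x) (χ-out (notR (lia 3 (\x a m -> x == a :+ #1 => a :< m => x <= m) x a _ h a<n')))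
          (outs x (miss (+ 1) 0≤+ 1<c (cut-out a∈) (lia 3 (\x a e -> x == a :+ #1 => a :+ (e :- x) == e :- #1) x a e h)) (miss' (+ 1) 0≤+ 1<c (cut-out a∈) (lia 4 (\x a e n -> x == a :+ #1 => a :+ (e :+ n :- x) == e :- #1 :+ n) x a e n h)))
         (no h) -> case mem? R x of \ where
          (inl r) -> case ap-out (n' + + 1) (+ 1) (c - + 2) r of \(i , i1 , i2 , eq) -> lia 4 (\y q r f -> y == #0 => q == #0 => r <= #1 => f == #0 => y :+ q :+ r :+ f <= #1) _ _ _ _ (χ-out p) (χ-out (out-bool (x ≟ a + + 1) h)) (χ≤1 R x)
           (outs x (miss (i + + 1) (0≤x⇒0≤x+1 i1) (lia 2 (\i c -> i <= c :- #2 => i :+ #1 :< c) i c i2) n'∈ (lia 4 (\x i e m -> x == m :+ #1 :+ 1 *: i => m :+ (e :- x) == e :- (i :+ #1)) x i e n' eq))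
            (miss' (i + + 1) (0≤x⇒0≤x+1 i1) (lia 2 (\i c -> i <= c :- #2 => i :+ #1 :< c) i c i2) n'∈ (lia 5 (\x i e m n -> x == m :+ #1 :+ 1 *: i => m :+ (e :+ n :- x) == e :- (i :+ #1) :+ n) x i e n' n eq)))
          (inr r) -> lia 5 (\y q r u v -> y == #0 => q == #0 => r == #0 => u :+ v <= #1 => y :+ q :+ r :+ (u :+ v) <= #1) _ _ _ (χ Y.A (e - x)) (χ Y.A (e + n - x)) (χ-out p) (χ-out (out-bool (x ≟ a + + 1) h)) (χ-out r) oneOf
     where
     notR : x ≤ n' -> x ∉ R
     notR le = out \r -> case ap-out (n' + + 1) (+ 1) (c - + 2) r of \(i , i1 , _ , eq) -> lia 3 (\x m i -> x <= m => x == m :+ #1 :+ 1 *: i => #0 <= i => ff) x _ i le eq i1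
     oneOf : χ Y.A (e - x) + χ Y.A (e + n - x) ≤ + 1
     oneOf = case mem? Y.A (e - x) of \ where
      (inr q) -> lia 2 (\u v -> u == #0 => v <= #1 => u :+ v <= #1) _ _ (χ-out q) (χ≤1 Y.A _)
      (inl q) -> lia 2 (\u v -> v == #0 => u <= #1 => u :+ v <= #1) _ _ (χ-out (Y.above (lia 4 (\e x n m -> #0 <= e :- x => m :< n => m :< e :+ n :- x) e x n _ (fst (Y.supp q)) n'<n))) (χ≤1 Y.A _)
    0≤e = lia 2 (\c e -> #2 <= c => c :- #1 <= e => #0 <= e) c e c≥2 e≥
    sumF = tr (∑-+ (\x -> χ Y.A (e - x)) (\x -> χ Y.A (e + n - x)) 0≤n)
     (tr (cong₂ _+_ (tr (∑-reflect (χ Y.A) e 0≤n) (cong (count Y.A (e - n + + 1)) (x-0+1≡x+1 e))) (tr (∑-reflect (χ Y.A) (e + n) 0≤n) (cong₂ (count Y.A) (lia 2 (\e n -> e :+ n :- n :+ #1 == e :+ #1) e n) (lia 2 (\e n -> e :+ n :- #0 :+ #1 == e :+ n :+ #1) e n))))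
     (tr (sym (∑-split (χ Y.A) (lia 2 (\e n -> #0 <= n => e :- n :+ #1 <= e :+ #1) e n 0≤n) (lia 2 (\e n -> #0 <= n => e :+ #1 <= e :+ n :+ #1) e n 0≤n)))
      (∑-widen (χ Y.A) (lia 2 (\e n -> e :< n => e :- n :+ #1 <= #0) e n e<n) Y.0≤n+1 (lia 3 (\e n m -> #0 <= e => m :< n => m :+ #1 <= e :+ n :+ #1) e n _ 0≤e n'<n) (\x _ h -> χ-out (Y.below h)) (\x h _ -> χ-out (Y.above (lia 2 (\x m -> m :+ #1 <= x => m :< x) x _ h))))))
    sumW = tr (∑-+ (\x -> χ Y.A x + χ (point (a + + 1)) x + χ R x) f 0≤n) (cong₂ _+_ (tr (∑-+ (\x -> χ Y.A x + χ (point (a + + 1)) x) (χ R) 0≤n) (cong₂ _+_ (tr (∑-+ (χ Y.A) (χ (point (a + + 1))) 0≤n) (cong₂ _+_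
      (∑-widen (χ Y.A) ≤r Y.0≤n+1 (x<y⇒x+1≤y n'<n) (\x p q -> ⊥e (≤⇒≯ p q)) (\x h _ -> χ-out (Y.above (lia 2 (\x m -> m :+ #1 <= x => m :< x) x _ h))))
      (count-point (a + + 1) (0≤x⇒0≤x+1 (fst (Y.supp a∈))) (lia 3 (\a m n -> a :< m => m :< n => a :+ #1 :< n) a _ n a<n' n'<n))))
      (tr (count-ap≡ (n' + + 1) (+ 1) ≤r (0≤x⇒0≤x+1 Y.0≤n) (2≤x⇒0≤x-2 c≥2) (lia 3 (\m n k -> m <= 2 *: k :- #1 => m :+ #1 :+ 1 *: (n :- (2 *: k :- #1) :- #2) :< n) _ n Y.k n'≤)) (lia 1 (\c -> c :- #2 :+ #1 == c :- #1) c)))) sumF)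
    absurd = lia 4 (\s n k c -> s == k :+ #1 :+ (n :- (2 *: k :- #1) :- #1) :+ k => s <= n :- #0 => #0 <= #0 => ff) _ n Y.k c sumW (subst (∑ W 0z n ≤_) (∑-one' 0≤n) (∑-mono W (\_ -> + 1) 0≤n W≤1)) 0≤+
   full : ∀ t -> 0z ≤ t -> t ≤ n' -> t ∈ A
   full t = climb (\t -> t ∈ A) n' lo (\t a b ih -> case mem? A (t + + 1) of \ where
    (inl p) -> p
    (inr p) -> ⊥e (absurd t (cut-in ih (<⇒≤ b)) b p))
  tight = mkTwoAP X 0z n (+ 1) n' 0z ≤r Y.0≤n ≤r
   (\x x∈ -> [ (\e -> inr (0z , ≤r , ≤r , tr e (sym (+0 n)))) , (\x∈' -> inl (x , fst (Y.supp x∈') , snd (Y.supp x∈') , x≡0+1x)) ]′ (split x∈))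
   (\i a b -> move A (full i a b) (x≡0+1x))
   (\i a b -> move A hi (lia 2 (\n i -> #0 <= i => i <= #0 => n == n :+ 1 *: i) n i a b))
   (\i j a b c d e -> lia 4 (\i j n m -> #0 :+ 1 *: i == n :+ 1 *: j => i <= m => #0 <= j => m :< n => ff) i j n _ e b c n'<n)

-- Decomposition into two chains of a given difference

module Chains {n : ℤ} (X : NSet n) (n≥1 : + 1 ≤ n) (δ : ℤ) (δ≥1 : + 1 ≤ δ) where
 open OnSet X
 private
  0≤δ = ≤t 0≤+ δ≥1
  module _ (c : ℤ) (c∈ : c ∈ A) (c≢0 : ¬ c ≡ 0z) (back : ∀ b -> b ∈ A -> ¬ b ≡ 0z -> ¬ b ≡ c -> b - δ ∈ A) where
   c≥1 = 0≤x⇒x≢0⇒1≤x (fst (supp c∈)) c≢0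
   -- The chain from s must not pass t, the start of the other chain; this keeps the two chains
   -- disjoint.
   Run : ℤ -> ℤ -> ℤ -> Set
   Run s t i = ∀ j -> 0z ≤ j -> j ≤ i -> s + δ * j ∈ A × ¬ s + δ * j ≡ t
   Reach : ℤ -> Set
   Reach b = (Σ ℤ \i -> 0z ≤ i × b ≡ 0z + δ * i × Run 0z c i) ⊎ (Σ ℤ \i -> 0z ≤ i × b ≡ c + δ * i × Run c 0z i)
   s0 : ∀ s -> s + δ * 0z ≡ s
   s0 s = tr (cong (\m -> s + m) (*0 δ)) (+0 s)
   run0 : ∀ {s t} -> s ∈ A -> ¬ s ≡ t -> Run s t 0z
   run0 {s} p q j a b = move A p (sym e) , \e' -> q (tr (sym e) e')
    where
    e = tr (cong (\j -> s + δ * j) (≤≥ b a)) (s0 s)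
   extend : ∀ {s t b i} -> b ∈ A -> ¬ b ≡ t -> b - δ ≡ s + δ * i -> Run s t i -> b ≡ s + δ * (i + + 1) × Run s t (i + + 1)
   extend {s} {t} {b} {i} b∈ b≢ e run = eq , \j p q -> case j ≤? i of \ where
       (yes h) -> run j p h
       (no h) -> let
         j≡ = lia 2 (\j i -> j <= i :+ #1 => ~ j <= i => j == i :+ #1) j i q h
         e' = tr eq (cong (\j -> s + δ * j) (sym j≡)) in move A b∈ e' , \e'' -> b≢ (tr e' e'')
    where
    eq = lia 5 (\b d s w w' -> b :- d == s :+ w => w' == w :+ d => b == s :+ w') b δ s (δ * i) _ e (*-step δ i)
   reach : ∀ m b -> b ∈ A -> b ≤ + m -> Reach b
   reach m b b∈ le = case b ≟ 0z of \ where
       (yes z) -> inl (0z , ≤r , tr z (sym (s0 0z)) , run0 lo (\e -> c≢0 (sym e)))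
       (no nz) -> case b ≟ c of \ where
        (yes e) -> inr (0z , ≤r , tr e (sym (s0 c)) , run0 c∈ c≢0)
        (no ne) -> go m le nz ne
    where
    up : ∀ {i} -> 0z ≤ i -> 0z ≤ i + + 1
    up {i} = 0≤x⇒0≤x+1
    go : ∀ m -> b ≤ + m -> ¬ b ≡ 0z -> ¬ b ≡ c -> Reach b
    go zero le nz _ = ⊥e (nz (≤≥ le (fst (supp b∈))))
    go (suc m) le nz ne = case reach m (b - δ) (back b b∈ nz ne) (lia 3 (\b d m -> b <= #1 :+ m => #1 <= d => b :- d <= m) b δ _ le δ≥1) of \ where
     (inl (i , a , e , run)) -> inl (i + + 1 , up a , extend {0z} {c} b∈ ne e run)
     (inr (i , a , e , run)) -> inr (i + + 1 , up a , extend {c} {0z} b∈ nz e run)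
   last : ∀ s t -> s ∈ A -> ¬ s ≡ t -> Σ ℤ \p -> 0z ≤ p × Run s t p × (∀ i -> 0z ≤ i -> Run s t i -> i ≤ p)
   last s t s∈ s≢ = case least bad {0z} {n + + 2} (lia 1 (\n -> #1 <= n => #0 <= n :+ #2) n n≥1) of \ where
       (inl (i , a , _ , p , before)) -> i - + 1 , lia 1 (\i -> #0 <= i => ~ i == #0 => #0 <= i :- #1) i a (\z -> bad-out i p (fst (at0 i z)) (snd (at0 i z))) ,
        (\j c d -> good j (before j c (lia 2 (\i j -> j <= i :- #1 => j :< i) i j d))) ,
        (\j c run -> case j ≤? i - + 1 of \ where
         (yes h) -> h
         (no h) -> ⊥e (let r = run i a (lia 2 (\i j -> ~ j <= i :- #1 => i <= j) i j h) in bad-out i p (fst r) (snd r)))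
       (inr none) -> ⊥e (lia 4 (\s w n d -> s :+ w <= n => #0 <= s => #0 <= w :- n :- #1 => #0 <= d => ff) s (δ * (n + + 1)) n δ (snd (supp (fst (good (n + + 1) (none (n + + 1) 0≤n+1 (lia 1 (\n -> n :+ #1 :< n :+ #2) n)))))) (fst (supp s∈))
         (subst (0z ≤_) (ring δ n) (*-nonneg (1≤x⇒0≤x-1 δ≥1) 0≤n+1)) 0≤δ)
    where
    ring : ∀ δ n -> (δ - + 1) * (n + + 1) ≡ δ * (n + + 1) - n - + 1
    ring = solve
    bad : 𝔹
    bad i = not (A (s + δ * i)) ∨ bool (s + δ * i ≟ t)
    good : ∀ i -> i ∉ bad -> s + δ * i ∈ A × ¬ s + δ * i ≡ t
    good i p = (case mem? A (s + δ * i) of \ where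
       (inl q) -> q
       (inr q) -> clash (cong (\b -> not b ∨ bool (s + δ * i ≟ t)) q) p) , \e -> clash (∨r (not (A (s + δ * i))) (in-bool (s + δ * i ≟ t) e)) p
     where
     ∨r : ∀ a {b} -> b ≡ true -> a ∨ b ≡ true
     ∨r true _ = refl
     ∨r false e = e
    bad-out : ∀ i -> i ∈ bad -> s + δ * i ∈ A -> ¬ s + δ * i ≡ t -> ⊥
    bad-out i p q ne = [ (\h -> clash h (cong not q)) , (\h -> ne (bool-in (s + δ * i ≟ t) h)) ]′ (∨-in {not (A (s + δ * i))} p)
    at0 : ∀ i -> i ≡ 0z -> s + δ * i ∈ A × ¬ s + δ * i ≡ t
    at0 i z = run0 s∈ s≢ i (≡⇒≤ (sym z)) (≡⇒≤ z)
   chains0 : TwoAP A k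
   chains0 = case last 0z c lo (\e -> c≢0 (sym e)) of \(p , p≥0 , runp , maxp) -> case last c 0z c∈ c≢0 of \(q , q≥0 , runq , maxq) ->
     mkTwoAP X 0z c δ p q δ≥1 p≥0 q≥0
      (\x x∈ -> [ (\(i , a , e , run) -> inl (i , a , maxp i a run , e)) , (\(i , a , e , run) -> inr (i , a , maxq i a run , e)) ]′ (reach (∣ x ∣) x x∈ (≡⇒≤ (sym (∣+∣ (fst (supp x∈)))))))
      (\i a b -> fst (runp i a b)) (\i a b -> fst (runq i a b))
      (\i j a b a' b' e -> case j ≤? i of \ where
       (yes h) -> snd (runp (i - j) (0≤- h) (lia 3 (\i j p -> i <= p => #0 <= j => i :- j <= p) i j p b a')) (tr (ring δ i j) (lia 3 (\u w c -> #0 :+ u == c :+ w => u :- w == c) (δ * i) (δ * j) c e))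
       (no h) -> lia 4 (\u w c d -> #0 :+ u == c :+ w => #1 <= c => #0 <= w :- u => #0 <= d => ff) (δ * i) (δ * j) c δ e c≥1 (subst (0z ≤_) (ring' δ i j) (*-nonneg 0≤δ (lia 2 (\i j -> ~ j <= i => #0 <= j :- i) i j h))) 0≤δ)
    where
    ring : ∀ δ i j -> 0z + δ * (i - j) ≡ δ * i - δ * j
    ring = solve
    ring' : ∀ δ i j -> δ * (j - i) ≡ δ * j - δ * i
    ring' = solve
 abstract
  chains : ∀ c -> (∀ b -> b ∈ A -> ¬ b ≡ 0z -> ¬ b ≡ c -> b - δ ∈ A) -> TwoAP A k
  chains c back = case mem? A c of \ where
      (inr c∉) -> atTop \b b∈ nz _ -> back b b∈ nz \e -> clash b∈ (move A c∉ (sym e))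
      (inl c∈) -> case c ≟ 0z of \ where
       (yes z) -> atTop \b b∈ nz _ -> back b b∈ nz \e -> nz (tr e z)
       (no nz) -> chains0 c c∈ nz back
   where
   -- Without a proper exception A is one chain, and its last element n is split off as the second
   -- progression.
   atTop : (∀ b -> b ∈ A -> ¬ b ≡ 0z -> ¬ b ≡ n -> b - δ ∈ A) -> TwoAP A k
   atTop = chains0 n hi \e -> lia 1 (\n -> n == #0 => #1 <= n => ff) n e n≥1

-- Restoring the maximum to a set with n = 2|A| - 2

module PeelHalf {n : ℤ} (X : NSet n) (k≥2 : + 2 ≤ OnSet.k X) (g≥3 : + 3 ≤ Peel.g X k≥2) (n'≥1 : + 1 ≤ Peel.n' X k≥2)
 (c : ℤ) (old : ∀ a -> a ∈ NSet.A (Peel.Y X k≥2) -> ¬ a ≡ Peel.n' X k≥2 -> ¬ a ≡ c -> n + a ∈ OnSet.D (Peel.Y X k≥2)) where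
 open OnSet X using (dd; 0≤n)
 open Peel X k≥2
 private
  m = n'
  module R = OnSet (rev X)
  g≡ = lia 2 (\n m -> n == m :+ (n :- m)) n n'
  Closed = ∀ a -> a ∈ Y.A -> ¬ a ≡ m -> ¬ a ≡ c -> a + g ∈ Y.A
  -- Translation by g permutes A up to the top element and c, so A consists of two progressions of difference g.
  finish : Closed -> TwoAP (NSet.A X) (OnSet.k X)
  finish cl = subst (TwoAP (NSet.A X)) (Rev.k-rev X) (twoAP-rev X (Chains.chains (rev X) n≥1 g (≤t 1≤+ g≥3) (n - c) \b b∈ nz ne ->
   let
     a∈ = Rev.rev-out X b∈
     up : n - b + g ∈ NSet.A X
     up = case split a∈ of \ where
       (inl e) -> ⊥e (nz (lia 2 (\n b -> n :- b == n => b == #0) n b e))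
       (inr a∈') -> case n - b ≟ m of \ where
        (yes e) -> move (NSet.A X) (OnSet.hi X) (tr g≡ (cong (_+ g) (sym e)))
        (no e) -> cut-out (cl (n - b) a∈' e (\e' -> ne (x-y≡z⇒y≡x-z n e')))
    in Rev.in-rev X up (lia 3 (\n b g -> n :- (n :- b :+ g) == b :- g) n b g)))
  old' : ∀ a -> a ∈ Y.A -> ¬ a ≡ m -> ¬ a ≡ c -> a + g + m ∈ Y.D × a + g ≤ m
  old' a a∈ p q = let h = old a a∈ p q in move Y.D h (lia 3 (\n a m -> n :+ a == a :+ (n :- m) :+ m) n a n') , lia 3 (\n a m -> n :+ a <= m :+ m => a :+ (n :- m) <= m) n a _ (snd (Y.D-supp h))
  module WithSolo (S : Solo Y) where
   open SoloFacts Y S using (z0; 0≤z0; z0<n; low∉; high∉; notBoth; left; right; hole; posR; negL; z0≥1; single)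
   -- A hole a + g cannot be z0 or lie beyond it, as it is covered from the right. Below z0 this is
   -- either excluded outright, or g is in Y and a + g is also a sum, so that the hole is covered
   -- twice.
   holeUp : (∀ z -> 0z ≤ z -> z < m -> z ∉ Y.A -> z < z0 -> z + m ∈ Y.D -> ⊥) ⊎ (g ≤ z0 -> g ∈ Y.A) -> (∀ z -> z0 < z -> z < m -> z ∉ Y.A -> z + m ∉ Y.D) -> Closed
   holeUp lower upper a a∈ p q = case mem? Y.A (a + g) of \ where
       (inl r) -> r
       (inr r) -> ⊥e (case a + g ≟ m of \ where
        (yes e) -> clash (move Y.A Y.hi (sym e)) r
        (no ne) -> let z<m = x≤y⇒x≢y⇒x<y (snd o) ne in case <-cmp (a + g) z0 of \ where
         (tri≈ _ e _) -> clash (move Y.D (fst o) (cong (_+ m) e)) high∉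
         (tri> _ _ h) -> clash (fst o) (upper (a + g) h z<m r)
         (tri< h _ _) -> [ (\l -> l (a + g) 0≤ z<m r h (fst o)) , (\l -> notBoth (a + g) 0≤ z<m r (\e -> <-irrefl e h) (Y.D-in a∈ (l (lia 3 (\a g z -> a :+ g :< z => #0 <= a => g <= z) a g _ h (fst (Y.supp a∈)))) refl) (fst o)) ]′ lower)
    where
    o = old' a a∈ p q
    0≤ = lia 2 (\a g -> #0 <= a => #3 <= g => #0 <= a :+ g) a g (fst (Y.supp a∈)) g≥3
   -- z0 - g would be an exception of the translation, hence equal to c.
   byAnti : (¬ c ≡ z0 - g) -> (∀ z -> z0 < z -> z < m -> z ∉ Y.A -> z + m ∉ Y.D) -> Closed
   byAnti c≢ upper = holeUp (inr \g≤ -> tr (anti-not Y.A left (lia 1 (\g -> #3 <= g => #0 <= g) g g≥3) g≤ refl) (cong not (out \p -> clash (move Y.D (fst (old' (z0 + - g) (move Y.A p (lia 2 (\z g -> #0 :+ z :- g == z :- g) z0 g)) (\e -> lia 3 (\z g m -> z :- g == m => z :< m => #3 <= g => ff) _ g m e z0<n g≥3) (\e -> c≢ (sym e)))) (lia 3 (\z g m -> z :- g :+ g :+ m == z :+ m) z0 g m)) high∉))) upper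
   module Ends (1∉ : + 1 ∉ Y.A) (m-1∉ : m - + 1 ∉ Y.A) where
    above1 : ∀ i -> 0z ≤ i -> z0 + i ≤ m -> m - i ∉ Y.A -> z0 + i ∈ Y.A
    above1 i a b p = tr (anti-not Y.A right (0≤y⇒x≤x+y a) b (lia 3 (\z i m -> m :- i == z :+ m :- (z :+ i)) z0 i m)) (cong not p)
    below1 = tr (anti-not Y.A left (1≤x⇒0≤x-1 z0≥1) x-1≤x (lia 1 (\z -> #1 == #0 :+ z :- (z :- #1)) z0)) (cong not 1∉)
    positive : Pieces.Pos Y z0 -> z0 ≤ m - + 5 -> Closed
    positive pos le = byAnti c≢ upper
     where
     upper : ∀ z -> z0 < z -> z < m -> z ∉ Y.A -> z + m ∉ Y.D
     upper z a b p = case z ≟ m - + 1 of \ where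
      (yes e) -> out \q -> case Y.D-out q of \(x , y , x∈ , y∈ , e') -> [ (\h -> clash (move Y.A y∈ h) m-1∉) , (\h -> clash (move Y.A x∈ h) m-1∉) ]′
       (lia 4 (\x y z m -> z == m :- #1 => x :+ y == z :+ m => x <= m => y <= m => y == m :- #1 :∨ x == m :- #1) x y z m e e' (snd (Y.supp x∈)) (snd (Y.supp y∈)))
      (no ne) -> posR z (≤t 0≤z0 (<⇒≤ a)) b p (y≡x-1⇒1≤y⇒2≤x (Y.φ-out (≤t 0≤z0 (<⇒≤ a)) p) (pos (z + + 1) (lia 2 (\z y -> y :< z => y :+ #2 <= z :+ #1) z _ a) (lia 2 (\z m -> z :< m => ~ z == m :- #1 => z :+ #1 <= m :- #1) z m b ne)))
     z0+1∈ = above1 (+ 1) 0≤+ (lia 2 (\z m -> z <= m :- #5 => z :+ #1 <= m) _ m le) m-1∉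
     z0+2∈ : z0 + + 2 ∈ Y.A
     z0+2∈ = case mem? Y.A (z0 + + 2) of \ where
      (inl p) -> p
      (inr p) -> ⊥e (lia 4 (\a b c d -> a == #0 => b == a :+ #1 => c == b :- #1 => d == c => #1 <= d => ff) _ _ _ _ (Periods.Critical.next (SoloFacts.crit Y S)) (Y.φ-in z0+1∈) (tr (Y.φ-out (lia 1 (\z -> #0 <= z => #0 <= z :+ #2) _ 0≤z0) p) (cong (\e -> Y.φ e - + 1) (lia 1 (\z -> z :+ #2 == z :+ #1 :+ #1) z0))) (cong Y.φ (lia 1 (\z -> z :+ #3 == z :+ #2 :+ #1) z0)) (pos (z0 + + 3) (lia 1 (\z -> z :+ #2 <= z :+ #3) z0) (lia 2 (\z m -> z <= m :- #5 => z :+ #3 <= m :- #1) _ m le)))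
     -- Above z0 the translation never leaves A, so every element th is congruent to the top.
     climbs : c < z0 -> ∀ t a -> a ∈ Y.A -> z0 < a -> m - a ≤ + t -> Σ ℤ \j -> m ≡ a + g * j
     climbs c< t a a∈ lt le' = case a ≟ m of \ where
         (yes e) -> 0z , tr (sym e) (sym (tr (cong (\w -> a + w) (*0 g)) (+0 a)))
         (no ne) -> go t le' ne
      where
      go : ∀ t -> m - a ≤ + t -> ¬ a ≡ m -> Σ ℤ \j -> m ≡ a + g * j
      go zero h ne = ⊥e (ne (≤≥ (snd (Y.supp a∈)) (lia 2 (\m a -> m :- a <= #0 => m <= a) m a h)))
      go (suc t) h ne = case climbs c< t (a + g) up (lia 3 (\z a g -> z :< a => #3 <= g => z :< a :+ g) _ a g lt g≥3) (lia 4 (\m a g t -> m :- a <= #1 :+ t => #3 <= g => m :- (a :+ g) <= t) m a g _ h g≥3) of \ where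
          (j , e) -> j + + 1 , lia 5 (\m a g w w' -> m == a :+ g :+ w => w' == w :+ g => m == a :+ w') m a g (g * j) _ e (*-step g j)
       where
       o = old' a a∈ ne (\e -> <-asym lt (subst (_< z0) (sym e) c<))
       up : a + g ∈ Y.A
       up = case mem? Y.A (a + g) of \ where
        (inl r) -> r
        (inr r) -> case a + g ≟ m of \ where
         (yes e) -> move Y.A Y.hi (sym e)
         (no e) -> clash (fst o) (upper (a + g) (lia 3 (\z a g -> z :< a => #3 <= g => z :< a :+ g) _ a g lt g≥3) (≤≢⇒< (snd o) e) r)
     c≢ : ¬ c ≡ z0 - g
     c≢ e = case climbs c< (∣ m ∣) (z0 + + 1) z0+1∈ x<x+1 (bound (z0 + + 1) z0+1∈) of \(i , e₁) -> case climbs c< (∣ m ∣) (z0 + + 2) z0+2∈ (lia 1 (\z -> z :< z :+ #2) _) (bound (z0 + + 2) z0+2∈) of \(j , e₂) ->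
       case *-unit g (i - j) (tr (lia 4 (\z m u w -> m == z :+ #1 :+ u => m == z :+ #2 :+ w => #1 == u :- w) z0 m (g * i) (g * j) e₁ e₂) (ring g i j)) of \h -> lia 1 (\g -> #3 <= g => g <= #1 => ff) g g≥3 h
      where
      ring : ∀ g i j -> g * i - g * j ≡ g * (i - j)
      ring = solve
      *-unit : ∀ g i -> + 1 ≡ g * i -> g ≤ + 1
      *-unit g i e = case g ≤? + 1 of \ where
         (yes h) -> h
         (no h) -> let g≥1 = lia 1 (\g -> ~ g <= #1 => #1 <= g) g h in ⊥e (h (subst (g ≤_) (sym e) (subst (_≤ g * i) (*1 g) (*-monoˡ-≤-nonNeg' g≥1 (*-pos⁻ g i g≥1 (subst (0z <_) e 0<+))))))
       where
       *-monoˡ-≤-nonNeg' : ∀ {g i} -> + 1 ≤ g -> + 1 ≤ i -> g * + 1 ≤ g * i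
       *-monoˡ-≤-nonNeg' {g} {i} a b = lia 2 (\u w -> #0 <= w :- u => u <= w) _ _ (subst (0z ≤_) (ring' g i) (*-nonneg (≤t 0≤+ a) (0≤- b)))
        where
        ring' : ∀ g i -> g * (i - + 1) ≡ g * i - g * + 1
        ring' = solve
      bound : ∀ a -> a ∈ Y.A -> m - a ≤ + ∣ m ∣
      bound a a∈ = lia 3 (\m a t -> t == m => #0 <= a => m :- a <= t) m a _ (∣+∣ Y.0≤n) (fst (Y.supp a∈))
      c< = lia 3 (\c z g -> c == z :- g => #3 <= g => c :< z) c _ g e g≥3
    -- m - 2 ∈ A is too close to the top to be translated, so c = m - 2.
    alternating : Alt Y.A z0 m -> Closed
    alternating alt = byAnti c≢ upper
     where
     m-2∈ : m - + 2 ∈ Y.A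
     m-2∈ = case z0 ≤? m - + 2 of \ where
      (yes h) -> tr (alt (m - + 2) h (lia 1 (\m -> m :- #2 :+ #2 <= m) m)) (move Y.A Y.hi (lia 1 (\m -> m == m :- #2 :+ #2) m))
      (no h) -> move Y.A below1 (lia 2 (\z m -> ~ z <= m :- #2 => z :< m => z :- #1 == m :- #2) _ m h z0<n)
     c≢ : ¬ c ≡ z0 - g
     c≢ e = lia 3 (\m g z -> m :- #2 :+ g <= m => #3 <= g => ff) m g z0 (snd (old' (m - + 2) m-2∈ (\e' -> lia 1 (\m -> m :- #2 == m => ff) m e') (\e' -> lia 4 (\m g z c -> m :- #2 == c => c == z :- g => z :< m => #3 <= g => ff) m g _ c e' e z0<n g≥3))) g≥3
     parity : ∀ x -> z0 ≤ x -> x ∈ Y.A -> Σ ℤ \i -> x ≡ m - + 2 * i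
     parity x h x∈ = case half (0≤- (snd (Y.supp x∈))) of \ where
      (inl (i , _ , e)) -> i , lia 3 (\x m i -> m :- x == 2 *: i => x == m :- 2 *: i) x m i e
      (inr (i , 0≤i , e)) -> clash (tr (sym (alt-run Y.A alt 0≤i x h (lia 3 (\x m i -> m :- x == 2 *: i :+ #1 => x :+ 2 *: i <= m) x m i e))) x∈) (move Y.A m-1∉ (lia 3 (\x m i -> m :- x == 2 *: i :+ #1 => m :- #1 == x :+ 2 *: i) x m i e))
     upper : ∀ z -> z0 < z -> z < m -> z ∉ Y.A -> z + m ∉ Y.D
     upper z a b p = case half (0≤- (<⇒≤ b)) of \ where
        (inl (i , 0≤i , e)) -> clash (tr (alt-run Y.A alt 0≤i z (<⇒≤ a) (lia 3 (\x m i -> m :- x == 2 *: i => x :+ 2 *: i <= m) z m i e)) (move Y.A Y.hi (lia 3 (\x m i -> m :- x == 2 *: i => m == x :+ 2 *: i) z m i e))) p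
        (inr (i , 0≤i , e)) -> out \q -> case Y.D-out q of \(x , y , x∈ , y∈ , e') -> case parity x (lia 4 (\x y z m -> x :+ y == z :+ m => y <= m => z <= x) x y z m e' (snd (Y.supp y∈)) |>0 <⇒≤ a) x∈ of \(s , es) -> case parity y (lia 4 (\x y z m -> x :+ y == z :+ m => x <= m => z <= y) x y z m e' (snd (Y.supp x∈)) |>0 <⇒≤ a) y∈ of \(t , et) ->
         lia 7 (\x y z m i s t -> x :+ y == z :+ m => m :- z == 2 *: i :+ #1 => x == m :- 2 *: s => y == m :- 2 *: t => ff) x y z m i s t e' e es et
      where
      _|>0_ : ∀ {y} -> z ≤ y -> z0 ≤ z -> z0 ≤ y
      p |>0 q = ≤t q p
  -- The member m - 1 cannot be raised by g, so it is the exception c. Hence m - (g - 1) is no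
  -- member, and antisymmetry puts g into Y. If a + g were a hole, the sum a + g would be missing by
  -- the positive balance of the reflected set.
  bottomClosed : (S : Solo (rev Y)) -> Solo.z0 S ≡ m - + 1 -> + 1 ∈ NSet.A (rev Y) -> (∀ t -> + 1 ≤ t -> t ≤ m - + 1 -> + 1 ≤ OnSet.φ (rev Y) t) -> Closed
  bottomClosed S e 1∈ pos a a∈ p q = case mem? Y.A (a + g) of \ where
      (inl r) -> r
      (inr r) -> clash (Y.D-in a∈ g∈ refl) (tr (sym (tr (RY.D-rev (m - (a + g) + m)) (cong Y.D (lia 2 (\x m -> m :+ m :- (m :- x :+ m) == x) _ m))))
       (SF.posR (m - (a + g)) (0≤- (snd o)) (lia 3 (\m a g -> #0 <= a => #3 <= g => m :- (a :+ g) :< m) m a g (fst (Y.supp a∈)) g≥3) (h∉ r)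
        (y≡x-1⇒1≤y⇒2≤x (Z.φ-out (0≤- (snd o)) (h∉ r)) (pos _ (lia 2 (\x m -> x <= m => #1 <= m :- x :+ #1) _ m (snd o)) (lia 3 (\m a g -> #0 <= a => #3 <= g => m :- (a :+ g) :+ #1 <= m :- #1) m a g (fst (Y.supp a∈)) g≥3)))))
   where
   module SF = SoloFacts (rev Y) S
   module RY = Rev Y
   module Z = OnSet (rev Y)
   o = old' a a∈ p q
   h∉ : a + g ∉ Y.A -> m - (a + g) ∉ Z.A
   h∉ r = out \s -> clash (move Y.A (RY.rev-out s) (lia 2 (\x m -> m :- (m :- x) == x) _ m)) r
   m-1∈ = RY.rev-out 1∈
   g≤m = lia 3 (\a g m -> a :+ g <= m => #0 <= a => g <= m) a g m (snd o) (fst (Y.supp a∈))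
   c≡ : c ≡ m - + 1
   c≡ = case m - + 1 ≟ c of \ where
    (yes h) -> sym h
    (no h) -> ⊥e (lia 2 (\m g -> m :- #1 :+ g <= m => #3 <= g => ff) m g (snd (old' (m - + 1) m-1∈ (\h' -> lia 1 (\m -> m :- #1 == m => ff) m h') h)) g≥3)
   gap∉ : g - + 1 ∉ Z.A
   gap∉ = out \s -> let y∈ = RY.rev-out s in lia 2 (\m g -> m :- (g :- #1) :+ g <= m => ff) m g (snd (old' (m - (g - + 1)) y∈ (\h -> lia 2 (\m g -> m :- (g :- #1) == m => #3 <= g => ff) m g h g≥3) (\h -> lia 3 (\m g c -> m :- (g :- #1) == c => c == m :- #1 => #3 <= g => ff) m g c h c≡ g≥3)))
   g∈ = move Y.A (RY.rev-out (tr (anti-not Z.A {x = m - g} SF.left (0≤- g≤m) (lia 3 (\m g z -> z == m :- #1 => #3 <= g => m :- g <= z) m g _ e g≥3) (lia 3 (\m g z -> z == m :- #1 => g :- #1 == #0 :+ z :- (m :- g)) m g _ e)) (cong not gap∉))) (x-[x-y]≡y m)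
  topClosed : (S : Solo Y) -> Solo.z0 S ≡ m - + 1 -> (∀ t -> + 1 ≤ t -> t ≤ m - + 1 -> + 1 ≤ Y.φ t) -> Closed
  topClosed S e pos = WithSolo.holeUp S (inl \z a b p h q -> clash q (posR z a b p (y≡x-1⇒1≤y⇒2≤x (Y.φ-out a p) (pos (z + + 1) (0≤x⇒1≤x+1 a) (lia 3 (\z y m -> z :< y => y == m :- #1 => z :+ #1 <= m :- #1) z _ m h e)))))
    (\z a b _ -> ⊥e (lia 3 (\z y m -> y :< z => z :< m => y == m :- #1 => ff) z _ m a b e))
   where open SoloFacts Y S using (z0; posR)
 abstract
  peelHalf : Coprime Y -> HalfKind Y -> TwoAP (NSet.A X) (OnSet.k X) ⊎ TwoAP Y.A Y.k
  peelHalf cop (even ev) = ⊥e (cop (+ 2) ≤r ev)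
  peelHalf cop (aps T) = inr T
  peelHalf cop (top S e _ pos) = inl (finish (topClosed S e pos))
  peelHalf cop (bottom S e 1∈ pos) = inl (finish (bottomClosed S e 1∈ pos))
  peelHalf cop (altPos S a b _ pos le) = inl (finish (WithSolo.Ends.positive S a b pos le))
  peelHalf cop (negAlt S a b _ _ alt) = inl (finish (WithSolo.Ends.alternating S a b alt))
  peelHalf cop (negPos S a b _ _ pos le) = inl (finish (WithSolo.Ends.positive S a b pos le))

-- One point beside two parallel progressions

six : ℤ -> ℤ -> ℤ -> List ℤ
six b s t = b ∷ b + t ∷ b + t + t ∷ b + s ∷ b + s + t ∷ b + s + s ∷ []

record K6Set (P : 𝔹) (size : ℤ) : Set where
 field
  b s t : ℤ
  size≡ : size ≡ + 6
  mem : All (_∈ P) (six b s t)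
  cover : ∀ x -> x ∈ P -> Any (x ≡_) (six b s t)

div-sub : ∀ {d a b} -> Div d a -> Div d b -> Div d (a - b)
div-sub {d} (i , refl) (j , refl) = i - j , ring d i j
 where
 ring : ∀ d i j -> d * i - d * j ≡ d * (i - j)
 ring = solve

-- The reflected set after a removal: 0 stands for the removed maximum, the rest is two progressions
-- from u and v. Sums of positive members fall into `F00`, `F01` or `F11`, and whether δ divides u
-- and v decides which of these can meet which progression.
module TwoEnds {n : ℤ} (B : NSet n) (cop : Coprime B) (u v δ p q c : ℤ) (δ≥1 : + 1 ≤ δ) (u≥1 : + 1 ≤ u) (u<v : u < v) (p≥0 : 0z ≤ p) (q≥0 : 0z ≤ q)
 (cover : ∀ x -> x ∈ NSet.A B -> x ≡ 0z ⊎ (Σ ℤ \i -> (0z ≤ i × i ≤ p) × x ≡ u + δ * i) ⊎ (Σ ℤ \i -> (0z ≤ i × i ≤ q) × x ≡ v + δ * i))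
 (in0 : ∀ i -> 0z ≤ i -> i ≤ p -> u + δ * i ∈ NSet.A B) (in1 : ∀ i -> 0z ≤ i -> i ≤ q -> v + δ * i ∈ NSet.A B)
 (disj : ∀ i j -> 0z ≤ i -> i ≤ p -> 0z ≤ j -> j ≤ q -> ¬ u + δ * i ≡ v + δ * j)
 (kpq : OnSet.k B ≡ p + q + + 3) (long : + 2 * OnSet.k B - + 1 ≤ n)
 (gen : ∀ x -> x ∈ NSet.A B -> 0z < x -> ¬ x ≡ u -> ¬ x ≡ c -> Gen B x) where
 open OnSet B
 private
  Result = TwoAP A k ⊎ K6Set A k
  -- Three explicit values and a tail let linear arithmetic deal with the product of δ and j, which
  -- enters as an unknown of its own.
  Idx : ℤ -> Set
  Idx j = (j ≡ 0z × δ * j ≡ 0z) ⊎ (j ≡ + 1 × δ * j ≡ δ) ⊎ (j ≡ + 2 × δ * j ≡ δ + δ) ⊎ (+ 3 ≤ j × δ + δ + δ ≤ δ * j)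
  IDX : Expr -> Expr -> Expr -> Formula
  IDX d j w = (j == #0 :∧ w == #0) :∨ (j == #1 :∧ w == d) :∨ (j == #2 :∧ w == d :+ d) :∨ (#3 <= j :∧ d :+ d :+ d <= w)
  0≤δ = ≤t 0≤+ δ≥1
  δ2 : δ * + 2 ≡ δ + δ
  δ2 = ring δ
   where
   ring : ∀ δ -> δ * + 2 ≡ δ + δ
   ring = solve
  abstract
   idx : ∀ j -> 0z ≤ j -> Idx j
   idx j 0≤j = case j ≟ 0z of \ where
       (yes e) -> inl (e , tr (cong (δ *_) e) (*0 δ))
       (no n0) -> case j ≟ + 1 of \ where
        (yes e) -> inr (inl (e , tr (cong (δ *_) e) (*1 δ)))
        (no n1) -> case j ≟ + 2 of \ where
         (yes e) -> inr (inr (inl (e , tr (cong (δ *_) e) δ2)))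
         (no n2) -> let j≥3 = lia 1 (\j -> #0 <= j => ~ j == #0 => ~ j == #1 => ~ j == #2 => #3 <= j) j 0≤j n0 n1 n2 in
          inr (inr (inr (j≥3 , lia 2 (\d w -> #0 <= w :- d :- d :- d => d :+ d :+ d <= w) δ _ (subst (0z ≤_) (ring δ j) (*-nonneg 0≤δ (0≤- j≥3))))))
    where
    ring : ∀ δ j -> δ * (j - + 3) ≡ δ * j - δ - δ - δ
    ring = solve
  0≤w : ∀ {j} -> 0z ≤ j -> 0z ≤ δ * j
  0≤w = *-nonneg 0≤δ
  F00 F01 F11 Form : ℤ -> Set
  F00 x = Σ ℤ \j -> (0z ≤ j × j ≤ p + p) × x ≡ u + u + δ * j
  F01 x = Σ ℤ \j -> (0z ≤ j × j ≤ p + q) × x ≡ u + v + δ * j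
  F11 x = Σ ℤ \j -> (0z ≤ j × j ≤ q + q) × x ≡ v + v + δ * j
  Form x = F00 x ⊎ F01 x ⊎ F11 x
  add : ∀ a b {x y z i j r s} -> (0z ≤ i × i ≤ r) -> (0z ≤ j × j ≤ s) -> x ≡ a + δ * i -> y ≡ b + δ * j -> x + y ≡ z -> Σ ℤ \l -> (0z ≤ l × l ≤ r + s) × z ≡ a + b + δ * l
  add a b {i = i} {j} (i1 , i2) (j1 , j₂) refl refl refl = i + j , (+≤ i1 j1 , +≤ i2 j₂) , ring a b δ i j
   where
   ring : ∀ a b δ i j -> a + δ * i + (b + δ * j) ≡ a + b + δ * (i + j)
   ring = solve
  pos : ∀ {x} -> 0z < x -> x ≡ 0z -> ⊥
  pos h e = <-irrefl (sym e) h
  form : ∀ x -> x ∈ A -> 0z < x -> ¬ x ≡ u -> ¬ x ≡ c -> Form x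
  form x x∈ 0<x a b = case gen x x∈ 0<x a b of \(y , z , (y∈ , 0<y) , (z∈ , 0<z) , e) -> case cover y y∈ of \ where
   (inl e') -> ⊥e (pos 0<y e')
   (inr (inl (i , bi , ei))) -> case cover z z∈ of \ where
    (inl e') -> ⊥e (pos 0<z e')
    (inr (inl (j , bj , ej))) -> inl (add u u bi bj ei ej e)
    (inr (inr (j , bj , ej))) -> inr (inl (add u v bi bj ei ej e))
   (inr (inr (i , bi , ei))) -> case cover z z∈ of \ where
    (inl e') -> ⊥e (pos 0<z e')
    (inr (inl (j , bj , ej))) -> inr (inl (add u v bj bi ej ei (tr (+-comm z y) e)))
    (inr (inr (j , bj , ej))) -> inr (inr (add v v bi bj ei ej e))
  form0 : ∀ i -> + 1 ≤ i -> i ≤ p -> ¬ u + δ * i ≡ c -> Form (u + δ * i)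
  form0 i a b = form _ (in0 i (≤t 0≤+ a) b) (lia 2 (\u w -> #1 <= u => #0 <= w => #0 :< u :+ w) u _ u≥1 (0≤w (≤t 0≤+ a)))
   (\e -> lia 4 (\u d j w -> u :+ w == u => #1 <= d => #1 <= j => IDX d j w => ff) u δ i (δ * i) e δ≥1 a (idx i (≤t 0≤+ a)))
  form1 : ∀ i -> 0z ≤ i -> i ≤ q -> ¬ v + δ * i ≡ c -> Form (v + δ * i)
  form1 i a b = form _ (in1 i a b) (lia 3 (\u v w -> #1 <= u => u :< v => #0 <= w => #0 :< v :+ w) u v _ u≥1 u<v (0≤w a))
   (\e -> lia 3 (\u v w -> u :< v => #0 <= w => v :+ w == u => ff) u v _ u<v (0≤w a) e)
  w0 = *0 δ
  w1 : δ * + 1 ≡ δ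
  w1 = *1 δ
  n≥1 = lia 3 (\u w n -> u :+ w <= n => #1 <= u => w == #0 => #1 <= n) u _ n (snd (supp (in0 0z ≤r p≥0))) u≥1 w0
  u∈ = move A (in0 0z ≤r p≥0) (tr (cong (\w -> u + w) w0) (+0 u))
  v∈ = move A (in1 0z ≤r q≥0) (tr (cong (\w -> v + w) w0) (+0 v))
  c01 : ∀ {i j} -> 0z ≤ i -> i ≤ p -> 0z ≤ j -> j ≤ q -> u + δ * i ≡ c -> ¬ v + δ * j ≡ c
  c01 a b a' b' e e' = disj _ _ a b a' b' (tr e (sym e'))
  down : ∀ a {r b} -> (∀ i -> 0z ≤ i -> i ≤ r -> a + δ * i ∈ A) -> (Σ ℤ \i -> (0z ≤ i × i ≤ r) × b ≡ a + δ * i) -> b ≡ a ⊎ b - δ ∈ A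
  down a {r} {b} mem (i , (p , l) , e) = case i ≟ 0z of \ where
     (yes z) -> inl (tr e (tr (cong (\i -> a + δ * i) z) (tr (cong (\w -> a + w) w0) (+0 a))))
     (no nz) -> inr (move A (mem (i - + 1) (lia 1 (\i -> #0 <= i => ~ i == #0 => #0 <= i :- #1) i p nz) (≤t x-1≤x l)) (sym (tr (cong (_- δ) e) (ring a δ i))))
   where
   ring : ∀ u δ i -> u + δ * i - δ ≡ u + δ * (i - + 1)
   ring = solve
  zero∈ : ∀ {b a} -> b ≡ a -> a ≡ δ -> b - δ ∈ A
  zero∈ refl refl = move A lo (sym (+-inverseʳ δ))
  startU : u ≡ δ -> TwoAP A k
  startU e = Chains.chains B n≥1 δ δ≥1 v \b b∈ nz ne -> [ (\z -> ⊥e (nz z)) , [ (\h -> [ (\e' -> zero∈ e' e) , (\r -> r) ]′ (down u in0 h)) , (\h -> [ (\e' -> ⊥e (ne e')) , (\r -> r) ]′ (down v in1 h)) ]′ ]′ (cover b b∈)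
  startV : v ≡ δ -> TwoAP A k
  startV e = Chains.chains B n≥1 δ δ≥1 u \b b∈ nz ne -> [ (\z -> ⊥e (nz z)) , [ (\h -> [ (\e' -> ⊥e (ne e')) , (\r -> r) ]′ (down u in0 h)) , (\h -> [ (\e' -> zero∈ e' e) , (\r -> r) ]′ (down v in1 h)) ]′ ]′ (cover b b∈)
  -- The positive members are u, perhaps 2u, and perhaps c: a chain of difference u from 0 with one
  -- exception.
  chainU : p ≡ 0z -> (∀ i -> 0z ≤ i -> i ≤ q -> v + δ * i ≡ u + u ⊎ v + δ * i ≡ c) -> Result
  chainU p0 z = inl (Chains.chains B n≥1 u u≥1 c \b b∈ nz ne -> case cover b b∈ of \ where
   (inl e) -> ⊥e (nz e)
   (inr (inl (i , (a , l) , e))) -> move A lo (lia 6 (\b u d i w p -> b == u :+ w => p == #0 => i <= p => #0 <= i => IDX d i w => #0 == b :- u) b u δ i (δ * i) p e p0 l a (idx i a))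
   (inr (inr (i , (a , l) , e))) -> [ (\h -> move A u∈ (lia 2 (\b u -> b == u :+ u => u == b :- u) b u (tr e h))) , (\h -> ⊥e (ne (tr e h))) ]′ (z i a l))
  -- All members lie in the triangle 0, u, u + δ, 2u, 2u + δ, 2u + 2δ. The full triangle is K_6;
  -- without the corner 2u + 2δ there are two chains of difference u, without 2u two of difference u
  -- + δ.
  module Final (p1 : p ≡ + 1) (j₀ : ℤ) (j0≥0 : 0z ≤ j₀) (v≡ : v ≡ u + u + δ * j₀) (small : j₀ + q ≤ + 2) where
   at : ∀ i -> v + δ * i ≡ u + u + δ * (j₀ + i)
   at i = tr (cong (_+ δ * i) v≡) (ring u δ j₀ i)
    where
    ring : ∀ u δ j i -> u + u + δ * j + δ * i ≡ u + u + δ * (j + i)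
    ring = solve
   u+δ∈ = move A (in0 (+ 1) 0≤+ (≡⇒≤ (sym p1))) (cong (\w -> u + w) w1)
   cases : ∀ x -> x ∈ A -> x ≡ 0z ⊎ x ≡ u ⊎ x ≡ u + δ ⊎ (Σ ℤ \j -> (j₀ ≤ j × j ≤ j₀ + q) × x ≡ u + u + δ * j)
   cases x x∈ = case cover x x∈ of \ where
    (inl z) -> inl z
    (inr (inl (i , (a , l) , e))) -> [ (\h -> inr (inl h)) , (\h -> inr (inr (inl h))) ]′ (lia 6 (\x u d i w p -> x == u :+ w => p == #1 => i <= p => #0 <= i => IDX d i w => x == u :∨ x == u :+ d) x u δ i (δ * i) p e p1 l a (idx i a))
    (inr (inr (i , (a , l) , e))) -> inr (inr (inr (j₀ + i , (lia 2 (\i j -> #0 <= i => j <= j :+ i) i _ a , +-monoʳ-≤ j₀ l) , tr e (at i))))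
   stepU : j₀ + q ≤ + 1 -> TwoAP A k
   stepU le = Chains.chains B n≥1 u u≥1 (u + δ) \b b∈ nz ne -> case cases b b∈ of \ where
    (inl e) -> ⊥e (nz e)
    (inr (inl e)) -> move A lo (lia 2 (\b u -> b == u => #0 == b :- u) b u e)
    (inr (inr (inl e))) -> ⊥e (ne e)
    (inr (inr (inr (j , (a , l) , e)))) -> [ (\h -> move A u∈ (sym h)) , (\h -> move A u+δ∈ (sym h)) ]′ (lia 6 (\b u d j w s -> b == u :+ u :+ w => j <= s => s <= #1 => #0 <= j => IDX d j w => b :- u == u :∨ b :- u == u :+ d) b u δ j (δ * j) _ e l le (≤t j0≥0 a) (idx j (≤t j0≥0 a)))
   stepUδ : + 1 ≤ j₀ -> TwoAP A k
   stepUδ ge = Chains.chains B n≥1 (u + δ) (lia 2 (\u d -> #1 <= u => #1 <= d => #1 <= u :+ d) u δ u≥1 δ≥1) u \b b∈ nz ne -> case cases b b∈ of \ where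
    (inl e) -> ⊥e (nz e)
    (inr (inl e)) -> ⊥e (ne e)
    (inr (inr (inl e))) -> move A lo (lia 2 (\b u -> b == u => #0 == b :- u) b _ e)
    (inr (inr (inr (j , (a , l) , e)))) -> [ (\h -> move A u∈ (sym h)) , (\h -> move A u+δ∈ (sym h)) ]′ (lia 7 (\b u d j w s i -> b == u :+ u :+ w => j <= s => s <= #2 => #1 <= i => i <= j => IDX d j w => b :- (u :+ d) == u :∨ b :- (u :+ d) == u :+ d) b u δ j (δ * j) _ _ e l small ge a (idx j (≤t j0≥0 a)))
   k6 : j₀ ≡ 0z -> q ≡ + 2 -> K6Set A k
   k6 j0 q2 = record { b = 0z ; s = u + δ ; t = u ; size≡ = tr kpq (cong₂ (\a b -> a + b + + 3) p1 q2)
     ; mem = lo ∷ move A u∈ (sym (0+ u)) ∷ at' 0z (0z + u + u) ≤r (≤t 0≤+ (≡⇒≤ (sym q2))) (lia 3 (\u w d -> w == #0 => #1 <= d => u :+ u :+ w == #0 :+ u :+ u) u _ δ w0 δ≥1) ∷ move A u+δ∈ (sym (0+ _))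
      ∷ at' (+ 1) (0z + (u + δ) + u) 0≤+ (≤t 1≤+ (≡⇒≤ (sym q2))) (lia 3 (\u w d -> w == d => u :+ u :+ w == #0 :+ (u :+ d) :+ u) u _ δ w1)
      ∷ at' (+ 2) (0z + (u + δ) + (u + δ)) 0≤+ (≡⇒≤ (sym q2)) (lia 3 (\u w d -> w == d :+ d => u :+ u :+ w == #0 :+ (u :+ d) :+ (u :+ d)) u _ δ δ2) ∷ []
     ; cover = \x x∈ -> case cases x x∈ of \ where
       (inl e) -> here e
       (inr (inl e)) -> th (here (tr e (sym (0+ u))))
       (inr (inr (inl e))) -> th (th (th (here (tr e (sym (0+ _))))))
       (inr (inr (inr (j , (a , l) , e)))) -> [ (\h -> th (th (here h))) , [ (\h -> th (th (th (th (here h))))) , (\h -> th (th (th (th (th (here h)))))) ]′ ]′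
        (lia 6 (\x u d j w s -> x == u :+ u :+ w => j <= s => s <= #2 => #0 <= j => IDX d j w => x == #0 :+ u :+ u :∨ x == #0 :+ (u :+ d) :+ u :∨ x == #0 :+ (u :+ d) :+ (u :+ d)) x u δ j (δ * j) _ e l small (≤t j0≥0 a) (idx j (≤t j0≥0 a))) }
    where
    at' : ∀ i y -> 0z ≤ i -> i ≤ q -> u + u + δ * i ≡ y -> y ∈ A
    at' i y a l e = move A (in1 i a l) (tr (at i) (tr (cong (\j -> u + u + δ * j) (tr (cong (_+ i) j0) (0+ i))) e))
   final : Result
   final = case + 1 ≤? j₀ of \ where
    (yes h) -> inl (stepUδ h)
    (no h) -> case j₀ + q ≤? + 1 of \ where
     (yes h') -> inl (stepU h')
     (no h') -> inr (k6 (lia 1 (\j -> #0 <= j => ~ #1 <= j => j == #0) _ j0≥0 h) (lia 2 (\j q -> #0 <= j => ~ #1 <= j => ~ j :+ q <= #1 => j :+ q <= #2 => q == #2) _ q j0≥0 h h' small))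
  finish : p ≡ + 1 -> F00 v -> F00 (v + δ * q) -> Result
  finish p1 (j , (a , _) , e) (j' , (a' , l') , e') = Final.final p1 j a e (lia 4 (\j q j' p -> j :+ q <= j' => j' <= p :+ p => p == #1 => j :+ q <= #2) j q _ p (*-cancel-≤ {δ} δ≥1 (≡⇒≤ (tr (ring δ j q) (lia 5 (\v u x y z -> v == u :+ u :+ x => v :+ y == u :+ u :+ z => x :+ y == z) v u (δ * j) (δ * q) _ e e')))) l' p1)
   where
   ring : ∀ δ j q -> δ * (j + q) ≡ δ * j + δ * q
   ring = solve
  unit : ∀ d a b e -> + 1 ≤ d -> δ ≡ a * d -> u ≡ b * d -> v ≡ e * d -> d ≡ + 1
  unit d a b e d≥1 eδ eu ev = case + 2 ≤? d of \ where
      (no h) -> 1≤x⇒2≰x⇒x≡1 d≥1 h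
      (yes h) -> ⊥e (cop d h \x x∈ -> case cover x x∈ of \ where
       (inl z) -> 0z , tr z (sym (*0 d))
       (inr (inl (i , _ , e'))) -> b + a * i , tr e' (tr (cong₂ (\u δ -> u + δ * i) eu eδ) (ring d a b i))
       (inr (inr (i , _ , e'))) -> e + a * i , tr e' (tr (cong₂ (\u δ -> u + δ * i) ev eδ) (ring d a e i)))
   where
   ring : ∀ d a b i -> b * d + a * d * i ≡ d * (b + a * i)
   ring = solve
  -- As k = p + q + 3, the number 2p + 2q + 5 is 2k - 1, the least length allowed, and n does not
  -- exceed the larger end of the two progressions.
  tooShort : ∀ a -> δ ≡ a -> u + a * p < + 2 * p + + 2 * q + + 5 -> v + a * q < + 2 * p + + 2 * q + + 5 -> ⊥
  tooShort a e h0 h1 = case cover n hi of \ where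
      (inl z) -> lia 2 (\n m -> n == #0 => #1 <= n => ff) n n z n≥1
      (inr (inl (i , (_ , l) , e'))) -> lia 9 (\n u x y d p q k z -> n == u :+ x => #0 <= y :- x => y == z => u :+ z :< 2 *: p :+ 2 *: q :+ #5 => k == p :+ q :+ #3 => 2 *: k :- #1 <= n => ff) n u (δ * i) _ δ p q k _ e' (up i p l) (cong (_* p) e) h0 kpq long
      (inr (inr (i , (_ , l) , e'))) -> lia 9 (\n u x y d p q k z -> n == u :+ x => #0 <= y :- x => y == z => u :+ z :< 2 *: p :+ 2 *: q :+ #5 => k == p :+ q :+ #3 => 2 *: k :- #1 <= n => ff) n v (δ * i) _ δ p q k _ e' (up i q l) (cong (_* q) e) h1 kpq long
   where
   ring : ∀ δ i p -> δ * (p - i) ≡ δ * p - δ * i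
   ring = solve
   up : ∀ i p -> i ≤ p -> 0z ≤ δ * p - δ * i
   up i p l = subst (0z ≤_) (ring δ i p) (*-nonneg 0≤δ (0≤- l))
  tooShort2 : δ ≡ + 2 -> u ≤ + 4 -> v ≤ + 2 * p + + 4 -> ⊥
  tooShort2 e a b = tooShort (+ 2) e (lia 3 (\u p q -> u <= #4 => #0 <= q => u :+ 2 *: p :< 2 *: p :+ 2 *: q :+ #5) u p q a q≥0) (lia 3 (\v p q -> v <= 2 *: p :+ #4 => v :+ 2 *: q :< 2 *: p :+ 2 *: q :+ #5) v p q b)
  -- The sum u + v, and every sum of two elements of the second progression, exceeds v.
  vGen : ¬ v ≡ c -> F00 v
  vGen ne = case form v v∈ (<-trans (1≤x⇒0<x u≥1) u<v) (\e -> <-irrefl (sym e) u<v) ne of \ where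
   (inl f) -> f
   (inr (inl (j , (a , _) , e))) -> ⊥e (lia 3 (\u v w -> v == u :+ v :+ w => #1 <= u => #0 <= w => ff) u v _ e u≥1 (0≤w a))
   (inr (inr (j , (a , _) , e))) -> ⊥e (lia 3 (\u v w -> v == v :+ v :+ w => #1 <= u => u :< v => #0 <= w => ff) u v _ e u≥1 u<v (0≤w a))
  twice : p ≡ 0z -> ∀ {x} -> F00 x -> x ≡ u + u
  twice p0 {x} (j , (a , l) , e) = lia 6 (\x u d j w p -> x == u :+ u :+ w => #0 <= j => j <= p :+ p => p == #0 => IDX d j w => x == u :+ u) x u δ j (δ * j) p e a l p0 (idx j a)
  vAt0 : v + δ * 0z ≡ v
  vAt0 = tr (cong (\w -> v + w) w0) (+0 v)
  D-mult : ∀ i -> Div δ (δ * i)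
  D-mult i = i , refl
  F00-div : ∀ {x i} -> x ≡ u + δ * i -> F00 x -> Div δ u
  F00-div {x} {i} e (j , _ , e') = subst (Div δ) (lia 4 (\x u y z -> x == u :+ y => x == u :+ u :+ z => y :- z == u) x u (δ * i) (δ * j) e e') (div-sub {δ} (D-mult i) (D-mult j))
  F01-div0 : ∀ {x i} -> x ≡ u + δ * i -> F01 x -> Div δ v
  F01-div0 {x} {i} e (j , _ , e') = subst (Div δ) (lia 5 (\x u v y z -> x == u :+ y => x == u :+ v :+ z => y :- z == v) x u v (δ * i) (δ * j) e e') (div-sub {δ} (D-mult i) (D-mult j))
  F01-div1 : ∀ {x i} -> x ≡ v + δ * i -> F01 x -> Div δ u
  F01-div1 {x} {i} e (j , _ , e') = subst (Div δ) (lia 5 (\x u v y z -> x == v :+ y => x == u :+ v :+ z => y :- z == u) x u v (δ * i) (δ * j) e e') (div-sub {δ} (D-mult i) (D-mult j))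
  F11-div : ∀ {x i} -> x ≡ v + δ * i -> F11 x -> Div δ v
  F11-div {x} {i} e (j , _ , e') = subst (Div δ) (lia 4 (\x u y z -> x == u :+ y => x == u :+ u :+ z => y :- z == u) x v (δ * i) (δ * j) e e') (div-sub {δ} (D-mult i) (D-mult j))
  Big : ℤ -> Set
  Big x = x ≡ δ + δ ⊎ δ + δ + δ ≤ x
  big : ∀ x -> + 1 ≤ x -> ¬ x ≡ δ -> Div δ x -> Big x
  big x x≥1 ne (i , e) = case 0z ≤? i of \ where
   (yes h) -> lia 4 (\x d i w -> x == w => #1 <= x => ~ x == d => IDX d i w => x == d :+ d :∨ d :+ d :+ d <= x) x δ i _ e x≥1 ne (idx i h)
   (no h) -> ⊥e (h (≤t 0≤+ (*-pos⁻ δ i δ≥1 (lia 2 (\x w -> x == w => #1 <= x => #0 :< w) x _ e x≥1))))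
  F00-div1 : ∀ {x i} -> Div δ u -> x ≡ v + δ * i -> F00 x -> Div δ v
  F00-div1 {x} {i} (e , eu) ex (j , _ , e') = e + e + j - i , tr (lia 5 (\x u v y z -> x == v :+ y => x == u :+ u :+ z => v == u :+ u :+ z :- y) x u v (δ * i) (δ * j) ex e') (tr (cong (\x -> x + x + δ * j - δ * i) eu) (ring δ e j i))
   where
   ring : ∀ δ e j i -> δ * e + δ * e + δ * j - δ * i ≡ δ * (e + e + j - i)
   ring = solve
  F11-div0 : ∀ {x i} -> Div δ v -> x ≡ u + δ * i -> F11 x -> Div δ u
  F11-div0 {x} {i} (e , ev) ex (j , _ , e') = e + e + j - i , tr (lia 5 (\x u v y z -> x == u :+ y => x == v :+ v :+ z => u == v :+ v :+ z :- y) x u v (δ * i) (δ * j) ex e') (tr (cong (\x -> x + x + δ * j - δ * i) ev) (ring δ e j i))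
   where
   ring : ∀ δ e j i -> δ * e + δ * e + δ * j - δ * i ≡ δ * (e + e + j - i)
   ring = solve
  zeroOr : ∀ {x} -> 0z ≤ x -> x ≡ 0z ⊎ + 1 ≤ x
  zeroOr {x} = lia 1 (\x -> #0 <= x => x == #0 :∨ #1 <= x) x
  1≤2 : + 1 ≤ + 2
  1≤2 = +≤+ (ℕ.s≤s ℕ.z≤n)
  0≤1 : 0z ≤ + 1
  0≤1 = 0≤+
  0≤2 : 0z ≤ + 2
  0≤2 = 0≤+
  w3 : δ * + 3 ≡ δ + δ + δ
  w3 = ring δ
   where
   ring : ∀ δ -> δ * + 3 ≡ δ + δ + δ
   ring = solve
  Z : ℤ -> Set
  Z i = v + δ * i ≡ u + u ⊎ v + δ * i ≡ c
  threeZ : Z 0z -> Z (+ 1) -> Z (+ 2) -> ⊥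
  threeZ = lia 7 (\v u c x y z d -> x == #0 => y == d => z == d :+ d => #1 <= d => (v :+ x == u :+ u :∨ v :+ x == c) => (v :+ y == u :+ u :∨ v :+ y == c) => (v :+ z == u :+ u :∨ v :+ z == c) => ff) v u c _ _ _ δ w0 w1 δ2 δ≥1
  Z01 : Z 0z -> Z (+ 1) -> u + u ≡ v ⊎ u + u ≡ v + δ
  Z01 = lia 6 (\v u c x y d -> x == #0 => y == d => #1 <= d => (v :+ x == u :+ u :∨ v :+ x == c) => (v :+ y == u :+ u :∨ v :+ y == c) => u :+ u == v :∨ u :+ u == v :+ d) v u c _ _ δ w0 w1 δ≥1
  Z0 : p ≡ 0z -> Z 0z
  Z0 p0 = case v ≟ c of \ where
   (yes e) -> inr (tr vAt0 e)
   (no ne) -> inl (tr vAt0 (twice p0 (vGen ne)))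
  shortZ : p ≡ 0z -> (+ 1 ≤ q -> Z (+ 1)) -> q ≤ + 1 -> Result
  shortZ p0 z1 le = chainU p0 \i a l -> case zeroOr a of \ where
   (inl z) -> subst Z (sym z) (Z0 p0)
   (inr h) -> subst Z (≤≥ h (≤t l le)) (z1 (≤t h l))
  -- Only the first progression consists of multiples of δ.
  caseU : Div δ u -> Big u -> ¬ Div δ v -> Result
  caseU du bu nv = chainU p0 \i a l -> inr (tr (cong (\i -> v + δ * i) (≤≥ (subst (i ≤_) q0 l) a)) (tr vAt0 v≡c))
   where
   v≡c : v ≡ c
   v≡c = case v ≟ c of \ where
    (yes e) -> e
    (no ne) -> ⊥e (nv (F00-div1 {i = 0z} du (sym vAt0) (vGen ne)))
   q0 : q ≡ 0z
   q0 = case zeroOr q≥0 of \ where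
    (inl e) -> e
    (inr h) -> ⊥e (case form1 (+ 1) 0≤1 h (\e -> lia 4 (\v c y d -> v == c => v :+ y == c => y == d => #1 <= d => ff) v c _ δ v≡c e w1 δ≥1) of \ where
     (inl f) -> nv (F00-div1 {i = + 1} du refl f)
     (inr (inl (j , (a , _) , e))) -> lia 5 (\u v y w d -> v :+ y == u :+ v :+ w => y == d => #0 <= w => #1 <= d => (u == d :+ d :∨ d :+ d :+ d <= u) => ff) u v _ _ δ e w1 (0≤w a) δ≥1 bu
     (inr (inr f)) -> nv (F11-div {i = + 1} refl f))
   p0 : p ≡ 0z
   p0 = case zeroOr p≥0 of \ where
    (inl e) -> e
    (inr h) -> ⊥e (case form0 (+ 1) ≤r h (\e -> c01 0≤1 h ≤r q≥0 e (tr vAt0 v≡c)) of \ where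
     (inl (j , (a , _) , e)) -> lia 4 (\u y w d -> u :+ y == u :+ u :+ w => y == d => #0 <= w => #1 <= d => (u == d :+ d :∨ d :+ d :+ d <= u) => ff) u _ _ δ e w1 (0≤w a) δ≥1 bu
     (inr (inl f)) -> nv (F01-div0 {i = + 1} refl f)
     (inr (inr (j , (a , _) , e))) -> lia 5 (\u v y w d -> u :+ y == v :+ v :+ w => y == d => #0 <= w => #1 <= d => u :< v => (u == d :+ d :∨ d :+ d :+ d <= u) => ff) u v _ _ δ e w1 (0≤w a) δ≥1 u<v bu)
  -- Modulo δ the first progression can come only from `F01`, the second only from `F00` or `F11`.
  -- So u + δ, if present, is too small for a sum and is the exception, and v lies in `F00`. The
  -- cases with p at least 2 or q at least 3 are then refuted, in part because the set is too short.
  caseV : ¬ Div δ u -> ¬ u ≡ δ -> Div δ v -> Big v -> Result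
  caseV nu u≢δ dv bv = case zeroOr p≥0 of \ where
     (inl p0) -> case q ≤? + 1 of \ where
      (yes h) -> shortZ p0 (Z1 p0) h
      (no h) -> ⊥e (absurd0 p0 (≰⇒≥' h))
     (inr h) -> case + 2 ≤? p of \ where
      (yes h') -> ⊥e (absurd2 h h')
      (no h') -> one h (1≤x⇒2≰x⇒x≡1 h h')
   where
   ≰⇒≥' = x≰1⇒2≤x
   g1 : ∀ i -> 0z ≤ i -> i ≤ q -> ¬ v + δ * i ≡ c -> F00 (v + δ * i) ⊎ F11 (v + δ * i)
   g1 i a l ne = case form1 i a l ne of \ where
    (inl f) -> inl f
    (inr (inl f)) -> ⊥e (nu (F01-div1 {i = i} refl f))
    (inr (inr f)) -> inr f
   g₀ : ∀ i -> + 1 ≤ i -> i ≤ p -> ¬ u + δ * i ≡ c -> F01 (u + δ * i)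
   g₀ i a l ne = case form0 i a l ne of \ where
    (inl f) -> ⊥e (nu (F00-div {i = i} refl f))
    (inr (inl f)) -> f
    (inr (inr f)) -> ⊥e (nu (F11-div0 {i = i} dv refl f))
   Z1 : p ≡ 0z -> + 1 ≤ q -> Z (+ 1)
   Z1 p0 h = case v + δ * + 1 ≟ c of \ where
    (yes e) -> inr e
    (no ne) -> case g1 (+ 1) 0≤1 h ne of \ where
     (inl f) -> inl (twice p0 f)
     (inr (j , (a , _) , e)) -> ⊥e (lia 4 (\v y w d -> v :+ y == v :+ v :+ w => y == d => #0 <= w => #1 <= d => (v == d :+ d :∨ d :+ d :+ d <= v) => ff) v _ _ δ e w1 (0≤w a) δ≥1 bv)
   twoδ : + 2 ≤ q -> F11 (v + δ * + 2) -> v ≡ δ + δ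
   twoδ h (j , (a , _) , e) = lia 4 (\v y w d -> v :+ y == v :+ v :+ w => y == d :+ d => #0 <= w => #1 <= d => (v == d :+ d :∨ d :+ d :+ d <= v) => v == d :+ d) v _ _ δ e δ2 (0≤w a) δ≥1 bv
   absurd0 : p ≡ 0z -> + 2 ≤ q -> ⊥
   absurd0 p0 h = case v + δ * + 2 ≟ c of \ where
      (yes e) -> threeZ (Z0 p0) z1 (inr e)
      (no ne) -> case g1 (+ 2) 0≤2 h ne of \ where
       (inl f) -> threeZ (Z0 p0) z1 (inl (twice p0 f))
       (inr f) -> let v2 = twoδ h f in case Z01 (Z0 p0) z1 of \ where
        (inl e) -> u≢δ (lia 3 (\u v d -> u :+ u == v => v == d :+ d => u == d) u v δ e v2)
        -- Here δ, u and v are 2, 3 and 4 times u - δ, which therefore is 1 by coprimality.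
        (inr e) -> let d1 = unit (u - δ) (+ 2) (+ 3) (+ 4) (lia 3 (\u v d -> u :+ u == v :+ d => v == d :+ d => #1 <= d => #1 <= u :- d) u v δ e v2 δ≥1) (lia 3 (\u v d -> u :+ u == v :+ d => v == d :+ d => d == 2 *: (u :- d)) u v δ e v2) (lia 3 (\u v d -> u :+ u == v :+ d => v == d :+ d => u == 3 *: (u :- d)) u v δ e v2) (lia 3 (\u v d -> u :+ u == v :+ d => v == d :+ d => v == 4 *: (u :- d)) u v δ e v2) in
         tooShort2 (lia 3 (\u v d -> u :+ u == v :+ d => v == d :+ d => u :- d == #1 => d == #2) u v δ e v2 d1) (lia 3 (\u v d -> u :+ u == v :+ d => v == d :+ d => u :- d == #1 => u <= #4) u v δ e v2 d1) (lia 4 (\u v d p -> u :+ u == v :+ d => v == d :+ d => u :- d == #1 => #0 <= p => v <= 2 *: p :+ #4) u v δ p e v2 d1 p≥0)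
    where
    z1 = Z1 p0 (≤t 1≤2 h)
   c≡ : + 1 ≤ p -> u + δ * + 1 ≡ c
   c≡ h = case u + δ * + 1 ≟ c of \ where
    (yes e) -> e
    (no ne) -> case g₀ (+ 1) ≤r h ne of \ where
     (j , (a , _) , e) -> ⊥e (lia 5 (\u v y w d -> u :+ y == u :+ v :+ w => y == d => #0 <= w => #1 <= d => (v == d :+ d :∨ d :+ d :+ d <= v) => ff) u v _ _ δ e w1 (0≤w a) δ≥1 bv)
   ne1 : + 1 ≤ p -> ∀ {i} -> 0z ≤ i -> i ≤ q -> ¬ v + δ * i ≡ c
   ne1 h a l = c01 0≤1 h a l (c≡ h)
   v00 : + 1 ≤ p -> F00 v
   v00 h = vGen \e -> ne1 h ≤r q≥0 (tr vAt0 e)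
   noTwo : + 1 ≤ p -> v ≡ δ + δ -> ⊥
   noTwo h v2 = case v00 h of \(j , (a , _) , e) -> let
      dd = lia 5 (\u v d j w -> v == u :+ u :+ w => v == d :+ d => ~ u == d => #1 <= u => #1 <= d => IDX d j w => d == 2 *: u) u v δ j (δ * j) e v2 u≢δ u≥1 δ≥1 (idx j a)
      v4 = lia 3 (\u v d -> d == 2 *: u => v == d :+ d => v == 4 *: u) u v δ dd v2
      u1 = unit u (+ 2) (+ 1) (+ 4) u≥1 dd (sym (1* u)) v4 in
    tooShort2 (lia 2 (\u d -> d == 2 *: u => u == #1 => d == #2) u δ dd u1) (lia 1 (\u -> u == #1 => u <= #4) u u1) (lia 3 (\u v p -> v == 4 *: u => u == #1 => #0 <= p => v <= 2 *: p :+ #4) u v p v4 u1 p≥0)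
   absurd2 : + 1 ≤ p -> + 2 ≤ p -> ⊥
   absurd2 h h' = case g₀ (+ 2) 1≤2 h' (\e -> lia 5 (\u c y z d -> u :+ y == c => u :+ z == c => y == d => z == d :+ d => #1 <= d => ff) u c _ _ δ (c≡ h) e w1 δ2 δ≥1) of \ where
    (j , (a , _) , e) -> noTwo h (lia 5 (\u v y w d -> u :+ y == u :+ v :+ w => y == d :+ d => #0 <= w => #1 <= d => (v == d :+ d :∨ d :+ d :+ d <= v) => v == d :+ d) u v _ _ δ e δ2 (0≤w a) δ≥1 bv)
   one : + 1 ≤ p -> p ≡ + 1 -> Result
   one h p1 = case q ≤? + 2 of \ where
      (yes l) -> finish p1 (v00 h) (case g1 q q≥0 ≤r (ne1 h q≥0 ≤r) of \ where
       (inl f) -> f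
       (inr (j , (a , _) , e)) -> ⊥e (noTwo h (lia 5 (\v d q y w -> v :+ y == v :+ v :+ w => q <= #2 => #0 <= w => #1 <= d => (v == d :+ d :∨ d :+ d :+ d <= v) => IDX d q y => v == d :+ d) v δ q (δ * q) _ e l (0≤w a) δ≥1 bv (idx q q≥0))))
      (no l) -> ⊥e (three (lia 1 (\q -> ~ q <= #2 => #3 <= q) q l))
    where
    three : + 3 ≤ q -> ⊥
    three l = case v00 h of \(j₀ , (a0 , _) , e0) -> case g1 (+ 2) 0≤2 l2 (ne1 h 0≤2 l2) of \ where
       (inr f) -> noTwo h (twoδ l2 f)
       (inl (j₂ , (a2 , b2) , e₂)) -> let v2u = lia 9 (\u v d i x j y p z -> v == u :+ u :+ x => v :+ z == u :+ u :+ y => z == d :+ d => j <= p :+ p => p == #1 => #0 <= i => #1 <= d => IDX d i x => IDX d j y => v == u :+ u) u v δ _ (δ * j₀) _ (δ * j₂) p _ e0 e₂ δ2 b2 p1 a0 δ≥1 (idx j₀ a0) (idx j₂ a2) in case g1 (+ 3) 0≤3 l (ne1 h 0≤3 l) of \ where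
        (inl (j , (a , b) , e)) -> lia 7 (\u v d j y p z -> v == u :+ u => v :+ z == u :+ u :+ y => z == d :+ d :+ d => j <= p :+ p => p == #1 => #1 <= d => IDX d j y => ff) u v δ j (δ * j) p _ v2u e w3 b p1 δ≥1 (idx j a)
        (inr (j , (a , b) , e)) -> case lia 4 (\v d y z -> v :+ z == v :+ v :+ y => z == d :+ d :+ d => #0 <= y => (v == d :+ d :∨ d :+ d :+ d <= v) => v == d :+ d :∨ v == d :+ d :+ d) v δ _ _ e w3 (0≤w a) bv of \ where
         (inl v2) -> noTwo h v2
         (inr v3) -> let d1 = unit (u - δ) (+ 2) (+ 3) (+ 6) (lia 3 (\u v d -> v == u :+ u => v == d :+ d :+ d => #1 <= d => #1 <= u :- d) u v δ v2u v3 δ≥1) (lia 3 (\u v d -> v == u :+ u => v == d :+ d :+ d => d == 2 *: (u :- d)) u v δ v2u v3) (lia 3 (\u v d -> v == u :+ u => v == d :+ d :+ d => u == 3 *: (u :- d)) u v δ v2u v3) (lia 3 (\u v d -> v == u :+ u => v == d :+ d :+ d => v == 6 *: (u :- d)) u v δ v2u v3) in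
          tooShort2 (lia 3 (\u v d -> v == u :+ u => v == d :+ d :+ d => u :- d == #1 => d == #2) u v δ v2u v3 d1) (lia 3 (\u v d -> v == u :+ u => v == d :+ d :+ d => u :- d == #1 => u <= #4) u v δ v2u v3 d1) (lia 4 (\u v d p -> v == u :+ u => v == d :+ d :+ d => u :- d == #1 => p == #1 => v <= 2 *: p :+ #4) u v δ p v2u v3 d1 p1)
     where
     l2 = ≤t (+≤+ (ℕ.s≤s (ℕ.s≤s ℕ.z≤n))) l
     0≤3 = 0≤+
  -- Neither does: each progression has its sums in the double of the other one.
  caseNone : ¬ Div δ u -> ¬ Div δ v -> Result
  caseNone nu nv = case zeroOr p≥0 of \ where
     (inl p0) -> chainU p0 \i a l -> case v + δ * i ≟ c of \ where
      (yes e) -> inr e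
      (no ne) -> inl (twice p0 (only00 i a l ne))
     (inr h) -> case u + δ * + 1 ≟ c of \ where
      (yes e) -> case + 2 ≤? p of \ where
       (no h') -> finish (1≤x⇒2≰x⇒x≡1 h h') (v00 h e) (only00 q q≥0 ≤r (c01 0≤1 h q≥0 ≤r e))
       (yes h') -> ⊥e (case v00 h e of \(j₀ , (a0 , _) , e0) -> case only11 (+ 2) 1≤2 h' (not2 e) of \(j , (a , _) , e₁) ->
        [ (\(x , y) -> contraD y x) , (\(x , y) -> contraE e h h' y x) ]′ (lia 8 (\u v d i x j y z -> v == u :+ u :+ x => u :+ z == v :+ v :+ y => z == d :+ d => #1 <= u => #1 <= d => #0 <= y => IDX d i x => IDX d j y => (v == u :+ u :∧ d == 3 *: u) :∨ (v == u :+ u :∧ 3 *: u == d :+ d)) u v δ j₀ (δ * j₀) j _ _ e0 e₁ δ2 u≥1 δ≥1 (0≤w a) (idx j₀ a0) (idx j a)))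
      (no ne) -> case only11 (+ 1) ≤r h ne of \(j , (a , _) , e₁) -> second h (lia 6 (\u v d j y z -> u :+ z == v :+ v :+ y => z == d => u :< v => #1 <= u => #1 <= d => IDX d j y => u :+ d == v :+ v) u v δ j (δ * j) _ e₁ w1 u<v u≥1 δ≥1 (idx j a))
   where
   only00 : ∀ i -> 0z ≤ i -> i ≤ q -> ¬ v + δ * i ≡ c -> F00 (v + δ * i)
   only00 i a l ne = case form1 i a l ne of \ where
    (inl f) -> f
    (inr (inl f)) -> ⊥e (nu (F01-div1 {i = i} refl f))
    (inr (inr f)) -> ⊥e (nv (F11-div {i = i} refl f))
   only11 : ∀ i -> + 1 ≤ i -> i ≤ p -> ¬ u + δ * i ≡ c -> F11 (u + δ * i)
   only11 i a l ne = case form0 i a l ne of \ where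
    (inl f) -> ⊥e (nu (F00-div {i = i} refl f))
    (inr (inl f)) -> ⊥e (nv (F01-div0 {i = i} refl f))
    (inr (inr f)) -> f
   v00 : + 1 ≤ p -> u + δ * + 1 ≡ c -> F00 v
   v00 h e = vGen \e' -> c01 0≤1 h ≤r q≥0 e (tr vAt0 e')
   not2 : u + δ * + 1 ≡ c -> ¬ u + δ * + 2 ≡ c
   not2 e e' = lia 5 (\u c y z d -> u :+ y == c => u :+ z == c => y == d => z == d :+ d => #1 <= d => ff) u c _ _ δ e e' w1 δ2 δ≥1
   -- The remaining configurations have difference 3. Each progression must end below twice the end
   -- of the other, which for the small u and v at hand is too short for n.
   module Three (δ3 : δ ≡ + 3) where
    l3 : ∀ i -> δ * i ≡ + 3 * i
    l3 i = cong (_* i) δ3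
    boundU : ∀ i -> + 1 ≤ i -> i ≤ p -> ¬ u + δ * i ≡ c -> u + + 3 * i ≤ v + v + + 6 * q
    boundU i a l ne = case only11 i a l ne of \(j , (_ , b) , e) -> lia 7 (\u v i j q x y -> u :+ x == v :+ v :+ y => x == 3 *: i => y == 3 *: j => j <= q :+ q => u :+ 3 *: i <= v :+ v :+ 6 *: q) u v i j q _ _ e (l3 i) (l3 j) b
    boundV : ∀ i -> 0z ≤ i -> i ≤ q -> ¬ v + δ * i ≡ c -> v + + 3 * i ≤ u + u + + 6 * p
    boundV i a l ne = case only00 i a l ne of \(j , (_ , b) , e) -> lia 7 (\u v i j q x y -> u :+ x == v :+ v :+ y => x == 3 *: i => y == 3 *: j => j <= q :+ q => u :+ 3 *: i <= v :+ v :+ 6 *: q) v u i j p _ _ e (l3 i) (l3 j) b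
    other : ∀ a i -> a + δ * i ≡ c -> ¬ a + δ * (i - + 1) ≡ c
    other a i e e' = lia 4 (\a c x y -> a :+ x == c => a :+ y == c => x :- y == #3 => ff) a c (δ * i) (δ * (i - + 1)) e e' (lia 3 (\i x y -> x == 3 *: i => y == 3 *: (i :- #1) => x :- y == #3) i _ _ (l3 i) (l3 (i - + 1)))
    -- If the last term is the exception c, the term before it is not, at the cost of one step of 3.
    lastU : p ≤ + 1 ⊎ u + + 3 * p ≤ v + v + + 6 * q + + 3
    lastU = case p ≤? + 1 of \ where
     (yes h) -> inl h
     (no h) -> inr (case u + δ * p ≟ c of \ where
      (no ne) -> lia 2 (\x y -> x <= y => x <= y :+ #3) _ _ (boundU p (lia 1 (\p -> ~ p <= #1 => #1 <= p) p h) ≤r ne)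
      (yes e) -> lia 3 (\u p y -> u :+ 3 *: (p :- #1) <= y => u :+ 3 *: p <= y :+ #3) u p _ (boundU (p - + 1) (lia 1 (\p -> ~ p <= #1 => #1 <= p :- #1) p h) x-1≤x (other u p e)))
    lastV : q ≡ 0z ⊎ v + + 3 * q ≤ u + u + + 6 * p + + 3
    lastV = case zeroOr q≥0 of \ where
     (inl h) -> inl h
     (inr h) -> inr (case v + δ * q ≟ c of \ where
      (no ne) -> lia 2 (\x y -> x <= y => x <= y :+ #3) _ _ (boundV q q≥0 ≤r ne)
      (yes e) -> lia 3 (\u p y -> u :+ 3 *: (p :- #1) <= y => u :+ 3 *: p <= y :+ #3) v q _ (boundV (q - + 1) (0≤- h) x-1≤x (other v q e)))
   contraD : δ ≡ + 3 * u -> v ≡ u + u -> ⊥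
   contraD d3 v2 = tooShort (+ 3) δ3 (lia 4 (\u v p q -> (p <= #1 :∨ u :+ 3 *: p <= v :+ v :+ 6 *: q :+ #3) => u == #1 => v == u :+ u => #0 <= q => u :+ 3 *: p :< 2 *: p :+ 2 *: q :+ #5) u v p q lastU u1 v2 q≥0)
     (lia 4 (\u v p q -> (q == #0 :∨ v :+ 3 *: q <= u :+ u :+ 6 *: p :+ #3) => u == #1 => v == u :+ u => #0 <= p => v :+ 3 *: q :< 2 *: p :+ 2 *: q :+ #5) u v p q lastV u1 v2 p≥0)
    where
    u1 = unit u (+ 3) (+ 1) (+ 2) u≥1 d3 (sym (1* u)) (tr v2 (lia 1 (\u -> u :+ u == 2 *: u) u))
    δ3 = tr d3 (cong (+ 3 *_) u1)
    open Three δ3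
   contraE : u + δ * + 1 ≡ c -> + 1 ≤ p -> + 2 ≤ p -> + 3 * u ≡ δ + δ -> v ≡ u + u -> ⊥
   contraE e h h' r v2 = tooShort (+ 3) δ3 (lia 4 (\u v p q -> u :+ 3 *: p <= v :+ v :+ 6 *: q => u == #2 => v == u :+ u => #0 <= q => u :+ 3 *: p :< 2 *: p :+ 2 *: q :+ #5) u v p q (boundU p h ≤r pne) u2 v2 q≥0)
     (lia 4 (\u v p q -> v :+ 3 *: q <= u :+ u :+ 6 *: p => u == #2 => v == u :+ u => #0 <= p => v :+ 3 *: q :< 2 *: p :+ 2 *: q :+ #5) u v p q (boundV q q≥0 ≤r (c01 0≤1 h q≥0 ≤r e)) u2 v2 p≥0)
    where
    d1 = unit (δ - u) (+ 3) (+ 2) (+ 4) (lia 2 (\u d -> 3 *: u == d :+ d => #1 <= u => #1 <= d :- u) u δ r u≥1) (lia 2 (\u d -> 3 *: u == d :+ d => d == 3 *: (d :- u)) u δ r) (lia 2 (\u d -> 3 *: u == d :+ d => u == 2 *: (d :- u)) u δ r) (lia 3 (\u d v -> 3 *: u == d :+ d => v == u :+ u => v == 4 *: (d :- u)) u δ v r v2)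
    u2 : u ≡ + 2
    u2 = lia 2 (\u d -> 3 *: u == d :+ d => d :- u == #1 => u == #2) u δ r d1
    δ3 = lia 2 (\u d -> 3 *: u == d :+ d => d :- u == #1 => d == #3) u δ r d1
    open Three δ3
    pne : ¬ u + δ * p ≡ c
    pne e' = lia 5 (\u c x y p -> u :+ x == c => u :+ y == c => x == 3 *: p => y == #3 => #2 <= p => ff) u c _ _ p e' e (l3 p) (l3 (+ 1)) h'
   second : + 1 ≤ p -> u + δ ≡ v + v -> Result
   second h s = case v ≟ c of \ where
    (no ne) -> ⊥e (case vGen ne of \(j , (a , _) , e) -> let r = lia 5 (\u v d j w -> u :+ d == v :+ v => v == u :+ u :+ w => #1 <= u => #1 <= d => IDX d j w => (d == 3 *: u :∧ v == u :+ u)) u v δ j (δ * j) s e u≥1 δ≥1 (idx j a) in contraD (fst r) (snd r))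
    (yes e) -> case zeroOr q≥0 of \ where
     (inr h') -> ⊥e (case only00 (+ 1) 0≤1 h' (\e' -> lia 4 (\v c y d -> v == c => v :+ y == c => y == d => #1 <= d => ff) v c _ δ e e' w1 δ≥1) of \(j , (a , _) , e₁) ->
      let r = lia 6 (\u v d j w y -> u :+ d == v :+ v => v :+ y == u :+ u :+ w => y == d => u :< v => #1 <= u => #1 <= d => IDX d j w => (d == 3 *: u :∧ v == u :+ u)) u v δ j (δ * j) _ s e₁ w1 u<v u≥1 δ≥1 (idx j a) in contraD (fst r) (snd r))
     (inl q0) -> case + 2 ≤? p of \ where
      (yes h') -> ⊥e (case only11 (+ 2) 1≤2 h' (\e' -> c01 0≤2 h' ≤r q≥0 e' (tr vAt0 e)) of \(j , (a , l) , e₁) -> lia 7 (\u v d j w y q -> u :+ d == v :+ v => u :+ y == v :+ v :+ w => y == d :+ d => q == #0 => j <= q :+ q => #1 <= d => IDX d j w => ff) u v δ j (δ * j) _ q s e₁ δ2 q0 l δ≥1 (idx j a))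
      (no h') -> inl (Chains.chains B n≥1 v (≤t u≥1 (<⇒≤ u<v)) u \b b∈ nz ne -> case cover b b∈ of \ where
       (inl z) -> ⊥e (nz z)
       (inr (inl (i , (a , l) , e₁))) -> [ (\z -> ⊥e (ne z)) , (\z -> move A v∈ (sym z)) ]′ (lia 7 (\b u v d i w p -> b == u :+ w => i <= p => ~ #2 <= p => u :+ d == v :+ v => #0 <= i => IDX d i w => b == u :∨ b :- v == v) b u v δ i (δ * i) p e₁ l h' s a (idx i a))
       (inr (inr (i , (a , l) , e₁))) -> move A lo (lia 6 (\b v d i w q -> b == v :+ w => i <= q => q == #0 => #0 <= i => IDX d i w => #0 == b :- v) b v δ i (δ * i) q e₁ l q0 a (idx i a)))
  -- Coprimality gives δ = 1, so the positive members form two intervals. As n is at least 2k - 1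
  -- they are far apart (`far`), and few sums can reach the second interval.
  caseBoth : ¬ u ≡ δ -> Div δ u -> Div δ v -> Result
  caseBoth u≢δ (a , ea) (b , eb) = case zeroOr p≥0 of \ where
     (inl p0) -> case q ≤? + 1 of \ where
      (yes h) -> shortZ p0 (Z1 p0) h
      (no h) -> ⊥e (absurd0 p0 (x≰1⇒2≤x h))
     (inr h) -> case + 2 ≤? p of \ where
      (yes h') -> ⊥e (case v00 h of \(j , (_ , l) , e) -> case form0 (+ 2) 1≤2 h' (\e' -> lia 4 (\u c x y -> u :+ x == c => u :+ y == c => x == #1 => y == #2 => ff) u c _ _ (c≡ h) e' (lin (+ 1)) (lin (+ 2))) of \ where
       (inl (i , (a , _) , e')) -> lia 8 (\u v p q i j x y -> v == u :+ u :+ y => y == j => j <= p :+ p => u :+ #2 == u :+ u :+ x => #0 <= x => 2 *: p :+ q :+ #5 <= v => #0 <= q => ff) u v p q i j _ _ e (lin j) l (tr (cong (\w -> u + w) (sym (lin (+ 2)))) e') (0≤w a) far q≥0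
       (inr (inl (i , (a , _) , e'))) -> lia 5 (\u v p q x -> u :+ #2 == u :+ v :+ x => #0 <= x => 2 *: p :+ q :+ #5 <= v => #0 <= q => #1 <= p => ff) u v p q _ (tr (cong (\w -> u + w) (sym (lin (+ 2)))) e') (0≤w a) far q≥0 h
       (inr (inr (i , (a , _) , e'))) -> lia 5 (\u v p q x -> u :+ #2 == v :+ v :+ x => #0 <= x => 2 *: p :+ q :+ #5 <= v => #0 <= q => #1 <= p => u :< v => ff) u v p q _ (tr (cong (\w -> u + w) (sym (lin (+ 2)))) e') (0≤w a) far q≥0 h u<v)
      (no h') -> one h (1≤x⇒2≰x⇒x≡1 h h')
   where
   δ1 = unit δ (+ 1) a b δ≥1 (sym (1* δ)) (tr ea (*-comm δ a)) (tr eb (*-comm δ b))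
   lin : ∀ j -> δ * j ≡ j
   lin j = tr (cong (_* j) δ1) (1* j)
   u≥2 : + 2 ≤ u
   u≥2 = lia 2 (\u d -> d == #1 => ~ u == d => #1 <= u => #2 <= u) u δ δ1 u≢δ u≥1
   apart : u + p < v
   apart = case u + p <? v of \ where
    (yes h) -> h
    (no h) -> ⊥e (disj (v - u) 0z (0≤- (<⇒≤ u<v)) (lia 3 (\u v p -> ~ u :+ p :< v => v :- u <= p) u v p h) ≤r q≥0 (tr (cong (\w -> u + w) (lin (v - u))) (tr (x+[y-x]≡y u) (sym vAt0))))
   far : + 2 * p + q + + 5 ≤ v
   far = case + 2 * p + q + + 5 ≤? v of \ where
    (yes h) -> h
    (no h) -> let lt = lia 3 (\v p q -> ~ 2 *: p :+ q :+ #5 <= v => v :+ 1 *: q :< 2 *: p :+ 2 *: q :+ #5) v p q h in ⊥e (tooShort (+ 1) δ1 (lia 4 (\u v p q -> u :+ p :< v => v :+ 1 *: q :< 2 *: p :+ 2 *: q :+ #5 => #0 <= q => u :+ 1 *: p :< 2 *: p :+ 2 *: q :+ #5) u v p q apart lt q≥0) lt)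
   g1 : ∀ i -> 0z ≤ i -> i ≤ q -> ¬ v + δ * i ≡ c -> F00 (v + δ * i) ⊎ u ≤ i
   g1 i a l ne = case form1 i a l ne of \ where
    (inl f) -> inl f
    (inr (inl (j , (b , _) , e))) -> inr (lia 5 (\u v i x w -> v :+ x == u :+ v :+ w => x == i => #0 <= w => u <= i) u v i _ _ e (lin i) (0≤w b))
    (inr (inr (j , (b , _) , e))) -> ⊥e (lia 6 (\v i x w q p -> v :+ x == v :+ v :+ w => x == i => #0 <= w => i <= q => 2 *: p :+ q :+ #5 <= v => #0 <= p => ff) v i _ _ q p e (lin i) (0≤w b) l far p≥0)
   Z1 : p ≡ 0z -> + 1 ≤ q -> Z (+ 1)
   Z1 p0 h = case v + δ * + 1 ≟ c of \ where
    (yes e) -> inr e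
    (no ne) -> [ (\f -> inl (twice p0 f)) , (\l -> ⊥e (lia 1 (\u -> #2 <= u => u <= #1 => ff) u u≥2 l)) ]′ (g1 (+ 1) 0≤1 h ne)
   absurd0 : p ≡ 0z -> + 2 ≤ q -> ⊥
   absurd0 p0 h = case v + δ * + 2 ≟ c of \ where
      (yes e) -> threeZ (Z0 p0) z1 (inr e)
      (no ne) -> [ (\f -> threeZ (Z0 p0) z1 (inl (twice p0 f))) , (\l -> lia 5 (\u v d p q -> (u :+ u == v :∨ u :+ u == v :+ d) => #1 <= d => u <= #2 => 2 *: p :+ q :+ #5 <= v => #0 <= p => #2 <= q => ff) u v δ p q (Z01 (Z0 p0) z1) δ≥1 l far p≥0 h) ]′ (g1 (+ 2) 0≤2 h ne)
    where
    z1 = Z1 p0 (≤t 1≤2 h)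
   c≡ : + 1 ≤ p -> u + δ * + 1 ≡ c
   c≡ h = case u + δ * + 1 ≟ c of \ where
    (yes e) -> e
    (no ne) -> ⊥e (let s = cong (\w -> u + w) (sym (lin (+ 1))) in case form0 (+ 1) ≤r h ne of \ where
     (inl (j , (a , _) , e)) -> lia 2 (\u w -> u :+ #1 == u :+ u :+ w => #2 <= u => #0 <= w => ff) u _ (tr s e) u≥2 (0≤w a)
     (inr (inl (j , (a , _) , e))) -> lia 3 (\u v w -> u :+ #1 == u :+ v :+ w => #2 <= u => u :< v => #0 <= w => ff) u v _ (tr s e) u≥2 u<v (0≤w a)
     (inr (inr (j , (a , _) , e))) -> lia 3 (\u v w -> u :+ #1 == v :+ v :+ w => #2 <= u => u :< v => #0 <= w => ff) u v _ (tr s e) u≥2 u<v (0≤w a))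
   v00 : + 1 ≤ p -> F00 v
   v00 h = vGen \e -> c01 0≤1 h ≤r q≥0 (c≡ h) (tr vAt0 e)
   one : + 1 ≤ p -> p ≡ + 1 -> Result
   one h p1 = case v00 h of \(j , (a , l) , e) -> let
      v≤ = lia 5 (\u v p j w -> v == u :+ u :+ w => w == j => j <= p :+ p => p == #1 => v <= u :+ u :+ #2) u v p j _ e (lin j) l p1
      impossible : ∀ i -> i ≤ + 3 -> i ≤ q -> u ≤ i -> ⊥
      impossible i b b' h = lia 5 (\u v p q i -> v <= u :+ u :+ #2 => u <= i => i <= #3 => i <= q => 2 *: p :+ q :+ #5 <= v => p == #1 => ff) u v p q i v≤ h b b' far p1 in case q ≤? + 2 of \ where
    (yes b) -> finish p1 (v00 h) ([ (\f -> f) , (\u≤ -> ⊥e (impossible q (≤t b (+≤+ (ℕ.s≤s (ℕ.s≤s ℕ.z≤n)))) ≤r u≤)) ]′ (g1 q q≥0 ≤r (c01 0≤1 h q≥0 ≤r (c≡ h))))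
    (no b) -> ⊥e (let q≥3 = lia 1 (\q -> ~ q <= #2 => #3 <= q) q b in case g1 (+ 3) 0≤+ q≥3 (c01 0≤1 h 0≤+ q≥3 (c≡ h)) of \ where
     (inr u≤) -> impossible (+ 3) ≤r q≥3 u≤
     (inl (i , (_ , l') , e')) -> lia 8 (\u v p j w i y z -> v == u :+ u :+ w => #0 <= w => v :+ z == u :+ u :+ y => z == #3 => y == i => i <= p :+ p => p == #1 => ff) u v p j _ i _ _ e (0≤w a) e' (lin (+ 3)) (lin i) l' p1)
 abstract
  twoEnds : TwoAP A k ⊎ K6Set A k
  twoEnds = case u ≟ δ of \ where
     (yes e) -> inl (startU e)
     (no u≢δ) -> case v ≟ δ of \ where
      (yes e) -> inl (startV e)
      (no v≢δ) -> case div? δ u δ≥1 (≤t 0≤1 u≥1) of \ where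
       (yes du) -> case div? δ v δ≥1 (≤t 0≤1 v≥1) of \ where
        (yes dv) -> caseBoth u≢δ du dv
        (no nv) -> caseU du (big u u≥1 u≢δ du) nv
       (no nu) -> case div? δ v δ≥1 (≤t 0≤1 v≥1) of \ where
        (yes dv) -> caseV nu u≢δ dv (big v v≥1 v≢δ dv)
        (no nv) -> caseNone nu nv
   where
   v≥1 : + 1 ≤ v
   v≥1 = ≤t u≥1 (<⇒≤ u<v)

coprime-rev : ∀ {n} (X : NSet n) -> Coprime X -> Coprime (rev X)
coprime-rev {n} X cop d d≥2 div = cop d d≥2 \x x∈ -> subst (Div d) (x-[x-y]≡y n) (div-sub {d} (div n (in-rev lo (+0 n))) (div (n - x) (in-rev x∈ refl)))
 where
 open Rev X
 open NSet X

-- Symmetries and sums of the triangle K_6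

Shape : 𝔹 -> ℤ -> ℤ -> ℤ -> Set
Shape P b s t = All (_∈ P) (six b s t) × (∀ x -> x ∈ P -> Any (x ≡_) (six b s t))

swapShape : ∀ {P b s t} -> Shape P b s t -> Shape P b t s
swapShape {P} {b} {s} {t} (m1 ∷ m2 ∷ m3 ∷ m4 ∷ m5 ∷ m6 ∷ [] , c) = m1 ∷ m4 ∷ m6 ∷ m2 ∷ move P m5 eq ∷ m3 ∷ [] , \x x∈ -> case c x x∈ of \ where
   (here e) -> here e
   (th (here e)) -> th (th (th (here e)))
   (th (th (here e))) -> th (th (th (th (th (here e)))))
   (th (th (th (here e)))) -> th (here e)
   (th (th (th (th (here e))))) -> th (th (th (th (here (tr e eq)))))
   (th (th (th (th (th (here e)))))) -> th (th (here e))
 where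
 eq = lia 3 (\b s t -> b :+ s :+ t == b :+ t :+ s) b s t

-- Together with `swapShape` this generates the affine symmetries of the triangle, so that any
-- corner can serve as base point.
turnShape : ∀ {P b s t} -> Shape P b s t -> Shape P (b + t + t) (s - t) (- t)
turnShape {P} {b} {s} {t} (m1 ∷ m2 ∷ m3 ∷ m4 ∷ m5 ∷ m6 ∷ [] , c) = m3 ∷ move P m2 e₂ ∷ move P m1 e₁ ∷ move P m5 e₅ ∷ move P m4 e4 ∷ move P m6 e₆ ∷ [] , \x x∈ -> case c x x∈ of \ where
   (here e) -> th (th (here (tr e e₁)))
   (th (here e)) -> th (here (tr e e₂))
   (th (th (here e))) -> here e
   (th (th (th (here e)))) -> th (th (th (th (here (tr e e4)))))
   (th (th (th (th (here e))))) -> th (th (th (here (tr e e₅))))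
   (th (th (th (th (th (here e)))))) -> th (th (th (th (th (here (tr e e₆))))))
 where
 e₁ = ring b t
  where
  ring : ∀ b t -> b ≡ b + t + t + - t + - t
  ring = solve
 e₂ = ring b t
  where
  ring : ∀ b t -> b + t ≡ b + t + t + - t
  ring = solve
 e4 = ring b s t
  where
  ring : ∀ b s t -> b + s ≡ b + t + t + (s - t) + - t
  ring = solve
 e₅ = lia 3 (\b s t -> b :+ s :+ t == b :+ t :+ t :+ (s :- t)) b s t
 e₆ = lia 3 (\b s t -> b :+ s :+ s == b :+ t :+ t :+ (s :- t) :+ (s :- t)) b s t

k6-rev : ∀ {n} (X : NSet n) {z} -> K6Set (NSet.A (rev X)) z -> K6Set (NSet.A X) z
k6-rev {n} X K = record { b = n - b ; s = - s ; t = - t ; size≡ = size≡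
  ; mem = case mem of \ where (m1 ∷ m2 ∷ m3 ∷ m4 ∷ m5 ∷ m6 ∷ []) -> rev-out m1 ∷ move A (rev-out m2) (r2 n b t) ∷ move A (rev-out m3) (r3 n b t t) ∷ move A (rev-out m4) (r2 n b s) ∷ move A (rev-out m5) (r3 n b s t) ∷ move A (rev-out m6) (r3 n b s s) ∷ []
  ; cover = \x x∈ -> case cover (n - x) (in-rev x∈ refl) of \ where
    (here e) -> here (flip x e)
    (th (here e)) -> th (here (tr (flip x e) (r2 n b t)))
    (th (th (here e))) -> th (th (here (tr (flip x e) (r3 n b t t))))
    (th (th (th (here e)))) -> th (th (th (here (tr (flip x e) (r2 n b s)))))
    (th (th (th (th (here e))))) -> th (th (th (th (here (tr (flip x e) (r3 n b s t))))))
    (th (th (th (th (th (here e)))))) -> th (th (th (th (th (here (tr (flip x e) (r3 n b s s))))))) }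
 where
 open K6Set K
 open Rev X
 open NSet X
 r2 : ∀ n b t -> n - (b + t) ≡ n - b + - t
 r2 = solve
 r3 : ∀ n b s t -> n - (b + s + t) ≡ n - b + - s + - t
 r3 = solve
 flip : ∀ x {y} -> n - x ≡ y -> x ≡ n - y
 flip x refl = lia 2 (\n x -> x == n :- (n :- x)) n x

count-list : ∀ P L {a b} -> a ≤ b -> (∀ x -> x ∈ P -> Any (x ≡_) L) -> count P a b ≤ + length L
-- A head that recurs in the tail could be dropped, and P would be covered by fewer entries than it
-- has members.
distinct : ∀ P L {a b} -> a ≤ b -> (∀ x -> x ∈ P -> Any (x ≡_) L) -> + length L ≤ count P a b -> AllPairs (\x y -> ¬ x ≡ y) L

private
 without : 𝔹 -> ℤ -> 𝔹
 without P y x = P x ∧ not (bool (x ≟ y))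
 without-sub : ∀ P y {L} -> (∀ x -> x ∈ P -> Any (x ≡_) (y ∷ L)) -> ∀ x -> x ∈ without P y -> Any (x ≡_) L
 without-sub P y c x q = case c x (fst (∧-in {P x} q)) of \ where
  (here e) -> clash (snd (∧-in {P x} q)) (cong not (in-bool (x ≟ y) e))
  (th r) -> r
 count-without : ∀ P y {a b} -> a ≤ b -> count P a b ≤ count (without P y) a b + + 1
 count-without P y a≤b = ≤t (count-⊂ P (ins y (without P y)) a≤b sub) (count-ins≤ y (without P y) a≤b)
  where
  sub : ∀ {x} -> x ∈ P -> x ∈ ins y (without P y)
  sub {x} p with x ≟ y
  ... | yes e = tr (cong (\b -> b ∧ false ∨ true) p) refl
  ... | no ne = cong (\b -> b ∧ true ∨ false) p

count-list P [] a≤b c = ≡⇒≤ (tr (∑-cong (χ P) (\_ -> 0z) a≤b (\x _ _ -> χ-out (out \p -> case c x p of \()))) (∑-zero a≤b))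
count-list P (y ∷ L) a≤b c = ≤t (count-without P y a≤b) (lia 2 (\u m -> u <= m => u :+ #1 <= #1 :+ m) _ _ (count-list (without P y) L a≤b (without-sub P y c)))

distinct P [] a≤b c big = []
distinct P (y ∷ L) {a} {b} a≤b c big = ¬Any⇒All¬ L (\r -> lia 2 (\u m -> u <= m => #1 :+ m <= u => ff) _ _ (count-list P L a≤b (\x p -> case c x p of \ where
   (here e) -> Any.map (tr e) r
   (th q) -> q)) big)
 ∷ distinct (without P y) L a≤b (without-sub P y c) (lia 3 (\m u v -> #1 :+ m <= u => u <= v :+ #1 => m <= v) _ _ _ big (count-without P y a≤b))

-- The points with nonnegative coordinates of sum at most 4, that is, K_6 + K_6.
idx15 : List ℤ²
idx15 = (+ 0 , + 0) ∷ (+ 0 , + 1) ∷ (+ 0 , + 2) ∷ (+ 0 , + 3) ∷ (+ 0 , + 4) ∷ (+ 1 , + 0) ∷ (+ 1 , + 1) ∷ (+ 1 , + 2) ∷ (+ 1 , + 3) ∷ (+ 2 , + 0) ∷ (+ 2 , + 1) ∷ (+ 2 , + 2) ∷ (+ 3 , + 0) ∷ (+ 3 , + 1) ∷ (+ 4 , + 0) ∷ []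

at : ℤ -> ℤ -> ℤ -> ℤ² -> ℤ
at b s t (i , j) = b + i * s + j * t

private
 _∈?_ = DecMem._∈?_ (≡-dec _≟_ _≟_)

abstract
 K6-sums : ∀ x y -> x Mem.∈ K6 -> y Mem.∈ K6 -> (x +² y) Mem.∈ idx15
 K6-sums x y p q = All.lookup (All.lookup (toWitness {a? = All.all? (\x -> All.all? (\y -> (x +² y) ∈? idx15) K6) K6} tt) p) q

unique-injective : ∀ (f : ℤ² -> ℤ) L -> AllPairs (\x y -> ¬ x ≡ y) (map f L) -> ∀ {x y} -> x Mem.∈ L -> y Mem.∈ L -> f x ≡ f y -> x ≡ y
unique-injective f (z ∷ L) (u ∷ us) (here refl) (here refl) e = refl
unique-injective f (z ∷ L) (u ∷ us) (here refl) (th q) e = ⊥e (All.lookup u (∈-map⁺ f q) e)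
unique-injective f (z ∷ L) (u ∷ us) (th p) (here refl) e = ⊥e (All.lookup u (∈-map⁺ f p) (sym e))
unique-injective f (z ∷ L) (u ∷ us) (th p) (th q) e = unique-injective f L us p q e

shape-at : ∀ {P b s t} -> Shape P b s t -> ∀ x -> x ∈ P -> Σ ℤ² \z -> z Mem.∈ K6 × x ≡ at b s t z
shape-at {b = b} {s} {t} (_ , c) x x∈ = case c x x∈ of \ where
 (here e) -> _ , here refl , tr e (lia 3 (\b s t -> b == b :+ 0 *: s :+ 0 *: t) b s t)
 (th (here e)) -> _ , th (here refl) , tr e (lia 3 (\b s t -> b :+ t == b :+ 0 *: s :+ 1 *: t) b s t)
 (th (th (here e))) -> _ , th (th (here refl)) , tr e (lia 3 (\b s t -> b :+ t :+ t == b :+ 0 *: s :+ 2 *: t) b s t)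
 (th (th (th (here e)))) -> _ , th (th (th (here refl))) , tr e (lia 3 (\b s t -> b :+ s == b :+ 1 *: s :+ 0 *: t) b s t)
 (th (th (th (th (here e))))) -> _ , th (th (th (th (here refl)))) , tr e (lia 3 (\b s t -> b :+ s :+ t == b :+ 1 *: s :+ 1 *: t) b s t)
 (th (th (th (th (th (here e)))))) -> _ , th (th (th (th (th (here refl))))) , tr e (lia 3 (\b s t -> b :+ s :+ s == b :+ 2 *: s :+ 0 *: t) b s t)

at-+ : ∀ b s t x y -> at b s t x + at b s t y ≡ at (b + b) s t (x +² y)
at-+ b s t (i , j) (i' , j') = ring b s t i j i' j'
 where
 ring : ∀ b s t i j i' j' -> b + i * s + j * t + (b + i' * s + j' * t) ≡ b + b + (i + i') * s + (j + j') * t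
 ring = solve

module K6Sums {n : ℤ} (X : NSet n) (b s t : ℤ) (sh : Shape (NSet.A X) b s t) where
 open OnSet X
 sums : ∀ x -> x ∈ D -> Any (x ≡_) (map (at (b + b) s t) idx15)
 sums x p = case D-out p of \(y , z , y∈ , z∈ , e) -> case shape-at sh y y∈ of \(i , i∈ , ei) -> case shape-at sh z z∈ of \(j , j∈ , ej) ->
  subst (\x -> x Mem.∈ map (at (b + b) s t) idx15) (tr (sym (at-+ b s t i j)) (tr (sym (cong₂ _+_ ei ej)) e)) (∈-map⁺ (at (b + b) s t) (K6-sums i j i∈ j∈))
 module _ (large : + 15 ≤ dd) where
  -- The 15 expressions cover 2A, so if 2A has 15 elements no two expressions coincide.
  injective = unique-injective (at (b + b) s t) idx15 (distinct D (map (at (b + b) s t) idx15) (0≤x⇒0≤x+x+1 0≤n) sums large)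
  apart : ∀ i j i' j' -> {T (bool ((+ i , + j) ∈? idx15) ∧ bool ((+ i' , + j') ∈? idx15))} -> ¬ (+ i , + j) ≡ (+ i' , + j') -> ¬ + i * s + + j * t ≡ + i' * s + + j' * t
  apart i j i' j' {w} ne e = ne (injective (bool-in ((+ i , + j) ∈? idx15) (fst (∧-in {bool ((+ i , + j) ∈? idx15)} (true! w)))) (bool-in ((+ i' , + j') ∈? idx15) (snd (∧-in {bool ((+ i , + j) ∈? idx15)} (true! w))))
    (tr (+-assoc (b + b) _ _) (tr (cong (\w -> b + b + w) e) (sym (+-assoc (b + b) _ _)))))
   where
   true! : ∀ {b} -> T b -> b ≡ true
   true! {true} _ = refl

-- The triangle with its least corner at 0. Each excluded relation between d and e would be a
-- coincidence among the 15 sums.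
record Normal {n : ℤ} (X : NSet n) : Set where
 open NSet X
 field
  d e : ℤ
  d≥1 : + 1 ≤ d
  d<e : d < e
  shape : Shape A 0z e d
  n≡ : n ≡ e + e
  e≢2d : ¬ e ≡ d + d
  e≢3d : ¬ e ≡ + 3 * d
  e≢4d : ¬ e ≡ + 4 * d
  2e≢3d : ¬ + 2 * e ≡ + 3 * d
  3e≢4d : ¬ + 3 * e ≡ + 4 * d

module Normalise {n : ℤ} (X : NSet n) (large : + 15 ≤ OnSet.dd X) where
 open OnSet X
 private
  build : ∀ b s t -> Shape A b s t -> + 1 ≤ t -> t < s -> Normal X
  build b s t sh t≥1 t<s = record { d = t ; e = s ; d≥1 = t≥1 ; d<e = t<s ; shape = sh' ; n≡ = n≡
    ; e≢2d = \e -> K.apart large 1 0 0 2 (\()) (lia 2 (\s t -> s == t :+ t => 1 *: s :+ 0 *: t == 0 *: s :+ 2 *: t) s t e)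
    ; e≢3d = \e -> K.apart large 1 0 0 3 (\()) (lia 2 (\s t -> s == 3 *: t => 1 *: s :+ 0 *: t == 0 *: s :+ 3 *: t) s t e)
    ; e≢4d = \e -> K.apart large 1 0 0 4 (\()) (lia 2 (\s t -> s == 4 *: t => 1 *: s :+ 0 *: t == 0 *: s :+ 4 *: t) s t e)
    ; 2e≢3d = \e -> K.apart large 2 0 0 3 (\()) (lia 2 (\s t -> 2 *: s == 3 *: t => 2 *: s :+ 0 *: t == 0 *: s :+ 3 *: t) s t e)
    ; 3e≢4d = \e -> K.apart large 3 0 0 4 (\()) (lia 2 (\s t -> 3 *: s == 4 *: t => 3 *: s :+ 0 *: t == 0 *: s :+ 4 *: t) s t e) }
   where
   module K = K6Sums X b s t sh
   m = fst sh
   b≡0 : b ≡ 0z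
   b≡0 = case m of \ where
    (m1 ∷ _) -> case snd sh 0z lo of \ where
     (here e) -> sym e
     (th (here e)) -> ⊥e (lia 2 (\b t -> #0 == b :+ t => #0 <= b => #1 <= t => ff) b t e (fst (supp m1)) t≥1)
     (th (th (here e))) -> ⊥e (lia 2 (\b t -> #0 == b :+ t :+ t => #0 <= b => #1 <= t => ff) b t e (fst (supp m1)) t≥1)
     (th (th (th (here e)))) -> ⊥e (lia 3 (\b s t -> #0 == b :+ s => #0 <= b => #1 <= t => t :< s => ff) b s t e (fst (supp m1)) t≥1 t<s)
     (th (th (th (th (here e))))) -> ⊥e (lia 3 (\b s t -> #0 == b :+ s :+ t => #0 <= b => #1 <= t => t :< s => ff) b s t e (fst (supp m1)) t≥1 t<s)
     (th (th (th (th (th (here e)))))) -> ⊥e (lia 3 (\b s t -> #0 == b :+ s :+ s => #0 <= b => #1 <= t => t :< s => ff) b s t e (fst (supp m1)) t≥1 t<s)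
   sh' = subst (\b -> Shape A b s t) b≡0 sh
   n≡ : n ≡ s + s
   n≡ = case fst sh' of \ where
    (_ ∷ _ ∷ _ ∷ _ ∷ _ ∷ m6 ∷ []) -> let h = snd (supp m6) in case snd sh' n hi of \ where
     (here e) -> ⊥e (lia 3 (\n s t -> n == #0 => #0 :+ s :+ s <= n => #1 <= t => t :< s => ff) n s t e h t≥1 t<s)
     (th (here e)) -> ⊥e (lia 3 (\n s t -> n == #0 :+ t => #0 :+ s :+ s <= n => #1 <= t => t :< s => ff) n s t e h t≥1 t<s)
     (th (th (here e))) -> ⊥e (lia 3 (\n s t -> n == #0 :+ t :+ t => #0 :+ s :+ s <= n => #1 <= t => t :< s => ff) n s t e h t≥1 t<s)
     (th (th (th (here e)))) -> ⊥e (lia 3 (\n s t -> n == #0 :+ s => #0 :+ s :+ s <= n => #1 <= t => t :< s => ff) n s t e h t≥1 t<s)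
     (th (th (th (th (here e))))) -> ⊥e (lia 3 (\n s t -> n == #0 :+ s :+ t => #0 :+ s :+ s <= n => #1 <= t => t :< s => ff) n s t e h t≥1 t<s)
     (th (th (th (th (th (here e)))))) -> lia 2 (\n s -> n == #0 :+ s :+ s => n == s :+ s) n s e
  corner : ∀ b s t -> Shape A b s t -> + 1 ≤ s -> + 1 ≤ t -> Normal X
  corner b s t sh s≥1 t≥1 = case <-cmp s t of \ where
   (tri< h _ _) -> build b t s (swapShape sh) s≥1 h
   (tri> _ _ h) -> build b s t sh t≥1 h
   (tri≈ _ h _) -> ⊥e (K6Sums.apart X b s t sh large 1 0 0 1 (\()) (lia 2 (\s t -> s == t => 1 *: s :+ 0 *: t == 0 *: s :+ 1 *: t) s t h))
 abstract
  -- The symmetries move the least corner to the base, where both generators are positive; two equal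
  -- corners would be a coincidence of sums.
  normalise : ∀ b s t -> Shape A b s t -> Normal X
  normalise b s t sh = case + 1 ≤? s of \ where
     (yes s≥1) -> case + 1 ≤? t of \ where
      (yes t≥1) -> corner b s t sh s≥1 t≥1
      (no h) -> atT h (lia 2 (\s t -> #1 <= s => ~ #1 <= t => #1 <= s :- t) s t s≥1 h)
     (no h) -> case t <? s of \ where
      (yes l) -> atT (lia 2 (\s t -> ~ #1 <= s => t :< s => #1 <= t => ff) s t h l) (y<x⇒1≤x-y l)
      (no l) -> let t≢s = \e -> K.apart large 1 0 0 1 (\()) (lia 2 (\s t -> s == t => 1 *: s :+ 0 *: t == 0 *: s :+ 1 *: t) s t e) in
       corner _ _ _ (turnShape (swapShape sh)) (lia 2 (\s t -> ~ t :< s => ~ s == t => #1 <= t :- s) s t l t≢s) (neg s h \e -> K.apart large 1 0 0 0 (\()) (lia 2 (\s t -> s == #0 => 1 *: s :+ 0 *: t == 0 *: s :+ 0 *: t) s t e))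
   where
   module K = K6Sums X b s t sh
   neg : ∀ x -> ¬ + 1 ≤ x -> ¬ x ≡ 0z -> + 1 ≤ - x
   neg x h ne = subst (+ 1 ≤_) (0+ (- x)) (lia 1 (\x -> ~ #1 <= x => ~ x == #0 => #1 <= #0 :- x) x h ne)
   atT : ¬ + 1 ≤ t -> + 1 ≤ s - t -> Normal X
   atT h l = corner _ _ _ (turnShape sh) l (neg t h \e -> K.apart large 0 1 0 0 (\()) (lia 2 (\s t -> t == #0 => 0 *: s :+ 1 *: t == 0 *: s :+ 0 *: t) s t e))

-- Restoring the maximum to two progressions or to the triangle

module BiSep {P : 𝔹} {z : ℤ} (T : BiAP P z) where
 open BiAP T
 In0 In1 : ℤ -> Set
 In0 x = Σ ℤ \i -> 0z ≤ i × i ≤ p × x ≡ u + δ * i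
 In1 x = Σ ℤ \i -> 0z ≤ i × i ≤ q × x ≡ v + δ * i
 private
  sum : ∀ a b {r s x y} -> (Σ ℤ \i -> 0z ≤ i × i ≤ r × x ≡ a + δ * i) -> (Σ ℤ \i -> 0z ≤ i × i ≤ s × y ≡ b + δ * i) -> x + y ∈ ap (a + b) δ (r + s)
  sum a b {r} {s} (i , i1 , i2 , refl) (j , j1 , j₂ , refl) = in-ap (a + b) δ (r + s) (i + j) (+≤ i1 j1) (+≤ i2 j₂) (ring a b δ i j)
   where
   ring : ∀ u v δ i j -> u + δ * i + (v + δ * j) ≡ u + v + δ * (i + j)
   ring = solve
 sep01 : ∀ {a b c d} -> In0 a -> In0 b -> In0 c -> In1 d -> ¬ a + b ≡ c + d
 sep01 a b c d e = d01 (sum u u a b) (move (ap (u + v) δ (p + q)) (sum u v c d) (sym e))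
 sep02 : ∀ {a b c d} -> In0 a -> In0 b -> In1 c -> In1 d -> ¬ a + b ≡ c + d
 sep02 a b c d e = d02 (sum u u a b) (move (ap (v + v) δ (q + q)) (sum v v c d) (sym e))
 sep12 : ∀ {a b c d} -> In0 a -> In1 b -> In1 c -> In1 d -> ¬ a + b ≡ c + d
 sep12 a b c d e = d12 (sum u v a b) (move (ap (v + v) δ (q + q)) (sum v v c d) (sym e))
 disj : ∀ i j -> 0z ≤ i -> i ≤ p -> 0z ≤ j -> j ≤ q -> ¬ u + δ * i ≡ v + δ * j
 disj i j a b a' b' e = sep01 x x x (j , a' , b' , e) refl
  where
  x : In0 (u + δ * i)
  x = i , a , b , refl

module PeelTwo {n : ℤ} (X : NSet n) (k≥2 : + 2 ≤ OnSet.k X) (cop : Coprime X) (long : + 2 * OnSet.k X - + 1 ≤ n)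
 (c : ℤ) (old : ∀ a -> a ∈ NSet.A (Peel.Y X k≥2) -> ¬ a ≡ Peel.n' X k≥2 -> ¬ a ≡ c -> n + a ∈ OnSet.D (Peel.Y X k≥2)) where
 open OnSet X
 open Peel X k≥2
 private
  module R = Rev X
 module _ (T : BiAP Y.A Y.k) where
  open BiAP T
  private
   open BiSep T using (disj)
   flip : ∀ a r i -> n - (a + δ * (r - i)) ≡ n - (a + δ * r) + δ * i
   flip a r i = ring n a δ r i
    where
    ring : ∀ n a δ r i -> n - (a + δ * (r - i)) ≡ n - (a + δ * r) + δ * i
    ring = solve
   0≤r-i = 0≤-
   r-i≤ : ∀ {i r} -> 0z ≤ i -> r - i ≤ r
   r-i≤ {i} {r} = 0≤x⇒y-x≤y
   -- The progression that ends in n' has to come first, because the reflection makes it the one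
   -- that starts at u.
   go : ∀ u v p q -> 0z ≤ p -> 0z ≤ q -> p + q + + 2 ≡ Y.k ->
    (∀ x -> x ∈ Y.A -> (Σ ℤ \i -> 0z ≤ i × i ≤ p × x ≡ u + δ * i) ⊎ (Σ ℤ \i -> 0z ≤ i × i ≤ q × x ≡ v + δ * i)) ->
    (∀ i -> 0z ≤ i -> i ≤ p -> u + δ * i ∈ Y.A) -> (∀ i -> 0z ≤ i -> i ≤ q -> v + δ * i ∈ Y.A) ->
    (∀ i j -> 0z ≤ i -> i ≤ p -> 0z ≤ j -> j ≤ q -> ¬ u + δ * i ≡ v + δ * j) -> v + δ * q < u + δ * p -> TwoAP A k ⊎ K6Set A k
   go u v p q p≥0 q≥0 size cov i0 i1 dj lt = [ (\t -> inl (subst (TwoAP A) R.k-rev (twoAP-rev X t))) , (\t -> inr (subst (K6Set A) R.k-rev (k6-rev X t))) ]′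
     (TwoEnds.twoEnds (rev X) (coprime-rev X cop) U V δ p q (n - c) δ≥1 U≥1 U<V p≥0 q≥0 cover'
      (\i a b -> R.in-rev (cut-out (i0 (p - i) (0≤r-i b) (r-i≤ a))) (flip u p i)) (\i a b -> R.in-rev (cut-out (i1 (q - i) (0≤r-i b) (r-i≤ a))) (flip v q i))
      (\i j a b a' b' e -> dj (p - i) (q - j) (0≤r-i b) (r-i≤ a) (0≤r-i b') (r-i≤ a') (lia 3 (\n x y -> n :- x == n :- y => x == y) n _ _ (tr (flip u p i) (tr e (sym (flip v q j))))))
      (tr R.k-rev (lia 4 (\k k' p q -> k == k' :+ #1 => p :+ q :+ #2 == k' => k == p :+ q :+ #3) k _ p q kY size)) (subst (\k -> + 2 * k - + 1 ≤ n) (sym R.k-rev) long) gen)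
    where
    U V : ℤ
    U = n - (u + δ * p)
    V = n - (v + δ * q)
    top∈ = i0 p p≥0 ≤r
    U≥1 = lia 3 (\n m x -> x <= m => m :< n => #1 <= n :- x) n _ _ (snd (Y.supp top∈)) n'<n
    U<V = lia 3 (\n x y -> x :< y => n :- y :< n :- x) n _ _ lt
    cover' : ∀ x -> x ∈ NSet.A (rev X) -> x ≡ 0z ⊎ (Σ ℤ \i -> (0z ≤ i × i ≤ p) × x ≡ U + δ * i) ⊎ (Σ ℤ \i -> (0z ≤ i × i ≤ q) × x ≡ V + δ * i)
    cover' x x∈ = case split (R.rev-out x∈) of \ where
       (inl e) -> inl (lia 2 (\n x -> n :- x == n => x == #0) n x e)
       (inr y∈) -> inr ([ (\h -> inl (conv u p h)) , (\h -> inr (conv v q h)) ]′ (cov (n - x) y∈))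
     where
     conv : ∀ a r -> (Σ ℤ \i -> 0z ≤ i × i ≤ r × n - x ≡ a + δ * i) -> Σ ℤ \i -> (0z ≤ i × i ≤ r) × x ≡ n - (a + δ * r) + δ * i
     conv a r (i , l , h , e) = r - i , (0≤r-i h , r-i≤ l) , tr (x-y≡z⇒y≡x-z n e) (tr (cong (\j -> n - (a + δ * j)) (x≡y-[y-x] r)) (flip a r (r - i)))
    top≡ : u + δ * p ≡ n'
    top≡ = case cov n' Y.hi of \ where
       (inl (i , a , b , e)) -> ≤≥ (snd (Y.supp top∈)) (lia 3 (\m x y -> m == x => #0 <= y :- x => m <= y) _ _ _ e (up u p i b))
       (inr (i , a , b , e)) -> ⊥e (lia 4 (\m x y z -> m == x => #0 <= y :- x => y :< z => z <= m => ff) _ _ _ _ e (up v q i b) lt (snd (Y.supp top∈)))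
     where
     ring : ∀ a δ r i -> δ * (r - i) ≡ a + δ * r - (a + δ * i)
     ring = solve
     up : ∀ a r i -> i ≤ r -> 0z ≤ a + δ * r - (a + δ * i)
     up a r i b = subst (0z ≤_) (ring a δ r i) (*-nonneg (≤t 0≤+ δ≥1) (0≤r-i b))
    gen : ∀ x -> x ∈ NSet.A (rev X) -> 0z < x -> ¬ x ≡ U -> ¬ x ≡ n - c -> Gen (rev X) x
    gen x x∈ 0<x ne ne' = case split (R.rev-out x∈) of \ where
     (inl e) -> ⊥e (lia 2 (\n x -> n :- x == n => #0 :< x => ff) n x e 0<x)
     (inr y∈) -> subst (Gen (rev X)) (x-[x-y]≡y n) (old-gen (old (n - x) y∈ (\e -> ne (lia 4 (\n x m y -> n :- x == m => y == m => x == n :- y) n x _ _ e top≡)) (\e -> ne' (x-y≡z⇒y≡x-z n e))))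
  abstract
   peelTwo : TwoAP A k ⊎ K6Set A k
   peelTwo = case <-cmp (u + δ * p) (v + δ * q) of \ where
    (tri≈ _ e _) -> ⊥e (disj p q p≥0 ≤r q≥0 ≤r e)
    (tri> _ _ h) -> go u v p q p≥0 q≥0 size≡ cover in0 in1 disj h
    (tri< h _ _) -> go v u q p q≥0 p≥0 (tr (cong (_+ + 2) (+-comm q p)) size≡) (\x x∈ -> [ inr , inl ]′ (cover x x∈)) in1 in0 (\i j a b a' b' e -> disj j i a' b' a b (sym e)) h
 module _ (K : K6Set Y.A Y.k) (large : + 15 ≤ Y.dd) where
  private
   module RY = Rev Y
   module Z = OnSet (rev Y)
   largeZ = subst (+ 15 ≤_) (sym RY.dd-rev) large
   abstract
    N : Normal (rev Y)
    N = Normalise.normalise (rev Y) largeZ _ _ _ (K6Set.mem K' , K6Set.cover K')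
     where
     K'' : K6Set (NSet.A (rev (rev Y))) Y.k
     K'' = record { K6Set K ; mem = All.map (\{x} p -> RY'.in-rev (RY.in-rev p refl) (x-[x-y]≡y n')) (K6Set.mem K) ; cover = \x p -> K6Set.cover K x (move Y.A (RY.rev-out (RY'.rev-out p)) (x-[x-y]≡y n')) }
      where module RY' = Rev (rev Y)
     K' : K6Set Z.A Y.k
     K' = k6-rev (rev Y) K''
   open Normal N
   sh = shape
   -- With |A| = 7 the length n is at least 13, and n = m + g = 2e + g.
   n13 = lia 6 (\n m k k' e g -> 2 *: k :- #1 <= n => k == k' :+ #1 => k' == #6 => m == e :+ e => g == n :- m => #13 <= e :+ e :+ g) n _ k _ e g long kY (K6Set.size≡ K) n≡ refl
   g≥1 = y<x⇒1≤x-y n'<n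
   -- These are g plus the nine sums with at most one e. The other six sums are at least 2e, and g
   -- would push them beyond the maximum 2e.
   LOW : Expr -> Expr -> Expr -> Expr -> Formula
   LOW y g d e = y == g :∨ y == g :+ d :∨ y == g :+ 2 *: d :∨ y == g :+ 3 *: d :∨ y == g :+ 4 *: d :∨ y == g :+ e :∨ y == g :+ e :+ d :∨ y == g :+ e :+ 2 *: d :∨ y == g :+ e :+ 3 *: d
   Low : ℤ -> Set
   Low y = y ≡ g ⊎ y ≡ g + d ⊎ y ≡ g + + 2 * d ⊎ y ≡ g + + 3 * d ⊎ y ≡ g + + 4 * d ⊎ y ≡ g + e ⊎ y ≡ g + e + d ⊎ y ≡ g + e + + 2 * d ⊎ y ≡ g + e + + 3 * d
   c' = n' - c
   -- That n + (m - y) lies in 2Y says, after reflection, that y - g is a sum of two elements.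
   gens : ∀ y -> y ∈ Z.A -> ¬ y ≡ 0z -> ¬ y ≡ c' -> Low y
   gens y y∈ nz ne = pick (K6Sums.sums (rev Y) 0z e d sh (y - g) in2)
    where
    a∈ = RY.rev-out y∈
    in2 = tr (RY.D-rev (y - g)) (move Y.D (old (n' - y) a∈ (\h -> nz (lia 2 (\m y -> m :- y == m => y == #0) _ y h)) (\h -> ne (x-y≡z⇒y≡x-z n' h))) (lia 3 (\n m y -> n :+ (m :- y) == m :+ m :- (y :- (n :- m))) n n' y))
    y≤ = subst (y ≤_) n≡ (snd (Z.supp y∈))
    L : ∀ {i j} -> y - g ≡ + 0 + + 0 + + i * e + + j * d -> y ≡ g + (+ i * e + + j * d)
    L {i} {j} h = lia 4 (\y g a b -> y :- g == #0 :+ a :+ b => y == g :+ (a :+ b)) y g (+ i * e) (+ j * d) (tr h refl)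
    far : ∀ {i j} -> y - g ≡ + 0 + + 0 + + (2 ℕ.+ i) * e + + j * d -> ⊥
    far {i} {j} h = lia 6 (\y g e a b t -> y :- g == #0 :+ t :+ b => t == e :+ e :+ a => #0 <= a => #0 <= b => y <= e :+ e => #1 <= g => ff) y g e _ _ _ h (ring (+ i) e) (*-nonneg {+ i} {e} 0≤+ (≤t 0≤+ (≤t d≥1 (<⇒≤ d<e)))) (*-nonneg {+ j} {d} 0≤+ (≤t 0≤+ d≥1)) y≤ g≥1
     where
     ring : ∀ i e -> (+ 2 + i) * e ≡ e + e + i * e
     ring = solve
    pick : Any ((y - g) ≡_) (map (at (0z + 0z) e d) idx15) -> Low y
    pick (here h) = inl (lia 4 (\y g e d -> y :- g == #0 :+ 0 *: e :+ 0 *: d => y == g) y g e d h)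
    pick (th (here h)) = inr (inl (lia 4 (\y g e d -> y :- g == #0 :+ 0 *: e :+ 1 *: d => y == g :+ d) y g e d h))
    pick (th (th (here h))) = inr (inr (inl (lia 4 (\y g e d -> y :- g == #0 :+ 0 *: e :+ 2 *: d => y == g :+ 2 *: d) y g e d h)))
    pick (th (th (th (here h)))) = inr (inr (inr (inl (lia 4 (\y g e d -> y :- g == #0 :+ 0 *: e :+ 3 *: d => y == g :+ 3 *: d) y g e d h))))
    pick (th (th (th (th (here h))))) = inr (inr (inr (inr (inl (lia 4 (\y g e d -> y :- g == #0 :+ 0 *: e :+ 4 *: d => y == g :+ 4 *: d) y g e d h)))))
    pick (th (th (th (th (th (here h)))))) = inr (inr (inr (inr (inr (inl (lia 4 (\y g e d -> y :- g == #0 :+ 1 *: e :+ 0 *: d => y == g :+ e) y g e d h))))))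
    pick (th (th (th (th (th (th (here h))))))) = inr (inr (inr (inr (inr (inr (inl (lia 4 (\y g e d -> y :- g == #0 :+ 1 *: e :+ 1 *: d => y == g :+ e :+ d) y g e d h)))))))
    pick (th (th (th (th (th (th (th (here h)))))))) = inr (inr (inr (inr (inr (inr (inr (inl (lia 4 (\y g e d -> y :- g == #0 :+ 1 *: e :+ 2 *: d => y == g :+ e :+ 2 *: d) y g e d h))))))))
    pick (th (th (th (th (th (th (th (th (here h))))))))) = inr (inr (inr (inr (inr (inr (inr (inr (lia 4 (\y g e d -> y :- g == #0 :+ 1 *: e :+ 3 *: d => y == g :+ e :+ 3 *: d) y g e d h))))))))
    pick (th (th (th (th (th (th (th (th (th r))))))))) = ⊥e (case r of \ where
     (here h) -> far {0} {0} h
     (th (here h)) -> far {0} {1} h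
     (th (th (here h))) -> far {0} {2} h
     (th (th (th (here h)))) -> far {1} {0} h
     (th (th (th (th (here h))))) -> far {1} {1} h
     (th (th (th (th (th (here h)))))) -> far {2} {0} h)
   unit : ∀ h a b f -> + 1 ≤ h -> g ≡ a * h -> d ≡ b * h -> e ≡ f * h -> h ≡ + 1
   unit h a b f h≥1 eg ed ee = case + 2 ≤? h of \ where
      (no l) -> 1≤x⇒2≰x⇒x≡1 h≥1 l
      (yes l) -> ⊥e (cop h l \x x∈ -> case split x∈ of \ where
       (inl e') -> f + f + a , tr e' (tr (lia 4 (\n m e g -> m == e :+ e => g == n :- m => n == e :+ e :+ g) n _ e g n≡ refl) (tr (cong₂ (\e g -> e + e + g) ee eg) (ring1 f a h)))
       (inr y∈) -> case shape-at sh (n' - x) (RY.in-rev y∈ refl) of \((i , j) , _ , ex) -> f + f - (i * f + j * b) , tr (lia 4 (\m x y e -> m :- x == y => m == e :+ e => x == e :+ e :- y) _ x _ e ex n≡) (tr (cong₂ (\e d -> e + e - (0z + i * e + j * d)) ee ed) (ring2 f b i j h)))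
    where
    ring1 : ∀ f a h -> f * h + f * h + a * h ≡ h * (f + f + a)
    ring1 = solve
    ring2 : ∀ f b i j h -> f * h + f * h - (0z + i * (f * h) + j * (b * h)) ≡ h * (f + f - (i * f + j * b))
    ring2 = solve
   m2 : 0z + d ∈ Z.A
   m2 = case fst sh of \ where (_ ∷ p ∷ _) -> p
   m3 : 0z + d + d ∈ Z.A
   m3 = case fst sh of \ where (_ ∷ _ ∷ p ∷ _) -> p
   m4 : 0z + e ∈ Z.A
   m4 = case fst sh of \ where (_ ∷ _ ∷ _ ∷ p ∷ _) -> p
   m5 : 0z + e + d ∈ Z.A
   m5 = case fst sh of \ where (_ ∷ _ ∷ _ ∷ _ ∷ p ∷ _) -> p
   m6 : 0z + e + e ∈ Z.A
   m6 = case fst sh of \ where (_ ∷ _ ∷ _ ∷ _ ∷ _ ∷ p ∷ []) -> p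
   lowE : ¬ e ≡ c' -> Low e
   lowE ne = gens e (move Z.A m4 (0+ e)) (\z -> lia 2 (\d e -> e == #0 => #1 <= d => d :< e => ff) d e z d≥1 d<e) ne
   -- Only e = 5d escapes the excluded ratios. Coprimality then gives d = 1, and 2e + g = 11 is
   -- below 13.
   five : g ≡ d -> Low e -> ⊥
   five gd l = lia 3 (\d e g -> g == d => e == 5 *: d => d == #1 => #13 <= e :+ e :+ g => ff) d e g gd e5 (unit d (+ 1) (+ 1) (+ 5) d≥1 (tr gd (sym (1* d))) (sym (1* d)) e5) n13
    where
    e5 = lia 3 (\e d g -> LOW e g d e => g == d => #1 <= d => d :< e => ~ e == d :+ d => ~ e == 3 *: d => ~ e == 4 *: d => e == 5 *: d) e d g l gd d≥1 d<e e≢2d e≢3d e≢4d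
   caseD : g ≡ d -> ⊥
   caseD gd = case e ≟ c' of \ where
      (no ne) -> five gd (lowE ne)
      (yes ee) -> let l = gens (e + e) (move Z.A m6 (cong (_+ e) (0+ e))) (\z -> lia 2 (\d e -> e :+ e == #0 => #1 <= d => d :< e => ff) d e z d≥1 d<e) (\h -> lia 3 (\d e c -> e :+ e == c => e == c => #1 <= d => d :< e => ff) d e _ h ee d≥1 d<e) in last l
    where
    -- Only 2e = 5d remains. Then d, g and e are 2, 2 and 5 times e - 2d, which is 1 by coprimality,
    -- and 2e + g = 12 is below 13.
    last : Low (e + e) -> ⊥
    last l = lia 3 (\d e g -> g == d => 2 *: e == 5 *: d => e :- 2 *: d == #1 => #13 <= e :+ e :+ g => ff) d e g gd e5 (unit (e - + 2 * d) (+ 2) (+ 2) (+ 5) (lia 2 (\d e -> 2 *: e == 5 *: d => #1 <= d => #1 <= e :- 2 *: d) d e e5 d≥1) (lia 3 (\d e g -> g == d => 2 *: e == 5 *: d => g == 2 *: (e :- 2 *: d)) d e g gd e5) (lia 2 (\d e -> 2 *: e == 5 *: d => d == 2 *: (e :- 2 *: d)) d e e5) (lia 2 (\d e -> 2 *: e == 5 *: d => e == 5 *: (e :- 2 *: d)) d e e5)) n13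
     where
     e5 = lia 3 (\e d g -> LOW (e :+ e) g d e => g == d => #1 <= d => d :< e => ~ e == d :+ d => ~ e == 3 *: d => ~ e == 4 *: d => ~ 2 *: e == 3 *: d => 2 *: e == 5 *: d) e d g l gd d≥1 d<e e≢2d e≢3d e≢4d 2e≢3d
   case2D : ¬ d ≡ c' -> ⊥
   case2D ne = caseD (lia 3 (\d e g -> LOW d g d e => #1 <= g => #1 <= d => d :< e => g == d) d e g (gens d (move Z.A m2 (0+ d)) (\z -> lia 1 (\d -> d == #0 => #1 <= d => ff) d z d≥1) ne) g≥1 d≥1 d<e)
  abstract
   peelK6 : ⊥
   peelK6 = case d ≟ c' of \ where
      (no ne) -> case2D ne
      (yes dc) -> case lia 3 (\d e g -> LOW (d :+ d) g d e => #1 <= g => #1 <= d => d :< e => g == d :∨ g == d :+ d :∨ g == d :+ d :- e) d e g (gens (d + d) (move Z.A m3 (cong (_+ d) (0+ d))) (\z -> lia 1 (\d -> d :+ d == #0 => #1 <= d => ff) d z d≥1) (\h -> lia 2 (\d c -> d :+ d == c => d == c => #1 <= d => ff) d _ h dc d≥1)) g≥1 d≥1 d<e of \ where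
       (inl gd) -> five gd (lE dc)
       (inr (inr gd)) -> lia 3 (\e d g -> LOW e g d e => g == d :+ d :- e => #1 <= g => #1 <= d => d :< e => ~ 2 *: e == 3 *: d => ff) e d g (lE dc) gd g≥1 d≥1 d<e 2e≢3d
       (inr (inl gd)) -> case lia 3 (\e d g -> LOW e g d e => g == d :+ d => #1 <= d => d :< e => ~ e == d :+ d => ~ e == 3 *: d => ~ e == 4 *: d => e == 5 *: d :∨ e == 6 *: d) e d g (lE dc) gd d≥1 d<e e≢2d e≢3d e≢4d of \ where
        (inl e5) -> lia 3 (\d e g -> g == d :+ d => e == 5 *: d => d == #1 => #13 <= e :+ e :+ g => ff) d e g gd e5 (unit d (+ 2) (+ 1) (+ 5) d≥1 (tr gd (lia 1 (\d -> d :+ d == 2 *: d) d)) (sym (1* d)) e5) n13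
        (inr e6) -> lia 3 (\d e g -> LOW (e :+ d) g d e => g == d :+ d => e == 6 *: d => #1 <= d => ff) d e g (gens (e + d) (move Z.A m5 (cong (_+ d) (0+ e))) (\z -> lia 2 (\d e -> e :+ d == #0 => #1 <= d => d :< e => ff) d e z d≥1 d<e) (\h -> lia 3 (\d e c -> e :+ d == c => d == c => #1 <= d => d :< e => ff) d e _ h dc d≥1 d<e)) gd e6 d≥1
    where
    lE : d ≡ c' -> Low e
    lE dc = lowE \h -> <-irrefl (tr dc (sym h)) d<e

-- Sets generated by 1 through sums of their own elements

End1 : ∀ {n} -> NSet n -> Set
End1 X = ∀ x -> x ∈ NSet.A X -> 0z < x -> ¬ x ≡ + 1 -> Gen X x

module EndFacts {n : ℤ} (X : NSet n) (end : End1 X) where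
 open OnSet X
 private
  first : ∀ a -> + 1 ≤ a -> a ≤ n -> Least A a (n + + 1)
  first a a≥1 a≤n = [ (\r -> r) , (\none -> clash hi (none n a≤n (x<x+1))) ]′ (least A {a} {n + + 1} (≤t a≤n (x≤x+1)))
 -- The least positive element is not a sum of two positive ones.
 one∈ : + 1 ≤ n -> + 1 ∈ A
 one∈ h = case first (+ 1) ≤r h of \(w , w≥1 , _ , w∈ , before) -> case w ≟ + 1 of \ where
  (yes e) -> move A w∈ e
  (no ne) -> ⊥e (case end w w∈ (<-≤-trans 0<+ w≥1) ne of \(a , b , (a∈ , 0<a) , (_ , 0<b) , e) -> clash a∈ (before a (lia 1 (\a -> #0 :< a => #1 <= a) a 0<a) (lia 3 (\a b w -> a :+ b == w => #0 :< b => a :< w) a b w e 0<b)))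
 -- The least element above 1 can only be 1 + 1.
 two∈ : + 2 ≤ n -> + 2 ∈ A
 two∈ h = case first (+ 2) 1≤+ h of \(w , w≥2 , _ , w∈ , before) -> case end w w∈ (<-≤-trans 0<+ w≥2) (\e -> lia 1 (\w -> w == #1 => #2 <= w => ff) w e w≥2) of \(a , b , (a∈ , 0<a) , (b∈ , 0<b) , e) ->
  let small = \x y (x∈ : x ∈ A) (0<x : 0z < x) (0<y : 0z < y) (e : x + y ≡ w) -> case + 2 ≤? x of \ where
     (yes l) -> clash x∈ (before x l (lia 3 (\a b w -> a :+ b == w => #0 :< b => a :< w) x y w e 0<y))
     (no l) -> lia 1 (\x -> #0 :< x => ~ #2 <= x => x == #1) x 0<x l
  in move A w∈ (tr (sym e) (cong₂ _+_ (small a b a∈ 0<a 0<b e) (small b a b∈ 0<b 0<a (tr (+-comm b a) e))))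
 coprime : + 1 ≤ n -> Coprime X
 coprime h d d≥2 div = case div (+ 1) (one∈ h) of \(i , e) -> lia 2 (\d w -> #1 == w => #0 <= w :- d => #2 <= d => ff) d _ e (subst (0z ≤_) (ring d i) (*-nonneg (≤t 0≤+ d≥2) (0≤- (*-pos⁻ d i (≤t 1≤+ d≥2) (subst (0z <_) e 0<+))))) d≥2
  where
  ring : ∀ d i -> d * (i - + 1) ≡ d * i - d
  ring = solve
 -- If 0 lies in I, the least element w of the other progression satisfies w + 0 ∈ I + I', so it is not a sum of smaller elements; hence w = 1, and 2 = 1 + 1 has no place.
 not-biAP : + 2 ≤ n -> BiAP A k -> ⊥
 not-biAP n≥2 T = [ (\z -> go In0 In1 v (0z , ≤r , q≥0 , sym (at0 v)) (in1 0z ≤r q≥0) (\x -> \(i , a , _ , e) -> from v i a e) cover sep01 sep02 sep12 (\x y -> disj' x y) z)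
   , (\z -> go In1 In0 u (0z , ≤r , p≥0 , sym (at0 u)) (in0 0z ≤r p≥0) (\x -> \(i , a , _ , e) -> from u i a e) (\x x∈ -> [ inr , inl ]′ (cover x x∈)) (\{a} {b} {c} {d} p q r s e -> sep12 s r p q (tr (+-comm d c) (sym e))) (\p q r s e -> sep02 r s p q (sym e)) (\{a} {b} {c} {d} p q r s e -> sep01 r s q p (tr (sym e) (+-comm a b))) (\x y -> disj' y x) z) ]′ (cover 0z lo)
  where
  open BiAP T
  open BiSep T
  at0 : ∀ a -> a + δ * 0z ≡ a
  at0 a = tr (cong (\w -> a + w) (*0 δ)) (+0 a)
  from : ∀ a {x} i -> 0z ≤ i -> x ≡ a + δ * i -> a ≤ x
  from a {x} i h e = lia 3 (\a x w -> x == a :+ w => #0 <= w => a <= x) a x _ e (*-nonneg (≤t 0≤+ δ≥1) h)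
  disj' : ∀ {x} -> In0 x -> In1 x -> ⊥
  disj' a b = sep01 a a a b refl
  go : ∀ (I I' : ℤ -> Set) w -> I' w -> w + δ * 0z ∈ A -> (∀ x -> I' x -> w ≤ x) -> (∀ x -> x ∈ A -> I x ⊎ I' x) ->
   (∀ {a b c d} -> I a -> I b -> I c -> I' d -> ¬ a + b ≡ c + d) -> (∀ {a b c d} -> I a -> I b -> I' c -> I' d -> ¬ a + b ≡ c + d) -> (∀ {a b c d} -> I a -> I' b -> I' c -> I' d -> ¬ a + b ≡ c + d) ->
   (∀ {x} -> I x -> I' x -> ⊥) -> I 0z -> ⊥
  go I I' w w' w∈0 min cov s1 s2 s3 dj z = case w ≟ + 1 of \ where
      (yes e) -> let one = subst I' e w' in [ (\t -> s2 {0z} {+ 2} z t one one refl) , (\t -> s3 {0z} {+ 2} z t one one refl) ]′ (cov (+ 2) (two∈ n≥2))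
      (no ne) -> case end w w∈ (≤≢⇒< (fst (supp w∈)) \e -> dj z (subst I' (sym e) w')) ne of \(a , b , (a∈ , 0<a) , (b∈ , 0<b) , e) ->
       s1 (low' a b a∈ 0<b e) (low' b a b∈ 0<a (tr (+-comm b a) e)) z w' (tr e (sym (0+ w)))
   where
   w∈ = move A w∈0 (at0 w)
   low' : ∀ a b -> a ∈ A -> 0z < b -> a + b ≡ w -> I a
   low' a b a∈ 0<b e = [ (\r -> r) , (\r -> ⊥e (lia 3 (\a b w -> a :+ b == w => #0 :< b => w <= a => ff) a b w e 0<b (min a r))) ]′ (cov a a∈)
 -- The corner e would be a sum of two numbers from d and 2d, hence 2d, 3d or 4d, which the distinct
 -- sums exclude.
 not-K6 : Normal X -> ⊥
 not-K6 N = case end e e∈ (lia 2 (\d e -> #1 <= d => d :< e => #0 :< e) d e d≥1 d<e) (\h -> lia 2 (\d e -> e == #1 => #1 <= d => d :< e => ff) d e h d≥1 d<e) of \(a , b , (a∈ , 0<a) , (b∈ , 0<b) , h) ->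
   lia 4 (\a b d e -> (a == d :∨ a == d :+ d) => (b == d :∨ b == d :+ d) => a :+ b == e => ~ e == d :+ d => ~ e == 3 *: d => ~ e == 4 *: d => ff) a b d e (small a b a∈ 0<a 0<b h) (small b a b∈ 0<b 0<a (tr (+-comm b a) h)) h e≢2d e≢3d e≢4d
  where
  open Normal N
  e∈ : e ∈ A
  e∈ = case fst shape of \ where (_ ∷ _ ∷ _ ∷ p ∷ _) -> move A p (0+ e)
  small : ∀ a b -> a ∈ A -> 0z < a -> 0z < b -> a + b ≡ e -> a ≡ d ⊎ a ≡ d + d
  small a b a∈ 0<a 0<b h = case snd shape a a∈ of \ where
      (here z) -> ⊥e (<-irrefl (sym z) 0<a)
      (th (here z)) -> inl (tr z (0+ d))
      (th (th (here z))) -> inr (tr z (cong (_+ d) (0+ d)))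
      (th (th (th (here z)))) -> big 0z ≤r (tr z (+-comm 0z e))
      (th (th (th (th (here z))))) -> big d (≤t 0≤+ d≥1) (tr z (cong (_+ d) (0+ e)))
      (th (th (th (th (th (here z)))))) -> big e (≤t 0≤+ (≤t d≥1 (<⇒≤ d<e))) (tr z (cong (_+ e) (0+ e)))
   where
   big : ∀ y -> 0z ≤ y -> a ≡ e + y -> a ≡ d ⊎ a ≡ d + d
   big y p q = ⊥e (lia 4 (\a b e y -> a :+ b == e => #0 :< b => a == e :+ y => #0 <= y => ff) a b e y h 0<b q p)

-- The summands are smaller than the sum, so they survive the truncation.
end1-cut : ∀ {n} (X : NSet n) m m∈ -> End1 X -> End1 (cut X m m∈)
end1-cut X m m∈ end x x∈ 0<x ne = case end x (cut-out x∈) 0<x ne of \(a , b , (a∈ , 0<a) , (b∈ , 0<b) , e) -> a , b ,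
  (cut-in a∈ (lia 4 (\a b x m -> a :+ b == x => #0 :< b => x <= m => a <= m) a b x m e 0<b x≤) , 0<a) , (cut-in b∈ (lia 4 (\a b x m -> a :+ b == x => #0 :< a => x <= m => b <= m) a b x m e 0<a x≤) , 0<b) , e
 where
 open Cut X m m∈
 x≤ = snd (NSet.supp (cut X m m∈) x∈)

k≥two : ∀ {n} (X : NSet n) -> + 1 ≤ n -> + 2 ≤ OnSet.k X
k≥two {n} X n≥1 = lia 3 (\k c x -> k == c :+ x => #1 <= c => x == #1 => #2 <= k) k _ _ (∑-step (χ A) 0z n 0≤n) (subst (_≤ count A 0z n) (χ-in lo) (∑-term≤ (χ A) 0z (\x _ _ -> χ≥0 A x) ≤r (<-≤-trans 0<+ n≥1))) (χ-in hi)
 where open OnSet X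

subset-tight : ∀ P Q {a b} -> a ≤ b -> (∀ {x} -> x ∈ P -> x ∈ Q) -> count Q a b ≤ count P a b -> ∀ x -> a ≤ x -> x < b -> x ∈ Q -> x ∈ P
subset-tight P Q {a} {b} a≤b sub le x p q x∈ = χ-in⁻ (lia 2 (\u v -> u :- v == #0 => u == #1 => #1 <= v) _ _
 (∑-zeros (\x -> χ Q x - χ P x) (\x _ _ -> 0≤- (χ-mono {P} {Q} sub)) (lia 3 (\s u v -> s == u :- v => u <= v => s <= #0) _ _ _ (∑-sub (χ Q) (χ P) a≤b) le) x p q) (χ-in x∈))

-- Induction on |A| for n at least 2|A| - 1

Res : ∀ {n} -> NSet n -> Set
Res X = TwoAP (NSet.A X) (OnSet.k X) ⊎ K6Set (NSet.A X) (OnSet.k X)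

-- The bound starts at n = 2k - 2, one step before the structure, because truncated sets can land
-- there; their structure is then supplied by `halfKind`.
Bound Structure : ∀ {n} -> NSet n -> Set
Bound {n} X = Coprime X -> + 2 * OnSet.k X - + 2 ≤ n -> + 3 * OnSet.k X - + 3 ≤ OnSet.dd X
Structure {n} X = Coprime X -> + 2 * OnSet.k X - + 1 ≤ n -> OnSet.dd X ≤ + 3 * OnSet.k X - + 3 -> Res X

module Step (K : ℤ) (IH : ∀ {n} (Z : NSet n) -> OnSet.k Z < K -> Bound Z × Structure Z) where
 -- Generation by 1 rules out both outcomes of `Structure`, so the bound is not attained.
 strict : ∀ {m} (Z : NSet m) -> OnSet.k Z < K -> End1 Z -> + 2 ≤ m -> + 2 * OnSet.k Z - + 1 ≤ m -> + 3 * OnSet.k Z - + 2 ≤ OnSet.dd Z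
 strict {m} Z k< end m≥2 sparse = case + 3 * Z.k - + 2 ≤? Z.dd of \ where
     (yes h) -> h
     (no h) -> let small = lia 2 (\k d -> ~ 3 *: k :- #2 <= d => d <= 3 *: k :- #3) Z.k _ h in ⊥e (case snd (IH Z k<) cop sparse small of \ where
      (inl T) -> E.not-biAP m≥2 (twoAP-biAP Z T large)
      (inr S) -> E.not-K6 (Normalise.normalise Z (lia 2 (\k d -> k == #6 => 3 *: k :- #3 <= d => #15 <= d) _ _ (K6Set.size≡ S) large) _ _ _ (K6Set.mem S , K6Set.cover S)))
  where
  module Z = OnSet Z
  module E = EndFacts Z end
  cop = E.coprime (≤t 1≤+ m≥2)
  large = fst (IH Z k<) cop (≤t (lia 1 (\k -> 2 *: k :- #2 <= 2 *: k :- #1) Z.k) sparse)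
 module Analyse {n : ℤ} (X : NSet n) (kK : OnSet.k X ≡ K) (k≥2 : + 2 ≤ OnSet.k X) (cop : Coprime X) (long : + 2 * OnSet.k X - + 2 ≤ n) where
  open OnSet X
  open Peel X k≥2
  -- `Tight` arises when removing n destroys only two sums: n - A then consists of multiples of its
  -- least positive element, which coprimality makes 1.
  Done Tight : Set
  Done = + 3 * k - + 3 ≤ dd × (+ 2 * k - + 1 ≤ n -> dd ≤ + 3 * k - + 3 -> Res X)
  Tight = End1 (rev X) × n' ≡ n - + 1
  Yk< : Y.k < K
  Yk< = lia 3 (\a k K -> k == K => k == a :+ #1 => a :< K) _ k K kK kY
  private
   common : ∀ d -> + 2 ≤ d -> (∀ a -> a ∈ Y.A -> Div d a) -> Done
   common d d≥2 div = PeelCommon.lower X k≥2 cop d d≥2 div , \_ small -> inl (PeelCommon.tight X k≥2 cop d d≥2 div small)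
   module _ (copY : Coprime Y) (n'≥1 : + 1 ≤ n') (j3 : Y.dd + + 3 ≤ dd) where
    n≥2k' = lia 3 (\n k k' -> 2 *: k :- #2 <= n => k == k' :+ #1 => 2 *: k' <= n) n k Y.k long kY
    -- Three lost sums match the growth of 3k - 3, so equality for X forces equality for Y and
    -- leaves no fourth lost sum.
    fromBound : + 3 * Y.k - + 3 ≤ Y.dd -> (+ 2 * k - + 1 ≤ n -> dd ≤ Y.dd + + 3 -> Y.dd ≤ + 3 * Y.k - + 3 -> Res X) -> Done
    fromBound b f = lia 4 (\k k' d d' -> 3 *: k' :- #3 <= d' => d' :+ #3 <= d => k == k' :+ #1 => 3 *: k :- #3 <= d) k Y.k _ _ b j3 kY
     , \l s -> f l (lia 4 (\k k' d d' -> d <= 3 *: k :- #3 => 3 *: k' :- #3 <= d' => k == k' :+ #1 => d <= d' :+ #3) k Y.k _ _ s b kY) (lia 4 (\k k' d d' -> d <= 3 *: k :- #3 => d' :+ #3 <= d => k == k' :+ #1 => d' <= 3 *: k' :- #3) k Y.k _ _ s j3 kY)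
    two : + 2 * k - + 1 ≤ n -> dd ≤ Y.dd + + 3 -> + 3 * Y.k - + 3 ≤ Y.dd -> TwoAP Y.A Y.k -> Res X
    two l j b T = PeelTwo.peelTwo X k≥2 cop l (fst (old-but-one j)) (snd (old-but-one j)) (twoAP-biAP Y T b)
    interval : HasInterval Y.D (+ 2 * Y.k - + 1) -> n' ≤ + 2 * Y.k - + 3 -> Done
    interval J h = PeelInterval.lower X k≥2 J n≥2k' , \l small -> inl (PeelInterval.tight X k≥2 J n≥2k' small (lia 3 (\n k k' -> 2 *: k :- #1 <= n => k == k' :+ #1 => 2 *: k' :< n) n k Y.k l kY) (≤t h (lia 1 (\k -> 2 *: k :- #3 <= 2 *: k :- #1) Y.k)))
    overlapping : + 2 ≤ Y.φ (n' + + 1) -> Overlaps.Overlap Y -> Done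
    overlapping φ≥ ov = fromBound (overlap-dd Y φ≥ ov) \l j small -> two l j (overlap-dd Y φ≥ ov) (overlap-twoAP Y φ≥ ov small)
    half' : + 2 * k - + 1 ≤ n -> dd ≤ Y.dd + + 3 -> Y.dd ≤ + 3 * Y.k - + 3 -> + 3 * Y.k - + 3 ≤ Y.dd -> n' ≡ + 2 * Y.k - + 2 -> Res X
    half' l j small b e = [ inl , two l j b ]′ (PeelHalf.peelHalf X k≥2 (lia 4 (\n m k k' -> 2 *: k :- #1 <= n => k == k' :+ #1 => m == 2 *: k' :- #2 => #3 <= n :- m) n _ k Y.k l kY e) n'≥1 (fst (old-but-one j)) (snd (old-but-one j)) copY (halfKind Y e (≤≥ small b)))
    sparse : + 2 * k - + 1 ≤ n -> dd ≤ Y.dd + + 3 -> + 3 * Y.k - + 3 ≤ Y.dd -> Res Y -> Res X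
    sparse l j b (inl T) = two l j b T
    sparse l j b (inr S) = ⊥e (PeelTwo.peelK6 X k≥2 cop l (fst (old-but-one j)) (snd (old-but-one j)) S (lia 2 (\k d -> k == #6 => 3 *: k :- #3 <= d => #15 <= d) _ _ (K6Set.size≡ S) b))
    three : Done
    three = case n' ≤? + 2 * Y.k - + 3 of \ where
     (yes h) -> [ (\J -> interval J h) , overlapping (lia 3 (\f m k -> f == 2 *: k :- m :- #1 => m <= 2 *: k :- #3 => #2 <= f) _ _ Y.k Y.φend h) ]′ (Overlaps.interval-or-overlap Y (≤t h (lia 1 (\k -> 2 *: k :- #3 <= 2 *: k :- #2) Y.k)))
     (no h) -> let b = fst (IH Y Yk<) copY (lia 2 (\k m -> ~ m <= 2 *: k :- #3 => 2 *: k :- #2 <= m) Y.k _ h) in fromBound b \l j small -> case n' ≟ + 2 * Y.k - + 2 of \ where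
      (yes e) -> half' l j small b e
      (no ne) -> sparse l j b (snd (IH Y Yk<) copY (lia 2 (\k m -> ~ m <= 2 *: k :- #3 => ~ m == 2 *: k :- #2 => 2 *: k :- #1 <= m) Y.k _ h ne) small)
   tightEnd : dd ≤ Y.dd + + 2 -> Tight
   tightEnd j2 = (\x x∈ 0<x ne -> gen-all j2 x x∈ 0<x \e -> ne (tr e g≡1)) , lia 2 (\n m -> n :- m == #1 => m == n :- #1) n _ g≡1
    where
    g≡1 : g ≡ + 1
    g≡1 = case + 2 ≤? g of \ where
     (yes h) -> ⊥e (coprime-rev X cop g h (multiples (rev X) g (gen-all j2)))
     (no h) -> lia 2 (\n m -> m :< n => ~ #2 <= n :- m => n :- m == #1) n _ n'<n h
  abstract
   analyse : Done ⊎ Tight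
   analyse = case + 1 ≤? n' of \ where
    (no h) -> inl (common (+ 2) ≤r \a a∈ -> 0z , lia 2 (\a m -> #0 <= a => a <= m => ~ #1 <= m => a == #0) a _ (fst (Y.supp a∈)) (snd (Y.supp a∈)) h)
    (yes h) -> case coprime? Y h of \ where
     (inr (d , d≥2 , div)) -> inl (common d d≥2 div)
     (inl copY) -> case dd ≤? Y.dd + + 2 of \ where
      (yes j) -> inr (tightEnd j)
      (no j) -> inl (three copY h (lia 2 (\d y -> ~ d <= y :+ #2 => y :+ #3 <= d) _ Y.dd j))

module StepEnd (K : ℤ) (IH : ∀ {n} (Z : NSet n) -> OnSet.k Z < K -> Bound Z × Structure Z) where
 open Step K IH
 module BothTight {n : ℤ} (X : NSet n) (kK : OnSet.k X ≡ K) (endL : End1 X) (endR : End1 (rev X)) where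
  open OnSet X
  -- The parts up to m and from m on both contain m, so their sizes add up to k + 1. Their sumsets
  -- share only 2m, as one ends and the other begins there. The upper part is reflected, so that it
  -- starts at 0.
  module Split (m : ℤ) (m∈ : m ∈ A) (0<m : 0z < m) (m<n : m < n) where
   private
    module R = Rev X
    module XR = OnSet (rev X)
   n₂ = n - m
   n2∈ = R.in-rev m∈ refl
   A1 = cut X m m∈
   A2 = cut (rev X) n₂ n2∈
   module A1 = OnSet A1
   module A2 = OnSet A2
   module C1 = Cut X m m∈
   module C2 = Cut (rev X) n₂ n2∈
   1≤m = lia 1 (\m -> #0 :< m => #1 <= m) m 0<m
   1≤n2 = x<y⇒1≤y-x m<n
   sizes = lia 4 (\a b k c -> k == c :+ b => a == c :+ #1 => a :+ b == k :+ #1) A1.k A2.k k (count A 0z m)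
    (tr (∑-split (χ A) (<⇒≤ 0<m) (x<y⇒x≤y+1 m<n)) (cong (\s -> count A 0z m + s) (sym (tr C2.k-cut (tr (∑-cong (χ XR.A) (\x -> χ A (n - x)) A2.0≤n+1 (\x _ _ -> cong bit (A-rev X x))) (tr (count-rev A n A2.0≤n+1) (cong₂ (count A) (lia 2 (\m n -> n :- (n :- m :+ #1) :+ #1 == m) m n) (x-0+1≡x+1 n))))))))
    (tr C1.k-cut (tr (∑-step (χ A) 0z m (<⇒≤ 0<m)) (cong (\s -> count A 0z m + s) (χ-in m∈))))
   k1< = lia 4 (\a b k K -> a :+ b == k :+ #1 => k == K => #2 <= b => a :< K) A1.k A2.k k K sizes kK (k≥two A2 1≤n2)
   k2< = lia 4 (\a b k K -> a :+ b == k :+ #1 => k == K => #2 <= a => b :< K) A1.k A2.k k K sizes kK (k≥two A1 1≤m)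
   φm = tr (sym (C1.φ-cut (m + + 1) A1.0≤n+1 ≤r)) A1.φend
   end1 = end1-cut X m m∈ endL
   end2 = end1-cut (rev X) n₂ n2∈ endR
   lowD highD : ℤ
   lowD = count D 0z (m + m)
   highD = count XR.D 0z (n₂ + n₂)
   0≤2m = +≤ (<⇒≤ 0<m) (<⇒≤ 0<m)
   0≤2n2 = +≤ A2.0≤n A2.0≤n
   ddsum = tr (∑-split (χ D) 0≤2m (lia 2 (\m n -> m :< n => m :+ m <= n :+ n :+ #1) m n m<n)) (cong (\s -> lowD + s) (tr (sym (tr (∑-cong (χ XR.D) (\x -> χ D (n + n - x)) 0≤N (\x _ _ -> cong bit (R.D-rev x))) (tr (count-rev D (n + n) 0≤N) (cong₂ (count D) (lia 2 (\m n -> n :+ n :- (n :- m :+ (n :- m) :+ #1) :+ #1 == m :+ m) m n) (lia 1 (\n -> n :+ n :- #0 :+ #1 == n :+ n :+ #1) n)))))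
     (tr (∑-step (χ XR.D) 0z (n₂ + n₂) 0≤2n2) (cong (\s -> highD + s) (χ-in (XR.D-in n2∈ n2∈ refl))))))
    where
    0≤N = +≤ 0≤2n2 0≤+
   dd1 = tr (∑-step (χ A1.D) 0z (m + m) 0≤2m) (cong (\s -> count A1.D 0z (m + m) + s) (χ-in (A1.n+A⊂D A1.hi)))
   dd2 = tr (∑-step (χ A2.D) 0z (n₂ + n₂) 0≤2n2) (cong (\s -> count A2.D 0z (n₂ + n₂) + s) (χ-in (A2.n+A⊂D A2.hi)))
   sub1 = count-⊂ A1.D D 0≤2m C1.D⊂
   sub2 = count-⊂ A2.D XR.D 0≤2n2 C2.D⊂
   total = lia 7 (\d a b x y p q -> d == x :+ (y :+ #1) => a == p :+ #1 => b == q :+ #1 => p <= x => q <= y => a :+ b <= d :+ #1) dd A1.dd A2.dd lowD highD (count A1.D 0z (m + m)) (count A2.D 0z (n₂ + n₂)) ddsum dd1 dd2 sub1 sub2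
   module _ (long : + 2 * k - + 1 ≤ n) (small : dd ≤ + 3 * k - + 3) where
    private
     ≥2 : ∀ {x b} -> + 2 * b - + 1 ≤ x -> + 2 ≤ b -> + 2 ≤ x
     ≥2 {x} {b} = lia 2 (\x b -> 2 *: b :- #1 <= x => #2 <= b => #2 <= x) x b
    sparse2 : φ (n + + 1) < φ (m + + 1) -> + 3 * A2.k - + 2 ≤ A2.dd
    sparse2 h = strict A2 k2< end2 (≥2 s (k≥two A2 1≤n2)) s
     where
     s = lia 7 (\f e a b k m n -> f == 2 *: a :- m :- #1 => e == 2 *: k :- n :- #1 => e :< f => a :+ b == k :+ #1 => 2 *: b :- #1 <= n :- m) (φ (m + + 1)) (φ (n + + 1)) A1.k A2.k k m n φm φend h sizes
    -- Both parts are sparse, so with a and b elements they yield (3a - 2) + (3b - 2) - 1 = 3k - 2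
    -- sums.
    inside : φ (n + + 1) < φ (m + + 1) -> φ (m + + 1) ≤ 0z -> ⊥
    inside h h' = lia 6 (\a b k d p q -> a :+ b == k :+ #1 => p :+ q <= d :+ #1 => 3 *: a :- #2 <= p => 3 *: b :- #2 <= q => d <= 3 *: k :- #3 => ff) A1.k A2.k k dd A1.dd A2.dd sizes total (strict A1 k1< end1 (≥2 s (k≥two A1 1≤m)) s) (sparse2 h) small
     where
     s = lia 3 (\f a m -> f == 2 *: a :- m :- #1 => f <= #0 => 2 *: a :- #1 <= m) (φ (m + + 1)) A1.k m φm h'
    module _ (φ≡1 : φ (m + + 1) ≡ + 1) where
     private
      m≡ = lia 3 (\f a m -> f == 2 *: a :- m :- #1 => f == #1 => m == 2 *: a :- #2) (φ (m + + 1)) A1.k m φm φ≡1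
      m≥2 = lia 2 (\m k -> m == 2 *: k :- #2 => #2 <= k => #2 <= m) m A1.k m≡ (k≥two A1 1≤m)
      module E = EndFacts A1 end1
      b1 = fst (IH A1 k1<) (E.coprime 1≤m) (≡⇒≤ (sym m≡))
      b2 = sparse2 (lia 4 (\f e k n -> f == #1 => e == 2 *: k :- n :- #1 => 2 *: k :- #1 <= n => e :< f) (φ (m + + 1)) (φ (n + + 1)) k n φ≡1 φend long)
      up1 = lia 6 (\a b k d p q -> a :+ b == k :+ #1 => p :+ q <= d :+ #1 => 3 *: b :- #2 <= q => d <= 3 *: k :- #3 => p <= 3 *: a :- #3) A1.k A2.k k dd A1.dd A2.dd sizes total b2 small
      tot' = lia 6 (\a b k d p q -> a :+ b == k :+ #1 => 3 *: a :- #3 <= p => 3 *: b :- #2 <= q => d <= 3 *: k :- #3 => d :+ #1 <= p :+ q) A1.k A2.k k dd A1.dd A2.dd sizes b1 b2 small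
      -- The counts leave no room: all sums below 2m come from the left part, and likewise all sums
      -- above 2m from the right part.
      old1 = subset-tight A1.D D 0≤2m C1.D⊂ (lia 7 (\d a b x y p q -> d == x :+ (y :+ #1) => a == p :+ #1 => b == q :+ #1 => q <= y => d :+ #1 <= a :+ b => x <= p) dd A1.dd A2.dd lowD highD (count A1.D 0z (m + m)) (count A2.D 0z (n₂ + n₂)) ddsum dd1 dd2 sub2 tot')
      old2 = subset-tight A2.D XR.D 0≤2n2 C2.D⊂ (lia 7 (\d a b x y p q -> d == x :+ (y :+ #1) => a == p :+ #1 => b == q :+ #1 => p <= x => d :+ #1 <= a :+ b => y <= q) dd A1.dd A2.dd lowD highD (count A1.D 0z (m + m)) (count A2.D 0z (n₂ + n₂)) ddsum dd1 dd2 sub1 tot')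
      -- Both summands of 2t - i are at least t - i, so one that differs from t would fall into the
      -- gap below t; and they cannot both be t.
      gapped : ∀ {t} (Z : NSet t) γ -> (∀ x -> t - γ < x -> x < t -> x ∉ NSet.A Z) -> ∀ i -> 0z < i -> i < γ -> t + t - i ∈ OnSet.D Z -> ⊥
      gapped {t} Z γ free i a b p = case OnSet.D-out Z p of \(x , y , x∈ , y∈ , e) -> case x ≟ t of \ where
       (yes h) -> clash y∈ (free y (lia 5 (\x y t i g -> x :+ y == t :+ t :- i => x == t => i :< g => t :- g :< y) x y t i γ e h b) (lia 4 (\x y t i -> x :+ y == t :+ t :- i => x == t => #0 :< i => y :< t) x y t i e h a))
       (no h) -> clash x∈ (free x (lia 5 (\x y t i g -> x :+ y == t :+ t :- i => y <= t => i :< g => t :- g :< x) x y t i γ e (snd (NSet.supp Z y∈)) b) (≤≢⇒< (snd (NSet.supp Z x∈)) h))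
      module Top (m-1∉ : m - + 1 ∉ A1.A) where
       G1 : Greatest A1.A 0z m
       G1 = [ (\r -> r) , (\none -> clash A1.lo (none 0z ≤r 0<m)) ]′ (greatest A1.A {0z} {m} (<⇒≤ 0<m))
       G2 : Greatest A2.A 0z n₂
       G2 = [ (\r -> r) , (\none -> clash A2.lo (none 0z ≤r (<-≤-trans 0<+ 1≤n2))) ]′ (greatest A2.A {0z} {n₂} A2.0≤n)
       a1 a2 α β : ℤ
       a1 = fst G1
       a2 = fst G2
       α = m - a1
       β = n₂ - a2
       a1∈ = fst (snd (snd (snd G1)))
       a2∈ = fst (snd (snd (snd G2)))
       pos : ∀ {a t} -> a < t -> + 1 ≤ t - a
       pos {a} {t} = x<y⇒1≤y-x
       α≥1 = pos (fst (snd (snd G1)))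
       β≥1 = pos (fst (snd (snd G2)))
       α≥2 : + 2 ≤ α
       α≥2 = case α ≟ + 1 of \ where
        (yes e) -> clash (move A1.A a1∈ (lia 2 (\a m -> m :- a == #1 => a == m :- #1) a1 m e)) m-1∉
        (no ne) -> 1≤x⇒x≢1⇒2≤x α≥1 ne
       mix : ∀ {x} -> x ∈ A -> n - a2 + x ∈ D
       mix x∈ = D-in (R.rev-out (C2.cut-out a2∈)) x∈ refl
       back : ∀ {x a t} -> t - (t - a) < x -> a < x
       back {x} {a} {t} = lia 3 (\x a m -> m :- (m :- a) :< x => a :< x) x a t
       0≤s = lia 4 (\m a b c -> #0 <= a => #1 <= c :- b => #0 <= m => #0 <= m :+ m :- (m :- a :- (c :- b)))
       s< = lia 3 (\s a b -> b :< a => s :- (a :- b) :< s)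
       0<d = lia 2 (\a b -> b :< a => #0 :< a :- b)
       d< = lia 2 (\a b -> #1 <= b => a :- b :< a)
       -- The two neighbours of m add up to 2m - (α - β). For unequal gaps this lies on the side of
       -- the larger gap and within its length of 2m, which `gapped` forbids.
       same : α ≡ β
       same = case <-cmp α β of \ where
        (tri≈ _ e _) -> e
        (tri> _ _ h) -> ⊥e (gapped A1 α (\x p q -> snd (snd (snd (snd G1))) x (back {t = m} p) q) (α - β) (0<d α β h) (d< α β β≥1)
         (old1 (m + m - (α - β)) (0≤s m a1 a2 n₂ (fst (A1.supp a1∈)) β≥1 (<⇒≤ 0<m)) (s< (m + m) α β h) (move D (mix (C1.cut-out a1∈)) (lia 4 (\n m a b -> n :- b :+ a == m :+ m :- (m :- a :- (n :- m :- b))) n m a1 a2))))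
        (tri< h _ _) -> ⊥e (gapped A2 β (\x p q -> snd (snd (snd (snd G2))) x (back {t = n₂} p) q) (β - α) (0<d β α h) (d< β α α≥1)
         (old2 (n₂ + n₂ - (β - α)) (0≤s n₂ a2 a1 m (fst (A2.supp a2∈)) α≥1 A2.0≤n) (s< (n₂ + n₂) β α h) (tr (R.D-rev _) (move D (mix (C1.cut-out a1∈)) (lia 4 (\n m a b -> n :- b :+ a == n :+ n :- (n :- m :+ (n :- m) :- (n :- m :- b :- (m :- a)))) n m a1 a2)))))
       module RA = Rev A1
       -- Adding the first element above m to m - c gives a sum below 2m, so c - α is a sum of two smaller elements.
       all : ∀ t c -> c ∈ NSet.A (rev A1) -> c ≤ + t -> Div α c
       all t c c∈ le = case c ≟ 0z of \ where
          (yes z) -> 0z , tr z (sym (*0 α))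
          (no nz) -> case c ≟ α of \ where
           (yes e) -> + 1 , tr e (sym (*1 α))
           (no ne) -> rec t le (case c <? α of \ where
            (yes l) -> clash (RA.rev-out c∈) (snd (snd (snd (snd G1))) (m - c) (lia 3 (\c a m -> c :< m :- a => a :< m :- c) c a1 m l) (lia 2 (\c m -> #0 <= c => ~ c == #0 => m :- c :< m) c m (fst (NSet.supp (rev A1) c∈)) nz))
            (no l) -> lia 2 (\c a -> ~ c :< a => ~ c == a => a :< c) c α l ne)
        where
        rec : ∀ t -> c ≤ + t -> α < c -> Div α c
        rec zero l h = ⊥e (lia 2 (\a c -> c <= #0 => a :< c => #1 <= a => ff) α c l h α≥1)
        rec (suc t) l h = case A1.D-out (old1 (m + m - (c - α)) (lia 3 (\m c a -> c <= m => #1 <= a => #0 <= m => #0 <= m :+ m :- (c :- a)) m c α (snd (NSet.supp (rev A1) c∈)) α≥1 (<⇒≤ 0<m)) (s< (m + m) c α h)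
           (move D (mix (C1.cut-out (RA.rev-out c∈))) (lia 5 (\n m b a c -> a == n :- m :- b => n :- b :+ (m :- c) == m :+ m :- (c :- a)) n m a2 α c same))) of \(x , y , x∈ , y∈ , e) -> case all t (m - x) (RA.in-rev x∈ refl) (sm x y e (snd (A1.supp y∈))) of \(i , ei) -> case all t (m - y) (RA.in-rev y∈ refl) (sm y x (tr (+-comm y x) e) (snd (A1.supp x∈))) of \(j , ej) ->
          i + j + + 1 , tr (lia 7 (\c m x y a u w -> x :+ y == m :+ m :- (c :- a) => m :- x == u => m :- y == w => c == u :+ w :+ a) c m x y α (α * i) (α * j) e ei ej) (ring α i j)
         where
         ring : ∀ α i j -> α * i + α * j + α ≡ α * (i + j + + 1)
         ring = solve
         sm : ∀ x y -> x + y ≡ m + m - (c - α) -> y ≤ m -> m - x ≤ + t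
         sm x y e y≤ = lia 6 (\x y m c a t -> x :+ y == m :+ m :- (c :- a) => y <= m => c <= #1 :+ t => #1 <= a => m :- x <= t) x y m c α (+ t) e y≤ l α≥1
       absurd = coprime-rev A1 (E.coprime 1≤m) α α≥2 \c c∈ -> all (∣ c ∣) c c∈ (≡⇒≤ (sym (∣+∣ (fst (NSet.supp (rev A1) c∈)))))
     abstract
      -- The left part satisfies m = 2|A1| - 2, and each kind conflicts with its generation by 1.
      -- Only for `top`, where m - 1 is a hole, must the gaps on the two sides of m be compared.
      onBand : ⊥
      onBand = case halfKind A1 m≡ (≤≥ up1 b1) of \ where
       (even ev) -> E.coprime 1≤m (+ 2) ≤r ev
       (aps T) -> E.not-biAP m≥2 (twoAP-biAP A1 T b1)
       (top S e _ _) -> Top.absurd (move A1.A (SoloFacts.hole A1 S) e)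
       (bottom S e _ _) -> clash (E.one∈ 1≤m) (move A1.A (tr (sym (A-rev A1 _)) (SoloFacts.hole (rev A1) S)) (lia 2 (\m z -> z == m :- #1 => m :- z == #1) m (Solo.z0 S) e))
       (altPos _ h _ _ _ _) -> clash (E.one∈ 1≤m) h
       (negAlt _ h _ _ _ _) -> clash (E.one∈ 1≤m) h
       (negPos _ h _ _ _ _ _) -> clash (E.one∈ 1≤m) h

rev-rev-in : ∀ {n} (X : NSet n) {x} -> x ∈ NSet.A X -> x ∈ NSet.A (rev (rev X))
rev-rev-in {n} X {x} p = Rev.in-rev (rev X) (Rev.in-rev X p refl) (x-[x-y]≡y n)

rev-rev-out : ∀ {n} (X : NSet n) {x} -> x ∈ NSet.A (rev (rev X)) -> x ∈ NSet.A X
rev-rev-out {n} X {x} p = move (NSet.A X) (Rev.rev-out X (Rev.rev-out (rev X) p)) (x-[x-y]≡y n)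

module Main (K : ℤ) (IH : ∀ {n} (Z : NSet n) -> OnSet.k Z < K -> Bound Z × Structure Z) where
 open Step K IH
 module Contradiction {n : ℤ} (X : NSet n) (kK : OnSet.k X ≡ K) (n≥1 : + 1 ≤ n) (endL : End1 X) (endR : End1 (rev X))
  (long : + 2 * OnSet.k X - + 1 ≤ n) (small : OnSet.dd X ≤ + 3 * OnSet.k X - + 3) where
  open OnSet X
  private
   module R = Rev X
   end = φ (n + + 1)
   end≤0 = lia 3 (\e k n -> e == 2 *: k :- n :- #1 => 2 *: k :- #1 <= n => e <= #0) _ k n φend long
   φn≡ = φn
   -- Splitting at m shows that the balance never returns to [end, 1] at an element.
   band : ∀ m -> m ∈ A -> 0z < m -> m < n -> φ (m + + 1) ≤ + 1 -> end ≤ φ (m + + 1) -> ⊥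
   band m m∈ a b p q = case φ (m + + 1) ≟ + 1 of \ where
     (yes e) -> StepEnd.BothTight.Split.onBand K IH X kK endL endR m m∈ a b long small e
     (no ne) -> case φ (m + + 1) ≟ end of \ where
      (no ne') -> StepEnd.BothTight.Split.inside K IH X kK endL endR m m∈ a b long small (lia 2 (\e f -> e <= f => ~ f == e => e :< f) _ _ q ne') (lia 1 (\f -> f <= #1 => ~ f == #1 => f <= #0) _ p ne)
      (yes e) -> StepEnd.BothTight.Split.onBand K IH (rev X) (tr R.k-rev kK) endR endL' (n - m) (R.in-rev m∈ refl) (lia 2 (\m n -> m :< n => #0 :< n :- m) m n b) (lia 2 (\m n -> #0 :< m => n :- m :< n) m n a) (subst (\k -> + 2 * k - + 1 ≤ n) (sym R.k-rev) long) (subst₂ (\d k -> d ≤ + 3 * k - + 3) (sym R.dd-rev) (sym R.k-rev) small)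
       (lia 5 (\r e f g h -> r == e :- g => g == h => f == h :+ #1 => f == e => r == #1) _ _ _ _ _ (R.φ-rev (n - m + + 1) (lia 2 (\m n -> m :< n => #0 <= n :- m :+ #1) m n b) (lia 2 (\m n -> #0 :< m => n :- m :+ #1 <= n :+ #1) m n a)) (cong φ (lia 2 (\m n -> n :+ #1 :- (n :- m :+ #1) == m) m n)) (φ-in m∈) e)
    where
    endL' : End1 (rev (rev X))
    endL' x x∈ 0<x ne = case endL x (rev-rev-out X x∈) 0<x ne of \(a , b , (a∈ , p) , (b∈ , q) , e) -> a , b , (rev-rev-in X a∈ , p) , (rev-rev-in X b∈ , q) , e
   first : Least (\z -> bool (φ (z + + 1) ≤? 0z)) 0z n
   first = [ (\r -> r) , (\none -> ⊥e (bool-out (φ (n - + 1 + + 1) ≤? 0z) (none (n - + 1) (0≤- n≥1) (x-1<x)) (lia 3 (\f g e -> g == f => e == f :+ #1 => e <= #0 => g <= #0) _ _ _ (cong φ (x-1+1≡x)) φn≡ end≤0))) ]′ (least (\z -> bool (φ (z + + 1) ≤? 0z)) {0z} {n} 0≤n)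
   z : ℤ
   z = fst first
   z<n = fst (snd (snd first))
   z≤0 : φ (z + + 1) ≤ 0z
   z≤0 = bool-in (φ (z + + 1) ≤? 0z) (fst (snd (snd (snd first))))
   before : ∀ y -> 0z ≤ y -> y < z -> + 1 ≤ φ (y + + 1)
   before y a b = x≰0⇒1≤x (bool-out (φ (y + + 1) ≤? 0z) (snd (snd (snd (snd first))) y a b))
   z≥1 : + 1 ≤ z
   z≥1 = case z ≟ 0z of \ where
    (yes e) -> ⊥e (lia 2 (\f g -> f == #1 => g == f => g <= #0 => ff) _ _ φ1 (cong (\z -> φ (z + + 1)) e) z≤0)
    (no ne) -> 0≤x⇒x≢0⇒1≤x (fst (snd first)) ne
   φz : + 1 ≤ φ z
   φz = subst (\y -> + 1 ≤ φ y) x-1+1≡x (before (z - + 1) (0≤- z≥1) (x-1<x))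
   0≤z = ≤t 0≤+ z≥1
   -- A member after z would put the level back into [end,1]. So only holes follow, until the level
   -- is just below `end`.
   run : ∀ t -> z ≤ t -> t ≤ z + + 1 - end -> t ∉ A × φ (t + + 1) ≡ z - t
   run t z≤t t≤ = climb (\t -> t ∉ A × φ (t + + 1) ≡ z - t) (z + + 1 - end) base step' z≤t t≤
    where
    base : z ∉ A × φ (z + + 1) ≡ z - z
    base = case φ-case X z 0≤z of \ where
     (inl (_ , e)) -> ⊥e (lia 2 (\f g -> f == g :+ #1 => #1 <= g => f <= #0 => ff) _ _ e φz z≤0)
     (inr (p , e)) -> p , lia 3 (\f g z -> f == g :- #1 => #1 <= g => f <= #0 => f == z :- z) _ _ z e φz z≤0
    step' : ∀ t -> z ≤ t -> t < z + + 1 - end -> t ∉ A × φ (t + + 1) ≡ z - t -> t + + 1 ∉ A × φ (t + + 1 + + 1) ≡ z - (t + + 1)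
    step' t a b (_ , e) = case φ-case X (t + + 1) 0≤ of \ where
       (inr (p , e')) -> p , lia 4 (\f g z t -> g == z :- t => f == g :- #1 => f == z :- (t :+ #1)) _ _ z t e e'
       (inl (p , e')) -> ⊥e (case t + + 1 ≟ n of \ where
        (yes h) -> lia 5 (\g z t en fn -> g == z :- t => t :< z :+ #1 :- en => en == fn :+ #1 => fn == g => #0 <= #0 => ff) _ z t _ _ e b φn≡ (cong φ (sym h)) ≤r
        (no h) -> band (t + + 1) p (lia 2 (\z t -> #1 <= z => z <= t => #0 :< t :+ #1) z t z≥1 a) (≤≢⇒< (snd (supp p)) h) (lia 4 (\f g z t -> g == z :- t => f == g :+ #1 => z <= t => f <= #1) _ _ z t e e' a) (lia 5 (\f g z t en -> g == z :- t => f == g :+ #1 => t :< z :+ #1 :- en => en <= f) _ _ z t _ e e' b))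
     where
     0≤ = lia 2 (\z t -> #1 <= z => z <= t => #0 <= t :+ #1) z t z≥1 a
   Z = z + + 2 - end
   z≤Z = lia 2 (\z e -> e <= #0 => z <= z :+ #1 :- e) z _ end≤0
   Z≤n : Z ≤ n
   Z≤n = case Z ≤? n of \ where
    (yes h) -> h
    (no h) -> ⊥e (clash hi (fst (run n (<⇒≤ z<n) (lia 3 (\z e n -> ~ z :+ #2 :- e <= n => n <= z :+ #1 :- e) z end n h))))
   -- From below `end` the level could come back only through a member that lifts it to `end`, which
   -- `band` excludes.
   after : ∀ t -> Z ≤ t -> t ≤ n -> φ t < end
   after t a b = climb (\t -> φ t < end) n (lia 4 (\f g z e -> f == g => g == z :- (z :+ #1 :- e) => #0 <= #0 => f :< e) _ _ z _ (cong φ (lia 2 (\z e -> z :+ #2 :- e == z :+ #1 :- e :+ #1) z end)) (snd (run (z + + 1 - end) z≤Z ≤r)) ≤r)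
    (\t c d ih -> let 0<t = lia 3 (\z e t -> #1 <= z => e <= #0 => z :+ #2 :- e <= t => #0 :< t) z _ t z≥1 end≤0 c in case φ-case X t (<⇒≤ 0<t) of \ where
     (inr (_ , e)) -> lia 3 (\f g e -> f == g :- #1 => g :< e => f :< e) _ _ _ e ih
     (inl (p , e)) -> case end ≤? φ (t + + 1) of \ where
      (no h) -> ≰⇒> h
      (yes h) -> ⊥e (band t p 0<t d (lia 3 (\f g e -> f == g :+ #1 => g :< e => e <= #0 => f <= #1) _ _ _ e ih end≤0) h)) a b
   Q = ap z (+ 1) (+ 1 - end)
   -- Q is the run of holes from z on. Every hole outside it is covered: before z because the level
   -- is positive, from Z on because it is below the final one.
   extra : ∀ t -> 0z ≤ t -> t < n -> 0z ≤ ex t + χ Q t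
   extra t a b = case mem? A t of \ where
      (inl p) -> lia 2 (\x q -> x == #0 => #0 <= q => #0 <= x :+ q) _ _ (ex-in p) (χ≥0 Q t)
      (inr p) -> case t <? z of \ where
       (yes h) -> nonneg p (χ-in (low a (before t a h))) (χ≥0 D _)
       (no h) -> case Z ≤? t of \ where
        (yes h') -> lia 4 (\x q u v -> x == u :+ v :- #1 => v == #1 => #0 <= u => #0 <= q => #0 <= x :+ q) _ _ _ _ (ex-hole p) (χ-in (high a (x<y⇒x≤y+1 b) (after t h' (<⇒≤ b)))) (χ≥0 D _) (χ≥0 Q t)
        (no h') -> lia 4 (\x q u v -> x == u :+ v :- #1 => q == #1 => #0 <= u => #0 <= v => #0 <= x :+ q) _ _ _ _ (ex-hole p) (χ-in (in-ap z (+ 1) (+ 1 - end) (t - z) (lia 2 (\t z -> ~ t :< z => #0 <= t :- z) t z h) (lia 3 (\t z e -> ~ z :+ #2 :- e <= t => t :- z <= #1 :- e) t z end h') (lia 2 (\t z -> t == z :+ 1 *: (t :- z)) t z))) (χ≥0 D _) (χ≥0 D _)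
    where
    nonneg : t ∉ A -> χ D t ≡ + 1 -> 0z ≤ χ D (t + n) -> 0z ≤ ex t + χ Q t
    nonneg p e h = lia 4 (\x q u v -> x == u :+ v :- #1 => u == #1 => #0 <= v => #0 <= q => #0 <= x :+ q) _ _ _ _ (ex-hole p) e h (χ≥0 Q t)
   -- The sum of ex is at most end - 2, and only the 2 - end holes of the run can contribute negatively.
   zeros = ∑-zeros (\t -> ex t + χ Q t) extra (lia 8 (\s x q e d n k w -> s == x :+ q => x == d :- n :- k => q == #1 :- e :+ #1 => d <= 3 *: k :- #3 => e == 2 *: k :- n :- #1 => s <= #0) _ _ _ _ _ n k 0z (∑-+ ex (χ Q) 0≤n) ∑ex (count-ap≡ z (+ 1) ≤r 0≤z (lia 1 (\e -> e <= #0 => #0 <= #1 :- e) _ end≤0) (lia 3 (\z e n -> z :+ #2 :- e <= n => z :+ 1 *: (#1 :- e) :< n) z end n Z≤n)) small φend)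
   -- The positive level makes t a sum. By `zeros` it is covered only once, so t + n is missing, and
   -- n - 1 in A excludes t + 1.
   spread : ∀ t -> 0z ≤ t -> t < z -> t ∉ A -> t + + 1 ∉ A
   spread t a b p = D-not {x = n + t} (move D (χ-out⁻ {D (t + n)} (lia 4 (\x q u v -> x :+ q == #0 => x == u :+ v :- #1 => u == #1 => #0 <= q => v <= #0) _ _ _ _ (zeros t a (<-trans b z<n)) (ex-hole p) (χ-in (low a (before t a b))) (χ≥0 Q t))) (+-comm t n)) (R.rev-out (EndFacts.one∈ (rev X) endR n≥1)) (lia 2 (\n t -> n :- #1 :+ (t :+ #1) == n :+ t) n t)
   hole0 : Least (\x -> not (A x)) 0z (z + + 1)
   hole0 = [ (\r -> r) , (\none -> clash (cong not (fst (run z ≤r z≤Z))) (none z 0≤z (x<x+1))) ]′ (least (\x -> not (A x)) {0z} {z + + 1} (≤t 0≤z (x≤x+1)))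
   h = fst hole0
   h≥0 = fst (snd hole0)
   h≤z : h ≤ z
   h≤z = x<y+1⇒x≤y (fst (snd (snd hole0)))
   holes : ∀ t -> h ≤ t -> t ≤ z -> t ∉ A
   holes t = climb (\t -> t ∉ A) z (not-true (fst (snd (snd (snd hole0))))) (\t a b ih -> spread t (≤t h≥0 a) b ih)
   -- All of [0,h) belongs to A, yet the level at z + 1 is at most 0, so at least h steps lie
   -- between h and z + 1.
   z≥2h : + 2 * h ≤ z + + 1
   z≥2h = lia 5 (\f g b h z -> f == g :+ b => f <= #0 => g == h :- #0 => h :- (z :+ #1) <= b => 2 *: h <= z :+ #1) _ _ _ h z (φ-split h≥0 (≤t h≤z (x≤x+1))) z≤0 (bal-full A h≥0 (\x a b -> not-false (snd (snd (snd (snd hole0))) x a b))) (bal-lower A (≤t h≤z (x≤x+1)))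
   next : Least A (z + + 1) (n + + 1)
   next = [ (\r -> r) , (\none -> clash hi (none n (x<y⇒x+1≤y z<n) (x<x+1))) ]′ (least A {z + + 1} {n + + 1} (x<y⇒x+1≤y+1 z<n))
   w = fst next
  abstract
   -- The next member w beyond z is a sum of two smaller ones, which lie below h; hence w < 2h,
   -- although 2h is at most z + 1 and thus at most w.
   contradiction' : ⊥
   contradiction' = case next of \(w , w> , _ , w∈ , gap) -> let
      small' : ∀ a b -> a ∈ A -> 0z < b -> a + b ≡ w -> a < h
      small' a b a∈ 0<b e = case a <? h of \ where
       (yes l) -> l
       (no l) -> clash a∈ (case a ≤? z of \ where
        (yes l') -> holes a (≮⇒≥ l) l'
        (no l') -> gap a (lia 2 (\a z -> ~ a <= z => z :+ #1 <= a) a z l') (lia 3 (\a b w -> a :+ b == w => #0 :< b => a :< w) a b w e 0<b)) in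
    case endL w w∈ (lia 2 (\z w -> #1 <= z => z :+ #1 <= w => #0 :< w) z w z≥1 w>) (\e -> lia 2 (\z w -> #1 <= z => z :+ #1 <= w => w == #1 => ff) z w z≥1 w> e) of \(a , b , (a∈ , 0<a) , (b∈ , 0<b) , e) ->
     lia 5 (\a b w h z -> a :+ b == w => a :< h => b :< h => 2 *: h <= z :+ #1 => z :+ #1 <= w => ff) a b w h z e (small' a b a∈ 0<b e) (small' b a b∈ 0<a (tr (+-comm b a) e)) z≥2h w>
 module _ {n : ℤ} (X : NSet n) (kK : OnSet.k X ≡ K) (k≥2 : + 2 ≤ OnSet.k X) (cop : Coprime X) (long : + 2 * OnSet.k X - + 2 ≤ n) where
  open OnSet X
  private
   module R = Rev X
   module An = Analyse X kK k≥2 cop long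
   module An' = Analyse (rev X) (tr R.k-rev kK) (subst (+ 2 ≤_) (sym R.k-rev) k≥2) (coprime-rev X cop) (subst (\k -> + 2 * k - + 2 ≤ n) (sym R.k-rev) long)
   n≥2 = lia 2 (\n k -> 2 *: k :- #2 <= n => #2 <= k => #2 <= n) n k long k≥2
   back : An'.Done -> An.Done
   back (b , s) = subst₂ (\k d -> + 3 * k - + 3 ≤ d) R.k-rev R.dd-rev b , \l sm -> [ (\t -> inl (subst (TwoAP A) R.k-rev (twoAP-rev X t))) , (\t -> inr (subst (K6Set A) R.k-rev (k6-rev X t))) ]′ (s (subst (\k -> + 2 * k - + 1 ≤ n) (sym R.k-rev) l) (subst₂ (\k d -> d ≤ + 3 * k - + 3) (sym R.k-rev) (sym R.dd-rev) sm))
   -- The strict bound for Y, 3(k - 1) - 2, and the two lost sums give 3k - 3. Equality for n at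
   -- least 2k - 1 is refuted by `Contradiction`.
   both : An.Tight -> An'.Tight -> An.Done
   both (endR , n'≡) (endRR , _) = lia 4 (\k k' d d' -> k == k' :+ #1 => d' :+ #2 <= d => 3 *: k' :- #2 <= d' => 3 *: k :- #3 <= d) k P.Y.k _ _ P.kY P.two-new strictY , \l sm -> ⊥e (Contradiction.contradiction' X kK (≤t 1≤+ n≥2) endL endR l sm)
    where
    module P = Peel X k≥2
    endL : End1 X
    endL x x∈ 0<x ne = case endRR x (rev-rev-in X x∈) 0<x ne of \(a , b , (a∈ , p) , (b∈ , q) , e) -> a , b , (rev-rev-out X a∈ , p) , (rev-rev-out X b∈ , q) , e
    sparseY = lia 4 (\k k' n m -> k == k' :+ #1 => 2 *: k :- #2 <= n => m == n :- #1 => 2 *: k' :- #1 <= m) k P.Y.k n _ P.kY long n'≡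
    strictY = strict P.Y An.Yk< (end1-cut X P.n' P.n'∈ endL) (lia 2 (\m k -> 2 *: k :- #1 <= m => #2 <= k => #2 <= m) _ _ sparseY (k≥two P.Y (lia 2 (\m n -> m == n :- #1 => #2 <= n => #1 <= m) _ n n'≡ n≥2))) sparseY
  abstract
   resolve : An.Done
   resolve = [ (\d -> d) , (\t -> [ back , both t ]′ An'.analyse) ]′ An.analyse

freiman : ∀ m {n} (X : NSet n) -> OnSet.k X ≤ + m -> Bound X × Structure X
freiman zero X le = ⊥e (≤⇒≯ le (<-≤-trans 0<+ (OnSet.k≥1 X)))
freiman (suc m) {n} X le = (\cop long -> fst (go cop long)) , \cop long small -> snd (go cop (≤t (lia 1 (\k -> 2 *: k :- #2 <= 2 *: k :- #1) k) long)) long small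
 where
 open OnSet X
 n≥1 : Coprime X -> + 1 ≤ n
 n≥1 cop = case + 1 ≤? n of \ where
  (yes h) -> h
  (no h) -> ⊥e (cop (+ 2) ≤r \a a∈ -> 0z , lia 2 (\a m -> #0 <= a => a <= m => ~ #1 <= m => a == #0) a n (fst (supp a∈)) (snd (supp a∈)) h)
 go : Coprime X -> + 2 * k - + 2 ≤ n -> + 3 * k - + 3 ≤ dd × (+ 2 * k - + 1 ≤ n -> dd ≤ + 3 * k - + 3 -> Res X)
 go cop long = Main.resolve k (\Z lt -> freiman m Z (lia 3 (\a k m -> a :< k => k <= #1 :+ m => a <= m) _ k _ lt le)) X refl (k≥two X (n≥1 cop)) cop long

-- From lists to decidable sets, and the additively minimal blocks

memb : List ℤ -> 𝔹
memb L x = bool (DecMem._∈?_ _≟_ x L)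

in-memb : ∀ {L x} -> x Mem.∈ L -> x ∈ memb L
in-memb {L} {x} = in-bool (DecMem._∈?_ _≟_ x L)

memb-out : ∀ {L x} -> x ∈ memb L -> x Mem.∈ L
memb-out {L} {x} = bool-in (DecMem._∈?_ _≟_ x L)

length-count : ∀ L P {a b} -> a ≤ b -> Unique L -> (∀ x -> x Mem.∈ L -> x ∈ P) -> (∀ x -> x ∈ P -> x Mem.∈ L) -> (∀ x -> x Mem.∈ L -> a ≤ x × x < b) -> count P a b ≡ + length L
length-count L P {a} {b} a≤b uq f g range = ≤≥ (count-list P L a≤b g) (subst (_≤ count P a b) (tr (cong (_+ + length L) (∑-zero a≤b)) (0+ _))
  (count-extra (\_ -> false) P L a≤b (fresh uq) (All.tabulate \{x} p -> range x p , f x p) \()))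
 where
 fresh : ∀ {L} -> Unique L -> Fresh (\_ -> false) L
 fresh [] = tt
 fresh (u ∷ us) = refl , u , fresh us

module Block (A : List ℤ) (uq : Unique A) (u v : ℤ) where
 P? : ∀ x -> Dec (u ≤ x × x ≤ v)
 P? x = (u ≤? x) ×-dec (x ≤? v)
 block = L.filter P? A
 in-block : ∀ {x} -> x Mem.∈ A -> u ≤ x -> x ≤ v -> x Mem.∈ block
 in-block p a b = ∈-filter⁺ P? p (a , b)
 block-out : ∀ {x} -> x Mem.∈ block -> x Mem.∈ A × (u ≤ x × x ≤ v)
 block-out {x} p = ∈-filter⁻ P? {x} {A} p
 unique = Unique.filter⁺ P? uq
 subset : Df.SubsetOf block u v
 subset x p = snd (block-out p)
 counts : ∀ a b -> u ≤ a -> b ≤ v -> a ≤ b + + 1 -> + Df.count block a b ≡ count (memb A) a (b + + 1)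
 counts a b u≤a b≤v a≤b = sym (tr (∑-cong (χ (memb A)) (χ (memb M)) a≤b \x p q -> cong bit (Bool-ext
    (\r -> in-memb (∈-filter⁺ Q? (in-block (memb-out {A} r) (≤t u≤a p) (≤t (x≤ x q) b≤v)) (p , x≤ x q)))
    (\r -> in-memb {A} (fst (block-out (fst (∈-filter⁻ Q? {x} {block} (memb-out {M} r))))))))
   (length-count M (memb M) a≤b (Unique.filter⁺ Q? unique) (\x -> in-memb) (\x -> memb-out) \x r -> let s = snd (∈-filter⁻ Q? {x} {block} r) in fst s , x≤y⇒x<y+1 (snd s)))
  where
  Q? : ∀ x -> Dec (a ≤ x × x ≤ b)
  Q? x = (a ≤? x) ×-dec (x ≤? b)
  M = L.filter Q? block
  x≤ : ∀ x -> x < b + + 1 -> x ≤ b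
  x≤ x = x<y+1⇒x≤y
 twice : ∀ a b -> u ≤ a -> b ≤ v -> a ≤ b + + 1 -> + (2 ℕ.* Df.count block a b) ≡ bal (memb A) a (b + + 1) + (b - a + + 1)
 twice a b p q r = tr (pos-* 2 (Df.count block a b)) (lia 5 (\c d s a b -> c == d => s == 2 *: d :- (b :+ #1 :- a) => 2 *: c == s :+ (b :- a :+ #1)) _ _ _ a b (counts a b p q r) (bal-count (memb A) r))
 halfDense : u ≤ v + + 1 -> bal (memb A) u (v + + 1) ≡ 0z -> Df.HalfDense block u v
 halfDense le e = tr (twice u v ≤r ≤r le) (tr (cong (_+ (v - u + + 1)) e) (0+ _))
 antiSymmetric : Anti (memb A) u v -> Df.AntiSymmetric block u v
 antiSymmetric (av , co) = (\x (p , q) -> let r = block-out p in clash (in-memb {A} (fst (block-out q))) (av x (fst (snd r)) (snd (snd r)) (in-memb {A} (fst r)))) ,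
  \x a b -> case mem? (memb A) x of \ where
   (inl p) -> inl (in-block (memb-out {A} p) a b)
   (inr p) -> inr (in-block (memb-out {A} (co x a b p)) (lia 3 (\x u v -> x <= v => u <= u :+ v :- x) x u v b) (lia 3 (\x u v -> u <= x => u :+ v :- x <= v) x u v a))

-- The block (ζ, n) of a set whose balance is positive th; ζ = -1 is allowed.
module LeftBlock {n : ℤ} (A : List ℤ) (uq : Unique A) (X : NSet n) (X≡ : ∀ x -> NSet.A X x ≡ memb A x) (n≥1 : + 1 ≤ n) (ζ u v : ℤ) (u≡ : u ≡ ζ + + 1) (v≡ : v ≡ n - + 1) (ζ≥ : - + 1 ≤ ζ) (ζ≤ : ζ ≤ n - + 2) where
 open OnSet X using (D; D-in; D-out; φ; φ-split; supp; hi)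
 open Block A uq u v public
 private
  u≤v+1 = lia 4 (\u v z n -> u == z :+ #1 => v == n :- #1 => z <= n :- #2 => u <= v :+ #1) u v ζ n u≡ v≡ ζ≤
  0≤u = lia 2 (\u z -> u == z :+ #1 => con (- + 1) <= z => #0 <= u) u ζ u≡ ζ≥
  inA : ∀ {x} -> x ∈ NSet.A X -> x Mem.∈ A
  inA {x} p = memb-out {A} (tr (sym (X≡ x)) p)
  outA : ∀ {x} -> x Mem.∈ A -> x ∈ NSet.A X
  outA {x} p = tr (X≡ x) (in-memb p)
 module _ (start : φ u ≡ 0z) (final : φ n ≡ 0z) (pos : ∀ t -> ζ + + 2 ≤ t -> t ≤ n - + 1 -> + 1 ≤ φ t) (anti : Anti (NSet.A X) u v)
  (ζ∉ : ζ + n ∉ D) (R : ∀ y -> ζ < y -> y < n -> y ∉ NSet.A X -> y + n ∉ D) where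
  private
   balX : ∀ {t} -> u ≤ t -> bal (NSet.A X) u t ≡ φ t
   balX {t} h = lia 3 (\b f g -> g == f :+ b => f == #0 => b == g) _ _ _ (φ-split 0≤u h) start
   balφ : ∀ {t} -> u ≤ t -> bal (memb A) u t ≡ φ t
   balφ h = tr (∑-cong (step (memb A)) (step (NSet.A X)) h (\x _ _ -> cong (\b -> + 2 * bit b - + 1) (sym (X≡ x)))) (balX h)
  leftDense = halfDense u≤v+1 (tr (balφ u≤v+1) (tr (cong φ (lia 2 (\v n -> v == n :- #1 => v :+ #1 == n) v n v≡)) final)) , \x a b ->
   lia 4 (\c s x u -> c == s :+ (x :- u :+ #1) => #1 <= s => x :- u :+ #1 :< c) _ _ x u (twice u x ≤r (≤t b (x-1≤x)) (≤t a (x≤x+1)))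
    (subst (+ 1 ≤_) (sym (balφ (≤t a (x≤x+1)))) (pos (x + + 1) (lia 3 (\x u z -> u == z :+ #1 => u <= x => z :+ #2 <= x :+ #1) x u ζ u≡ a) (lia 3 (\x v n -> v == n :- #1 => x <= v :- #1 => x :+ #1 <= n :- #1) x v n v≡ b)))
  anti' = antiSymmetric ((\x p q r -> tr (sym (X≡ _)) (fst anti x p q (tr (X≡ x) r))) , \x p q r -> tr (sym (X≡ _)) (snd anti x p q (tr (X≡ x) r)))
  private
   v+1 = lia 2 (\v n -> v == n :- #1 => v :+ #1 == n) v n v≡
   Ext : ℤ -> Set
   Ext x = x Mem.∈ block ⊎ x ≡ v + + 1
   ext-in : ∀ {x} -> Ext x -> x ∈ NSet.A X × u ≤ x
   ext-in (inl p) = outA (fst (block-out p)) , fst (snd (block-out p))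
   ext-in (inr e) = move (NSet.A X) hi (sym (tr e v+1)) , subst (u ≤_) (sym e) u≤v+1
   in-ext : ∀ {x} -> x ∈ NSet.A X -> u ≤ x -> Ext x
   in-ext {x} p h = case x ≟ v + + 1 of \ where
    (yes e) -> inr e
    (no ne) -> inl (in-block (inA p) h (lia 3 (\x v n -> v :+ #1 == n => x <= n => ~ x == v :+ #1 => x <= v) x v n v+1 (snd (supp p)) ne))
  -- Up to u + v - 1 the positive balance produces sums by the pigeonhole principle. For a larger
  -- sum x the number x - n exceeds ζ and cannot be a hole, since y + n is missing for each hole y
  -- there; so x is n plus a member.
  minimal : Df.LeftAdditivelyMinimal block u v
  minimal = leftDense , anti' , (\{x} (a , b , a∈ , b∈ , e) -> fwd x a b (ext-in a∈) (ext-in b∈) (sym e)) , \{x} -> \ where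
      (inr (y , y∈ , e)) -> v + + 1 , y , inr refl , y∈ , e
      (inl (l , h)) -> case pigeonhole (NSet.A X) u (x - u) (lia 2 (\x u -> u :+ u <= x => u <= x :- u :+ #1) x u l) (subst (+ 1 ≤_) (sym (balX (lia 2 (\x u -> u :+ u <= x => u <= x :- u :+ #1) x u l)))
        (pos (x - u + + 1) (lia 3 (\x u z -> u == z :+ #1 => u :+ u <= x => z :+ #2 <= x :- u :+ #1) x u ζ u≡ l) (lia 4 (\x u v n -> v == n :- #1 => x <= u :+ v :- #1 => x :- u :+ #1 <= n :- #1) x u v n v≡ h))) of \(y , a , b , p , q) ->
       y , u + (x - u) - y , in-ext p a , in-ext q (lia 3 (\x u y -> y :< x :- u :+ #1 => u <= u :+ (x :- u) :- y) x u y b) , lia 3 (\x u y -> x == y :+ (u :+ (x :- u) :- y)) x u y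
   where
   fwd : ∀ x a b -> (a ∈ NSet.A X × u ≤ a) -> (b ∈ NSet.A X × u ≤ b) -> a + b ≡ x -> (u + u ≤ x × x ≤ u + v - + 1) ⊎ (Σ ℤ \y -> Ext y × x ≡ v + + 1 + y)
   fwd x a b (a∈ , ua) (b∈ , ub) e = case x ≤? u + v - + 1 of \ where
       (yes h) -> inl (subst (u + u ≤_) e (+≤ ua ub) , h)
       (no h) -> inr (x - n , in-ext (y∈ h) (u≤y h) , lia 3 (\x v n -> v :+ #1 == n => x == v :+ #1 :+ (x :- n)) x v n v+1)
    where
    x∈ = D-in a∈ b∈ (tr e (x≡x-y+y n))
    ζ≤y = lia 5 (\x u v z n -> u == z :+ #1 => v == n :- #1 => ~ x <= u :+ v :- #1 => z <= x :- n) x u v ζ n u≡ v≡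
    ζ<y : ¬ x ≤ u + v - + 1 -> ζ < x - n
    ζ<y h = ≤≢⇒< (ζ≤y h) \e' -> clash (move D x∈ (cong (_+ n) (sym e'))) ζ∉
    u≤y : ¬ x ≤ u + v - + 1 -> u ≤ x - n
    u≤y h = lia 3 (\u z y -> u == z :+ #1 => z :< y => u <= y) u ζ _ u≡ (ζ<y h)
    y∈ : ¬ x ≤ u + v - + 1 -> x - n ∈ NSet.A X
    y∈ h = case mem? (NSet.A X) (x - n) of \ where
     (inl p) -> p
     (inr p) -> case x - n ≟ n of \ where
      (yes e') -> move (NSet.A X) hi (sym e')
      (no ne) -> clash x∈ (R (x - n) (ζ<y h) (≤≢⇒< (lia 4 (\a b x n -> a :+ b == x => a <= n => b <= n => x :- n <= n) a b x n e (snd (supp a∈)) (snd (supp b∈))) ne) p)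

-- The block (0,ω) of a set whose balance is at most 0 from 2 up to ω - 1; the point adjoined for
-- additive minimality is 0 on its left.
module RightBlock {n : ℤ} (A : List ℤ) (uq : Unique A) (X : NSet n) (X≡ : ∀ x -> NSet.A X x ≡ memb A x) (ω v : ℤ) (v≡ : v ≡ ω - + 1) (ω≥ : + 2 ≤ ω) where
 open OnSet X using (D; D-in; D-out; φ; φ1; φ-split; supp; lo)
 open Block A uq (+ 1) v public
 private
  1≤v+1 = lia 2 (\v w -> v == w :- #1 => #2 <= w => #1 <= v :+ #1) v ω v≡ ω≥
  v+1 = lia 2 (\v n -> v == n :- #1 => v :+ #1 == n) v ω v≡
  inA : ∀ {x} -> x ∈ NSet.A X -> x Mem.∈ A
  inA {x} p = memb-out {A} (tr (sym (X≡ x)) p)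
  outA : ∀ {x} -> x Mem.∈ A -> x ∈ NSet.A X
  outA {x} p = tr (X≡ x) (in-memb p)
 module _ (final : φ ω ≡ + 1) (neg : ∀ s -> + 2 ≤ s -> s ≤ ω - + 1 -> φ s ≤ 0z) (anti : Anti (NSet.A X) (+ 1) v) (ω∉A : ω ∉ NSet.A X)
  (ω∉ : ω ∉ D) (R : ∀ y -> 0z < y -> y < ω -> y ∉ NSet.A X -> y ∉ D) where
  private
   balX : ∀ {t} -> + 1 ≤ t -> t ≤ v + + 1 -> bal (NSet.A X) t (v + + 1) ≡ + 1 - φ t
   balX {t} h h' = lia 4 (\b f g w -> g == f :+ b => g == w => w == #1 => b == #1 :- f) _ (φ t) _ _ (φ-split (≤t 0≤+ h) h') (cong φ v+1) final
   same : ∀ {t} -> t ≤ v + + 1 -> bal (memb A) t (v + + 1) ≡ bal (NSet.A X) t (v + + 1)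
   same h = ∑-cong (step (memb A)) (step (NSet.A X)) h (\x _ _ -> cong (\b -> + 2 * bit b - + 1) (sym (X≡ x)))
   big : ∀ {t} -> + 2 ≤ t -> t ≤ v -> + 1 ≤ bal (NSet.A X) t (v + + 1)
   big {t} h h' = lia 2 (\b f -> b == #1 :- f => f <= #0 => #1 <= b) _ _ (balX (≤t 1≤+ h) (≤t h' (x≤x+1))) (neg t h (subst (t ≤_) v≡ h'))
  rightDense = halfDense 1≤v+1 (tr (same 1≤v+1) (tr (balX ≤r 1≤v+1) (cong (\f -> + 1 - f) φ1))) , \x a b ->
   lia 4 (\c s x v -> c == s :+ (v :- x :+ #1) => #1 <= s => v :- x :+ #1 :< c) _ _ x v (twice x v (≤t 1≤+ a) ≤r (≤t b (x≤x+1))) (subst (+ 1 ≤_) (sym (same (≤t b (x≤x+1)))) (big a b))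
  anti' = antiSymmetric ((\x p q r -> tr (sym (X≡ _)) (fst anti x p q (tr (X≡ x) r))) , \x p q r -> tr (sym (X≡ _)) (snd anti x p q (tr (X≡ x) r)))
  private
   Ext : ℤ -> Set
   Ext x = x Mem.∈ block ⊎ x ≡ 0z
   ext-in : ∀ {x} -> Ext x -> x ∈ NSet.A X × x ≤ v
   ext-in (inl p) = outA (fst (block-out p)) , snd (snd (block-out p))
   ext-in (inr refl) = lo , lia 2 (\v w -> v == w :- #1 => #2 <= w => #0 <= v) v ω v≡ ω≥
   in-ext : ∀ {x} -> x ∈ NSet.A X -> x ≤ v -> Ext x
   in-ext {x} p h = case x ≟ 0z of \ where
    (yes e) -> inr e
    (no ne) -> inl (in-block (inA p) (0≤x⇒x≢0⇒1≤x (fst (supp p)) ne) h)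
  minimal : Df.RightAdditivelyMinimal block (+ 1) v
  minimal = rightDense , anti' , (\{x} (a , b , a∈ , b∈ , e) -> fwd x a b (ext-in a∈) (ext-in b∈) (sym e)) , \{x} -> \ where
      (inr (y , y∈ , e)) -> 0z , y , inr refl , y∈ , e
      (inl (l , h)) -> case pigeonhole (NSet.A X) (x - v) v (lia 2 (\x v -> x <= v :+ v => x :- v <= v :+ #1) x v h) (big (lia 2 (\x v -> #1 :+ v :+ #1 <= x => #2 <= x :- v) x v l) (lia 2 (\x v -> x <= v :+ v => x :- v <= v) x v h)) of \(y , a , b , p , q) ->
       y , x - v + v - y , in-ext p (x<y+1⇒x≤y b) , in-ext q (lia 3 (\x v y -> x :- v <= y => x :- v :+ v :- y <= v) x v y a) , lia 3 (\x v y -> x == y :+ (x :- v :+ v :- y)) x v y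
   where
   fwd : ∀ x a b -> (a ∈ NSet.A X × a ≤ v) -> (b ∈ NSet.A X × b ≤ v) -> a + b ≡ x -> (+ 1 + v + + 1 ≤ x × x ≤ v + v) ⊎ (Σ ℤ \y -> Ext y × x ≡ 0z + y)
   fwd x a b (a∈ , av) (b∈ , bv) e = case + 1 + v + + 1 ≤? x of \ where
       (yes h) -> inl (h , subst (_≤ v + v) e (+≤ av bv))
       (no h) -> inr (x , in-ext (x∈A h) (lia 3 (\x v w -> v :+ #1 == w => x :< w => x <= v) x v ω v+1 (x<ω h)) , sym (0+ x))
    where
    x∈ = D-in a∈ b∈ e
    x<ω : ¬ + 1 + v + + 1 ≤ x -> x < ω
    x<ω h = ≤≢⇒< (lia 3 (\x v w -> v :+ #1 == w => ~ #1 :+ v :+ #1 <= x => x <= w) x v ω v+1 h) \e' -> clash (move D x∈ e') ω∉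
    x∈A : ¬ + 1 + v + + 1 ≤ x -> x ∈ NSet.A X
    x∈A h = case mem? (NSet.A X) x of \ where
     (inl p) -> p
     (inr p) -> case x ≟ 0z of \ where
      (yes z) -> move (NSet.A X) lo (sym z)
      (no nz) -> clash x∈ (R x (≤≢⇒< (subst (0z ≤_) e (+≤ (fst (supp a∈)) (fst (supp b∈)))) \z -> nz (sym z)) (x<ω h) p)

-- Dropping both end points leaves the centre p + q unchanged.
Anti-shrink : ∀ P {p q u v} -> Anti P p q -> u ≡ p + + 1 -> v ≡ q - + 1 -> Anti P u v
Anti-shrink P {p} {q} (av , co) refl refl = (\x a b r -> move P (av x (lo a) (hi b) r) (eq x)) , \x a b r -> move P (co x (lo a) (hi b) r) (eq x)
 where
 lo : ∀ {x} -> p + + 1 ≤ x -> p ≤ x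
 lo {x} = x+1≤y⇒x≤y
 hi : ∀ {x} -> x ≤ q - + 1 -> x ≤ q
 hi {x} = lia 2 (\q x -> x <= q :- #1 => x <= q) q x
 eq : ∀ x -> p + q - x ≡ p + + 1 + (q - + 1) - x
 eq x = lia 3 (\p q x -> p :+ q :- x == p :+ #1 :+ (q :- #1) :- x) p q x

module Forms {n : ℤ} (A : List ℤ) (uq : Unique A) (X : NSet n) (X≡ : ∀ x -> NSet.A X x ≡ memb A x) where
 open OnSet X hiding (A)
 private
  inA : ∀ {x} -> x ∈ NSet.A X -> x Mem.∈ A
  inA {x} p = memb-out {A} (tr (sym (X≡ x)) p)
  outA : ∀ {x} -> x Mem.∈ A -> x ∈ NSet.A X
  outA {x} p = tr (X≡ x) (in-memb p)
 -- The uncovered hole is ζ = 2k - 1. A hole at n - 1 enters as ζ = -1 with k = 0, because ζ + n is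
 -- then n - 1 and the block is all of [0,n - 1].
 tForm : ∀ κ0 ζ -> + 2 * κ0 ≡ ζ + + 1 -> - + 1 ≤ ζ -> ζ ≤ n - + 5 -> φ (+ 2 * κ0) ≡ 0z -> φ n ≡ 0z -> (∀ t -> ζ + + 2 ≤ t -> t ≤ n - + 1 -> + 1 ≤ φ t) -> Anti (NSet.A X) (+ 2 * κ0) (n - + 1) ->
  ζ + n ∉ D -> (∀ y -> ζ < y -> y < n -> y ∉ NSet.A X -> y + n ∉ D) -> (∀ j -> 0z ≤ j -> j ≤ κ0 -> + 2 * j ∈ NSet.A X) -> (∀ x -> x ∈ NSet.A X -> x ≤ ζ -> Σ ℤ \j -> x ≡ + 2 * j) -> Df.IsTForm A n
 tForm κ0 ζ e ζ≥ ζ≤ start final pos anti ζ∉ R evens left = κ0 , B.block , κ≥0 , lia 3 (\k z n -> 2 *: k == z :+ #1 => z <= n :- #5 => 2 *: k <= n :- #4) κ0 ζ n e ζ≤ , B.unique , B.subset , B.leftDense start final pos anti ζ∉ R , B.anti' start final pos anti ζ∉ R , B.minimal start final pos anti ζ∉ R , fwd , bwd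
  where
  n≥1 = lia 2 (\z n -> con (- + 1) <= z => z <= n :- #5 => #1 <= n) ζ n ζ≥ ζ≤
  module B = LeftBlock A uq X X≡ n≥1 ζ (+ 2 * κ0) (n - + 1) e refl ζ≥ (≤t ζ≤ (lia 1 (\n -> n :- #5 <= n :- #2) n))
  κ≥0 = lia 2 (\k z -> 2 *: k == z :+ #1 => con (- + 1) <= z => #0 <= k) _ ζ e ζ≥
  fwd : ∀ {x} -> x Mem.∈ A -> Df.TSet κ0 n B.block x
  fwd {x} p = case x ≤? ζ of \ where
   (yes h) -> case left x (outA p) h of \(j , ej) -> inl (j , lia 2 (\x j -> x == 2 *: j => #0 <= x => #0 <= j) x j ej (fst (supp (outA p))) , lia 4 (\x j k z -> x == 2 *: j => x <= z => 2 *: k == z :+ #1 => j <= k) x j _ ζ ej h e , ej)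
   (no h) -> case x ≟ n of \ where
    (yes e') -> inr (inr e')
    (no ne) -> inr (inl (B.in-block p (lia 3 (\x k z -> 2 *: k == z :+ #1 => ~ x <= z => 2 *: k <= x) x κ0 ζ e h) (x≤y⇒x≢y⇒x≤y-1 (snd (supp (outA p))) ne)))
  bwd : ∀ {x} -> Df.TSet κ0 n B.block x -> x Mem.∈ A
  bwd (inl (j , a , b , ej)) = inA (move (NSet.A X) (evens j a b) (sym ej))
  bwd (inr (inl p)) = fst (B.block-out p)
  bwd (inr (inr e')) = inA (move (NSet.A X) hi (sym e'))
 module _ (S : Solo X) where
  open SoloFacts X S using (z0; 0≤z0; z0<n; low∉; high∉; left; right; hole; posR; negL; z0≥1; next; crit) renaming (half to halfφ)
  private
   φn0 : φ n ≡ 0z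
   φn0 = lia 2 (\f g -> g == f :+ #1 => g == #1 => f == #0) _ _ φn halfφ
   n≡2 : n ≡ + 2 * k - + 2
   n≡2 = lia 3 (\f k n -> f == 2 *: k :- n :- #1 => f == #1 => n == 2 *: k :- #2) _ k n φend halfφ
   up2 : ∀ {z} -> 0z ≤ z -> z ∉ NSet.A X -> + 1 ≤ φ (z + + 1) -> + 2 ≤ φ z
   up2 {z} a p h = y≡x-1⇒1≤y⇒2≤x (φ-out a p) h
  topForm : z0 ≡ n - + 1 -> + 1 ∈ NSet.A X -> (∀ t -> + 1 ≤ t -> t ≤ n - + 1 -> + 1 ≤ φ t) -> Df.IsTForm A n
  topForm e 1∈ pos = tForm 0z (- + 1) refl ≤r (lia 3 (\z n k -> z == n :- #1 => n == 2 *: k :- #2 => #2 <= z => con (- + 1) <= n :- #5) _ n k e n≡2 (1≤x⇒x≢1⇒2≤x z0≥1 \h -> clash 1∈ (move (NSet.A X) hole h))) φ0 φn0 pos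
   (subst (Anti (NSet.A X) 0z) e left) (move D low∉ (tr e (+-comm n (- + 1))))
   (\y a b p -> case y ≟ z0 of \ where
    (yes h) -> move D high∉ (cong (_+ n) (sym h))
    (no h) -> let 0≤y = lia 1 (\y -> con (- + 1) :< y => #0 <= y) y a in posR y 0≤y b p (up2 0≤y p (pos (y + + 1) (lia 1 (\y -> con (- + 1) :< y => #1 <= y :+ #1) y a) (lia 3 (\y z n -> z == n :- #1 => y :< n => ~ y == z => y :+ #1 <= n :- #1) y _ n e b h))))
   (\j a b -> move (NSet.A X) lo (cong (+ 2 *_) (≤≥ a b))) (\x p h -> ⊥e (lia 1 (\x -> #0 <= x => x <= con (- + 1) => ff) x (fst (supp p)) h))
  module Inner (1∉ : + 1 ∉ NSet.A X) (n-1∉ : n - + 1 ∉ NSet.A X) where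
   private
    z0+1∈ = tr (anti-not (NSet.A X) right x≤x+1 (x<y⇒x+1≤y z0<n) (lia 2 (\z n -> n :- #1 == z :+ n :- (z :+ #1)) z0 n)) (cong not n-1∉)
    module _ (pos : Pieces.Pos X z0) where
     -- The hole n - 1 escapes the positivity assumption, but 2n - 1 could only be the sum of n and
     -- n - 1.
     R : ∀ y -> z0 < y -> y < n -> y ∉ NSet.A X -> y + n ∉ D
     R y a b p = case y ≟ n - + 1 of \ where
      (yes e) -> out \q -> case D-out q of \(s , t , s∈ , t∈ , e') -> [ (\h -> clash (move (NSet.A X) t∈ h) n-1∉) , (\h -> clash (move (NSet.A X) s∈ h) n-1∉) ]′
       (lia 4 (\x y z m -> z == m :- #1 => x :+ y == z :+ m => x <= m => y <= m => y == m :- #1 :∨ x == m :- #1) s t y n e e' (snd (supp s∈)) (snd (supp t∈)))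
      (no ne) -> posR y (≤t 0≤z0 (<⇒≤ a)) b p (up2 (≤t 0≤z0 (<⇒≤ a)) p (pos (y + + 1) (lia 2 (\z y -> y :< z => y :+ #2 <= z :+ #1) y _ a) (lia 2 (\z m -> z :< m => ~ z == m :- #1 => z :+ #1 <= m :- #1) y n b ne)))
    -1≤z0 : - + 1 ≤ z0
    -1≤z0 = lia 1 (\z -> #1 <= z => con (- + 1) <= z) _ z0≥1
   altForm : Alt (NSet.A X) 0z z0 -> Pieces.Pos X z0 -> z0 ≤ n - + 5 -> Df.IsTForm A n
   altForm alt pos le = tForm c z0 c≡ -1≤z0 le (tr (cong φ c≡) next) φn0 pos (Anti-shrink (NSet.A X) right c≡ refl) high∉ (R pos)
     (\j a b -> case + 2 * j ≤? z0 of \ where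
      (yes h) -> move (NSet.A X) (tr (sym (alt-run (NSet.A X) alt a 0z ≤r (subst (_≤ z0) (sym (0+ _)) h))) lo) (0+ _)
      (no h) -> move (NSet.A X) z0+1∈ (lia 3 (\j c z -> 2 *: c == z :+ #1 => j <= c => ~ 2 *: j <= z => z :+ #1 == 2 *: j) j c _ c≡ b h))
     (\x p h -> [ (\(i , _ , e) -> i , e) , (\(i , a , e) -> clash p (tr (cong (NSet.A X) (tr e (+-comm (+ 2 * i) (+ 1)))) (tr (sym (alt-run (NSet.A X) alt a (+ 1) 0≤+ (subst (_≤ z0) (tr e (+-comm (+ 2 * i) (+ 1))) h))) 1∉))) ]′ (half (fst (supp p))))
    where
    c : ℤ
    c = count (NSet.A X) 0z (z0 + + 1)
    c≡ : + 2 * c ≡ z0 + + 1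
    c≡ = lia 3 (\z c f -> f == 2 *: c :- (z :+ #1 :- #0) => f == #0 => 2 *: c == z :+ #1) z0 c _ (bal-count (NSet.A X) (0≤x⇒0≤x+1 0≤z0)) next
   -- The two blocks are the sides of the hole z0 = u + 1; the antisymmetries around it, shrunk by
   -- their end points, become those of the blocks.
   sForm : Pieces.Neg X z0 -> + 5 ≤ z0 -> Pieces.Pos X z0 -> z0 ≤ n - + 5 -> Df.IsSForm A n
   sForm neg ge pos le = u , C.block , B.block , lia 1 (\z -> #5 <= z => #4 <= z :- #1) _ ge , lia 2 (\z n -> z <= n :- #5 => z :- #1 <= n :- #6) _ n le ,
     C.unique , C.subset , C.rightDense φz neg antiC hole low∉ L , C.anti' φz neg antiC hole low∉ L , C.minimal φz neg antiC hole low∉ L ,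
     B.unique , B.subset , B.leftDense start φn0 pos antiB high∉ (R pos) , B.anti' start φn0 pos antiB high∉ (R pos) , B.minimal start φn0 pos antiB high∉ (R pos) , fwd , bwd
    where
    u = z0 - + 1
    u+2 = lia 1 (\z -> z :- #1 :+ #2 == z :+ #1) z0
    n≥1 = lia 2 (\z n -> #1 <= z => z :< n => #1 <= n) _ n z0≥1 z0<n
    module B = LeftBlock A uq X X≡ n≥1 z0 (u + + 2) (n - + 1) u+2 refl -1≤z0 (≤t le (lia 1 (\n -> n :- #5 <= n :- #2) n))
    module C = RightBlock A uq X X≡ z0 u refl (≤t (+≤+ (ℕ.s≤s (ℕ.s≤s ℕ.z≤n))) ge)
    φz = Periods.Critical.prior crit
    start : φ (u + + 2) ≡ 0z
    start = tr (cong φ u+2) next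
    antiB : Anti (NSet.A X) (u + + 2) (n - + 1)
    antiB = Anti-shrink (NSet.A X) right u+2 refl
    antiC = Anti-shrink (NSet.A X) left refl refl
    L : ∀ y -> 0z < y -> y < z0 -> y ∉ NSet.A X -> y ∉ D
    L y a b p = case y ≟ + 1 of \ where
     (no ne) -> negL y (<⇒≤ a) (<-trans b z0<n) p (neg y (lia 1 (\y -> #0 :< y => ~ y == #1 => #2 <= y) y a ne) (x<y⇒x≤y-1 b))
     (yes e) -> out \q -> case D-out q of \(s , t , s∈ , t∈ , e') -> [ (\h -> clash (move (NSet.A X) s∈ h) 1∉) , (\h -> clash (move (NSet.A X) t∈ h) 1∉) ]′ (lia 3 (\s t y -> s :+ t == y => y == #1 => #0 <= s => #0 <= t => s == #1 :∨ t == #1) s t y e' e (fst (supp s∈)) (fst (supp t∈)))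
    fwd : ∀ {x} -> x Mem.∈ A -> x ≡ 0z ⊎ x Mem.∈ C.block ⊎ x Mem.∈ B.block ⊎ x ≡ n
    fwd {x} p = case x ≟ 0z of \ where
     (yes e) -> inl e
     (no nz) -> case x ≟ n of \ where
      (yes e) -> inr (inr (inr e))
      (no nn) -> case <-cmp x z0 of \ where
       (tri≈ _ e _) -> clash (outA p) (move (NSet.A X) hole (sym e))
       (tri< h _ _) -> inr (inl (C.in-block p (0≤x⇒x≢0⇒1≤x (fst (supp (outA p))) nz) (x<y⇒x≤y-1 h)))
       (tri> _ _ h) -> inr (inr (inl (B.in-block p (lia 2 (\x z -> z :< x => z :- #1 :+ #2 <= x) x _ h) (x≤y⇒x≢y⇒x≤y-1 (snd (supp (outA p))) nn))))
    bwd : ∀ {x} -> x ≡ 0z ⊎ x Mem.∈ C.block ⊎ x Mem.∈ B.block ⊎ x ≡ n -> x Mem.∈ A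
    bwd (inl e) = inA (move (NSet.A X) lo (sym e))
    bwd (inr (inl p)) = fst (C.block-out p)
    bwd (inr (inr (inl p))) = fst (B.block-out p)
    bwd (inr (inr (inr e))) = inA (move (NSet.A X) hi (sym e))

reflected : ∀ {n} A -> let A' = map (\x -> n - x) A in Df.IsTForm A' n -> Df.IsReflectedTForm A n
reflected {n} A (κ0 , B , a , b , c , d , e , f , g , h1 , h2) = κ0 , B , a , b , c , d , e , f , g ,
 (\{x} p -> n - x , h1 (∈-map⁺ (\x -> n - x) p) , x≡y-[y-x] n) ,
 \{x} (t , t∈ , e) -> case ∈-map⁻ (\x -> n - x) {xs = A} (h2 t∈) of \(y , y∈ , e') -> subst (Mem._∈ A) (sym (tr e (tr (cong (\t -> n - t) e') (lia 2 (\y n -> n :- (n :- y) == y) y n)))) y∈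

-- Freiman isomorphisms and the assembly of the cases

halve : ∀ {a b : ℤ} -> a + a ≡ b + b -> a ≡ b
halve {a} {b} = lia 2 (\a b -> a :+ a == b :+ b => a == b) a b

-- Injectivity is the condition on sums for repeated summands: equal images give x + x = y + y.
freimanImage : ∀ X A (f : ℤ² -> ℤ) (g : ℤ² -> ℤ) -> (∀ x -> x Mem.∈ X -> f x Mem.∈ A) -> (∀ y -> y Mem.∈ A -> Σ ℤ² \x -> x Mem.∈ X × f x ≡ y) -> (∀ x y -> f x + f y ≡ g (x +² y)) ->
 (∀ a b c d -> a Mem.∈ X -> b Mem.∈ X -> c Mem.∈ X -> d Mem.∈ X -> f a + f b ≡ f c + f d -> (a +² b) ≡ (c +² d)) -> Df.FreimanImage X A
freimanImage X A f g into onto sum inj = f , into , onto , (\x y x∈ y∈ e -> let h = inj x x y y x∈ x∈ y∈ y∈ (cong₂ _+_ e e) in cong₂ _,_ (halve (cong fst h)) (halve (cong snd h))) ,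
 \a b c d p q r s -> mk⇔ (\e -> tr (sum a b) (tr (cong g e) (sym (sum c d)))) (inj a b c d p q r s)

-- The map is affine in (i,j). Sums of points with different first coordinates fall into different
-- ones of the three disjoint progressions, and within one of them δ separates the second
-- coordinates.
biAP-image : ∀ {A z} -> BiAP (memb A) z -> z ≡ + length A -> Df.BiArithmeticProgression A
biAP-image {A} {z} T zl = ∣ p ∣ , ∣ q ∣ , +-injective (tr (tr (cong₂ (\a b -> a + b + + 2) (∣+∣ p≥0) (∣+∣ q≥0)) size≡) zl) , freimanImage (Df.biAPModel (∣ p ∣) (∣ q ∣)) A f g into onto sum inj
 where
 open BiAP T
 f g : ℤ² -> ℤ
 f (i , j) = u + i * (v - u) + δ * j
 g (i , j) = u + u + i * (v - u) + δ * j
 sum : ∀ x y -> f x + f y ≡ g (x +² y)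
 sum (i , j) (i' , j') = ring u v δ i j i' j'
  where
  ring : ∀ u v δ i j i' j' -> u + i * (v - u) + δ * j + (u + i' * (v - u) + δ * j') ≡ u + u + (i + i') * (v - u) + δ * (j + j')
  ring = solve
 f0 : ∀ j -> f (+ 0 , j) ≡ u + δ * j
 f0 j = ring u v δ j
  where
  ring : ∀ u v δ j -> u + + 0 * (v - u) + δ * j ≡ u + δ * j
  ring = solve
 f1 : ∀ j -> f (+ 1 , j) ≡ v + δ * j
 f1 j = ring u v δ j
  where
  ring : ∀ u v δ j -> u + + 1 * (v - u) + δ * j ≡ v + δ * j
  ring = solve
 Row : ℤ² -> Set
 Row (i , j) = 0z ≤ j × ((i ≡ + 0 × j ≤ p) ⊎ (i ≡ + 1 × j ≤ q))
 le : ∀ {j r} -> 0z ≤ r -> j ℕ.< suc (∣ r ∣) -> + j ≤ r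
 le 0≤r (ℕ.s≤s h) = subst (_ ≤_) (∣+∣ 0≤r) (+≤+ h)
 row : ∀ x -> x Mem.∈ Df.biAPModel (∣ p ∣) (∣ q ∣) -> Row x
 row x x∈ = case ∈-++⁻ (map (\j -> (+ 0 , + j)) (L.upTo (suc (∣ p ∣)))) x∈ of \ where
  (inl h) -> case ∈-map⁻ (\j -> (+ 0 , + j)) {xs = L.upTo (suc (∣ p ∣))} h of \ where (j , j∈ , refl) -> 0≤+ , inl (refl , le p≥0 (∈-upTo⁻ j∈))
  (inr h) -> case ∈-map⁻ (\j -> (+ 1 , + j)) {xs = L.upTo (suc (∣ q ∣))} h of \ where (j , j∈ , refl) -> 0≤+ , inr (refl , le q≥0 (∈-upTo⁻ j∈))
 into : ∀ x -> x Mem.∈ Df.biAPModel (∣ p ∣) (∣ q ∣) -> f x Mem.∈ A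
 into x x∈ = memb-out (go x (row x x∈))
  where
  go : ∀ x -> Row x -> f x ∈ memb A
  go (_ , j) (a , inl (refl , b)) = move (memb A) (in0 j a b) (sym (f0 j))
  go (_ , j) (a , inr (refl , b)) = move (memb A) (in1 j a b) (sym (f1 j))
 onto : ∀ y -> y Mem.∈ A -> Σ ℤ² \x -> x Mem.∈ Df.biAPModel (∣ p ∣) (∣ q ∣) × f x ≡ y
 onto y y∈ = case cover y (in-memb y∈) of \ where
    (inl (i , a , b , e)) -> (+ 0 , i) , subst (\i -> (+ 0 , i) Mem.∈ Df.biAPModel (∣ p ∣) (∣ q ∣)) (∣+∣ a) (∈-++⁺ˡ (∈-map⁺ (\j -> (+ 0 , + j)) (∈-upTo⁺ (lt a b)))) , tr (f0 i) (sym e)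
    (inr (i , a , b , e)) -> (+ 1 , i) , subst (\i -> (+ 1 , i) Mem.∈ Df.biAPModel (∣ p ∣) (∣ q ∣)) (∣+∣ a) (∈-++⁺ʳ (map (\j -> (+ 0 , + j)) (L.upTo (suc (∣ p ∣)))) (∈-map⁺ (\j -> (+ 1 , + j)) (∈-upTo⁺ (lt a b)))) , tr (f1 i) (sym e)
  where
  lt : ∀ {i r} -> 0z ≤ i -> i ≤ r -> ∣ i ∣ ℕ.< suc (∣ r ∣)
  lt (+≤+ _) (+≤+ h) = ℕ.s≤s h
 Sums : ℤ² -> Set
 Sums x = (fst x ≡ + 0 × g x ∈ ap (u + u) δ (p + p)) ⊎ (fst x ≡ + 1 × g x ∈ ap (u + v) δ (p + q)) ⊎ (fst x ≡ + 2 × g x ∈ ap (v + v) δ (q + q))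
 sums : ∀ x y -> Row x -> Row y -> Sums (x +² y)
 sums (_ , j) (_ , j') (a , inl (refl , b)) (a' , inl (refl , b')) = inl (refl , in-ap (u + u) δ (p + p) (j + j') (+≤ a a') (+≤ b b') (ring u v δ (j + j')))
  where
  ring : ∀ u v δ j -> u + u + + 0 * (v - u) + δ * j ≡ u + u + δ * j
  ring = solve
 sums (_ , j) (_ , j') (a , inl (refl , b)) (a' , inr (refl , b')) = inr (inl (refl , in-ap (u + v) δ (p + q) (j + j') (+≤ a a') (+≤ b b') (ring u v δ (j + j'))))
  where
  ring : ∀ u v δ j -> u + u + + 1 * (v - u) + δ * j ≡ u + v + δ * j
  ring = solve
 sums (_ , j) (_ , j') (a , inr (refl , b)) (a' , inl (refl , b')) = inr (inl (refl , in-ap (u + v) δ (p + q) (j + j') (+≤ a a') (subst (j + j' ≤_) (+-comm q p) (+≤ b b')) (ring u v δ (j + j'))))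
  where
  ring : ∀ u v δ j -> u + u + + 1 * (v - u) + δ * j ≡ u + v + δ * j
  ring = solve
 sums (_ , j) (_ , j') (a , inr (refl , b)) (a' , inr (refl , b')) = inr (inr (refl , in-ap (v + v) δ (q + q) (j + j') (+≤ a a') (+≤ b b') (ring u v δ (j + j'))))
  where
  ring : ∀ u v δ j -> u + u + + 2 * (v - u) + δ * j ≡ v + v + δ * j
  ring = solve
 same : ∀ x y -> Sums x -> Sums y -> g x ≡ g y -> fst x ≡ fst y
 same x y (inl (a , _)) (inl (b , _)) e = tr a (sym b)
 same x y (inr (inl (a , _))) (inr (inl (b , _))) e = tr a (sym b)
 same x y (inr (inr (a , _))) (inr (inr (b , _))) e = tr a (sym b)
 same x y (inl (_ , r)) (inr (inl (_ , s))) e = ⊥e (d01 r (move (ap (u + v) δ (p + q)) s (sym e)))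
 same x y (inl (_ , r)) (inr (inr (_ , s))) e = ⊥e (d02 r (move (ap (v + v) δ (q + q)) s (sym e)))
 same x y (inr (inl (_ , r))) (inr (inr (_ , s))) e = ⊥e (d12 r (move (ap (v + v) δ (q + q)) s (sym e)))
 same x y (inr (inl (_ , r))) (inl (_ , s)) e = ⊥e (d01 s (move (ap (u + v) δ (p + q)) r e))
 same x y (inr (inr (_ , r))) (inl (_ , s)) e = ⊥e (d02 s (move (ap (v + v) δ (q + q)) r e))
 same x y (inr (inr (_ , r))) (inr (inl (_ , s))) e = ⊥e (d12 s (move (ap (v + v) δ (q + q)) r e))
 second : ∀ x y -> fst x ≡ fst y -> g x ≡ g y -> x ≡ y
 second (i , j) (_ , j') refl e = cong (i ,_) (≤≥ (*-cancel-≤ {δ} {j} {j'} δ≥1 (≡⇒≤ eq)) (*-cancel-≤ {δ} {j'} {j} δ≥1 (≡⇒≤ (sym eq))))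
  where
  eq = lia 3 (\c a b -> c :+ a == c :+ b => a == b) (u + u + i * (v - u)) _ _ e
 inj : ∀ a b c d -> a Mem.∈ _ -> b Mem.∈ _ -> c Mem.∈ _ -> d Mem.∈ _ -> f a + f b ≡ f c + f d -> (a +² b) ≡ (c +² d)
 inj a b c d a∈ b∈ c∈ d∈ e = let e' = tr (sym (sum a b)) (tr e (sum c d)) in second (a +² b) (c +² d) (same (a +² b) (c +² d) (sums a b (row a a∈) (row b b∈)) (sums c d (row c c∈) (row d d∈)) e') e'

module Conclude (A : List ℤ) (n : ℤ) (uq : Unique A) (len : 2 ℕ.≤ length A) (mn : Df.IsMin A (+ 0)) (mx : Df.IsMax A n) (gcd : Df.GcdOne A) (sz : Df.HasSize (Df.dbl Df.⟦ A ⟧) (3 ℕ.* length A ℕ.∸ 3)) where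
 X : NSet n
 X = record { A = memb A ; supp = \{x} p -> snd mn x (memb-out p) , snd mx x (memb-out p) ; lo = in-memb (fst mn) ; hi = in-memb (fst mx) }
 open OnSet X hiding (A)
 private
  ℓ = + length A
  k≡ = length-count A (memb A) 0≤n+1 uq (\x -> in-memb) (\x -> memb-out) \x p -> snd mn x p , x≤y⇒x<y+1 (snd mx x p)
  dbl-in : ∀ {x} -> x ∈ D -> Df.dbl Df.⟦ A ⟧ x
  dbl-in p = case D-out p of \(a , b , a∈ , b∈ , e) -> a , b , memb-out a∈ , memb-out b∈ , sym e
  dd≡ : dd ≡ + 3 * k - + 3
  dd≡ = case sz of \(M , uM , iff , lM) -> tr (length-count M D (0≤x⇒0≤x+x+1 0≤n) uM
     (\x p -> case Equivalence.to (iff x) p of \(a , b , a∈ , b∈ , e) -> D-in (in-memb a∈) (in-memb b∈) (sym e))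
     (\x p -> Equivalence.from (iff x) (dbl-in p))
     (\x p -> case Equivalence.to (iff x) p of \(a , b , a∈ , b∈ , e) -> let r = D-supp (D-in (in-memb a∈) (in-memb b∈) (sym e)) in fst r , lia 2 (\x n -> x <= n :+ n => x :< n :+ n :+ #1) x n (snd r)))
    (tr (cong +_ lM) (tr (sym (⊖-≥ (ℕ.≤-trans (ℕ.s≤s (ℕ.s≤s (ℕ.s≤s ℕ.z≤n))) (ℕ.*-monoʳ-≤ 3 len)))) (tr (sym (m-n≡m⊖n (3 ℕ.* length A) 3)) (cong (_- + 3) (tr (pos-* 3 (length A)) (cong (+ 3 *_) (sym k≡)))))))
  cop : Coprime X
  cop d d≥2 div = ℕ.<-irrefl (sym (ℕ.∣1⇒≡1 (gcd d \a a∈ -> case div a (in-memb a∈) of \ where (q , refl) -> ℕ.divides (∣ q ∣) (tr (abs-* d q) (ℕ.*-comm (∣ d ∣) (∣ q ∣)))))) (two d d≥2)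
   where
   two : ∀ d -> + 2 ≤ d -> 1 ℕ.< ∣ d ∣
   two (+ _) (+≤+ h) = h
  n≥1 = lia 3 (\k n l -> k == l => #2 <= l => k <= n :+ #1 => #1 <= n) k n ℓ k≡ (+≤+ len) k≤n+1
  Goal = Df.BiArithmeticProgression A ⊎ Df.ContainsIntervalOfLength (Df.dbl Df.⟦ A ⟧) (2 ℕ.* length A ℕ.∸ 1) ⊎ (length A ≡ 6 × Df.FreimanImage K6 A) ⊎ (+ (2 ℕ.* length A) ≡ n + + 2 × (Df.IsTForm A n ⊎ Df.IsReflectedTForm A n ⊎ Df.IsSForm A n))
  ap-goal : TwoAP (memb A) k -> Goal
  ap-goal T = inl (biAP-image (twoAP-biAP X T (≡⇒≤ (sym dd≡))) k≡)
  interval-goal : HasInterval D (+ 2 * k - + 1) -> Goal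
  interval-goal (a , h) = inr (inl (a , \i i< -> dbl-in (h (a + + i) (0≤y⇒x≤x+y 0≤+) (+-monoʳ-< a (subst (+ i <_) eq (+<+ i<))))))
   where
   eq = tr (sym (⊖-≥ (ℕ.≤-trans (ℕ.s≤s ℕ.z≤n) (ℕ.*-monoʳ-≤ 2 len)))) (tr (sym (m-n≡m⊖n (2 ℕ.* length A) 1)) (cong (_- + 1) (tr (pos-* 2 (length A)) (cong (+ 2 *_) (sym k≡)))))
  k6-goal : K6Set (memb A) k -> Goal
  k6-goal K = inr (inr (inl (+-injective (tr (sym k≡) size≡) , freimanImage K6 A (at b s t) (at (b + b) s t) into (\y y∈ -> case shape-at sh y (in-memb y∈) of \(z , z∈ , e) -> z , z∈ , sym e) (at-+ b s t)
    \x y z w x∈ y∈ z∈ w∈ e -> K6Sums.injective X b s t sh large (K6-sums x y x∈ y∈) (K6-sums z w z∈ w∈) (tr (sym (at-+ b s t x y)) (tr e (at-+ b s t z w))))))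
   where
   open K6Set K
   sh : Shape (memb A) b s t
   sh = mem , cover
   large = lia 2 (\k d -> d == 3 *: k :- #3 => k == #6 => #15 <= d) k _ dd≡ size≡
   into : ∀ x -> x Mem.∈ K6 -> at b s t x Mem.∈ A
   into x x∈ = memb-out (All.lookup {P = \x -> at b s t x ∈ memb A} (case mem of \ where
    (m1 ∷ m2 ∷ m3 ∷ m4 ∷ m5 ∷ m6 ∷ []) -> move (memb A) m1 (lia 3 (\b s t -> b == b :+ 0 *: s :+ 0 *: t) b s t) ∷ move (memb A) m2 (lia 3 (\b s t -> b :+ t == b :+ 0 *: s :+ 1 *: t) b s t) ∷ move (memb A) m3 (lia 3 (\b s t -> b :+ t :+ t == b :+ 0 *: s :+ 2 *: t) b s t)
     ∷ move (memb A) m4 (lia 3 (\b s t -> b :+ s == b :+ 1 *: s :+ 0 *: t) b s t) ∷ move (memb A) m5 (lia 3 (\b s t -> b :+ s :+ t == b :+ 1 *: s :+ 1 *: t) b s t) ∷ move (memb A) m6 (lia 3 (\b s t -> b :+ s :+ s == b :+ 2 *: s :+ 0 *: t) b s t) ∷ []) x∈)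
  A' = map (\x -> n - x) A
  uq' = Unique.map⁺ (\{x} {y} e -> lia 3 (\n x y -> n :- x == n :- y => x == y) n x y e) uq
  rev≡ : ∀ x -> NSet.A (rev X) x ≡ memb A' x
  rev≡ x = tr (A-rev X x) (Bool-ext (\p -> in-memb {A'} (subst (Mem._∈ A') (x-[x-y]≡y n) (∈-map⁺ (\x -> n - x) (memb-out {A} p))))
   (\p -> case ∈-map⁻ (\x -> n - x) {xs = A} (memb-out {A'} p) of \(y , y∈ , e) -> in-memb {A} (subst (Mem._∈ A) (lia 3 (\n x y -> x == n :- y => y == n :- x) n x y e) y∈)))
  module F = Forms A uq X (\_ -> refl)
  module F' = Forms A' uq' (rev X) rev≡
  -- Reflection exchanges the two sides of the hole, so this is the situation of `altPos` for n - A.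
  module FromNegAlt (S : Solo X) (1∉ : + 1 ∉ memb A) (n-1∉ : n - + 1 ∉ memb A) (neg : Pieces.Neg X (Solo.z0 S)) (ge : + 5 ≤ Solo.z0 S) (alt : Alt (memb A) (Solo.z0 S) n) where
   open SoloFacts X S using (z0; z0<n) renaming (half to halfφ)
   alt' : Alt (NSet.A (rev X)) 0z (n - z0)
   alt' t a b = tr (A-rev X t) (tr (cong (memb A) (lia 2 (\t n -> n :- t == n :- (t :+ #2) :+ #2) t n)) (tr (sym (alt (n - (t + + 2)) (lia 3 (\t n z -> t :+ #2 <= n :- z => z <= n :- (t :+ #2)) t n _ b) (lia 2 (\t n -> #0 <= t => n :- (t :+ #2) :+ #2 <= n) t n a))) (sym (A-rev X (t + + 2)))))
   pos' : Pieces.Pos (rev X) (n - z0)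
   pos' t a b = lia 3 (\r e f -> r == e :- f => e == #1 => f <= #0 => #1 <= r) _ _ _ (Rev.φ-rev X t (lia 3 (\t n z -> n :- z :+ #2 <= t => z :< n => #0 <= t) t n _ a z0<n) (lia 2 (\t n -> t <= n :- #1 => t <= n :+ #1) t n b)) halfφ
    (neg (n + + 1 - t) (lia 2 (\t n -> t <= n :- #1 => #2 <= n :+ #1 :- t) t n b) (lia 3 (\t n z -> n :- z :+ #2 <= t => n :+ #1 :- t <= z :- #1) t n z0 a))
   form = F'.Inner.altForm (soloRev X S) (tr (A-rev X (+ 1)) n-1∉) (tr (A-rev X (n - + 1)) (move (memb A) 1∉ (lia 1 (\n -> #1 == n :- (n :- #1)) n))) alt' pos' (lia 2 (\n z -> #5 <= z => n :- z <= n :- #5) n _ ge)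
  half-goal : n ≡ + 2 * k - + 2 -> HalfKind X -> Goal
  half-goal e = \ where
     (even ev) -> ⊥e (cop (+ 2) ≤r ev)
     (aps T) -> ap-goal T
     (top S z 1∈ pos) -> fin (inl (F.topForm S z 1∈ pos))
     (bottom S z 1∈ pos) -> fin (inr (inl (reflected A (F'.topForm S z 1∈ pos))))
     (altPos S a b alt pos le) -> fin (inl (F.Inner.altForm S a b alt pos le))
     (negAlt S a b neg ge alt) -> fin (inr (inl (reflected A (FromNegAlt.form S a b neg ge alt))))
     (negPos S a b neg ge pos le) -> fin (inr (inr (F.Inner.sForm S a b neg ge pos le)))
   where
   fin : Df.IsTForm A n ⊎ Df.IsReflectedTForm A n ⊎ Df.IsSForm A n -> Goal
   fin f = inr (inr (inr (tr (pos-* 2 (length A)) (tr (cong (+ 2 *_) (sym k≡)) (lia 2 (\k n -> n == 2 *: k :- #2 => 2 *: k == n :+ #2) k n e)) , f)))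
 conclude : Goal
 conclude = case n ≤? + 2 * k - + 3 of \ where
  (yes h) -> [ interval-goal , (\ov -> ap-goal (overlap-twoAP X (lia 3 (\f m k -> f == 2 *: k :- m :- #1 => m <= 2 *: k :- #3 => #2 <= f) _ n k φend h) ov (≡⇒≤ dd≡))) ]′ (Overlaps.interval-or-overlap X (≤t h (lia 1 (\k -> 2 *: k :- #3 <= 2 *: k :- #2) k)))
  (no h) -> case n ≟ + 2 * k - + 2 of \ where
   (yes e) -> half-goal e (halfKind X e dd≡)
   (no ne) -> [ ap-goal , k6-goal ]′ (snd (freiman (length A) X (≡⇒≤ k≡)) cop (lia 2 (\k m -> ~ m <= 2 *: k :- #3 => ~ m == 2 *: k :- #2 => 2 *: k :- #1 <= m) k n h ne) (≡⇒≤ dd≡))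

theorem2p1 : (A : List ℤ) (n : ℤ) -> Unique A -> 2 ℕ.≤ length A ->
 Df.IsMin A (+ 0) -> Df.IsMax A n -> Df.GcdOne A ->
 Df.HasSize (Df.dbl Df.⟦ A ⟧) (3 ℕ.* length A ℕ.∸ 3) ->
 Df.BiArithmeticProgression A
 ⊎ Df.ContainsIntervalOfLength (Df.dbl Df.⟦ A ⟧) (2 ℕ.* length A ℕ.∸ 1)
 ⊎ (length A ≡ 6 × Df.FreimanImage K6 A)
 ⊎ (+ (2 ℕ.* length A) ≡ n + + 2 × (Df.IsTForm A n ⊎ Df.IsReflectedTForm A n ⊎ Df.IsSForm A n))
theorem2p1 A n uq len mn mx gcd sz = Conclude.conclude A n uq len mn mx gcd sz
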